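{- Let $q\ge1$ and $p$ be integers with $\gcd(p,q)=1$, and let $k_1,k_2$ be positive integers and $k=k_1+k_2$. If both $k_1\Delta'(p,q)$ and $k_2\Delta'(p,q)$ have unimodular triangulations (with respect to $\Lambda_{p,q}$) that are standard on the boundary, then so does $k\Delta'(p,q)$.
   Context: Let $p'=(-p)\bmod q\in\{0,\dots,q-1\}$ and $\Lambda_{p,q}=q\mathbb{Z}\times q\mathbb{Z}\times\mathbb{Z}+\mathbb{Z}\,(p',1,0)\subset\mathbb{R}^3$. Let $\Delta'(p,q)=\operatorname{conv}\{(0,0,0),(q,0,0),(0,0,1),(0,q,1)\}$, regarded as an (empty) lattice tetrahedron with respect to $\Lambda_{p,q}$, and $m\Delta'(p,q)$ its dilation by $m$ about the origin. A unimodular triangulation is a triangulation into lattice simplices whose vertices form affine bases of $\Lambda_{p,q}$. A triangulation $T$ of $m\Delta'(p,q)$ is standard on the boundary if every edge of $T$ contained in the boundary of $m\Delta'(p,q)$ is parallel to an edge of $\Delta'(p,q)$. -}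

module Defs where

open import Data.Nat as ℕ using (ℕ; NonZero)
open import Data.Integer as ℤ using (ℤ; _%ℕ_)
open import Data.Rational as ℚ using (ℚ; 0ℚ; 1ℚ)
open import Data.Product using (Σ; ∃; _×_; _,_)
open import Data.Sum using (_⊎_)
open import Data.Fin using (Fin)
open import Data.List using (List; []; _∷_)
open import Data.List.Relation.Unary.All using (All)
open import Data.List.Membership.Propositional using (_∈_)
open import Relation.Binary.PropositionalEquality using (_≡_)
open import Relation.Nullary using (¬_)

Pt : Set
Pt = ℤ × ℤ × ℤ

PtQ : Set
PtQ = ℚ × ℚ × ℚ

ι : ℤ → ℚ
ι z = z ℚ./ 1

ιP : Pt → PtQ
ιP (x , y , z) = (ι x , ι y , ι z)

_+Q_ : PtQ → PtQ → PtQ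
(a , b , c) +Q (x , y , z) = (a ℚ.+ x , b ℚ.+ y , c ℚ.+ z)

_-Q_ : PtQ → PtQ → PtQ
(a , b , c) -Q (x , y , z) = (a ℚ.- x , b ℚ.- y , c ℚ.- z)

_·Q_ : ℚ → PtQ → PtQ
t ·Q (x , y , z) = (t ℚ.* x , t ℚ.* y , t ℚ.* z)

0Q : PtQ
0Q = (0ℚ , 0ℚ , 0ℚ)

_+Z_ : Pt → Pt → Pt
(a , b , c) +Z (x , y , z) = (a ℤ.+ x , b ℤ.+ y , c ℤ.+ z)

_-Z_ : Pt → Pt → Pt
(a , b , c) -Z (x , y , z) = (a ℤ.- x , b ℤ.- y , c ℤ.- z)

_·Z_ : ℤ → Pt → Pt
t ·Z (x , y , z) = (t ℤ.* x , t ℤ.* y , t ℤ.* z)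

-- Convex hulls (over ℚ; all data are rational)

wsum : List (ℚ × PtQ) → PtQ
wsum []             = 0Q
wsum ((t , v) ∷ ws) = (t ·Q v) +Q wsum ws

wtot : List (ℚ × PtQ) → ℚ
wtot []             = 0ℚ
wtot ((t , _) ∷ ws) = t ℚ.+ wtot ws

InConv : (PtQ → Set) → PtQ → Set
InConv A x = Σ (List (ℚ × PtQ)) λ ws →
  All (λ w → (0ℚ ℚ.≤ Data.Product.proj₁ w) × A (Data.Product.proj₂ w)) ws
  × wtot ws ≡ 1ℚ × wsum ws ≡ x

module _ (p : ℤ) (q : ℕ) .{{_ : NonZero q}} where

  p′ : ℕ
  p′ = (ℤ.- p) %ℕ q

  InΛ : Pt → Set
  InΛ v = Σ ℤ λ a → Σ ℤ λ b → Σ ℤ λ c → Σ ℤ λ d →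
    v ≡ ((a ℤ.* ℤ.+ q) ℤ.+ d ℤ.* ℤ.+ p′ , (b ℤ.* ℤ.+ q) ℤ.+ d , c)

  vert : ℕ → Fin 4 → Pt
  vert m Fin.zero                         = (ℤ.0ℤ , ℤ.0ℤ , ℤ.0ℤ)
  vert m (Fin.suc Fin.zero)               = (ℤ.+ (m ℕ.* q) , ℤ.0ℤ , ℤ.0ℤ)
  vert m (Fin.suc (Fin.suc Fin.zero))     = (ℤ.0ℤ , ℤ.0ℤ , ℤ.+ m)
  vert m (Fin.suc (Fin.suc (Fin.suc _)))  = (ℤ.0ℤ , ℤ.+ (m ℕ.* q) , ℤ.+ m)

  InPoly : ℕ → PtQ → Set
  InPoly m = InConv (λ v → ∃ λ i → v ≡ ιP (vert m i))

  InBoundary : ℕ → PtQ → Set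
  InBoundary m x = ∃ λ (j : Fin 4) →
    InConv (λ v → ∃ λ i → ¬ (i ≡ j) × v ≡ ιP (vert m i)) x

  Tet : Set
  Tet = Fin 4 → Pt

  IsVertexOf : Pt → Tet → Set
  IsVertexOf v S = ∃ λ i → v ≡ S i

  InTet : Tet → PtQ → Set
  InTet S = InConv (λ x → ∃ λ v → IsVertexOf v S × x ≡ ιP v)

  Unimodular : Tet → Set
  Unimodular S = ((i : Fin 4) → InΛ (S i)) ×
    ((w : Pt) → InΛ w → Σ ℤ λ a₁ → Σ ℤ λ a₂ → Σ ℤ λ a₃ →
       w ≡ S Fin.zero +Z ((a₁ ·Z (S (Fin.suc Fin.zero) -Z S Fin.zero))
                    +Z ((a₂ ·Z (S (Fin.suc (Fin.suc Fin.zero)) -Z S Fin.zero))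
                    +Z  (a₃ ·Z (S (Fin.suc (Fin.suc (Fin.suc Fin.zero))) -Z S Fin.zero)))))

  IsUnimodTriang : ℕ → List Tet → Set
  IsUnimodTriang m T =
    All Unimodular T ×
    All (λ S → ∀ x → InTet S x → InPoly m x) T ×
    (∀ x → InPoly m x → ∃ λ S → S ∈ T × InTet S x) ×
    -- any two simplices intersect in a common face
    (∀ S₁ S₂ → S₁ ∈ T → S₂ ∈ T → ∀ x → InTet S₁ x → InTet S₂ x →
       InConv (λ y → ∃ λ v → IsVertexOf v S₁ × IsVertexOf v S₂ × y ≡ ιP v) x)

  IsEdge : List Tet → Pt → Pt → Set
  IsEdge T u v = ∃ λ S → S ∈ T × IsVertexOf u S × IsVertexOf v S × ¬ (u ≡ v)

  EdgeInBoundary : ℕ → Pt → Pt → Set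
  EdgeInBoundary m u v = ∀ t → 0ℚ ℚ.≤ t → t ℚ.≤ 1ℚ →
    InBoundary m (ιP u +Q (t ·Q (ιP v -Q ιP u)))

  ParallelToEdge : Pt → Pt → Set
  ParallelToEdge u v = ∃ λ (i : Fin 4) → ∃ λ (j : Fin 4) → ¬ (i ≡ j) ×
    Σ ℚ λ t → (ιP v -Q ιP u) ≡ t ·Q (ιP (vert 1 j) -Q ιP (vert 1 i))

  StandardOnBoundary : ℕ → List Tet → Set
  StandardOnBoundary m T = ∀ u v → IsEdge T u v → EdgeInBoundary m u v →
    ParallelToEdge u v

  HasStdUnimodTriang : ℕ → Set
  HasStdUnimodTriang m = ∃ λ T → IsUnimodTriang m T × StandardOnBoundary m T

{-# OPTIONS --safe #-}
module Submission where

-- Write X = x / q, Y = y / q and w = z - Y, so that k Δ' is 0 ≤ Y ≤ z, 0 ≤ X ≤ k - z. The part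
-- w ≥ k₂ is a translate of k₁ Δ', the part Y ≥ k₁ a translate of k₂ Δ'. What remains is cut by
-- the planes Y = i, w = j and X = c into unit parallelepipeds, ending in one truncated piece per
-- column. In the middle of each cell lies a unit square z = const, which contains exactly one
-- lattice point on each line y = const strictly inside it. The path through these points in
-- the order of y has steps of height 1, so its edges joined to a unit segment in direction x are
-- unimodular tetrahedra; the regions of the square on either side of the path have unimodular
-- triangulations (a Farey subdivision) and are coned to the ends of the segment.
--
-- All cutting planes are parallel to facets of Δ', and all pieces are standard on them: for the
-- cells by construction, for the two boxes by hypothesis, since the edges of a unimodular
-- simplex are primitive. Hence the pieces match along the planes, where both sides carry the
-- standard triangulation. Matching inside a cell is proved by separating hyperplanes.
--
-- Convex hulls are handled through finitely supported measures on the lattice: a point is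
-- replaced by a measure with that barycentre, and only values of integral affine forms occur.

open import Defs
open import Data.Nat as ℕ using (ℕ; zero; suc; NonZero; z≤n; s≤s)
import Data.Nat.Properties as ℕ
import Data.Nat.DivMod as ℕ
open import Data.Nat.GCD using (gcd; GCD; gcd-GCD; module Bézout)
open import Data.Integer as ℤ using (ℤ; +_; -[1+_]; 0ℤ; 1ℤ; _+_; _*_; _-_; -_; _≤_; _<_; +≤+; +<+; ∣_∣)
import Data.Integer.Properties as ℤ
import Data.Integer.DivMod as ℤ
open import Data.Integer.Tactic.RingSolver using (solve-∀)
open import Data.Rational as ℚ using (ℚ; 0ℚ; 1ℚ)
import Data.Rational.Properties as ℚ
import Data.Rational.Unnormalised as ℚᵘ
import Data.Rational.Unnormalised.Properties as ℚᵘ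
import Data.Rational.Solver as ℚSolver
open import Data.Product using (Σ; ∃; _×_; _,_; proj₁; proj₂)
open import Data.Sum using (_⊎_; inj₁; inj₂; [_,_]′)
open import Data.Bool using (Bool; true; false; not)
open import Data.Fin as Fin using (Fin)
open import Data.Empty using (⊥; ⊥-elim)
open import Data.List using (List; []; _∷_; map; _++_; upTo; concatMap)
open import Data.List.Membership.Propositional.Properties using (∈-++⁻; ∈-++⁺ˡ; ∈-++⁺ʳ; ∈-map⁻; ∈-map⁺; ∈-upTo⁺; ∈-upTo⁻; ∈-concatMap⁺; ∈-concatMap⁻)
open import Data.List.Relation.Unary.All as All using (All; []; _∷_)
open import Data.List.Relation.Unary.Any using (Any; here; there; any?)
open import Data.List.Membership.Propositional using (_∈_; find; lose)
open import Relation.Binary.PropositionalEquality using (_≡_; _≢_; refl; sym; trans; cong; cong₂; subst; subst₂)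
open import Relation.Binary.Definitions using (tri<; tri≈; tri>)
open import Relation.Nullary using (¬_; Dec; yes; no)
open import Relation.Nullary.Decidable using (toWitness; map′; _×-dec_; _⊎-dec_; _→-dec_)
open import Data.Fin.Properties using (all?)
open import Data.Unit using (tt)

-- The path is in general neither straight nor convex, so no single plane separates the simplices to
-- its left from those to its right. The planes `y = j z` all contain the line of the bottom segment
-- and hence every possible apex. They cut the half cell into strips in each of which the path is
-- one edge, and the separating plane is chosen once the strip of the common point is known. This is
-- why `LeftOf` and `RightOf` speak of measures with barycentre in a strip. The fourth facet
-- `X + z = k` is parallel to no cutting plane; it truncates the last cell of each column. From
-- `i < k₁` and `l < k₂` follows `i + l + 2 ≤ k`, so every column keeps its full height. Hence there
-- are only two shapes of cell, and each half of a cell is a unit square joined to a parallel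
-- segment of length 0, 1 or 2. The half turn `ρ` reduces the right of the path to the left. It
-- preserves the path except at its ends, and this defect is what the two corner tetrahedra fill.

pr₂ : ∀ {A B C : Set} → A × B × C → B
pr₂ v = proj₁ (proj₂ v)

pr₃ : ∀ {A B C : Set} → A × B × C → C
pr₃ v = proj₂ (proj₂ v)

-- Inequalities over the integers and their transfer to the rationals

≤⇒0≤ : ∀ {a b} → a ≤ b → 0ℤ ≤ b - a
≤⇒0≤ = ℤ.i≤j⇒0≤j-i

0≤⇒≤ : ∀ {a b} → 0ℤ ≤ b - a → a ≤ b
0≤⇒≤ = ℤ.0≤i-j⇒j≤i

0≤+ : ∀ {a b} → 0ℤ ≤ a → 0ℤ ≤ b → 0ℤ ≤ a + b
0≤+ = ℤ.+-mono-≤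

0≤* : ∀ {a b} → 0ℤ ≤ a → 0ℤ ≤ b → 0ℤ ≤ a * b
0≤* {+ m} {+ n} _ _ = subst (0ℤ ≤_) (ℤ.pos-* m n) (+≤+ z≤n)

0≤-resp : ∀ {a b} → b ≡ a → 0ℤ ≤ a → 0ℤ ≤ b
0≤-resp refl p = p

≤-by : ∀ {a b} d → 0ℤ ≤ d → b - a ≡ d → a ≤ b
≤-by d p e = 0≤⇒≤ (0≤-resp e p)

0<⇒1≤ : ∀ {a} → 0ℤ < a → 1ℤ ≤ a
0<⇒1≤ = ℤ.i<j⇒suc[i]≤j

1≤⇒0< : ∀ {a} → 1ℤ ≤ a → 0ℤ < a
1≤⇒0< = ℤ.suc[i]≤j⇒i<j

0≤+ᴺ : ∀ n → 0ℤ ≤ + n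
0≤+ᴺ n = +≤+ z≤n

0≤∧≤0⇒≡0 : ∀ {a} → 0ℤ ≤ a → 0ℤ ≤ - a → a ≡ 0ℤ
0≤∧≤0⇒≡0 {a} p q = ℤ.≤-antisym (≤-by (- a) q (ℤ.+-identityˡ (- a))) p

ι-toℚᵘ : ∀ z → ℚ.toℚᵘ (ι z) ℚᵘ.≃ ℚᵘ.mkℚᵘ z 0
ι-toℚᵘ z = ℚ.toℚᵘ-fromℚᵘ (ℚᵘ.mkℚᵘ z 0)

ι-+ : ∀ a b → ι (a + b) ≡ ι a ℚ.+ ι b
ι-+ a b = ℚ.toℚᵘ-injective (ℚᵘ.≃-trans (ι-toℚᵘ (a + b)) (ℚᵘ.≃-sym
  (ℚᵘ.≃-trans (ℚ.toℚᵘ-homo-+ (ι a) (ι b)) (ℚᵘ.≃-trans (ℚᵘ.+-cong (ι-toℚᵘ a) (ι-toℚᵘ b)) (ℚᵘ.*≡* (eq a b))))))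
  where
  eq : ∀ a b → (a * 1ℤ + b * 1ℤ) * 1ℤ ≡ (a + b) * (1ℤ * 1ℤ)
  eq = solve-∀

ι-* : ∀ a b → ι (a * b) ≡ ι a ℚ.* ι b
ι-* a b = ℚ.toℚᵘ-injective (ℚᵘ.≃-trans (ι-toℚᵘ (a * b)) (ℚᵘ.≃-sym
  (ℚᵘ.≃-trans (ℚ.toℚᵘ-homo-* (ι a) (ι b)) (ℚᵘ.≃-trans (ℚᵘ.*-cong (ι-toℚᵘ a) (ι-toℚᵘ b)) (ℚᵘ.*≡* (eq a b))))))
  where
  eq : ∀ a b → (a * b) * 1ℤ ≡ (a * b) * (1ℤ * 1ℤ)
  eq = solve-∀

ι-injective : ∀ {a b} → ι a ≡ ι b → a ≡ b
ι-injective {a} {b} e with ℚᵘ.≃-trans (ℚᵘ.≃-sym (ι-toℚᵘ a)) (ℚᵘ.≃-trans (ℚ.toℚᵘ-cong e) (ι-toℚᵘ b))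
... | ℚᵘ.*≡* p = ℤ.*-cancelʳ-≡ a b 1ℤ p

ι-mono-≤ : ∀ {a b} → a ≤ b → ι a ℚ.≤ ι b
ι-mono-≤ {a} {b} p = ℚ.toℚᵘ-cancel-≤ (ℚᵘ.≤-respˡ-≃ (ℚᵘ.≃-sym (ι-toℚᵘ a)) (ℚᵘ.≤-respʳ-≃ (ℚᵘ.≃-sym (ι-toℚᵘ b))
  (ℚᵘ.*≤* (subst₂ _≤_ (sym (ℤ.*-identityʳ a)) (sym (ℤ.*-identityʳ b)) p))))

ι-cancel-≤ : ∀ {a b} → ι a ℚ.≤ ι b → a ≤ b
ι-cancel-≤ {a} {b} p with ℤ.≤-total a b
... | inj₁ a≤b = a≤b
... | inj₂ b≤a = ℤ.≤-reflexive (ι-injective (ℚ.≤-antisym p (ι-mono-≤ b≤a)))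

0<ι : ∀ {a} → 0ℤ < a → 0ℚ ℚ.< ι a
0<ι {a} p with ℚ.<-cmp 0ℚ (ι a)
... | tri< l _ _ = l
... | tri≈ _ e _ = ⊥-elim (ℤ.<-irrefl (ι-injective {0ℤ} {a} e) p)
... | tri> _ _ g = ⊥-elim (ℤ.≤⇒≯ (ι-cancel-≤ {a} {0ℤ} (ℚ.<⇒≤ g)) p)

0≤-ℚ* : ∀ {x y} → 0ℚ ℚ.≤ x → 0ℚ ℚ.≤ y → 0ℚ ℚ.≤ x ℚ.* y
0≤-ℚ* {x} {y} p q = subst (ℚ._≤ x ℚ.* y) (ℚ.*-zeroʳ x) (ℚ.*-monoˡ-≤-nonNeg x {{ℚ.nonNegative p}} q)

0<-ℚ* : ∀ {x y} → 0ℚ ℚ.< x → 0ℚ ℚ.< y → 0ℚ ℚ.< x ℚ.* y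
0<-ℚ* {x} {y} p q = subst (ℚ._< x ℚ.* y) (ℚ.*-zeroʳ x) (ℚ.*-monoʳ-<-pos x {{ℚ.positive p}} q)

ℚ-*-cancelˡ : ∀ {c x y} → 0ℚ ℚ.< c → c ℚ.* x ≡ c ℚ.* y → x ≡ y
ℚ-*-cancelˡ {c} p e = ℚ.≤-antisym (ℚ.*-cancelˡ-≤-pos c {{ℚ.positive p}} (ℚ.≤-reflexive e))
                                 (ℚ.*-cancelˡ-≤-pos c {{ℚ.positive p}} (ℚ.≤-reflexive (sym e)))

-- Finitely supported measures on lattice points

Meas : Set
Meas = List (ℚ × Pt)

E : (Pt → ℤ) → Meas → ℚ
E φ []             = 0ℚ
E φ ((t , v) ∷ ws) = t ℚ.* ι (φ v) ℚ.+ E φ ws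

E-cong : ∀ {φ χ} → (∀ v → φ v ≡ χ v) → ∀ ws → E φ ws ≡ E χ ws
E-cong h []             = refl
E-cong h ((t , v) ∷ ws) = cong₂ ℚ._+_ (cong (λ a → t ℚ.* ι a) (h v)) (E-cong h ws)

private
  lin+ : ∀ t a b x y → t ℚ.* (a ℚ.+ b) ℚ.+ (x ℚ.+ y) ≡ (t ℚ.* a ℚ.+ x) ℚ.+ (t ℚ.* b ℚ.+ y)
  lin+ = solve 5 (λ t a b x y → t :* (a :+ b) :+ (x :+ y) := (t :* a :+ x) :+ (t :* b :+ y)) refl
    where open ℚSolver.+-*-Solver
  lin* : ∀ t c a x → t ℚ.* (c ℚ.* a) ℚ.+ c ℚ.* x ≡ c ℚ.* (t ℚ.* a ℚ.+ x)
  lin* = solve 4 (λ t c a x → t :* (c :* a) :+ c :* x := c :* (t :* a :+ x)) refl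
    where open ℚSolver.+-*-Solver

E-+ : ∀ φ χ ws → E (λ v → φ v + χ v) ws ≡ E φ ws ℚ.+ E χ ws
E-+ φ χ []             = refl
E-+ φ χ ((t , v) ∷ ws) = trans (cong₂ (λ a b → t ℚ.* a ℚ.+ b) (ι-+ (φ v) (χ v)) (E-+ φ χ ws))
                               (lin+ t (ι (φ v)) (ι (χ v)) (E φ ws) (E χ ws))

E-* : ∀ c φ ws → E (λ v → c * φ v) ws ≡ ι c ℚ.* E φ ws
E-* c φ []             = sym (ℚ.*-zeroʳ (ι c))
E-* c φ ((t , v) ∷ ws) = trans (cong₂ (λ a b → t ℚ.* a ℚ.+ b) (ι-* c (φ v)) (E-* c φ ws))
                               (lin* t (ι c) (ι (φ v)) (E φ ws))

E-map : ∀ (g : Pt → Pt) φ ws → E φ (map (λ w → proj₁ w , g (proj₂ w)) ws) ≡ E (λ v → φ (g v)) ws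
E-map g φ []             = refl
E-map g φ ((t , v) ∷ ws) = cong (t ℚ.* ι (φ (g v)) ℚ.+_) (E-map g φ ws)

variable
  V W V′ W′ : Pt → Set
  φ χ : Pt → ℤ
  ws us : Meas

infix 4 _⊩_

-- the affine form φ is nonnegative at (the barycentre of) ws
record _⊩_ (ws : Meas) (φ : Pt → ℤ) : Set where
  constructor nn
  field get : 0ℚ ℚ.≤ E φ ws

⊩-cong : (∀ v → χ v ≡ φ v) → ws ⊩ φ → ws ⊩ χ
⊩-cong {ws = ws} h (nn p) = nn (subst (0ℚ ℚ.≤_) (sym (E-cong h ws)) p)

⊩-+ : ws ⊩ φ → ws ⊩ χ → ws ⊩ (λ v → φ v + χ v)
⊩-+ {ws = ws} {φ = φ} {χ = χ} (nn p) (nn q) = nn (subst (0ℚ ℚ.≤_) (sym (E-+ φ χ ws)) (ℚ.+-mono-≤ p q))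

⊩-* : ∀ {c} → 0ℤ ≤ c → ws ⊩ φ → ws ⊩ (λ v → c * φ v)
⊩-* {ws = ws} {φ = φ} {c = c} p (nn q) = nn (subst (0ℚ ℚ.≤_) (sym (E-* c φ ws)) (0≤-ℚ* (ι-mono-≤ p) q))

⊩-cancel : ∀ c → 0ℤ < c → ws ⊩ (λ v → c * φ v) → ws ⊩ φ
⊩-cancel {ws = ws} {φ = φ} c p (nn q) = nn (ℚ.*-cancelˡ-≤-pos (ι c) {{ℚ.positive (0<ι p)}}
  (subst₂ ℚ._≤_ (sym (ℚ.*-zeroʳ (ι c))) (E-* c φ ws) q))

⊩-total : ∀ ws φ → ws ⊩ φ ⊎ ws ⊩ (λ v → - φ v)
⊩-total ws φ with ℚ.≤-total 0ℚ (E φ ws)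
... | inj₁ p = inj₁ (nn p)
... | inj₂ p = inj₂ (nn (subst (0ℚ ℚ.≤_) (sym eq) (ℚ.neg-antimono-≤ p)))
  where
  eq : E (λ v → - φ v) ws ≡ ℚ.- E φ ws
  eq = trans (E-cong (λ v → sym (ℤ.-1*i≡-i (φ v))) ws)
      (trans (E-* ℤ.-1ℤ φ ws) (trans (sym (ℚ.neg-distribˡ-* 1ℚ (E φ ws))) (cong ℚ.-_ (ℚ.*-identityˡ (E φ ws)))))

⊩-map : ∀ (g : Pt → Pt) → ws ⊩ (λ v → φ (g v)) → map (λ w → proj₁ w , g (proj₂ w)) ws ⊩ φ
⊩-map {ws = ws} {φ = φ} g (nn p) = nn (subst (0ℚ ℚ.≤_) (sym (E-map g φ ws)) p)

-- With strictly positive weights the listed points are exactly the support, so that conclusions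
-- about all listed points make sense.
NonNegOn PosOn : (Pt → Set) → Meas → Set
NonNegOn V = All (λ w → (0ℚ ℚ.≤ proj₁ w) × V (proj₂ w))
PosOn    V = All (λ w → (0ℚ ℚ.< proj₁ w) × V (proj₂ w))

PosOn⇒NonNegOn : PosOn V ws → NonNegOn V ws
PosOn⇒NonNegOn = All.map (λ { (p , v) → ℚ.<⇒≤ p , v })

PosOn-weaken : (∀ v → V v → W v) → PosOn V ws → PosOn W ws
PosOn-weaken h = All.map (λ { (p , v) → p , h _ v })

support : PosOn V ws → All (λ w → V (proj₂ w)) ws
support = All.map proj₂

⊩-all : NonNegOn V ws → (∀ v → V v → 0ℤ ≤ φ v) → ws ⊩ φ
⊩-all []             h = nn ℚ.≤-refl
⊩-all ((p , v) ∷ ps) h = nn (ℚ.+-mono-≤ (0≤-ℚ* p (ι-mono-≤ (h _ v))) (_⊩_.get (⊩-all ps h)))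

⊩-pos : PosOn V ws → (∀ v → V v → 0ℤ ≤ φ v) → ws ⊩ φ
⊩-pos ps = ⊩-all (PosOn⇒NonNegOn ps)

-- A sum of nonnegative terms with positive weights is nonpositive only if every term vanishes: a
-- barycentre on a supporting plane forces the whole support into that plane.
⊩-zero : PosOn V ws → (∀ v → V v → 0ℤ ≤ φ v) → ws ⊩ (λ v → - φ v) →
         PosOn (λ v → V v × φ v ≡ 0ℤ) ws
⊩-zero [] h n = []
⊩-zero {ws = (t , u) ∷ ws} {φ = φ} ((p , v) ∷ ps) h (nn n) with ℤ.<-cmp 0ℤ (φ u)
... | tri≈ _ e _ = (p , v , sym e) ∷ ⊩-zero ps h (nn (subst (0ℚ ℚ.≤_) eq n))
  where
  eq : t ℚ.* ι (- φ u) ℚ.+ E (λ v → - φ v) ws ≡ E (λ v → - φ v) ws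
  eq = trans (cong (λ a → t ℚ.* ι (- a) ℚ.+ E (λ v → - φ v) ws) (sym e))
      (trans (cong (ℚ._+ E (λ v → - φ v) ws) (ℚ.*-zeroʳ t)) (ℚ.+-identityˡ _))
... | tri> _ _ g = ⊥-elim (ℤ.≤⇒≯ (h u v) g)
... | tri< l _ _ = ⊥-elim (ℚ.<-irrefl refl (ℚ.<-≤-trans (ℚ.+-mono-<-≤ (0<-ℚ* p (0<ι l)) (_⊩_.get (⊩-all (PosOn⇒NonNegOn ps) h)))
      (subst (ℚ._≤ 0ℚ) eq (ℚ.neg-antimono-≤ n))))
  where
  eq : ℚ.- (t ℚ.* ι (- φ u) ℚ.+ E (λ v → - φ v) ws) ≡ t ℚ.* ι (φ u) ℚ.+ E φ ws
  eq = trans (cong ℚ.-_ (trans (E-cong (λ v → sym (ℤ.-1*i≡-i (φ v))) ((t , u) ∷ ws)) (E-* ℤ.-1ℤ φ ((t , u) ∷ ws))))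
      (trans (ℚ.neg-distribˡ-* (ι ℤ.-1ℤ) (E φ ((t , u) ∷ ws))) (ℚ.*-identityˡ (E φ ((t , u) ∷ ws))))

-- Affine forms

record Aff (φ : Pt → ℤ) : Set where
  constructor aff
  field
    c₀ c₁ c₂ c₃ : ℤ
    eval        : ∀ x y z → φ (x , y , z) ≡ c₀ + (c₁ * x + (c₂ * y + c₃ * z))

private
  a-c : ∀ c x y z → c ≡ c + (0ℤ * x + (0ℤ * y + 0ℤ * z))
  a-c = solve-∀
  a-x : ∀ x y z → x ≡ 0ℤ + (1ℤ * x + (0ℤ * y + 0ℤ * z))
  a-x = solve-∀
  a-y : ∀ x y z → y ≡ 0ℤ + (0ℤ * x + (1ℤ * y + 0ℤ * z))
  a-y = solve-∀
  a-z : ∀ x y z → z ≡ 0ℤ + (0ℤ * x + (0ℤ * y + 1ℤ * z))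
  a-z = solve-∀
  a-+ : ∀ a₀ a₁ a₂ a₃ b₀ b₁ b₂ b₃ x y z →
    a₀ + (a₁ * x + (a₂ * y + a₃ * z)) + (b₀ + (b₁ * x + (b₂ * y + b₃ * z))) ≡
    a₀ + b₀ + ((a₁ + b₁) * x + ((a₂ + b₂) * y + (a₃ + b₃) * z))
  a-+ = solve-∀
  a-* : ∀ k a₀ a₁ a₂ a₃ x y z →
    k * (a₀ + (a₁ * x + (a₂ * y + a₃ * z))) ≡ k * a₀ + (k * a₁ * x + (k * a₂ * y + k * a₃ * z))
  a-* = solve-∀

aff-c : ∀ c → Aff (λ _ → c)
aff-c c = aff c 0ℤ 0ℤ 0ℤ (a-c c)

aff-1 : Aff proj₁
aff-1 = aff 0ℤ 1ℤ 0ℤ 0ℤ a-x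

aff-2 : Aff pr₂
aff-2 = aff 0ℤ 0ℤ 1ℤ 0ℤ a-y

aff-3 : Aff pr₃
aff-3 = aff 0ℤ 0ℤ 0ℤ 1ℤ a-z

aff-+ : Aff φ → Aff χ → Aff (λ v → φ v + χ v)
aff-+ (aff a₀ a₁ a₂ a₃ e) (aff b₀ b₁ b₂ b₃ f) = aff (a₀ + b₀) (a₁ + b₁) (a₂ + b₂) (a₃ + b₃)
  (λ x y z → trans (cong₂ _+_ (e x y z) (f x y z)) (a-+ a₀ a₁ a₂ a₃ b₀ b₁ b₂ b₃ x y z))

aff-* : ∀ k → Aff φ → Aff (λ v → k * φ v)
aff-* k (aff a₀ a₁ a₂ a₃ e) = aff (k * a₀) (k * a₁) (k * a₂) (k * a₃)
  (λ x y z → trans (cong (k *_) (e x y z)) (a-* k a₀ a₁ a₂ a₃ x y z))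

aff-cong : (∀ v → χ v ≡ φ v) → Aff φ → Aff χ
aff-cong h (aff a₀ a₁ a₂ a₃ e) = aff a₀ a₁ a₂ a₃ (λ x y z → trans (h (x , y , z)) (e x y z))

aff-neg : Aff φ → Aff (λ v → - φ v)
aff-neg {φ = φ} a = aff-cong (λ v → sym (ℤ.-1*i≡-i (φ v))) (aff-* ℤ.-1ℤ a)

aff-- : Aff φ → Aff χ → Aff (λ v → φ v - χ v)
aff-- a b = aff-+ a (aff-neg b)

AffMap : (Pt → Pt) → Set
AffMap g = Aff (λ v → proj₁ (g v)) × Aff (λ v → proj₁ (proj₂ (g v))) × Aff (λ v → proj₂ (proj₂ (g v)))

aff-∘ : ∀ {g} → Aff φ → AffMap g → Aff (λ v → φ (g v))
aff-∘ (aff a₀ a₁ a₂ a₃ e) (f₁ , f₂ , f₃) =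
  aff-cong (λ v → e _ _ _) (aff-+ (aff-c a₀) (aff-+ (aff-* a₁ f₁) (aff-+ (aff-* a₂ f₂) (aff-* a₃ f₃))))

infix 4 _≈_

-- equal total mass and equal barycentre
record _≈_ (ws us : Meas) : Set where
  constructor mom
  field same : ∀ φ → Aff φ → E φ ws ≡ E φ us

≈-sym : ws ≈ us → us ≈ ws
≈-sym e = mom λ φ a → sym (_≈_.same e φ a)

⊩-≈ : Aff φ → ws ≈ us → ws ⊩ φ → us ⊩ φ
⊩-≈ {φ = φ} a e (nn p) = nn (subst (0ℚ ℚ.≤_) (_≈_.same e φ a) p)

-- Vertex sets meeting in a common face

-- For the vertex sets of two simplices this says that their hulls intersect in the hull of the
-- common vertices. Formulated by supports, it follows from sign conditions on integral forms alone.
Meet : (V W : Pt → Set) → Set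
Meet V W = ∀ {ws us} → PosOn V ws → PosOn W us → ws ≈ us →
  All (λ w → W (proj₂ w)) ws × All (λ w → V (proj₂ w)) us

Meet-sym : Meet V W → Meet W V
Meet-sym m p q e with m q p (≈-sym e)
... | a , b = b , a

Meet-refl : ∀ {V} → Meet V V
Meet-refl p q e = support p , support q

Meet-mono : (∀ v → V v → V′ v) → (∀ v → V′ v → V v) →
  (∀ v → W v → W′ v) → (∀ v → W′ v → W v) → Meet V W → Meet V′ W′
Meet-mono a a′ b b′ m p q e with m (PosOn-weaken a′ p) (PosOn-weaken b′ q) e
... | x , y = All.map (b _) x , All.map (a _) y

Meet-restrict : ∀ (P : Pt → Set) → Meet V W → Meet (λ v → V v × P v) (λ v → W v × P v)
Meet-restrict P m p q e with m (PosOn-weaken (λ _ → proj₁) p) (PosOn-weaken (λ _ → proj₁) q) e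
... | x , y = All.zip (x , All.map proj₂ (support p)) , All.zip (y , All.map proj₂ (support q))

-- The form is nonpositive at one barycentre and nonnegative at the other. They coincide, so it
-- vanishes there, and `⊩-zero` applies to both measures.
separate : ∀ φ → Aff φ → (∀ v → V v → 0ℤ ≤ - φ v) → (∀ v → W v → 0ℤ ≤ φ v) →
  PosOn V ws → PosOn W us → ws ≈ us →
  PosOn (λ v → V v × φ v ≡ 0ℤ) ws × PosOn (λ v → W v × φ v ≡ 0ℤ) us
separate φ a hV hW p q e =
  All.map (λ { (x , v , z) → x , v , ℤ.neg-injective z })
    (⊩-zero p hV (⊩-cong (λ v → ℤ.neg-involutive (φ v)) (⊩-≈ a (≈-sym e) (⊩-pos q hW)))) ,
  ⊩-zero q hW (⊩-≈ (aff-neg a) e (⊩-pos p hV))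

Meet-separate : ∀ φ → Aff φ → (∀ v → V v → 0ℤ ≤ - φ v) → (∀ v → W v → 0ℤ ≤ φ v) →
  Meet (λ v → V v × φ v ≡ 0ℤ) (λ v → W v × φ v ≡ 0ℤ) → Meet V W
Meet-separate φ a hV hW m p q e with separate φ a hV hW p q e
... | p′ , q′ with m p′ q′ e
... | x , y = All.map proj₁ x , All.map proj₁ y

-- Otherwise φ is nonpositive at the common barycentre, and then it vanishes on the whole support of
-- `ws`.
positive-somewhere : ∀ φ → Aff φ → PosOn V ws → PosOn W us → ws ≈ us → (∀ v → V v → 0ℤ ≤ φ v) →
  Any (λ w → 0ℤ < φ (proj₂ w)) ws → Any (λ w → 0ℤ < φ (proj₂ w)) us
positive-somewhere {V = V} {ws = ws} {W = W} {us = us} φ a p q e h x with any? (λ w → 0ℤ ℤ.<? φ (proj₂ w)) us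
... | yes y = y
... | no ¬y = ⊥-elim (contra (⊩-zero p h (⊩-≈ (aff-neg a) (≈-sym e) (⊩-pos (go us q ¬y) (λ v z → z)))) x)
  where
  go : ∀ us → PosOn W us → ¬ Any (λ w → 0ℤ < φ (proj₂ w)) us → PosOn (λ v → 0ℤ ≤ - φ v) us
  go [] [] ¬y = []
  go (u ∷ us) ((t , _) ∷ q) ¬y = (t , ℤ.neg-mono-≤ (ℤ.≮⇒≥ (λ l → ¬y (here l)))) ∷ go us q (λ y → ¬y (there y))
  contra : ∀ {ws} → PosOn (λ v → V v × φ v ≡ 0ℤ) ws → Any (λ w → 0ℤ < φ (proj₂ w)) ws → ⊥
  contra ((_ , _ , z) ∷ _) (here l)  = ℤ.<-irrefl (sym z) l
  contra (_ ∷ ps)          (there x) = contra ps x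

-- Two faces of one simplex: every vertex is exposed by an affine form.
Meet-exposed : (∀ b → V b ⊎ W b → Σ (Pt → ℤ) λ φ → Aff φ × 0ℤ < φ b ×
     (∀ v → V v ⊎ W v → 0ℤ ≤ φ v × (0ℤ < φ v → v ≡ b))) → Meet V W
Meet-exposed {V = V} {W = W} h p q e = one inj₁ inj₂ p q e , one inj₂ inj₁ q p (≈-sym e)
  where
  one : (∀ {v} → V′ v → V v ⊎ W v) → (∀ {v} → W′ v → V v ⊎ W v) →
    PosOn V′ ws → PosOn W′ us → ws ≈ us → All (λ w → W′ (proj₂ w)) ws
  one {V′ = V′} {W′ = W′} {ws = ws} {us = us} iV iW p q e = All.tabulate step
    where
    step : ∀ {w} → w ∈ ws → W′ (proj₂ w)
    step {w} w∈ with h (proj₂ w) (iV (proj₂ (All.lookup p w∈)))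
    ... | φ , a , pos , others with find (positive-somewhere φ a p q e (λ v z → proj₁ (others v (iV z))) (lose w∈ pos))
    ... | u , u∈ , l = subst W′ (proj₂ (others _ (iW (proj₂ (All.lookup q u∈)))) l) (proj₂ (All.lookup q u∈))

-- The factor N admits maps onto a proper sublattice, where an integral form extends only up to a
-- multiple; for `η` it is q.
Embedding : (Pt → Pt) → Set
Embedding g = ∀ φ → Aff φ → Σ ℤ λ N → Σ (Pt → ℤ) λ φ′ → 0ℤ < N × Aff φ′ × (∀ v → φ′ (g v) ≡ N * φ v)

pushforward : (Pt → Pt) → Meas → Meas
pushforward g = map (λ w → proj₁ w , g (proj₂ w))

≈-pullback : ∀ {g} → Embedding g → pushforward g ws ≈ pushforward g us → ws ≈ us
≈-pullback {ws} {us} {g} emb e = mom λ φ a → go φ (emb φ a)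
  where
  go : ∀ φ → (Σ ℤ λ N → Σ (Pt → ℤ) λ φ′ → 0ℤ < N × Aff φ′ × (∀ v → φ′ (g v) ≡ N * φ v)) → E φ ws ≡ E φ us
  go φ (N , φ′ , N>0 , a′ , eq) = ℚ-*-cancelˡ (0<ι N>0)
    (trans (sym (E-* N φ ws)) (trans (sym (E-cong eq ws)) (trans (sym (E-map g φ′ ws))
    (trans (_≈_.same e φ′ a′) (trans (E-map g φ′ us) (trans (E-cong eq us) (E-* N φ us)))))))

PosOn-pullback : ∀ {g : Pt → Pt} → (∀ v → V v → ∃ λ c → v ≡ g c) → PosOn V ws →
  ∃ λ ws′ → ws ≡ pushforward g ws′ × PosOn (λ c → V (g c)) ws′
PosOn-pullback h [] = [] , refl , []
PosOn-pullback h ((t , v) ∷ ps) with h _ v | PosOn-pullback h ps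
... | c , refl | ws′ , refl , ps′ = (_ , c) ∷ ws′ , refl , (t , v) ∷ ps′

All-push : ∀ {P : Pt → Set} (g : Pt → Pt) {ws} → All (λ w → P (g (proj₂ w))) ws → All (λ w → P (proj₂ w)) (pushforward g ws)
All-push g []       = []
All-push g (p ∷ ps) = p ∷ All-push g ps

Meet-pullback : ∀ {g : Pt → Pt} → Embedding g → (∀ v → V v → ∃ λ c → v ≡ g c) → (∀ v → W v → ∃ λ c → v ≡ g c) →
  Meet (λ c → V (g c)) (λ c → W (g c)) → Meet V W
Meet-pullback {g = g} emb hV hW m p q e with PosOn-pullback hV p | PosOn-pullback hW q
... | ws′ , refl , p′ | us′ , refl , q′ with m p′ q′ (≈-pullback emb e)
... | x , y = All-push g x , All-push g y

-- Standard triangulation of a lattice plane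

-- Imposed on (u , v) and on (v , u), this leaves 0 and the six edge directions of the triangulation
-- cut out by integral values of n₁, n₂ and n₁ + n₂. Upper bounds suffice because the lower ones
-- come from the opposite pair.
record Hex (a b : ℤ) : Set where
  constructor hex
  field
    a≤1 : a ≤ 1ℤ
    b≤1 : b ≤ 1ℤ
    s≤1 : a + b ≤ 1ℤ
    deg : a ≡ 0ℤ ⊎ b ≡ 0ℤ ⊎ a + b ≡ 0ℤ

InRange : (Pt → ℤ) → ℤ → Pt → Set
InRange n a v = a ≤ n v × n v ≤ a + 1ℤ

minimum : ∀ (n : Pt → ℤ) (w : ℚ × Pt) ws → ∃ λ m → m ∈ (w ∷ ws) × All (λ u → n (proj₂ m) ≤ n (proj₂ u)) (w ∷ ws)
minimum n w [] = w , here refl , ℤ.≤-refl ∷ []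
minimum n w (w′ ∷ ws) with minimum n w′ ws
... | m , m∈ , min with ℤ.≤-total (n (proj₂ w)) (n (proj₂ m))
...   | inj₁ l = w , here refl , ℤ.≤-refl ∷ All.map (ℤ.≤-trans l) min
...   | inj₂ l = m , there m∈ , l ∷ min

range : ∀ n → PosOn V ws → (∀ u v → V u → V v → n u - n v ≤ 1ℤ) → ∃ λ a → PosOn (λ v → V v × InRange n a v) ws
-- The empty measure lies in every slab.
range {ws = []}     n p h = 0ℤ , []
range {ws = w ∷ ws} n p h with minimum n w ws
... | m , m∈ , min = n (proj₂ m) , All.map (λ { (x , l) → proj₁ x , proj₂ x , l ,
      ≤-by _ (≤⇒0≤ (h _ _ (proj₂ x) (proj₂ (All.lookup p m∈)))) (eq (n _) (n (proj₂ m))) }) (All.zip (p , min))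
  where
  eq : ∀ a b → b + 1ℤ - a ≡ 1ℤ - (a - b)
  eq = solve-∀

-- Two different unit slabs at integral heights are separated by an integral plane, which then
-- carries both supports and lies in one common slab.
commonRange : ∀ n → Aff n → PosOn V ws → PosOn W us → ws ≈ us →
  (∀ u v → V u → V v → n u - n v ≤ 1ℤ) → (∀ u v → W u → W v → n u - n v ≤ 1ℤ) →
  ∃ λ a → PosOn (λ v → V v × InRange n a v) ws × PosOn (λ v → W v × InRange n a v) us
commonRange {V = V} {W = W} n af p q e hV hW with range n p hV | range n q hW
... | a , p′ | b , q′ with ℤ.<-cmp a b
... | tri≈ _ refl _ = a , p′ , q′
... | tri< a<b _ _ = b , PosOn-weaken (fix {V}) (proj₁ s) , PosOn-weaken (fix {W}) (proj₂ s)
  where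
  eq₁ : ∀ x a b → - (x - b) ≡ (a + 1ℤ - x) + (b - (1ℤ + a))
  eq₁ = solve-∀
  s = separate (λ v → n v - b) (aff-- af (aff-c b))
        (λ v z → 0≤-resp (eq₁ (n v) a b) (0≤+ (≤⇒0≤ (proj₂ (proj₂ z))) (≤⇒0≤ (ℤ.i<j⇒suc[i]≤j a<b))))
        (λ v z → ≤⇒0≤ (proj₁ (proj₂ z))) p′ q′ e
  fix : ∀ {V : Pt → Set} {a} v → (V v × InRange n a v) × n v - b ≡ 0ℤ → V v × InRange n b v
  fix v ((z , _) , r) = z , ℤ.≤-reflexive (sym (ℤ.i-j≡0⇒i≡j _ _ r)) , ℤ.≤-trans (ℤ.≤-reflexive (ℤ.i-j≡0⇒i≡j _ _ r)) (ℤ.i≤i+j b 1ℤ)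
... | tri> _ _ b<a = a , PosOn-weaken (fix {V}) (proj₂ s) , PosOn-weaken (fix {W}) (proj₁ s)
  where
  eq₁ : ∀ x b a → - (x - a) ≡ (b + 1ℤ - x) + (a - (1ℤ + b))
  eq₁ = solve-∀
  s = separate (λ v → n v - a) (aff-- af (aff-c a))
        (λ v z → 0≤-resp (eq₁ (n v) b a) (0≤+ (≤⇒0≤ (proj₂ (proj₂ z))) (≤⇒0≤ (ℤ.i<j⇒suc[i]≤j b<a))))
        (λ v z → ≤⇒0≤ (proj₁ (proj₂ z))) q′ p′ (≈-sym e)
  fix : ∀ {V : Pt → Set} {b} v → (V v × InRange n b v) × n v - a ≡ 0ℤ → V v × InRange n a v
  fix v ((z , _) , r) = z , ℤ.≤-reflexive (sym (ℤ.i-j≡0⇒i≡j _ _ r)) , ℤ.≤-trans (ℤ.≤-reflexive (ℤ.i-j≡0⇒i≡j _ _ r)) (ℤ.i≤i+j a 1ℤ)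

-- By integrality m is one of the two ends of the slab, and s is the sign pointing from m into it.
sgn : ∀ a m → a ≤ m → m ≤ a + 1ℤ → Σ ℤ λ s → (∀ x → s * x ≡ 0ℤ → x ≡ 0ℤ) ×
  (∀ n → a ≤ n → n ≤ a + 1ℤ → 0ℤ ≤ s * (n - m) × 0ℤ ≤ 1ℤ - s * (n - m))
sgn a m l u with m ℤ.≤? a
... | yes m≤a with ℤ.≤-antisym m≤a l
...   | refl = 1ℤ , (λ x e → trans (sym (ℤ.*-identityˡ x)) e) ,
        λ n l′ u′ → 0≤-resp (eq₁ n a) (≤⇒0≤ l′) , 0≤-resp (eq₂ n a) (≤⇒0≤ u′)
  where
  eq₁ : ∀ n a → 1ℤ * (n - a) ≡ n - a
  eq₁ = solve-∀
  eq₂ : ∀ n a → 1ℤ - 1ℤ * (n - a) ≡ a + 1ℤ - n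
  eq₂ = solve-∀
sgn a m l u | no m≰a with ℤ.≤-antisym u (subst (_≤ m) (ℤ.+-comm 1ℤ a) (ℤ.i<j⇒suc[i]≤j (ℤ.≰⇒> m≰a)))
...   | refl = ℤ.-1ℤ , (λ x e → ℤ.neg-injective (trans (sym (ℤ.-1*i≡-i x)) e)) ,
        λ n l′ u′ → 0≤-resp (eq₁ n a) (≤⇒0≤ u′) , 0≤-resp (eq₂ n a) (≤⇒0≤ l′)
  where
  eq₁ : ∀ n a → - 1ℤ * (n - (a + 1ℤ)) ≡ a + 1ℤ - n
  eq₁ = solve-∀
  eq₂ : ∀ n a → 1ℤ - (- 1ℤ) * (n - (a + 1ℤ)) ≡ n - a
  eq₂ = solve-∀

two-of-three : ∀ {x y z} → 0ℤ ≤ x → 0ℤ ≤ y → 0ℤ ≤ z → 0ℤ < + 2 - (x + (y + z)) →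
  (x ≡ 0ℤ × y ≡ 0ℤ) ⊎ (x ≡ 0ℤ × z ≡ 0ℤ) ⊎ (y ≡ 0ℤ × z ≡ 0ℤ)
two-of-three {x} {y} {z} p q r s with x ℤ.≟ 0ℤ | y ℤ.≟ 0ℤ
... | yes e | yes f = inj₁ (e , f)
... | yes e | no f = inj₂ (inj₁ (e , 0≤∧≤0⇒≡0 r (0≤-resp (eq x y z) (0≤+ (≤⇒0≤ (0<⇒1≤ s)) (0≤+ p (≤⇒0≤ (0<⇒1≤ (ℤ.≤∧≢⇒< q (λ e → f (sym e))))))))))
  where
  eq : ∀ x y z → - z ≡ (+ 2 - (x + (y + z)) - 1ℤ) + (x + (y - 1ℤ))
  eq = solve-∀
... | no e | _ = inj₂ (inj₂ (0≤∧≤0⇒≡0 q (0≤-resp (eq x y z) (0≤+ s′ (0≤+ r x′))) , 0≤∧≤0⇒≡0 r (0≤-resp (eq′ x y z) (0≤+ s′ (0≤+ q x′)))))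
  where
  s′ = ≤⇒0≤ (0<⇒1≤ s)
  x′ = ≤⇒0≤ (0<⇒1≤ (ℤ.≤∧≢⇒< p (λ f → e (sym f))))
  eq : ∀ x y z → - y ≡ (+ 2 - (x + (y + z)) - 1ℤ) + (z + (x - 1ℤ))
  eq = solve-∀
  eq′ : ∀ x y z → - z ≡ (+ 2 - (x + (y + z)) - 1ℤ) + (y + (x - 1ℤ))
  eq′ = solve-∀

module _ (n₁ n₂ : Pt → ℤ) (a₁ : Aff n₁) (a₂ : Aff n₂) where

  private
    n₃ : Pt → ℤ
    n₃ v = n₁ v + n₂ v

    record R (a b c : ℤ) (V : Pt → Set) (v : Pt) : Set where
      constructor mkR
      field
        orig : V v
        in₁ : InRange n₁ a v
        in₂ : InRange n₂ b v
        in₃ : InRange n₃ c v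
    open R

    IsClique : (Pt → Set) → Set
    IsClique V = ∀ u v → V u → V v → Hex (n₁ u - n₁ v) (n₂ u - n₂ v)

    Sign : (Pt → ℤ) → ℤ → ℤ → ℤ → Set
    Sign n a m s = (∀ x → s * x ≡ 0ℤ → x ≡ 0ℤ) ×
      (∀ k → a ≤ k → k ≤ a + 1ℤ → 0ℤ ≤ s * (k - m) × 0ℤ ≤ 1ℤ - s * (k - m))

    mul0 : ∀ s {x} → x ≡ 0ℤ → s * x ≡ 0ℤ
    mul0 s refl = ℤ.*-zeroʳ s

    n₃-diff : ∀ x y x′ y′ → x + y - (x′ + y′) ≡ (x - x′) + (y - y′)
    n₃-diff = solve-∀

    -- The form that exposes v within its three slabs. On a clique containing v one of the
    -- differences vanishes and the other two contribute at most 1 each, so the form is nonnegative.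
    -- It is 2 at v, and it is positive only where two differences vanish, that is, at the
    -- coordinates of v.
    gap : ℤ → ℤ → ℤ → Pt → Pt → ℤ
    gap s₁ s₂ s₃ v u = + 2 - (s₁ * (n₁ u - n₁ v) + (s₂ * (n₂ u - n₂ v) + s₃ * (n₃ u - n₃ v)))

    aff-gap : ∀ s₁ s₂ s₃ v → Aff (gap s₁ s₂ s₃ v)
    aff-gap s₁ s₂ s₃ v = aff-- (aff-c (+ 2)) (aff-+ (aff-* s₁ (aff-- a₁ (aff-c (n₁ v))))
      (aff-+ (aff-* s₂ (aff-- a₂ (aff-c (n₂ v)))) (aff-* s₃ (aff-- (aff-+ a₁ a₂) (aff-c (n₃ v))))))

    two-ones : ∀ x y z → x ≡ 0ℤ ⊎ y ≡ 0ℤ ⊎ z ≡ 0ℤ → 0ℤ ≤ 1ℤ - x → 0ℤ ≤ 1ℤ - y → 0ℤ ≤ 1ℤ - z → 0ℤ ≤ + 2 - (x + (y + z))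
    two-ones .0ℤ y z (inj₁ refl) p q r = 0≤-resp (eq y z) (0≤+ q r)
      where
      eq : ∀ y z → + 2 - (0ℤ + (y + z)) ≡ (1ℤ - y) + (1ℤ - z)
      eq = solve-∀
    two-ones x .0ℤ z (inj₂ (inj₁ refl)) p q r = 0≤-resp (eq x z) (0≤+ p r)
      where
      eq : ∀ y z → + 2 - (y + (0ℤ + z)) ≡ (1ℤ - y) + (1ℤ - z)
      eq = solve-∀
    two-ones x y .0ℤ (inj₂ (inj₂ refl)) p q r = 0≤-resp (eq x y) (0≤+ p q)
      where
      eq : ∀ y z → + 2 - (y + (z + 0ℤ)) ≡ (1ℤ - y) + (1ℤ - z)
      eq = solve-∀

    at-v : ∀ x y z s₁ s₂ s₃ → + 2 - (s₁ * (x - x) + (s₂ * (y - y) + s₃ * (z - z))) ≡ + 2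
    at-v = solve-∀

    diff₂ : ∀ x y x′ y′ → y - y′ ≡ x + y - (x′ + y′) - (x - x′)
    diff₂ = solve-∀

    diff₁ : ∀ x y x′ y′ → x - x′ ≡ x + y - (x′ + y′) - (y - y′)
    diff₁ = solve-∀

    deg⇒ : ∀ s₁ s₂ s₃ u v → Hex (n₁ u - n₁ v) (n₂ u - n₂ v) →
      s₁ * (n₁ u - n₁ v) ≡ 0ℤ ⊎ s₂ * (n₂ u - n₂ v) ≡ 0ℤ ⊎ s₃ * (n₃ u - n₃ v) ≡ 0ℤ
    deg⇒ s₁ s₂ s₃ u v h with Hex.deg h
    ... | inj₁ z = inj₁ (mul0 s₁ z)
    ... | inj₂ (inj₁ z) = inj₂ (inj₁ (mul0 s₂ z))
    ... | inj₂ (inj₂ z) = inj₂ (inj₂ (mul0 s₃ (trans (n₃-diff (n₁ u) (n₂ u) (n₁ v) (n₂ v)) z)))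

    same-coords : ∀ s₁ s₂ s₃ a b c v → Sign n₁ a (n₁ v) s₁ → Sign n₂ b (n₂ v) s₂ → Sign n₃ c (n₃ v) s₃ →
      ∀ u → R a b c W u → 0ℤ < gap s₁ s₂ s₃ v u → n₁ u ≡ n₁ v × n₂ u ≡ n₂ v
    same-coords s₁ s₂ s₃ a b c v (z₁ , S₁) (z₂ , S₂) (z₃ , S₃) u (mkR _ (l₁ , u₁) (l₂ , u₂) (l₃ , u₃)) g
      with two-of-three (proj₁ (S₁ (n₁ u) l₁ u₁)) (proj₁ (S₂ (n₂ u) l₂ u₂)) (proj₁ (S₃ (n₃ u) l₃ u₃)) g
    ... | inj₁ (x , y) = ℤ.i-j≡0⇒i≡j _ _ (z₁ _ x) , ℤ.i-j≡0⇒i≡j _ _ (z₂ _ y)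
    ... | inj₂ (inj₁ (x , y)) = ℤ.i-j≡0⇒i≡j _ _ (z₁ _ x) ,
          ℤ.i-j≡0⇒i≡j _ _ (trans (diff₂ (n₁ u) (n₂ u) (n₁ v) (n₂ v)) (cong₂ _-_ (z₃ _ y) (z₁ _ x)))
    ... | inj₂ (inj₂ (x , y)) =
          ℤ.i-j≡0⇒i≡j _ _ (trans (diff₁ (n₁ u) (n₂ u) (n₁ v) (n₂ v)) (cong₂ _-_ (z₃ _ y) (z₂ _ x))) , ℤ.i-j≡0⇒i≡j _ _ (z₂ _ x)

    step : ∀ s₁ s₂ s₃ a b c v → Sign n₁ a (n₁ v) s₁ → Sign n₂ b (n₂ v) s₂ → Sign n₃ c (n₃ v) s₃ →
      IsClique V → (∀ u v → V u → W v → n₁ u ≡ n₁ v → n₂ u ≡ n₂ v → u ≡ v) →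
      PosOn (R a b c V) ws → PosOn (R a b c W) us → ws ≈ us → V v → ∀ t → (t , v) ∈ ws → W v
    step {V = V} {W = W} {us = us} s₁ s₂ s₃ a b c v S₁ S₂ S₃ cl det p q e vV t v∈ =
      finish (find (positive-somewhere (gap s₁ s₂ s₃ v) (aff-gap s₁ s₂ s₃ v) p q e nonneg (lose v∈ pos)))
      where
      nonneg : ∀ u → R a b c V u → 0ℤ ≤ gap s₁ s₂ s₃ v u
      nonneg u (mkR uV (l₁ , u₁) (l₂ , u₂) (l₃ , u₃)) = two-ones _ _ _ (deg⇒ s₁ s₂ s₃ u v (cl u v uV vV))
        (proj₂ (proj₂ S₁ _ l₁ u₁)) (proj₂ (proj₂ S₂ _ l₂ u₂)) (proj₂ (proj₂ S₃ _ l₃ u₃))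
      pos : 0ℤ < gap s₁ s₂ s₃ v v
      pos = subst (0ℤ <_) (sym (at-v (n₁ v) (n₂ v) (n₃ v) s₁ s₂ s₃)) (+<+ (s≤s z≤n))
      finish : (∃ λ x → x ∈ us × 0ℤ < gap s₁ s₂ s₃ v (proj₂ x)) → W v
      finish ((_ , u) , u∈ , g) = subst W (sym (det v u vV (orig uR) (sym (proj₁ uv)) (sym (proj₂ uv)))) (orig uR)
        where
        uR = proj₂ (All.lookup q u∈)
        uv = same-coords s₁ s₂ s₃ a b c v S₁ S₂ S₃ u uR g

    one : ∀ a b c → IsClique V → (∀ u v → V u → W v → n₁ u ≡ n₁ v → n₂ u ≡ n₂ v → u ≡ v) →
      PosOn (R a b c V) ws → PosOn (R a b c W) us → ws ≈ us → All (λ w → W (proj₂ w)) ws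
    one {V = V} {W = W} {ws = ws} a b c cl det p q e = All.tabulate go
      where
      go : ∀ {w} → w ∈ ws → W (proj₂ w)
      go {t , v} w∈ with proj₂ (All.lookup p w∈)
      ... | mkR vV (l₁ , u₁) (l₂ , u₂) (l₃ , u₃) with sgn a (n₁ v) l₁ u₁ | sgn b (n₂ v) l₂ u₂ | sgn c (n₃ v) l₃ u₃
      ... | s₁ , S₁ | s₂ , S₂ | s₃ , S₃ = step s₁ s₂ s₃ a b c v S₁ S₂ S₃ cl det p q e vV t w∈

    n₃-hex : ∀ u v → Hex (n₁ u - n₁ v) (n₂ u - n₂ v) → n₃ u - n₃ v ≤ 1ℤ
    n₃-hex u v h = subst (_≤ 1ℤ) (sym (n₃-diff (n₁ u) (n₂ u) (n₁ v) (n₂ v))) (Hex.s≤1 h)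

    mk : ∀ {a b c} v → ((V v × InRange n₁ a v) × InRange n₂ b v) × InRange n₃ c v → R a b c V v
    mk v (((x , r₁) , r₂) , r₃) = mkR x r₁ r₂ r₃

  -- Both supports are brought into the same slabs for n₁, n₂ and n₁ + n₂, that is, into at most one
  -- triangle of the standard triangulation. There `gap` exposes every vertex.
  Meet-clique : (∀ u v → V u → V v → Hex (n₁ u - n₁ v) (n₂ u - n₂ v)) →
    (∀ u v → W u → W v → Hex (n₁ u - n₁ v) (n₂ u - n₂ v)) →
    (∀ u v → V u → W v → n₁ u ≡ n₁ v → n₂ u ≡ n₂ v → u ≡ v) → Meet V W
  Meet-clique cV cW det p q e
    with commonRange n₁ a₁ p q e (λ u v x y → Hex.a≤1 (cV u v x y)) (λ u v x y → Hex.a≤1 (cW u v x y))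
  ... | a , p₁ , q₁ with commonRange n₂ a₂ p₁ q₁ e (λ u v x y → Hex.b≤1 (cV u v (proj₁ x) (proj₁ y)))
                                                   (λ u v x y → Hex.b≤1 (cW u v (proj₁ x) (proj₁ y)))
  ... | b , p₂ , q₂ with commonRange n₃ (aff-+ a₁ a₂) p₂ q₂ e
         (λ u v x y → n₃-hex u v (cV u v (proj₁ (proj₁ x)) (proj₁ (proj₁ y))))
         (λ u v x y → n₃-hex u v (cW u v (proj₁ (proj₁ x)) (proj₁ (proj₁ y))))
  ... | c , p₃ , q₃ = one a b c cV det (PosOn-weaken mk p₃) (PosOn-weaken mk q₃) e ,
        one a b c cW (λ u v x y e₁ e₂ → sym (det v u y x (sym e₁) (sym e₂))) (PosOn-weaken mk q₃) (PosOn-weaken mk p₃) (≈-sym e)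

pattern i0 = Fin.zero
pattern i1 = Fin.suc Fin.zero
pattern i2 = Fin.suc (Fin.suc Fin.zero)
pattern i3 = Fin.suc (Fin.suc (Fin.suc Fin.zero))

tet : Pt → Pt → Pt → Pt → Fin 4 → Pt
tet a b c d i0 = a
tet a b c d i1 = b
tet a b c d i2 = c
tet a b c d i3 = d

Vert : (Fin 4 → Pt) → Pt → Set
Vert S v = ∃ λ i → v ≡ S i

pattern at0 = i0 , refl
pattern at1 = i1 , refl
pattern at2 = i2 , refl
pattern at3 = i3 , refl

-- Chains of lattice points

-- The points (x , j) with x = r j - q τ j are the lattice points of the strip 0 ≤ x < q,
-- in lattice coordinates (j , τ j).
record Chain (r q : ℕ) : Set where
  field
    τ   : ℕ → ℤ
    q>0 : 0 ℕ.< q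
    τ0  : τ 0 ≡ 0ℤ
    τq  : τ q ≡ + r
    x≥0 : ∀ j → 0ℤ ≤ + r * + j - + q * τ j
    x<q : ∀ j → + r * + j - + q * τ j < + q
    x>0 : ∀ j → 0 ℕ.< j → j ℕ.< q → 0ℤ < + r * + j - + q * τ j
    bez : Σ ℤ λ α → Σ ℤ λ β → α * + r + β * + q ≡ 1ℤ

0<-by : ∀ {a b} c → 0ℤ < c → 0ℤ ≤ b → c * a ≡ b → b ≢ 0ℤ → 0ℤ < a
0<-by {a} {b} c c>0 b≥0 e b≢0 with ℤ.<-cmp 0ℤ a
... | tri< l _ _ = l
... | tri≈ _ refl _ = ⊥-elim (b≢0 (trans (sym e) (ℤ.*-zeroʳ c)))
... | tri> _ _ g = ⊥-elim (b≢0 (0≤∧≤0⇒≡0 b≥0 (0≤-resp (trans (cong -_ (sym e)) (ℤ.neg-distribʳ-* c a)) (0≤* (ℤ.<⇒≤ c>0) (ℤ.<⇒≤ (ℤ.neg-mono-< g))))))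

0<-cancel : ∀ {a b} c → 0ℤ < c → 0ℤ < b → c * a ≡ b → 0ℤ < a
0<-cancel c p b>0 e = 0<-by c p (ℤ.<⇒≤ b>0) e (λ z → ℤ.<-irrefl (sym z) b>0)

0<* : ∀ {a b} → 0ℤ < a → 0ℤ < b → 0ℤ < a * b
0<* {+ suc m} {+ suc n} _ _ = +<+ (s≤s z≤n)
0<* {+ zero} (+<+ ()) _
0<* {+ suc m} {+ zero} _ (+<+ ())

0<+ˡ : ∀ {a b} → 0ℤ < a → 0ℤ ≤ b → 0ℤ < a + b
0<+ˡ = ℤ.+-mono-<-≤

0<-resp : ∀ {a b} → b ≡ a → 0ℤ < a → 0ℤ < b
0<-resp refl p = p

<⇒0< : ∀ {a b} → a < b → 0ℤ < b - a
<⇒0< {a} {b} p = 1≤⇒0< (0≤⇒≤ (0≤-resp (eq a b) (≤⇒0≤ (ℤ.i<j⇒suc[i]≤j p))))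
  where
  eq : ∀ a b → b - a - 1ℤ ≡ b - (1ℤ + a)
  eq = solve-∀

ℕ≤⇒0≤ : ∀ {a b} → a ℕ.≤ b → 0ℤ ≤ + b - + a
ℕ≤⇒0≤ p = ≤⇒0≤ (+≤+ p)

ℕ<⇒0< : ∀ {a b} → a ℕ.< b → 0ℤ < + b - + a
ℕ<⇒0< p = <⇒0< (+<+ p)

small-multiple : ∀ D K → 0ℤ < D → 0ℤ ≤ D * K → 0ℤ < D - D * K → K ≡ 0ℤ
small-multiple D (+ zero) _ _ _ = refl
small-multiple D (+ suc n) D>0 _ l = ⊥-elim (ℤ.<-irrefl refl (ℤ.<-≤-trans l (≤-by (D * + n) (0≤* (ℤ.<⇒≤ D>0) (0≤+ᴺ n)) (eq D (+ n)))))
  where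
  eq : ∀ D n → 0ℤ - (D - D * (1ℤ + n)) ≡ D * n
  eq = solve-∀
small-multiple D -[1+ n ] D>0 l _ = ⊥-elim (ℤ.<-irrefl refl (ℤ.<-≤-trans (0<* D>0 (+<+ (s≤s (z≤n {n})))) (≤-by (D * -[1+ n ]) l (trans (ℤ.+-identityˡ _) (ℤ.neg-distribʳ-* D (+ suc n))))))

-- Farey subdivision of the region between a chord and the path

module Strip {r q : ℕ} (chain : Chain r q) where
  open Chain chain

  -- Twice the signed area, in lattice coordinates, of the triangle of the path points a, j, b. It
  -- is positive when the point j lies on the side of larger x of the chord.
  d : ℕ → ℕ → ℕ → ℤ
  d a b j = τ a * (+ b - + j) + τ b * (+ j - + a) - (+ b - + a) * τ j

  Conv : ℕ → ℕ → Set
  Conv a b = ∀ j → a ℕ.< j → j ℕ.< b → 0ℤ < d a b j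

  data Tree : ℕ → ℕ → Set where
    leaf : ∀ {a} → Tree a (suc a)
    -- d a b m = 1 makes (l a , l m , l b) a unimodular triangle, as in a Farey subdivision
    node : ∀ {a b} m → a ℕ.< m → m ℕ.< b → d a b m ≡ 1ℤ → Conv a m → Conv m b →
           Tree a m → Tree m b → Tree a b

  x : ℕ → ℤ
  x j = + r * + j - + q * τ j

  0<q : 0ℤ < + q
  0<q = +<+ q>0

  private
    q-bound : ∀ r q a b j ta tb tj → q * (b - a - (ta * (b - j) + tb * (j - a) - (b - a) * tj)) ≡
      (b - a) * (q - (r * j - q * tj)) + ((r * a - q * ta) * (b - j) + (r * b - q * tb) * (j - a))
    q-bound = solve-∀

    plücker₁ : ∀ a b m j ta tb tm tj → (b - a) * (ta * (m - j) + tm * (j - a) - (m - a) * tj) ≡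
      (ta * (b - j) + tb * (j - a) - (b - a) * tj) * (m - a) - (j - a) * (ta * (b - m) + tb * (m - a) - (b - a) * tm)
    plücker₁ = solve-∀

    plücker₂ : ∀ a b m j ta tb tm tj → (b - a) * (tm * (b - j) + tb * (j - m) - (b - m) * tj) ≡
      (ta * (b - j) + tb * (j - a) - (b - a) * tj) * (b - m) - (b - j) * (ta * (b - m) + tb * (m - a) - (b - a) * tm)
    plücker₂ = solve-∀

  -- Divided by `b - a`, this determinant is the horizontal distance from the chord to the point j
  -- in units of q, and the strip `0 ≤ x < q` has width less than one such unit.
  d<length : ∀ a b j → a ℕ.< j → j ℕ.< b → 0ℤ < + b - + a - d a b j
  d<length a b j p p′ = 0<-cancel (+ q) 0<q
    (0<+ˡ (0<* (ℕ<⇒0< (ℕ.<-trans p p′)) (<⇒0< (x<q j))) (0≤+ (0≤* (x≥0 a) (ℕ≤⇒0≤ (ℕ.<⇒≤ p′))) (0≤* (x≥0 b) (ℕ≤⇒0≤ (ℕ.<⇒≤ p)))))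
    (q-bound (+ r) (+ q) (+ a) (+ b) (+ j) (τ a) (τ b) (τ j))

  -- The point m has the least positive distance 1 from the chord, so no path point before it can
  -- fall on or behind the new chord: by the Plücker relation the new determinant, times `b - a`, is
  -- `(m - j) + (d a b j - 1) (m - a)`.
  Conv-left : ∀ {a b m} → a ℕ.< m → m ℕ.< b → d a b m ≡ 1ℤ → Conv a b → Conv a m
  Conv-left {a} {b} {m} p p′ e cv j l l′ = 0<-cancel (+ b - + a) (ℕ<⇒0< (ℕ.<-trans p p′))
    (0<+ˡ (ℕ<⇒0< l′) (0≤* (≤⇒0≤ (0<⇒1≤ (cv j l (ℕ.<-trans l′ p′)))) (ℕ≤⇒0≤ (ℕ.<⇒≤ p))))
    (trans (plücker₁ (+ a) (+ b) (+ m) (+ j) (τ a) (τ b) (τ m) (τ j)) (trans (cong (λ z → d a b j * (+ m - + a) - (+ j - + a) * z) e) (eq (d a b j) (+ a) (+ m) (+ j))))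
    where
    eq : ∀ D a m j → D * (m - a) - (j - a) * 1ℤ ≡ (m - j) + (D - 1ℤ) * (m - a)
    eq = solve-∀

  Conv-right : ∀ {a b m} → a ℕ.< m → m ℕ.< b → d a b m ≡ 1ℤ → Conv a b → Conv m b
  Conv-right {a} {b} {m} p p′ e cv j l l′ = 0<-cancel (+ b - + a) (ℕ<⇒0< (ℕ.<-trans p p′))
    (0<+ˡ (ℕ<⇒0< l) (0≤* (≤⇒0≤ (0<⇒1≤ (cv j (ℕ.<-trans p l) l′))) (ℕ≤⇒0≤ (ℕ.<⇒≤ p′))))
    (trans (plücker₂ (+ a) (+ b) (+ m) (+ j) (τ a) (τ b) (τ m) (τ j)) (trans (cong (λ z → d a b j * (+ b - + m) - (+ b - + j) * z) e) (eq (d a b j) (+ b) (+ m) (+ j))))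
    where
    eq : ∀ D b m j → D * (b - m) - (b - j) * 1ℤ ≡ (j - m) + (D - 1ℤ) * (b - m)
    eq = solve-∀

  Bez : ℕ → ℕ → Set
  Bez a b = Σ ℤ λ α → Σ ℤ λ β → α * (τ b - τ a) + β * (+ b - + a) ≡ 1ℤ

  -- The equation `d a b m ≡ 1` is itself a Bézout relation for the chord from a to m, so
  -- primitivity is inherited.
  Bez-left : ∀ a b m → d a b m ≡ 1ℤ → Bez a m
  Bez-left a b m e = - (+ b - + a) , τ b - τ a , trans (eq (+ a) (+ b) (+ m) (τ a) (τ b) (τ m)) e
    where
    eq : ∀ a b m ta tb tm → - (b - a) * (tm - ta) + (tb - ta) * (m - a) ≡ ta * (b - m) + tb * (m - a) - (b - a) * tm
    eq = solve-∀

  Bez-right : ∀ a b m → d a b m ≡ 1ℤ → Bez m b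
  Bez-right a b m e = + b - + a , - (τ b - τ a) , trans (eq (+ a) (+ b) (+ m) (τ a) (τ b) (τ m)) e
    where
    eq : ∀ a b m ta tb tm → (b - a) * (tb - tm) + - (tb - ta) * (b - m) ≡ ta * (b - m) + tb * (m - a) - (b - a) * tm
    eq = solve-∀

  private
    d-mod : ∀ a D i ta tb tm α β k → α ≡ i + k * D → α * (tb - ta) + β * (a + D - a) ≡ 1ℤ →
      ta * (a + D - (a + i)) + tb * (a + i - a) - (a + D - a) * tm ≡ 1ℤ + D * (- β - (tb - ta) * k + ta - tm)
    d-mod a D i ta tb tm α β k e f = trans (eq a D i ta tb tm k) fin
      where
      eq : ∀ a D i ta tb tm k → ta * (a + D - (a + i)) + tb * (a + i - a) - (a + D - a) * tm ≡
        (i + k * D) * (tb - ta) - (tb - ta) * k * D + D * (ta - tm)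
      eq = solve-∀
      eq₂ : ∀ a D ta tb tm α β k → α * (tb - ta) - (tb - ta) * k * D + D * (ta - tm) ≡
        (α * (tb - ta) + β * (a + D - a)) + D * (- β - (tb - ta) * k + ta - tm)
      eq₂ = solve-∀
      fin : (i + k * D) * (tb - ta) - (tb - ta) * k * D + D * (ta - tm) ≡ 1ℤ + D * (- β - (tb - ta) * k + ta - tm)
      fin = trans (cong (λ s → s * (tb - ta) - (tb - ta) * k * D + D * (ta - tm)) (sym e))
           (trans (eq₂ a D ta tb tm α β k) (cong (_+ D * (- β - (tb - ta) * k + ta - tm)) f))

  -- Let α be the Bézout coefficient of the slope of the chord. Modulo D, the determinant at index a
  -- + i is i times this slope, hence 1 for i = α mod D. It lies strictly between 0 and D, so it
  -- equals 1.
  middle : ∀ a D → 2 ℕ.≤ D → Conv a (a ℕ.+ D) → Bez a (a ℕ.+ D) →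
    ∃ λ m → a ℕ.< m × m ℕ.< a ℕ.+ D × d a (a ℕ.+ D) m ≡ 1ℤ
  middle a (suc zero) (s≤s ())
  middle a D@(suc (suc _)) 2≤D cv (α , β , bz) = m , a<m , m<b , dm
    where
    b = a ℕ.+ D
    i = α ℤ.%ℕ D
    k = α ℤ./ℕ D
    m = a ℕ.+ i
    m<b : m ℕ.< b
    m<b = ℕ.+-monoʳ-< a (ℤ.n%ℕd<d α D)
    K = - β - (τ b - τ a) * k + τ a - τ m
    form : d a b m ≡ 1ℤ + + D * K
    form = d-mod (+ a) (+ D) (+ i) (τ a) (τ b) (τ m) α β k (ℤ.a≡a%ℕn+[a/ℕn]*n α D) bz
    a<m : a ℕ.< m
    a<m with i in eq
    ... | suc _ = ℕ.m<m+n a (s≤s z≤n)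
    -- At i = 0 the determinant is 0, which is not congruent to 1 modulo D because D is at least 2.
    ... | zero = ⊥-elim (no-unit K′ (trans (sym form′) d0))
      where
      K′ = - β - (τ b - τ a) * k + τ a - τ (a ℕ.+ 0)
      form′ : d a b (a ℕ.+ 0) ≡ 1ℤ + + D * K′
      form′ = subst (λ n → d a b (a ℕ.+ n) ≡ 1ℤ + + D * (- β - (τ b - τ a) * k + τ a - τ (a ℕ.+ n))) eq form
      d0′ : ∀ a b ta tb → ta * (b - a) + tb * (a - a) - (b - a) * ta ≡ 0ℤ
      d0′ = solve-∀
      d0 : d a b (a ℕ.+ 0) ≡ 0ℤ
      d0 = subst (λ n → d a b n ≡ 0ℤ) (sym (ℕ.+-identityʳ a)) (d0′ (+ a) (+ b) (τ a) (τ b))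
      no-unit : ∀ K → ¬ (1ℤ + + D * K ≡ 0ℤ)
      no-unit (+ n) e = ℤ.<-irrefl (sym e) (0<+ˡ {1ℤ} (+<+ (s≤s z≤n)) (0≤* (0≤+ᴺ D) (0≤+ᴺ n)))
      no-unit -[1+ zero ] e = ℤ.<-irrefl e′ (0<* {+ D - 1ℤ} {1ℤ} (+<+ (s≤s z≤n)) (+<+ (s≤s z≤n)))
        where
        eq₀ : ∀ D → (D - 1ℤ) * 1ℤ ≡ - (1ℤ + D * - 1ℤ)
        eq₀ = solve-∀
        e′ : 0ℤ ≡ (+ D - 1ℤ) * 1ℤ
        e′ = sym (trans (eq₀ (+ D)) (cong -_ e))
      no-unit -[1+ suc n ] e = ℤ.<-irrefl e′ (0<+ˡ {+ D - 1ℤ} (+<+ (s≤s z≤n)) (0≤* (0≤+ᴺ D) (0≤+ᴺ (suc n))))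
        where
        eq₀ : ∀ D n → D - 1ℤ + D * n ≡ - (1ℤ + D * - (1ℤ + n))
        eq₀ = solve-∀
        e′ : 0ℤ ≡ + D - 1ℤ + + D * + suc n
        e′ = sym (trans (eq₀ (+ D) (+ suc n)) (cong -_ e))
    K≡0 : K ≡ 0ℤ
    K≡0 = small-multiple (+ D) K (+<+ (s≤s z≤n))
      (0≤-resp (eq₁ (+ D) K) (≤⇒0≤ (subst (1ℤ ≤_) form (0<⇒1≤ (cv m a<m m<b)))))
      (0<-resp (eq₂ (+ D) K (+ a)) (0<+ˡ (subst (λ z → 0ℤ < + b - + a - z) form (d<length a b m a<m m<b)) (+≤+ z≤n)))
      where
      eq₁ : ∀ D K → D * K ≡ 1ℤ + D * K - 1ℤ
      eq₁ = solve-∀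
      eq₂ : ∀ D K a → D - D * K ≡ a + D - a - (1ℤ + D * K) + 1ℤ
      eq₂ = solve-∀
    dm : d a b m ≡ 1ℤ
    dm = trans form (trans (cong (λ z → 1ℤ + + D * z) K≡0) (cong (λ z → 1ℤ + z) (ℤ.*-zeroʳ (+ D))))

  -- The recursion runs on a bound n for the length, since both parts of a subdivided chord are
  -- shorter.
  build : ∀ n a D → D ℕ.≤ n → 1 ℕ.≤ D → Conv a (a ℕ.+ D) → Bez a (a ℕ.+ D) → Tree a (a ℕ.+ D)
  build n a (suc zero) _ _ cv bz = subst (Tree a) (ℕ.+-comm 1 a) leaf
  build (suc n) a D@(suc (suc D′)) (s≤s le) _ cv bz = go (middle a D (s≤s (s≤s z≤n)) cv bz)
    where
    go : (∃ λ m → a ℕ.< m × m ℕ.< a ℕ.+ D × d a (a ℕ.+ D) m ≡ 1ℤ) → Tree a (a ℕ.+ D)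
    go (m , a<m , m<b , e) = node m a<m m<b e cvl cvr
      (subst (Tree a) eqm (build n a (m ℕ.∸ a) small₁ (ℕ.m<n⇒0<n∸m a<m)
        (subst (Conv a) (sym eqm) cvl) (subst (Bez a) (sym eqm) (Bez-left a (a ℕ.+ D) m e))))
      (subst (Tree m) eqb (build n m (a ℕ.+ D ℕ.∸ m) small₂ (ℕ.m<n⇒0<n∸m m<b)
        (subst (Conv m) (sym eqb) cvr) (subst (Bez m) (sym eqb) (Bez-right a (a ℕ.+ D) m e))))
      where
      cvl = Conv-left a<m m<b e cv
      cvr = Conv-right a<m m<b e cv
      eqm : a ℕ.+ (m ℕ.∸ a) ≡ m
      eqm = ℕ.m+[n∸m]≡n (ℕ.<⇒≤ a<m)
      eqb : m ℕ.+ (a ℕ.+ D ℕ.∸ m) ≡ a ℕ.+ D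
      eqb = ℕ.m+[n∸m]≡n (ℕ.<⇒≤ m<b)
      small₁ : m ℕ.∸ a ℕ.≤ n
      small₁ = ℕ.≤-trans (ℕ.≤-pred (ℕ.+-cancelˡ-≤ a _ _ (ℕ.≤-trans (ℕ.≤-reflexive (trans (ℕ.+-suc a (m ℕ.∸ a)) (cong suc eqm))) m<b))) le
      small₂ : a ℕ.+ D ℕ.∸ m ℕ.≤ n
      small₂ = ℕ.≤-trans (ℕ.≤-trans (ℕ.∸-monoʳ-≤ (a ℕ.+ D) a<m)
        (ℕ.≤-reflexive (trans (cong (ℕ._∸ suc a) (ℕ.+-suc a (suc D′))) (ℕ.m+n∸m≡n (suc a) (suc D′))))) le

  abstract
    -- The initial chord is the side `x = 0` of the square. There the determinant is the coordinate
    -- x of the path point, which is positive inside. Nothing later depends on the shape of the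
    -- tree, so it is kept abstract.
    tree : Tree 0 q
    tree = build q 0 q ℕ.≤-refl q>0 cv bz
      where
      eq : ∀ r q j t → 0ℤ * (q - j) + r * (j - 0ℤ) - (q - 0ℤ) * t ≡ r * j - q * t
      eq = solve-∀
      cv : Conv 0 q
      cv j p p′ = 0<-resp (trans (cong₂ (λ s u → s * (+ q - + j) + u * (+ j - 0ℤ) - (+ q - 0ℤ) * τ j) τ0 τq)
        (eq (+ r) (+ q) (+ j) (τ j))) (x>0 j p p′)
      bz : Bez 0 q
      bz = proj₁ bez , proj₁ (proj₂ bez) , trans (cong₂ (λ s u → proj₁ bez * (s - u) + proj₁ (proj₂ bez) * (+ q - 0ℤ)) τq τ0)
        (trans (eq₀ (proj₁ bez) (proj₁ (proj₂ bez)) (+ r) (+ q)) (proj₂ (proj₂ bez)))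
        where
        eq₀ : ∀ α β r q → α * (r - 0ℤ) + β * (q - 0ℤ) ≡ α * r + β * q
        eq₀ = solve-∀

-- Cones over the Farey triangles and their position relative to the path

module Path {r q : ℕ} (chain : Chain r q) where
  open Chain chain
  open Strip chain

  l : ℕ → Pt
  l j = + j , τ j , 1ℤ

  -- Since `x = r y - q t`, this is the point `x = q e` of the line `y = z = 0`: e counts unit steps
  -- along the bottom segment.
  ap : ℤ → Pt
  ap e = 0ℤ , - e , 0ℤ

  -- Homogeneous in y and z, so their zero planes contain the line of all apexes and bound the
  -- strips independently of the apex.
  lo hi : ℕ → Pt → ℤ
  lo a (y , t , z) = y - + a * z
  hi b (y , t , z) = + b * z - y

  level colevel : Pt → ℤ
  level (y , t , z) = z
  colevel (y , t , z) = 1ℤ - z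

  -- vanishes at l a, l b and ap e
  ch : ℕ → ℕ → ℤ → Pt → ℤ
  ch a b e v@(y , t , z) = τ a * hi b v + τ b * lo a v - (+ b - + a) * (t + e * (1ℤ - z))

  aff-lo : ∀ a → Aff (lo a)
  aff-lo a = aff-- aff-1 (aff-* (+ a) aff-3)

  aff-hi : ∀ b → Aff (hi b)
  aff-hi b = aff-- (aff-* (+ b) aff-3) aff-1

  aff-colevel : Aff colevel
  aff-colevel = aff-- (aff-c 1ℤ) aff-3

  aff-ch : ∀ a b e → Aff (ch a b e)
  aff-ch a b e = aff-- (aff-+ (aff-* (τ a) (aff-hi b)) (aff-* (τ b) (aff-lo a)))
                       (aff-* (+ b - + a) (aff-+ aff-2 (aff-* e aff-colevel)))

  lo-l : ∀ a j → lo a (l j) ≡ + j - + a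
  lo-l a j = cong (λ z → + j - z) (ℤ.*-identityʳ (+ a))

  hi-l : ∀ b j → hi b (l j) ≡ + b - + j
  hi-l b j = cong (λ z → z - + j) (ℤ.*-identityʳ (+ b))

  lo-ap : ∀ a e → lo a (ap e) ≡ 0ℤ
  lo-ap a e = cong (λ z → 0ℤ - z) (ℤ.*-zeroʳ (+ a))

  hi-ap : ∀ b e → hi b (ap e) ≡ 0ℤ
  hi-ap b e = cong (λ z → z - 0ℤ) (ℤ.*-zeroʳ (+ b))

  ch-l : ∀ a b e j → ch a b e (l j) ≡ d a b j
  ch-l a b e j = eq (+ a) (+ b) e (+ j) (τ a) (τ b) (τ j)
    where
    eq : ∀ a b e j ta tb tj → ta * (b * 1ℤ - j) + tb * (j - a * 1ℤ) - (b - a) * (tj + e * (1ℤ - 1ℤ)) ≡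
      ta * (b - j) + tb * (j - a) - (b - a) * tj
    eq = solve-∀

  ch-ap : ∀ a b e e′ → ch a b e (ap e′) ≡ (+ b - + a) * (e′ - e)
  ch-ap a b e e′ = eq (+ a) (+ b) e e′ (τ a) (τ b)
    where
    eq : ∀ a b e e′ ta tb → ta * (b * 0ℤ - 0ℤ) + tb * (0ℤ - a * 0ℤ) - (b - a) * (- e′ + e * (1ℤ - 0ℤ)) ≡ (b - a) * (e′ - e)
    eq = solve-∀

  ch-ap≡0 : ∀ a b e → ch a b e (ap e) ≡ 0ℤ
  ch-ap≡0 a b e = trans (ch-ap a b e e) (trans (cong ((+ b - + a) *_) (ℤ.+-inverseʳ e)) (ℤ.*-zeroʳ (+ b - + a)))

  d-start : ∀ a b → d a b a ≡ 0ℤ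
  d-start a b = eq (+ a) (+ b) (τ a) (τ b)
    where
    eq : ∀ a b ta tb → ta * (b - a) + tb * (a - a) - (b - a) * ta ≡ 0ℤ
    eq = solve-∀

  d-end : ∀ a b → d a b b ≡ 0ℤ
  d-end a b = eq (+ a) (+ b) (τ a) (τ b)
    where
    eq : ∀ a b ta tb → ta * (b - b) + tb * (b - a) - (b - a) * tb ≡ 0ℤ
    eq = solve-∀

  d-swap₁ : ∀ a m b → d a m b ≡ - d a b m
  d-swap₁ a m b = eq (+ a) (+ m) (+ b) (τ a) (τ m) (τ b)
    where
    eq : ∀ a m b ta tm tb → ta * (m - b) + tm * (b - a) - (m - a) * tb ≡ - (ta * (b - m) + tb * (m - a) - (b - a) * tm)
    eq = solve-∀

  d-swap₂ : ∀ a m b → d m b a ≡ - d a b m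
  d-swap₂ a m b = eq (+ a) (+ m) (+ b) (τ a) (τ m) (τ b)
    where
    eq : ∀ a m b ta tm tb → tm * (b - a) + tb * (a - m) - (b - m) * ta ≡ - (ta * (b - m) + tb * (m - a) - (b - a) * tm)
    eq = solve-∀

  -- Compares the plane over one path edge with the plane over a longer chord. In the strip of that
  -- edge the correction is nonnegative when the chord has the path on its far side.
  ch-step : ∀ a b e j v → (+ b - + a) * ch j (suc j) e v ≡
    ch a b e v - (d a b j * hi (suc j) v + d a b (suc j) * lo j v)
  ch-step a b e j (y , t , z) = eq (+ a) (+ b) e (+ j) (τ a) (τ b) (τ j) (τ (suc j)) y t z
    where
    eq : ∀ a b e j ta tb tj tk y t z →
      (b - a) * (tj * ((1ℤ + j) * z - y) + tk * (y - j * z) - (1ℤ + j - j) * (t + e * (1ℤ - z))) ≡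
      ta * (b * z - y) + tb * (y - a * z) - (b - a) * (t + e * (1ℤ - z))
      - ((ta * (b - j) + tb * (j - a) - (b - a) * tj) * ((1ℤ + j) * z - y) + (ta * (b - (1ℤ + j)) + tb * (1ℤ + j - a) - (b - a) * tk) * (y - j * z))
    eq = solve-∀

  d≥0 : ∀ {a b} → Conv a b → ∀ j → a ℕ.≤ j → j ℕ.≤ b → 0ℤ ≤ d a b j × (d a b j ≡ 0ℤ → j ≡ a ⊎ j ≡ b)
  d≥0 {a} {b} cv j p p′ with j ℕ.≟ a | j ℕ.≟ b
  ... | yes refl | _ = ℤ.≤-reflexive (sym (d-start a b)) , λ _ → inj₁ refl
  ... | no _ | yes refl = ℤ.≤-reflexive (sym (d-end a b)) , λ _ → inj₂ refl
  ... | no f | no g = ℤ.<⇒≤ pos , λ z → ⊥-elim (ℤ.<-irrefl (sym z) pos)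
    where pos = cv j (ℕ.≤∧≢⇒< p (λ e → f (sym e))) (ℕ.≤∧≢⇒< p′ g)

  data OnEdge (i j : ℕ) (e : ℤ) : Pt → Set where
    fst-pt : OnEdge i j e (l i)
    snd-pt : OnEdge i j e (l j)
    apex   : OnEdge i j e (ap e)

  ch-OnEdge : ∀ {i j e v} → OnEdge i j e v → ch i j e v ≡ 0ℤ
  ch-OnEdge {i} {j} {e} fst-pt = trans (ch-l i j e i) (d-start i j)
  ch-OnEdge {i} {j} {e} snd-pt = trans (ch-l i j e j) (d-end i j)
  ch-OnEdge {i} {j} {e} apex   = ch-ap≡0 i j e

  exposes : ∀ {V W : Pt → Set} {b} φ → Aff φ → 0ℤ < φ b → (∀ v → V v ⊎ W v → φ v ≡ 0ℤ ⊎ v ≡ b) →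
    Σ (Pt → ℤ) λ φ → Aff φ × 0ℤ < φ b × (∀ v → V v ⊎ W v → 0ℤ ≤ φ v × (0ℤ < φ v → v ≡ b))
  exposes {V} {W} {b} φ a pos h = φ , a , pos , go
    where
    go : ∀ v → V v ⊎ W v → 0ℤ ≤ φ v × (0ℤ < φ v → v ≡ b)
    go v z with h v z
    ... | inj₁ e = ℤ.≤-reflexive (sym e) , λ l → ⊥-elim (ℤ.<-irrefl (sym e) l)
    ... | inj₂ refl = ℤ.<⇒≤ pos , λ _ → refl

  -- Up to positive factors `hi j`, `lo i` and `colevel` are the barycentric coordinates of this
  -- triangle, so they expose its vertices.
  Meet-edge : ∀ {i j e} → i ℕ.< j → (∀ v → V v → OnEdge i j e v) → (∀ v → W v → OnEdge i j e v) → Meet V W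
  Meet-edge {V = V} {W = W} {i} {j} {e} i<j hV hW = Meet-exposed main
    where
    h : ∀ v → V v ⊎ W v → OnEdge i j e v
    h v (inj₁ z) = hV v z
    h v (inj₂ z) = hW v z
    at-i : ∀ v → V v ⊎ W v → hi j v ≡ 0ℤ ⊎ v ≡ l i
    at-i v z with h v z
    ... | fst-pt = inj₂ refl
    ... | snd-pt = inj₁ (trans (hi-l j j) (ℤ.+-inverseʳ (+ j)))
    ... | apex   = inj₁ (hi-ap j e)
    at-j : ∀ v → V v ⊎ W v → lo i v ≡ 0ℤ ⊎ v ≡ l j
    at-j v z with h v z
    ... | fst-pt = inj₁ (trans (lo-l i i) (ℤ.+-inverseʳ (+ i)))
    ... | snd-pt = inj₂ refl
    ... | apex   = inj₁ (lo-ap i e)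
    at-ap : ∀ v → V v ⊎ W v → colevel v ≡ 0ℤ ⊎ v ≡ ap e
    at-ap v z with h v z
    ... | fst-pt = inj₁ refl
    ... | snd-pt = inj₁ refl
    ... | apex   = inj₂ refl
    main : ∀ b → V b ⊎ W b → Σ (Pt → ℤ) λ φ → Aff φ × 0ℤ < φ b ×
      (∀ v → V v ⊎ W v → 0ℤ ≤ φ v × (0ℤ < φ v → v ≡ b))
    main b z with h b z
    ... | fst-pt = exposes {V} {W} (hi j) (aff-hi j) (0<-resp (hi-l j i) (ℕ<⇒0< i<j)) at-i
    ... | snd-pt = exposes {V} {W} (lo i) (aff-lo i) (0<-resp (lo-l i j) (ℕ<⇒0< i<j)) at-j
    ... | apex   = exposes {V} {W} colevel aff-colevel (+<+ (s≤s z≤n)) at-ap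

  -- Sides of the path

  -- The second component describes equality: only the triangle over the path edge touches the
  -- plane, so sets on opposite sides can share nothing else in this strip.
  LeftOf RightOf : ℤ → (Pt → Set) → Set
  LeftOf e V = ∀ j {ws} → PosOn V ws → ws ⊩ lo j → ws ⊩ hi (suc j) →
    ws ⊩ (λ v → - ch j (suc j) e v) × (ws ⊩ ch j (suc j) e → PosOn (OnEdge j (suc j) e) ws)
  RightOf e V = ∀ j {ws} → suc j ℕ.≤ q → PosOn V ws → ws ⊩ lo j → ws ⊩ hi (suc j) →
    ws ⊩ ch j (suc j) e × (ws ⊩ (λ v → - ch j (suc j) e v) → PosOn (OnEdge j (suc j) e) ws)

  locate : ∀ {ws} n → ws ⊩ lo 0 → ws ⊩ hi (suc n) → ∃ λ j → suc j ℕ.≤ suc n × ws ⊩ lo j × ws ⊩ hi (suc j)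
  locate zero    p p′ = 0 , ℕ.≤-refl , p , p′
  locate {ws} (suc n) p p′ with ⊩-total ws (lo (suc n))
  ... | inj₁ s = suc n , ℕ.≤-refl , s , p′
  ... | inj₂ s with locate n p (⊩-cong (λ { (y , _ , z) → eq y (+ suc n * z) }) s)
    where
    eq : ∀ y z → z - y ≡ - (y - z)
    eq = solve-∀
  ... | j , j≤ , a , b = j , ℕ.m≤n⇒m≤1+n j≤ , a , b

  InStrip : (Pt → Set) → Set
  InStrip V = ∀ v → V v → 0ℤ ≤ lo 0 v × 0ℤ ≤ hi q v

  -- First the strip of the common barycentre is located. There the plane over one path edge has the
  -- two measures on opposite sides, so both are supported on the triangle in this plane, and
  -- `Meet-edge` finishes.
  Meet-sides : ∀ e → InStrip V → LeftOf e V → RightOf e W → Meet V W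
  Meet-sides {V = V} {W = W} e st left right {ws} {us} p p′ eq = go (loc q q>0)
    where
    loc : ∀ q′ → 0 ℕ.< q′ → ws ⊩ hi q′ → ∃ λ j → suc j ℕ.≤ q′ × ws ⊩ lo j × ws ⊩ hi (suc j)
    loc (suc n) _ h = locate n (⊩-pos p (λ v z → proj₁ (st v z))) h
    go : (ws ⊩ hi q → ∃ λ j → suc j ℕ.≤ q × ws ⊩ lo j × ws ⊩ hi (suc j)) →
      All (λ w → W (proj₂ w)) ws × All (λ w → V (proj₂ w)) us
    go f with f (⊩-pos p (λ v z → proj₂ (st v z)))
    ... | j , j<q , a , b = fin (Meet-edge (ℕ.n<1+n j) (λ _ → proj₂) (λ _ → proj₂)
          (All.zipWith (λ { ((x , y) , (_ , z)) → x , y , z }) (p , proj₂ L (⊩-≈ (aff-ch j (suc j) e) (≈-sym eq) (proj₁ R))))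
          (All.zipWith (λ { ((x , y) , (_ , z)) → x , y , z }) (p′ , proj₂ R (⊩-≈ (aff-neg (aff-ch j (suc j) e)) eq (proj₁ L)))) eq)
      where
      L = left j p a b
      R = right j j<q p′ (⊩-≈ (aff-lo j) eq a) (⊩-≈ (aff-hi (suc j)) eq b)
      fin : ∀ {A B : Pt → Set} → All (λ w → W (proj₂ w) × A (proj₂ w)) ws × All (λ w → V (proj₂ w) × B (proj₂ w)) us →
        All (λ w → W (proj₂ w)) ws × All (λ w → V (proj₂ w)) us
      fin (x , y) = All.map proj₁ x , All.map proj₁ y

  private
    l-index : ∀ {i j} → + i - + j ≡ 0ℤ → i ≡ j
    l-index e = ℤ.+-injective (ℤ.i-j≡0⇒i≡j _ _ e)

  BelowChord : ℕ → ℕ → ℤ → Pt → Set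
  BelowChord a b e v = 0ℤ ≤ - ch a b e v × (- ch a b e v ≡ 0ℤ → OnEdge a b e v)

  -- By `ch-step` a positive multiple of the form in question is the chord form plus nonnegative
  -- multiples of `hi` and `lo`. In case of equality all three terms vanish, and wherever the
  -- determinant is positive this forces the support onto a boundary plane of the strip.
  below-chord : ∀ {a b e} j → a ℕ.≤ j → suc j ℕ.≤ b → Conv a b → PosOn (BelowChord a b e) ws → ws ⊩ lo j → ws ⊩ hi (suc j) →
    ws ⊩ (λ v → - ch j (suc j) e v) × (ws ⊩ ch j (suc j) e → PosOn (OnEdge j (suc j) e) ws)
  below-chord {ws = ws} {a} {b} {e} j a≤j j<b cv p L H = first , second
    where
    b-a>0 : 0ℤ < + b - + a
    b-a>0 = ℕ<⇒0< (ℕ.≤-<-trans a≤j j<b)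
    D₁ D₂ : ℤ
    D₁ = d a b j
    D₂ = d a b (suc j)
    D₁≥0 = d≥0 cv j a≤j (ℕ.<⇒≤ j<b)
    D₂≥0 = d≥0 cv (suc j) (ℕ.m≤n⇒m≤1+n a≤j) j<b
    chord : ws ⊩ (λ v → - ch a b e v)
    chord = ⊩-pos p (λ _ → proj₁)
    eq₁ : ∀ c s K x → c * s ≡ K - x → c * - s ≡ - K + x
    eq₁ c s K x e = trans (sym (ℤ.neg-distribʳ-* c s)) (trans (cong -_ e) (eq K x))
      where
      eq : ∀ K x → - (K - x) ≡ - K + x
      eq = solve-∀
    first : ws ⊩ (λ v → - ch j (suc j) e v)
    first = ⊩-cancel (+ b - + a) b-a>0
      (⊩-cong (λ v → eq₁ (+ b - + a) (ch j (suc j) e v) (ch a b e v) (D₁ * hi (suc j) v + D₂ * lo j v) (ch-step a b e j v))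
        (⊩-+ chord (⊩-+ (⊩-* (proj₁ D₁≥0) H) (⊩-* (proj₁ D₂≥0) L))))
    second : ws ⊩ ch j (suc j) e → PosOn (OnEdge j (suc j) e) ws
    second S = cases (j ℕ.≟ a) (suc j ℕ.≟ b)
      where
      S′ : ws ⊩ (λ v → (+ b - + a) * ch j (suc j) e v)
      S′ = ⊩-* (ℤ.<⇒≤ b-a>0) S
      solve₁ : ∀ s K x y → s ≡ K - (x + y) → - - K ≡ s + (x + y)
      solve₁ s K x y e = trans (eq K x y) (cong (λ s → s + (x + y)) (sym e))
        where
        eq : ∀ K x y → - - K ≡ K - (x + y) + (x + y)
        eq = solve-∀
      solve₂ : ∀ s K x y → s ≡ K - (x + y) → - x ≡ s + (- K + y)
      solve₂ s K x y e = trans (eq K x y) (cong (λ s → s + (- K + y)) (sym e))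
        where
        eq : ∀ K x y → - x ≡ K - (x + y) + (- K + y)
        eq = solve-∀
      solve₃ : ∀ s K x y → s ≡ K - (x + y) → - y ≡ s + (- K + x)
      solve₃ s K x y e = trans (eq K x y) (cong (λ s → s + (- K + x)) (sym e))
        where
        eq : ∀ K x y → - y ≡ K - (x + y) + (- K + x)
        eq = solve-∀
      on : PosOn (OnEdge a b e) ws
      on = All.map (λ { (t , c , z) → t , proj₂ c z })
        (⊩-zero p (λ _ → proj₁) (⊩-cong (λ v → solve₁ ((+ b - + a) * ch j (suc j) e v) (ch a b e v) (D₁ * hi (suc j) v) (D₂ * lo j v) (ch-step a b e j v)) (⊩-+ S′ (⊩-+ (⊩-* (proj₁ D₁≥0) H) (⊩-* (proj₁ D₂≥0) L)))))
      noH : 0ℤ < D₁ → ws ⊩ (λ v → - hi (suc j) v)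
      noH pos = ⊩-cancel D₁ pos (⊩-cong (λ v → trans (sym (ℤ.neg-distribʳ-* D₁ (hi (suc j) v))) (solve₂ _ (ch a b e v) _ _ (ch-step a b e j v))) (⊩-+ S′ (⊩-+ chord (⊩-* (proj₁ D₂≥0) L))))
      noL : 0ℤ < D₂ → ws ⊩ (λ v → - lo j v)
      noL pos = ⊩-cancel D₂ pos (⊩-cong (λ v → trans (sym (ℤ.neg-distribʳ-* D₂ (lo j v))) (solve₃ _ (ch a b e v) _ _ (ch-step a b e j v))) (⊩-+ S′ (⊩-+ chord (⊩-* (proj₁ D₁≥0) H))))
      cases : Dec (j ≡ a) → Dec (suc j ≡ b) → PosOn (OnEdge j (suc j) e) ws
      cases (yes refl) (yes refl) = on
      cases (yes refl) (no f) = PosOn-weaken keep (⊩-zero on nonneg (noL (cv (suc j) (ℕ.n<1+n j) (ℕ.≤∧≢⇒< j<b f))))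
        where
        nonneg : ∀ v → OnEdge a b e v → 0ℤ ≤ lo j v
        nonneg v fst-pt = 0≤-resp (lo-l j j) (ℕ≤⇒0≤ (ℕ.≤-refl {j}))
        nonneg v snd-pt = 0≤-resp (lo-l j b) (ℕ≤⇒0≤ (ℕ.<⇒≤ j<b))
        nonneg v apex   = 0≤-resp (lo-ap j e) ℤ.≤-refl
        keep : ∀ v → OnEdge a b e v × lo j v ≡ 0ℤ → OnEdge j (suc j) e v
        keep v (fst-pt , _) = fst-pt
        keep v (snd-pt , z) = ⊥-elim (ℕ.<-irrefl (sym (l-index (trans (sym (lo-l j b)) z))) j<b)
        keep v (apex , _)   = apex
      cases (no f) (yes refl) = PosOn-weaken keep (⊩-zero on nonneg (noH (cv j (ℕ.≤∧≢⇒< a≤j (λ e → f (sym e))) j<b)))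
        where
        nonneg : ∀ v → OnEdge a b e v → 0ℤ ≤ hi b v
        nonneg v fst-pt = 0≤-resp (hi-l b a) (ℕ≤⇒0≤ (ℕ.≤-trans a≤j (ℕ.<⇒≤ j<b)))
        nonneg v snd-pt = 0≤-resp (hi-l b b) (ℕ≤⇒0≤ (ℕ.≤-refl {b}))
        nonneg v apex   = 0≤-resp (hi-ap b e) ℤ.≤-refl
        keep : ∀ v → OnEdge a b e v × hi b v ≡ 0ℤ → OnEdge j (suc j) e v
        keep v (fst-pt , z) = ⊥-elim (ℕ.<-irrefl (sym (l-index (trans (sym (hi-l b a)) z))) (ℕ.≤-<-trans a≤j j<b))
        keep v (snd-pt , _) = snd-pt
        keep v (apex , _)   = apex
      -- Both determinants are positive, so `hi` and `lo` vanish at the barycentre and so does their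
      -- sum z: only the apex remains.
      cases (no f) (no g) = PosOn-weaken keep (⊩-zero on nonneg
         (⊩-cong (λ { (y , t , z) → eq y z (+ j) }) (⊩-+ (noH (cv j (ℕ.≤∧≢⇒< a≤j (λ e → f (sym e))) j<b))
            (noL (cv (suc j) (ℕ.m≤n⇒m≤1+n (ℕ.≤∧≢⇒< a≤j (λ e → f (sym e)))) (ℕ.≤∧≢⇒< j<b g))))))
        where
        eq : ∀ y z j → - z ≡ - ((1ℤ + j) * z - y) + - (y - j * z)
        eq = solve-∀
        nonneg : ∀ v → OnEdge a b e v → 0ℤ ≤ level v
        nonneg v fst-pt = +≤+ z≤n
        nonneg v snd-pt = +≤+ z≤n
        nonneg v apex   = +≤+ z≤n
        keep : ∀ v → OnEdge a b e v × level v ≡ 0ℤ → OnEdge j (suc j) e v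
        keep v (apex , _) = apex

  record IsTri (a m b : ℕ) : Set where
    constructor isTri
    field
      a<m  : a ℕ.< m
      m<b  : m ℕ.< b
      unit : d a b m ≡ 1ℤ
      cv₁  : Conv a m
      cv₂  : Conv m b

  coneTri : ℤ → ℕ × ℕ × ℕ → Fin 4 → Pt
  coneTri e (a , m , b) = tet (l a) (l m) (l b) (ap e)

  -- Exchanging two indices changes the sign of the determinant 1, so b has determinant -1 with
  -- respect to the chord from a to m.
  tri-below₁ : ∀ {a m b e} → IsTri a m b → ∀ v → Vert (coneTri e (a , m , b)) v → BelowChord a m e v
  tri-below₁ {a} {m} {b} {e} T v at0 = ℤ.≤-reflexive (sym (cong -_ (ch-OnEdge {a} {m} {e} fst-pt))) , λ _ → fst-pt
  tri-below₁ {a} {m} {b} {e} T v at1 = ℤ.≤-reflexive (sym (cong -_ (ch-OnEdge {a} {m} {e} snd-pt))) , λ _ → snd-pt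
  tri-below₁ {a} {m} {b} {e} T v at2 = 0≤-resp val (+≤+ z≤n) , λ z → ⊥-elim (one≢0 (trans (sym val) z))
    where
    val : - ch a m e (l b) ≡ 1ℤ
    val = cong -_ (trans (ch-l a m e b) (trans (d-swap₁ a m b) (cong -_ (IsTri.unit T))))
    one≢0 : ¬ (1ℤ ≡ 0ℤ)
    one≢0 ()
  tri-below₁ {a} {m} {b} {e} T v at3 = ℤ.≤-reflexive (sym (cong -_ (ch-OnEdge {a} {m} {e} apex))) , λ _ → apex

  tri-below₂ : ∀ {a m b e} → IsTri a m b → ∀ v → Vert (coneTri e (a , m , b)) v → BelowChord m b e v
  tri-below₂ {a} {m} {b} {e} T v at0 = 0≤-resp val (+≤+ z≤n) , λ z → ⊥-elim (one≢0 (trans (sym val) z))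
    where
    val : - ch m b e (l a) ≡ 1ℤ
    val = cong -_ (trans (ch-l m b e a) (trans (d-swap₂ a m b) (cong -_ (IsTri.unit T))))
    one≢0 : ¬ (1ℤ ≡ 0ℤ)
    one≢0 ()
  tri-below₂ {a} {m} {b} {e} T v at1 = ℤ.≤-reflexive (sym (cong -_ (ch-OnEdge {m} {b} {e} fst-pt))) , λ _ → fst-pt
  tri-below₂ {a} {m} {b} {e} T v at2 = ℤ.≤-reflexive (sym (cong -_ (ch-OnEdge {m} {b} {e} snd-pt))) , λ _ → snd-pt
  tri-below₂ {a} {m} {b} {e} T v at3 = ℤ.≤-reflexive (sym (cong -_ (ch-OnEdge {m} {b} {e} apex))) , λ _ → apex

  data OnChain (a b : ℕ) (e : ℤ) : Pt → Set where
    pt  : ∀ i → a ℕ.≤ i → i ℕ.≤ b → OnChain a b e (l i)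
    top : OnChain a b e (ap e)

  tri-chain : ∀ {a m b e} → IsTri a m b → ∀ v → Vert (coneTri e (a , m , b)) v → OnChain a b e v
  tri-chain (isTri p p′ _ _ _) v at0 = pt _ ℕ.≤-refl (ℕ.<⇒≤ (ℕ.<-trans p p′))
  tri-chain (isTri p p′ _ _ _) v at1 = pt _ (ℕ.<⇒≤ p) (ℕ.<⇒≤ p′)
  tri-chain (isTri p p′ _ _ _) v at2 = pt _ (ℕ.<⇒≤ (ℕ.<-trans p p′)) ℕ.≤-refl
  tri-chain (isTri p p′ _ _ _) v at3 = top

  private
    settled : ∀ {j e ws} → PosOn (OnEdge j (suc j) e) ws →
      ws ⊩ (λ v → - ch j (suc j) e v) × (ws ⊩ ch j (suc j) e → PosOn (OnEdge j (suc j) e) ws)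
    settled p = ⊩-pos p (λ v z → ℤ.≤-reflexive (sym (cong -_ (ch-OnEdge z)))) , λ _ → p

    rev : ∀ a b → - (a - b) ≡ b - a
    rev = solve-∀

  outside-high : ∀ {a b e} j → suc j ℕ.≤ a → PosOn (OnChain a b e) ws → ws ⊩ hi (suc j) → PosOn (OnEdge j (suc j) e) ws
  outside-high {a = a} {b} {e} j le p H = PosOn-weaken keep
      (⊩-zero {φ = λ v → - hi (suc j) v} p nonneg (⊩-cong (λ v → ℤ.neg-involutive _) H))
    where
    nonneg : ∀ v → OnChain a b e v → 0ℤ ≤ - hi (suc j) v
    nonneg v (pt i p _) = 0≤-resp (trans (cong -_ (hi-l (suc j) i)) (rev (+ suc j) (+ i))) (ℕ≤⇒0≤ (ℕ.≤-trans le p))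
    nonneg v top        = 0≤-resp (cong -_ (hi-ap (suc j) e)) ℤ.≤-refl
    keep : ∀ v → OnChain a b e v × - hi (suc j) v ≡ 0ℤ → OnEdge j (suc j) e v
    keep v (pt i _ _ , z) = subst (λ i → OnEdge j (suc j) e (l i)) (l-index (trans (sym (hi-l (suc j) i)) (ℤ.neg-injective z))) snd-pt
    keep v (top , _)      = apex

  outside-low : ∀ {a b e} j → b ℕ.≤ j → PosOn (OnChain a b e) ws → ws ⊩ lo j → PosOn (OnEdge j (suc j) e) ws
  outside-low {a = a} {b} {e} j le p L = PosOn-weaken keep
      (⊩-zero {φ = λ v → - lo j v} p nonneg (⊩-cong (λ v → ℤ.neg-involutive _) L))
    where
    nonneg : ∀ v → OnChain a b e v → 0ℤ ≤ - lo j v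
    nonneg v (pt i _ p) = 0≤-resp (trans (cong -_ (lo-l j i)) (rev (+ i) (+ j))) (ℕ≤⇒0≤ (ℕ.≤-trans p le))
    nonneg v top        = 0≤-resp (cong -_ (lo-ap j e)) ℤ.≤-refl
    keep : ∀ v → OnChain a b e v × - lo j v ≡ 0ℤ → OnEdge j (suc j) e v
    keep v (pt i _ _ , z) = subst (λ i → OnEdge j (suc j) e (l i)) (sym (l-index (trans (sym (lo-l j i)) (ℤ.neg-injective z)))) fst-pt
    keep v (top , _)      = apex

  -- A strip outside the range from a to b is touched in an end at most. Inside, one of the two
  -- short sides of the triangle faces the path in the given strip, and `below-chord` applies to it.
  tri-LeftOf : ∀ {a m b} e → IsTri a m b → LeftOf e (Vert (coneTri e (a , m , b)))
  tri-LeftOf {a} {m} {b} e T j p L H with suc j ℕ.≤? a | b ℕ.≤? j | suc j ℕ.≤? m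
  ... | yes z | _ | _ = settled (outside-high j z (PosOn-weaken (tri-chain T) p) H)
  ... | no _ | yes z | _ = settled (outside-low j z (PosOn-weaken (tri-chain T) p) L)
  ... | no f | no g | yes z = below-chord j (ℕ.≤-pred (ℕ.≰⇒> f)) z (IsTri.cv₁ T) (PosOn-weaken (tri-below₁ T) p) L H
  ... | no f | no g | no h = below-chord j (ℕ.≤-pred (ℕ.≰⇒> h)) (ℕ.≰⇒> g) (IsTri.cv₂ T) (PosOn-weaken (tri-below₂ T) p) L H

  tris : ∀ {a b} → Tree a b → List (ℕ × ℕ × ℕ)
  tris leaf = []
  tris {a} {b} (node m _ _ _ _ _ s t) = (a , m , b) ∷ (tris s ++ tris t)

  data InTree : ∀ {a b} → Tree a b → ℕ × ℕ × ℕ → Set where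
    root  : ∀ {a b m p p′ e c c′ s t} → InTree (node {a} {b} m p p′ e c c′ s t) (a , m , b)
    left  : ∀ {a b m p p′ e c c′ s t T} → InTree s T → InTree (node {a} {b} m p p′ e c c′ s t) T
    right : ∀ {a b m p p′ e c c′ s t T} → InTree t T → InTree (node {a} {b} m p p′ e c c′ s t) T

  tris-sound : ∀ {a b} (t : Tree a b) {T} → T ∈ tris t → InTree t T
  tris-sound (node m p p′ e c c′ s t) (here refl) = root
  tris-sound (node m p p′ e c c′ s t) (there i) with ∈-++⁻ (tris s) i
  ... | inj₁ i = left (tris-sound s i)
  ... | inj₂ i = right (tris-sound t i)

  tris-complete : ∀ {a b} {t : Tree a b} {T} → InTree t T → T ∈ tris t
  tris-complete root = here refl
  tris-complete (left i) = there (∈-++⁺ˡ (tris-complete i))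
  tris-complete (right {s = s} i) = there (∈-++⁺ʳ (tris s) (tris-complete i))

  inTree-IsTri : ∀ {a b} {t : Tree a b} {i m k} → InTree t (i , m , k) → IsTri i m k
  inTree-IsTri (root {p = p} {p′} {e} {c} {c′}) = isTri p p′ e c c′
  inTree-IsTri (left i)  = inTree-IsTri i
  inTree-IsTri (right i) = inTree-IsTri i

  inTree-bounds : ∀ {a b} {t : Tree a b} {i m k} → InTree t (i , m , k) → a ℕ.≤ i × k ℕ.≤ b
  inTree-bounds root = ℕ.≤-refl , ℕ.≤-refl
  inTree-bounds (left {p′ = p′} i)  = proj₁ (inTree-bounds i) , ℕ.≤-trans (proj₂ (inTree-bounds i)) (ℕ.<⇒≤ p′)
  inTree-bounds (right {p = p} i) = ℕ.≤-trans (ℕ.<⇒≤ p) (proj₁ (inTree-bounds i)) , proj₂ (inTree-bounds i)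

  OnChain-weaken : ∀ {a b a′ b′ e v} → a′ ℕ.≤ a → b ℕ.≤ b′ → OnChain a b e v → OnChain a′ b′ e v
  OnChain-weaken p p′ (pt i z z′) = pt i (ℕ.≤-trans p z) (ℕ.≤-trans z′ p′)
  OnChain-weaken p p′ top         = top

  inTree-chain : ∀ {a b e} {t : Tree a b} {T} → InTree t T → ∀ v → Vert (coneTri e T) v → OnChain a b e v
  inTree-chain i v z = OnChain-weaken (proj₁ (inTree-bounds i)) (proj₂ (inTree-bounds i)) (tri-chain (inTree-IsTri i) v z)

  chain-above : ∀ {a b e} → Conv a b → ∀ v → OnChain a b e v → 0ℤ ≤ ch a b e v × (ch a b e v ≡ 0ℤ → OnEdge a b e v)
  chain-above {a} {b} {e} cv v (pt i p p′) = 0≤-resp (ch-l a b e i) (proj₁ (d≥0 cv i p p′)) ,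
    λ z → [ (λ { refl → fst-pt }) , (λ { refl → snd-pt }) ]′ (proj₂ (d≥0 cv i p p′) (trans (sym (ch-l a b e i)) z))
  chain-above {a} {b} {e} cv v top = ℤ.≤-reflexive (sym (ch-ap≡0 a b e)) , λ _ → apex

  Meet-chord : ∀ {a b e} → a ℕ.< b → Conv a b → (∀ v → V v → BelowChord a b e v) → (∀ v → W v → OnChain a b e v) → Meet V W
  Meet-chord {a = a} {b} {e} a<b cv hV hW = Meet-separate (ch a b e) (aff-ch a b e)
    (λ v z → proj₁ (hV v z)) (λ v z → proj₁ (chain-above cv v (hW v z)))
    (Meet-edge a<b (λ v z → proj₂ (hV v (proj₁ z)) (cong -_ (proj₂ z))) (λ v z → proj₂ (chain-above cv v (hW v (proj₁ z))) (proj₂ z)))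

  Meet-height : ∀ {a b c d e} → b ℕ.≤ c → (∀ v → V v → OnChain a b e v) → (∀ v → W v → OnChain c d e v) → Meet V W
  Meet-height {a = a} {b} {c} {d} {e} b≤c hV hW = Meet-separate (lo c) (aff-lo c)
    (λ v z → nonpos v (hV v z)) (λ v z → nonneg v (hW v z))
    (Meet-edge (ℕ.n<1+n c) (λ v z → keep v (hV v (proj₁ z)) (proj₂ z)) (λ v z → keep v (hW v (proj₁ z)) (proj₂ z)))
    where
    nonpos : ∀ v → OnChain a b e v → 0ℤ ≤ - lo c v
    nonpos v (pt i _ p) = 0≤-resp (trans (cong -_ (lo-l c i)) (rev (+ i) (+ c))) (ℕ≤⇒0≤ (ℕ.≤-trans p b≤c))
    nonpos v top        = 0≤-resp (cong -_ (lo-ap c e)) ℤ.≤-refl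
    nonneg : ∀ v → OnChain c d e v → 0ℤ ≤ lo c v
    nonneg v (pt i p _) = 0≤-resp (lo-l c i) (ℕ≤⇒0≤ p)
    nonneg v top        = 0≤-resp (lo-ap c e) ℤ.≤-refl
    keep : ∀ {a b} v → OnChain a b e v → lo c v ≡ 0ℤ → OnEdge c (suc c) e v
    keep v (pt i _ _) z = subst (λ i → OnEdge c (suc c) e (l i)) (sym (l-index (trans (sym (lo-l c i)) z))) fst-pt
    keep v top        _ = apex

  -- The root triangle lies behind both of its short chords and the subtrees beyond them. The two
  -- subtrees are separated from each other by the plane `y = m z`.
  Meet-tris : ∀ {a b e} {t : Tree a b} {T U} → InTree t T → InTree t U → Meet (Vert (coneTri e T)) (Vert (coneTri e U))
  Meet-tris root root = Meet-refl
  Meet-tris (root {p = p} {p′} {u} {c} {c′}) (left i) = Meet-chord p c (tri-below₁ (isTri p p′ u c c′)) (inTree-chain i)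
  Meet-tris (root {p = p} {p′} {u} {c} {c′}) (right i) = Meet-chord p′ c′ (tri-below₂ (isTri p p′ u c c′)) (inTree-chain i)
  Meet-tris (left i) (root {p = p} {p′} {u} {c} {c′}) = Meet-sym (Meet-chord p c (tri-below₁ (isTri p p′ u c c′)) (inTree-chain i))
  Meet-tris (right i) (root {p = p} {p′} {u} {c} {c′}) = Meet-sym (Meet-chord p′ c′ (tri-below₂ (isTri p p′ u c c′)) (inTree-chain i))
  Meet-tris (left i) (left j) = Meet-tris i j
  Meet-tris (right i) (right j) = Meet-tris i j
  Meet-tris (left i) (right j) = Meet-height ℕ.≤-refl (inTree-chain i) (inTree-chain j)
  Meet-tris (right i) (left j) = Meet-sym (Meet-height ℕ.≤-refl (inTree-chain j) (inTree-chain i))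

Embedding-inv : ∀ {g h} → AffMap h → (∀ v → h (g v) ≡ v) → Embedding g
Embedding-inv {g} {h} ah inv φ a = 1ℤ , (λ v → φ (h v)) , +<+ (s≤s z≤n) , aff-∘ a ah ,
  λ v → trans (cong φ (inv v)) (sym (ℤ.*-identityˡ (φ v)))

Pt-≡ : ∀ {a b c a′ b′ c′ : ℤ} → a ≡ a′ → b ≡ b′ → c ≡ c′ → _≡_ {A = Pt} (a , b , c) (a′ , b′ , c′)
Pt-≡ refl refl refl = refl

PosOn-push : ∀ (g : Pt → Pt) → PosOn (λ v → V (g v)) ws → PosOn V (pushforward g ws)
PosOn-push g []       = []
PosOn-push g (p ∷ ps) = p ∷ PosOn-push g ps

PosOn-unpush : ∀ (g : Pt → Pt) {ws} → PosOn V (pushforward g ws) → PosOn (λ v → V (g v)) ws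
PosOn-unpush g {[]}     []       = []
PosOn-unpush g {_ ∷ _}  (p ∷ ps) = p ∷ PosOn-unpush g ps

⊩-unmap : ∀ (g : Pt → Pt) {ws} → pushforward g ws ⊩ φ → ws ⊩ (λ v → φ (g v))
⊩-unmap {φ = φ} g {ws} (nn p) = nn (subst (0ℚ ℚ.≤_) (E-map g φ ws) p)

-- The half turn and the right side of the path

module HalfCell {r q : ℕ} (chain : Chain r q) where
  open Chain chain
  open Strip chain
  open Path chain

  -- The symmetry of the tetrahedron exchanging the ends of both long edges; it maps the
  -- path l to the path bounding the other half of the square.
  ρ : Pt → Pt
  ρ (y , t , z) = + q * z - y , (+ r + 1ℤ) * z - t - + 2 , z

  ρ-aff : AffMap ρ
  ρ-aff = aff-- (aff-* (+ q) aff-3) aff-1 , aff-- (aff-- (aff-* (+ r + 1ℤ) aff-3) aff-2) (aff-c (+ 2)) , aff-3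

  ρ-involutive : ∀ v → ρ (ρ v) ≡ v
  ρ-involutive (y , t , z) = Pt-≡ (e₁ (+ q) y z) (e₂ (+ r) t z) refl
    where
    e₁ : ∀ q y z → q * z - (q * z - y) ≡ y
    e₁ = solve-∀
    e₂ : ∀ r t z → (r + 1ℤ) * z - ((r + 1ℤ) * z - t - + 2) - + 2 ≡ t
    e₂ = solve-∀

  ρ-injective : ∀ {u v} → ρ u ≡ ρ v → u ≡ v
  ρ-injective {u} {v} e = trans (sym (ρ-involutive u)) (trans (cong ρ e) (ρ-involutive v))

  ρ-embedding : Embedding ρ
  ρ-embedding = Embedding-inv ρ-aff ρ-involutive

  Meet-ρ : ∀ {S S′ : Fin 4 → Pt} → Meet (Vert S) (Vert S′) → Meet (Vert (λ i → ρ (S i))) (Vert (λ i → ρ (S′ i)))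
  Meet-ρ m = Meet-pullback ρ-embedding (λ v _ → ρ v , sym (ρ-involutive v)) (λ v _ → ρ v , sym (ρ-involutive v))
    (Meet-mono (λ { v (i , e) → i , cong ρ e }) (λ { v (i , e) → i , ρ-injective e })
               (λ { v (i , e) → i , cong ρ e }) (λ { v (i , e) → i , ρ-injective e }) m)

  -- The constant 2 in `ρ` is chosen so that `ap 1` is fixed, the middle of the longest bottom
  -- segment that occurs.
  ρ-ap : ∀ e → ρ (ap e) ≡ ap (+ 2 - e)
  ρ-ap e = Pt-≡ (e₁ (+ q)) (e₂ (+ r) e) refl
    where
    e₁ : ∀ q → q * 0ℤ - 0ℤ ≡ 0ℤ
    e₁ = solve-∀
    e₂ : ∀ r e → (r + 1ℤ) * 0ℤ - - e - + 2 ≡ - (+ 2 - e)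
    e₂ = solve-∀

  -- The defect of the path from invariance under the half turn: for i + i′ = q it satisfies
  -- `q δ = q - x i - x i′`. It is 0 at inner indices and 1 at the two ends, where both x are 0.
  δ : ℕ → ℕ → ℤ
  δ i i′ = τ i + τ i′ + 1ℤ - + r

  private
    qδ : ∀ r q i i′ t t′ → i + i′ ≡ q → q * (t + t′ + 1ℤ - r) ≡ q - (r * i - q * t) - (r * i′ - q * t′)
    qδ r q i i′ t t′ refl = eq r i i′ t t′
      where
      eq : ∀ r i i′ t t′ → (i + i′) * (t + t′ + 1ℤ - r) ≡ (i + i′) - (r * i - (i + i′) * t) - (r * i′ - (i + i′) * t′)
      eq = solve-∀

  δ≥0 : ∀ i i′ → i ℕ.+ i′ ≡ q → 0ℤ ≤ δ i i′
  δ≥0 i i′ e = 0≤-resp (eq (δ i i′)) (≤⇒0≤ (0<⇒1≤ (0<-cancel (+ q) 0<q (0<+ˡ (<⇒0< (x<q i)) (ℤ.<⇒≤ (<⇒0< (x<q i′))))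
      (trans (ℤ.*-distribˡ-+ (+ q) (δ i i′) 1ℤ) (trans (cong (_+ + q * 1ℤ) (qδ (+ r) (+ q) (+ i) (+ i′) (τ i) (τ i′) (cong +_ e))) (eq₂ (+ q) (x i) (x i′)))))))
    where
    eq : ∀ D → D ≡ D + 1ℤ - 1ℤ
    eq = solve-∀
    eq₂ : ∀ q x x′ → q - x - x′ + q * 1ℤ ≡ (q - x) + (q - x′)
    eq₂ = solve-∀

  -- Besides `δ ≥ 0`, the number `q (1 - δ) = x i + x i′` is positive at inner indices, so δ is less
  -- than 1.
  δ-interior : ∀ i i′ → 0 ℕ.< i → 0 ℕ.< i′ → i ℕ.+ i′ ≡ q → δ i i′ ≡ 0ℤ
  δ-interior i i′ p p′ e = 0≤∧≤0⇒≡0 (δ≥0 i i′ e) (0≤-resp (eq (δ i i′)) (≤⇒0≤ (0<⇒1≤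
      (0<-cancel (+ q) 0<q (0<+ˡ (x>0 i p i<q) (x≥0 i′))
        (trans (eq₁ (+ q) (δ i i′)) (trans (cong (λ z → + q - z) (qδ (+ r) (+ q) (+ i) (+ i′) (τ i) (τ i′) (cong +_ e))) (eq₂ (+ q) (x i) (x i′))))))))
    where
    i<q : i ℕ.< q
    i<q = subst (i ℕ.<_) e (ℕ.m<m+n i p′)
    eq : ∀ D → - D ≡ 1ℤ - D - 1ℤ
    eq = solve-∀
    eq₁ : ∀ q D → q * (1ℤ - D) ≡ q - q * D
    eq₁ = solve-∀
    eq₂ : ∀ q x x′ → q - (q - x - x′) ≡ x + x′
    eq₂ = solve-∀

  ρ-l : ∀ i i′ → i ℕ.+ i′ ≡ q → δ i i′ ≡ 0ℤ → ρ (l i′) ≡ l i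
  ρ-l i i′ e z = Pt-≡ (trans (cong (λ s → s * 1ℤ - + i′) (cong +_ (sym e))) (e₁ (+ i) (+ i′))) (trans (e₂ (+ r) (τ i) (τ i′)) (trans (cong (λ s → τ i - s) z) (ℤ.+-identityʳ (τ i)))) refl
    where
    e₁ : ∀ i i′ → (i + i′) * 1ℤ - i′ ≡ i
    e₁ = solve-∀
    e₂ : ∀ r t t′ → (r + 1ℤ) * 1ℤ - t′ - + 2 ≡ t - (t + t′ + 1ℤ - r)
    e₂ = solve-∀

  lo-ρ : ∀ a b → a ℕ.+ b ≡ q → ∀ v → lo a (ρ v) ≡ hi b v
  lo-ρ a b e (y , t , z) = trans (cong (λ s → s * z - y - + a * z) (cong +_ (sym e))) (eq (+ a) (+ b) y z)
    where
    eq : ∀ a b y z → (a + b) * z - y - a * z ≡ b * z - y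
    eq = solve-∀

  hi-ρ : ∀ a b → a ℕ.+ b ≡ q → ∀ v → hi a (ρ v) ≡ lo b v
  hi-ρ a b e (y , t , z) = trans (cong (λ s → + a * z - (s * z - y)) (cong +_ (sym e))) (eq (+ a) (+ b) y z)
    where
    eq : ∀ a b y z → a * z - ((a + b) * z - y) ≡ y - b * z
    eq = solve-∀

  -- The plane over a path edge agrees with the mirror image of the plane over the opposite edge up
  -- to the defects, which are nonzero only in the first and the last strip.
  ch-ρ : ∀ j j′ e → suc j ℕ.+ j′ ≡ q → ∀ v →
    ch j (suc j) (+ 2 - e) v ≡ - ch j′ (suc j′) e (ρ v) + (δ j (suc j′) * hi (suc j) v + δ (suc j) j′ * lo j v)
  ch-ρ j j′ e s (y , t , z) = trans (eq (+ r) (+ j) (+ j′) e (τ j) (τ (suc j)) (τ j′) (τ (suc j′)) y t z)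
      (cong (λ q → - (τ j′ * ((1ℤ + + j′) * z - (q * z - y)) + τ (suc j′) * (q * z - y - + j′ * z) - (1ℤ + + j′ - + j′) * ((+ r + 1ℤ) * z - t - + 2 + e * (1ℤ - z)))
        + (δ j (suc j′) * hi (suc j) (y , t , z) + δ (suc j) j′ * lo j (y , t , z))) (cong +_ s))
    where
    eq : ∀ r j j′ e tj tk tj′ tk′ y t z →
      tj * ((1ℤ + j) * z - y) + tk * (y - j * z) - (1ℤ + j - j) * (t + (+ 2 - e) * (1ℤ - z)) ≡
      - (tj′ * ((1ℤ + j′) * z - ((1ℤ + j + j′) * z - y)) + tk′ * ((1ℤ + j + j′) * z - y - j′ * z) - (1ℤ + j′ - j′) * ((r + 1ℤ) * z - t - + 2 + e * (1ℤ - z)))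
      + ((tj + tk′ + 1ℤ - r) * ((1ℤ + j) * z - y) + (tk + tj′ + 1ℤ - r) * (y - j * z))
    eq = solve-∀

  -- The half turn exchanges the strips j and q - 1 - j. As the defects are nonnegative, the
  -- mirrored path is never to the left of the path; in case of equality a positive defect excludes
  -- the end at which the two paths differ.
  mirror : ∀ {U : Pt → Set} e → LeftOf e V → (∀ v → U v → V (ρ v)) → RightOf (+ 2 - e) U
  mirror {V = V} {U} e lf UV j {ws} j<q p L H = first , second
    where
    j′ = q ℕ.∸ suc j
    s : suc j ℕ.+ j′ ≡ q
    s = ℕ.m+[n∸m]≡n j<q
    s₁ : j′ ℕ.+ suc j ≡ q
    s₁ = trans (ℕ.+-comm j′ (suc j)) s
    s₂ : suc j′ ℕ.+ j ≡ q
    s₂ = trans (cong suc (ℕ.+-comm j′ j)) s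
    s₃ : j ℕ.+ suc j′ ≡ q
    s₃ = trans (ℕ.+-comm j (suc j′)) s₂
    result = lf j′ (PosOn-push ρ (PosOn-weaken UV p)) (⊩-map ρ (⊩-cong (lo-ρ j′ (suc j) s₁) H)) (⊩-map ρ (⊩-cong (hi-ρ (suc j′) j s₂) L))
    δ₁ δ₂ : ℤ
    δ₁ = δ j (suc j′)
    δ₂ = δ (suc j) j′
    δ₁≥0 : 0ℤ ≤ δ₁
    δ₁≥0 = δ≥0 j (suc j′) s₃
    δ₂≥0 : 0ℤ ≤ δ₂
    δ₂≥0 = δ≥0 (suc j) j′ s
    chord : ws ⊩ (λ v → - ch j′ (suc j′) e (ρ v))
    chord = ⊩-unmap ρ (proj₁ result)
    first : ws ⊩ ch j (suc j) (+ 2 - e)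
    first = ⊩-cong (ch-ρ j j′ e s) (⊩-+ chord (⊩-+ (⊩-* δ₁≥0 H) (⊩-* δ₂≥0 L)))
    second : ws ⊩ (λ v → - ch j (suc j) (+ 2 - e) v) → PosOn (OnEdge j (suc j) (+ 2 - e)) ws
    second S = cases (δ₁ ℤ.≟ 0ℤ) (δ₂ ℤ.≟ 0ℤ)
      where
      solve₁ : ∀ C K x y → C ≡ - K + (x + y) → K ≡ - C + (x + y)
      solve₁ C K x y e = trans (eq K x y) (cong (λ C → - C + (x + y)) (sym e))
        where
        eq : ∀ K x y → K ≡ - (- K + (x + y)) + (x + y)
        eq = solve-∀
      solve₂ : ∀ C K x y → C ≡ - K + (x + y) → - x ≡ - C + (- K + y)
      solve₂ C K x y e = trans (eq K x y) (cong (λ C → - C + (- K + y)) (sym e))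
        where
        eq : ∀ K x y → - x ≡ - (- K + (x + y)) + (- K + y)
        eq = solve-∀
      solve₃ : ∀ C K x y → C ≡ - K + (x + y) → - y ≡ - C + (- K + x)
      solve₃ C K x y e = trans (eq K x y) (cong (λ C → - C + (- K + x)) (sym e))
        where
        eq : ∀ K x y → - y ≡ - (- K + (x + y)) + (- K + x)
        eq = solve-∀
      rel : ∀ {A : ℤ → ℤ → ℤ → ℤ → Set} → (∀ C K x y → C ≡ - K + (x + y) → A C K x y) → ∀ v →
        A (ch j (suc j) (+ 2 - e) v) (ch j′ (suc j′) e (ρ v)) (δ₁ * hi (suc j) v) (δ₂ * lo j v)
      rel f v = f _ (ch j′ (suc j′) e (ρ v)) (δ₁ * hi (suc j) v) (δ₂ * lo j v) (ch-ρ j j′ e s v)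
      on : PosOn (λ v → OnEdge j′ (suc j′) e (ρ v)) ws
      on = PosOn-unpush ρ (proj₂ result (⊩-map ρ (⊩-cong (rel solve₁) (⊩-+ S (⊩-+ (⊩-* δ₁≥0 H) (⊩-* δ₂≥0 L))))))
      noH : δ₁ ≢ 0ℤ → ws ⊩ (λ v → - hi (suc j) v)
      noH n = ⊩-cancel δ₁ (ℤ.≤∧≢⇒< δ₁≥0 (λ e → n (sym e))) (⊩-cong (λ v → trans (sym (ℤ.neg-distribʳ-* δ₁ (hi (suc j) v))) (rel solve₂ v)) (⊩-+ S (⊩-+ chord (⊩-* δ₂≥0 L))))
      noL : δ₂ ≢ 0ℤ → ws ⊩ (λ v → - lo j v)
      noL n = ⊩-cancel δ₂ (ℤ.≤∧≢⇒< δ₂≥0 (λ e → n (sym e))) (⊩-cong (λ v → trans (sym (ℤ.neg-distribʳ-* δ₂ (lo j v))) (rel solve₃ v)) (⊩-+ S (⊩-+ chord (⊩-* δ₁≥0 H))))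
      data Kind (v : Pt) : Set where
        lower : v ≡ ρ (l (suc j′)) → Kind v
        upper : v ≡ ρ (l j′) → Kind v
        tip   : v ≡ ap (+ 2 - e) → Kind v
      flip : ∀ {u v} → ρ u ≡ v → u ≡ ρ v
      flip {u} h = trans (sym (ρ-involutive u)) (cong ρ h)
      kind : ∀ v → OnEdge j′ (suc j′) e (ρ v) → Kind v
      kind v o = go _ refl o
        where
        go : ∀ w → ρ v ≡ w → OnEdge j′ (suc j′) e w → Kind v
        go _ h fst-pt = upper (flip h)
        go _ h snd-pt = lower (flip h)
        go _ h apex   = tip (trans (flip h) (ρ-ap e))
      kinds : PosOn Kind ws
      kinds = PosOn-weaken kind on
      kind-lo : ∀ v → Kind v → 0ℤ ≤ lo j v
      kind-lo v (lower refl) = 0≤-resp (trans (lo-ρ j (suc j′) s₃ (l (suc j′))) (hi-l (suc j′) (suc j′))) (ℕ≤⇒0≤ (ℕ.≤-refl {suc j′}))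
      kind-lo v (upper refl) = 0≤-resp (trans (lo-ρ j (suc j′) s₃ (l j′)) (hi-l (suc j′) j′)) (ℕ≤⇒0≤ (ℕ.n≤1+n j′))
      kind-lo v (tip refl) = 0≤-resp (lo-ap j (+ 2 - e)) ℤ.≤-refl
      kind-hi : ∀ v → Kind v → 0ℤ ≤ hi (suc j) v
      kind-hi v (lower refl) = 0≤-resp (trans (hi-ρ (suc j) j′ s (l (suc j′))) (lo-l j′ (suc j′))) (ℕ≤⇒0≤ (ℕ.n≤1+n j′))
      kind-hi v (upper refl) = 0≤-resp (trans (hi-ρ (suc j) j′ s (l j′)) (lo-l j′ j′)) (ℕ≤⇒0≤ (ℕ.≤-refl {j′}))
      kind-hi v (tip refl) = 0≤-resp (hi-ap (suc j) (+ 2 - e)) ℤ.≤-refl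
      lower-hi : ∀ {v} → v ≡ ρ (l (suc j′)) → hi (suc j) v ≡ 0ℤ → ⊥
      lower-hi refl z = ℕ.1+n≢n {j′} (ℤ.+-injective (ℤ.i-j≡0⇒i≡j (+ suc j′) (+ j′) (trans (sym (trans (hi-ρ (suc j) j′ s (l (suc j′))) (lo-l j′ (suc j′)))) z)))
      upper-lo : ∀ {v} → v ≡ ρ (l j′) → lo j v ≡ 0ℤ → ⊥
      upper-lo refl z = ℕ.1+n≢n {j′} (ℤ.+-injective (ℤ.i-j≡0⇒i≡j (+ suc j′) (+ j′) (trans (sym (trans (lo-ρ j (suc j′) s₃ (l j′)) (hi-l (suc j′) j′))) z)))
      fst′ : δ₁ ≡ 0ℤ → ∀ {v} → v ≡ ρ (l (suc j′)) → OnEdge j (suc j) (+ 2 - e) v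
      fst′ z refl = subst (OnEdge j (suc j) (+ 2 - e)) (sym (ρ-l j (suc j′) s₃ z)) fst-pt
      snd′ : δ₂ ≡ 0ℤ → ∀ {v} → v ≡ ρ (l j′) → OnEdge j (suc j) (+ 2 - e) v
      snd′ z refl = subst (OnEdge j (suc j) (+ 2 - e)) (sym (ρ-l (suc j) j′ s z)) snd-pt
      tip′ : ∀ {v} → v ≡ ap (+ 2 - e) → OnEdge j (suc j) (+ 2 - e) v
      tip′ refl = apex
      cases : Dec (δ₁ ≡ 0ℤ) → Dec (δ₂ ≡ 0ℤ) → PosOn (OnEdge j (suc j) (+ 2 - e)) ws
      cases (yes z₁) (yes z₂) = PosOn-weaken (λ { v (lower h) → fst′ z₁ h ; v (upper h) → snd′ z₂ h ; v (tip h) → tip′ h }) kinds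
      cases (yes z₁) (no n₂) = PosOn-weaken (λ { v (lower h , _) → fst′ z₁ h ; v (upper h , z) → ⊥-elim (upper-lo h z) ; v (tip h , _) → tip′ h })
        (⊩-zero kinds kind-lo (noL n₂))
      cases (no n₁) (yes z₂) = PosOn-weaken (λ { v (lower h , z) → ⊥-elim (lower-hi h z) ; v (upper h , _) → snd′ z₂ h ; v (tip h , _) → tip′ h })
        (⊩-zero kinds kind-hi (noH n₁))
      cases (no n₁) (no n₂) = PosOn-weaken (λ { v ((lower h , _) , z) → ⊥-elim (lower-hi h z) ; v ((upper h , z) , _) → ⊥-elim (upper-lo h z) ; v ((tip h , _) , _) → tip′ h })
        (⊩-zero (⊩-zero kinds kind-lo (noL n₂)) (λ v k → kind-hi v (proj₁ k)) (noH n₁))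

  -- Moving the apex one step to the left adds `colevel` to the form, which is nonnegative up to the
  -- level of the square.
  RightOf-lower : ∀ e → (∀ v → V v → 0ℤ ≤ colevel v) → RightOf (e + 1ℤ) V → RightOf e V
  RightOf-lower {V = V} e lev rt j {ws} j<q p L H = first , second
    where
    result = rt j j<q p L H
    gap : ∀ v → ch j (suc j) e v ≡ ch j (suc j) (e + 1ℤ) v + colevel v
    gap (y , t , z) = eq (+ j) e (τ j) (τ (suc j)) y t z
      where
      eq : ∀ j e a b y t z → a * ((1ℤ + j) * z - y) + b * (y - j * z) - (1ℤ + j - j) * (t + e * (1ℤ - z)) ≡
        a * ((1ℤ + j) * z - y) + b * (y - j * z) - (1ℤ + j - j) * (t + (e + 1ℤ) * (1ℤ - z)) + (1ℤ - z)
      eq = solve-∀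
    col : ws ⊩ colevel
    col = ⊩-pos p lev
    first : ws ⊩ ch j (suc j) e
    first = ⊩-cong gap (⊩-+ (proj₁ result) col)
    neg₁ : ∀ a b c → a ≡ b + c → - b ≡ - a + c
    neg₁ a b c e = trans (eq b c) (cong (λ a → - a + c) (sym e))
      where
      eq : ∀ b c → - b ≡ - (b + c) + c
      eq = solve-∀
    neg₂ : ∀ a b c → a ≡ b + c → - c ≡ - a + b
    neg₂ a b c e = trans (eq b c) (cong (λ a → - a + b) (sym e))
      where
      eq : ∀ b c → - c ≡ - (b + c) + b
      eq = solve-∀
    second : ws ⊩ (λ v → - ch j (suc j) e v) → PosOn (OnEdge j (suc j) e) ws
    second S = PosOn-weaken keep (⊩-zero (proj₂ result (⊩-cong (λ v → neg₁ _ (ch j (suc j) (e + 1ℤ) v) (colevel v) (gap v)) (⊩-+ S col)))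
      nonneg (⊩-cong (λ v → neg₂ _ (ch j (suc j) (e + 1ℤ) v) (colevel v) (gap v)) (⊩-+ S (proj₁ result))))
      where
      nonneg : ∀ v → OnEdge j (suc j) (e + 1ℤ) v → 0ℤ ≤ colevel v
      nonneg v fst-pt = +≤+ z≤n
      nonneg v snd-pt = +≤+ z≤n
      nonneg v apex   = +≤+ z≤n
      keep : ∀ v → OnEdge j (suc j) (e + 1ℤ) v × colevel v ≡ 0ℤ → OnEdge j (suc j) e v
      keep v (fst-pt , _) = fst-pt
      keep v (snd-pt , _) = snd-pt

-- Tetrahedra over the path edges and at the corners of the square

module Cells {r q : ℕ} (chain : Chain r q) where
  open Chain chain
  open Strip chain
  open Path chain
  open HalfCell chain

  edgeTet : ℕ → Fin 4 → Pt
  edgeTet i = tet (l i) (l (suc i)) (ap 0ℤ) (ap 1ℤ)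

  -- The corner `x = q`, `y = 0` of the square. The half turn takes it to `l q`, so the mirrored
  -- path starts here.
  r0 : Pt
  r0 = 0ℤ , - 1ℤ , 1ℤ

  -- For q ≥ 2 its base is the triangle between the first edges of the path and of the mirrored
  -- path, which meet in `l 1`. For q = 1 it is half of the square.
  cornerTet : Fin 4 → Pt
  cornerTet = tet (l 0) r0 (l 1) (ap 1ℤ)

  reflect : (Fin 4 → Pt) → Fin 4 → Pt
  reflect S i = ρ (S i)

  data OnEdge² (j : ℕ) : Pt → Set where
    fst-pt : OnEdge² j (l j)
    snd-pt : OnEdge² j (l (suc j))
    apex₀  : OnEdge² j (ap 0ℤ)
    apex₁  : OnEdge² j (ap 1ℤ)

  private
    ch-step-ap : ∀ j e e′ → ch j (suc j) e (ap e′) ≡ e′ - e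
    ch-step-ap j e e′ = trans (ch-ap j (suc j) e e′) (eq (+ j) (e′ - e))
      where
      eq : ∀ j x → (1ℤ + j - j) * x ≡ x
      eq = solve-∀

    1≢0 : ¬ (1ℤ ≡ 0ℤ)
    1≢0 ()

    rev : ∀ a b → - (a - b) ≡ b - a
    rev = solve-∀

    same-index : ∀ {i j} → + i - + j ≡ 0ℤ → i ≡ j
    same-index e = ℤ.+-injective (ℤ.i-j≡0⇒i≡j _ _ e)

  side₁ : ∀ {j} v → OnEdge² j v → 0ℤ ≤ - ch j (suc j) 1ℤ v × (- ch j (suc j) 1ℤ v ≡ 0ℤ → OnEdge j (suc j) 1ℤ v)
  side₁ {j} v fst-pt = ℤ.≤-reflexive (sym (cong -_ (ch-OnEdge {j} {suc j} {1ℤ} fst-pt))) , λ _ → fst-pt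
  side₁ {j} v snd-pt = ℤ.≤-reflexive (sym (cong -_ (ch-OnEdge {j} {suc j} {1ℤ} snd-pt))) , λ _ → snd-pt
  side₁ {j} v apex₁  = ℤ.≤-reflexive (sym (cong -_ (ch-OnEdge {j} {suc j} {1ℤ} apex))) , λ _ → apex
  side₁ {j} v apex₀  = 0≤-resp val (+≤+ z≤n) , λ z → ⊥-elim (1≢0 (trans (sym val) z))
    where
    val : - ch j (suc j) 1ℤ (ap 0ℤ) ≡ 1ℤ
    val = cong -_ (ch-step-ap j 1ℤ 0ℤ)

  side₀ : ∀ {j} v → OnEdge² j v → 0ℤ ≤ ch j (suc j) 0ℤ v × (ch j (suc j) 0ℤ v ≡ 0ℤ → OnEdge j (suc j) 0ℤ v)
  side₀ {j} v fst-pt = ℤ.≤-reflexive (sym (ch-OnEdge {j} {suc j} {0ℤ} fst-pt)) , λ _ → fst-pt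
  side₀ {j} v snd-pt = ℤ.≤-reflexive (sym (ch-OnEdge {j} {suc j} {0ℤ} snd-pt)) , λ _ → snd-pt
  side₀ {j} v apex₀  = ℤ.≤-reflexive (sym (ch-OnEdge {j} {suc j} {0ℤ} apex)) , λ _ → apex
  side₀ {j} v apex₁  = 0≤-resp val (+≤+ z≤n) , λ z → ⊥-elim (1≢0 (trans (sym val) z))
    where
    val : ch j (suc j) 0ℤ (ap 1ℤ) ≡ 1ℤ
    val = ch-step-ap j 0ℤ 1ℤ

  edge-on : ∀ {i} v → Vert (edgeTet i) v → OnEdge² i v
  edge-on v at0 = fst-pt
  edge-on v at1 = snd-pt
  edge-on v at2 = apex₀
  edge-on v at3 = apex₁

  edge-low : ∀ {i j} → suc i ℕ.≤ j → ∀ v → OnEdge² i v → 0ℤ ≤ - lo j v × (lo j v ≡ 0ℤ → OnEdge² j v)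
  edge-low {i} {j} p v fst-pt = 0≤-resp (trans (cong -_ (lo-l j i)) (rev (+ i) (+ j))) (ℕ≤⇒0≤ (ℕ.<⇒≤ p)) ,
    λ z → ⊥-elim (ℕ.<-irrefl (same-index (trans (sym (lo-l j i)) z)) p)
  edge-low {i} {j} p v snd-pt = 0≤-resp (trans (cong -_ (lo-l j (suc i))) (rev (+ suc i) (+ j))) (ℕ≤⇒0≤ p) ,
    λ z → subst (λ k → OnEdge² j (l k)) (sym (same-index (trans (sym (lo-l j (suc i))) z))) fst-pt
  edge-low {i} {j} p v apex₀ = 0≤-resp (cong -_ (lo-ap j 0ℤ)) ℤ.≤-refl , λ _ → apex₀
  edge-low {i} {j} p v apex₁ = 0≤-resp (cong -_ (lo-ap j 1ℤ)) ℤ.≤-refl , λ _ → apex₁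

  edge-high : ∀ {i j} → suc j ℕ.≤ i → ∀ v → OnEdge² i v → 0ℤ ≤ - hi (suc j) v × (- hi (suc j) v ≡ 0ℤ → OnEdge² j v)
  edge-high {i} {j} p v fst-pt = 0≤-resp (trans (cong -_ (hi-l (suc j) i)) (rev (+ suc j) (+ i))) (ℕ≤⇒0≤ p) ,
    λ z → subst (λ k → OnEdge² j (l k)) (same-index (trans (sym (hi-l (suc j) i)) (ℤ.neg-injective z))) snd-pt
  edge-high {i} {j} p v snd-pt = 0≤-resp (trans (cong -_ (hi-l (suc j) (suc i))) (rev (+ suc j) (+ suc i))) (ℕ≤⇒0≤ (ℕ.m≤n⇒m≤1+n p)) ,
    λ z → ⊥-elim (ℕ.<-irrefl (ℕ.suc-injective (same-index (trans (sym (hi-l (suc j) (suc i))) (ℤ.neg-injective z)))) p)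
  edge-high {i} {j} p v apex₀ = 0≤-resp (cong -_ (hi-ap (suc j) 0ℤ)) ℤ.≤-refl , λ _ → apex₀
  edge-high {i} {j} p v apex₁ = 0≤-resp (cong -_ (hi-ap (suc j) 1ℤ)) ℤ.≤-refl , λ _ → apex₁

  edge-strip : ∀ i j → PosOn (Vert (edgeTet i)) ws → ws ⊩ lo j → ws ⊩ hi (suc j) → PosOn (OnEdge² j) ws
  edge-strip i j p L H with ℕ.<-cmp i j
  ... | tri≈ _ refl _ = PosOn-weaken edge-on p
  ... | tri< i<j _ _ = PosOn-weaken (λ v z → proj₂ (edge-low i<j v (edge-on v (proj₁ z))) (ℤ.neg-injective (proj₂ z)))
        (⊩-zero {φ = λ v → - lo j v} p (λ v z → proj₁ (edge-low i<j v (edge-on v z))) (⊩-cong (λ v → ℤ.neg-involutive _) L))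
  ... | tri> _ _ j<i = PosOn-weaken (λ v z → proj₂ (edge-high j<i v (edge-on v (proj₁ z))) (proj₂ z))
        (⊩-zero {φ = λ v → - hi (suc j) v} p (λ v z → proj₁ (edge-high j<i v (edge-on v z))) (⊩-cong (λ v → ℤ.neg-involutive _) H))

  edge-LeftOf : ∀ i → LeftOf 1ℤ (Vert (edgeTet i))
  edge-LeftOf i j p L H = ⊩-pos on (λ v z → proj₁ (side₁ v z)) ,
    λ S → PosOn-weaken (λ v z → proj₂ (side₁ v (proj₁ z)) (proj₂ z))
      (⊩-zero {φ = λ v → - ch j (suc j) 1ℤ v} on (λ v z → proj₁ (side₁ v z)) (⊩-cong (λ v → ℤ.neg-involutive _) S))
    where on = edge-strip i j p L H

  edge-RightOf : ∀ i → RightOf 0ℤ (Vert (edgeTet i))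
  edge-RightOf i j _ p L H = ⊩-pos on (λ v z → proj₁ (side₀ v z)) ,
    λ S → PosOn-weaken (λ v z → proj₂ (side₀ v (proj₁ z)) (proj₂ z)) (⊩-zero on (λ v z → proj₁ (side₀ v z)) S)
    where on = edge-strip i j p L H

  Meet-edge² : ∀ {j} → (∀ v → V v → OnEdge² j v) → (∀ v → W v → OnEdge² j v) → Meet V W
  Meet-edge² {V = V} {W = W} {j} hV hW = Meet-exposed main
    where
    h : ∀ v → V v ⊎ W v → OnEdge² j v
    h v (inj₁ z) = hV v z
    h v (inj₂ z) = hW v z
    at-fst : ∀ v → V v ⊎ W v → hi (suc j) v ≡ 0ℤ ⊎ v ≡ l j
    at-fst v z with h v z
    ... | fst-pt = inj₂ refl
    ... | snd-pt = inj₁ (trans (hi-l (suc j) (suc j)) (ℤ.+-inverseʳ (+ suc j)))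
    ... | apex₀  = inj₁ (hi-ap (suc j) 0ℤ)
    ... | apex₁  = inj₁ (hi-ap (suc j) 1ℤ)
    at-snd : ∀ v → V v ⊎ W v → lo j v ≡ 0ℤ ⊎ v ≡ l (suc j)
    at-snd v z with h v z
    ... | fst-pt = inj₁ (trans (lo-l j j) (ℤ.+-inverseʳ (+ j)))
    ... | snd-pt = inj₂ refl
    ... | apex₀  = inj₁ (lo-ap j 0ℤ)
    ... | apex₁  = inj₁ (lo-ap j 1ℤ)
    at-ap₀ : ∀ v → V v ⊎ W v → - ch j (suc j) 1ℤ v ≡ 0ℤ ⊎ v ≡ ap 0ℤ
    at-ap₀ v z with h v z
    ... | fst-pt = inj₁ (cong -_ (ch-OnEdge {j} {suc j} {1ℤ} fst-pt))
    ... | snd-pt = inj₁ (cong -_ (ch-OnEdge {j} {suc j} {1ℤ} snd-pt))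
    ... | apex₀  = inj₂ refl
    ... | apex₁  = inj₁ (cong -_ (ch-OnEdge {j} {suc j} {1ℤ} apex))
    at-ap₁ : ∀ v → V v ⊎ W v → ch j (suc j) 0ℤ v ≡ 0ℤ ⊎ v ≡ ap 1ℤ
    at-ap₁ v z with h v z
    ... | fst-pt = inj₁ (ch-OnEdge {j} {suc j} {0ℤ} fst-pt)
    ... | snd-pt = inj₁ (ch-OnEdge {j} {suc j} {0ℤ} snd-pt)
    ... | apex₀  = inj₁ (ch-OnEdge {j} {suc j} {0ℤ} apex)
    ... | apex₁  = inj₂ refl
    main : ∀ b → V b ⊎ W b → Σ (Pt → ℤ) λ φ → Aff φ × 0ℤ < φ b ×
      (∀ v → V v ⊎ W v → 0ℤ ≤ φ v × (0ℤ < φ v → v ≡ b))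
    main b z with h b z
    ... | fst-pt = exposes {V} {W} (hi (suc j)) (aff-hi (suc j)) (0<-resp (hi-l (suc j) j) (ℕ<⇒0< (ℕ.n<1+n j))) at-fst
    ... | snd-pt = exposes {V} {W} (lo j) (aff-lo j) (0<-resp (lo-l j (suc j)) (ℕ<⇒0< (ℕ.n<1+n j))) at-snd
    ... | apex₀  = exposes {V} {W} (λ v → - ch j (suc j) 1ℤ v) (aff-neg (aff-ch j (suc j) 1ℤ)) (0<-resp (cong -_ (ch-step-ap j 1ℤ 0ℤ)) (+<+ (s≤s z≤n))) at-ap₀
    ... | apex₁  = exposes {V} {W} (ch j (suc j) 0ℤ) (aff-ch j (suc j) 0ℤ) (0<-resp (ch-step-ap j 0ℤ 1ℤ) (+<+ (s≤s z≤n))) at-ap₁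

  Meet-edges< : ∀ {i j} → i ℕ.< j → Meet (Vert (edgeTet i)) (Vert (edgeTet j))
  Meet-edges< {i} {j} i<j = Meet-separate (lo j) (aff-lo j)
    (λ v z → proj₁ (edge-low i<j v (edge-on v z))) (λ v z → nonneg v (edge-on v z))
    (Meet-edge² (λ v z → proj₂ (edge-low i<j v (edge-on v (proj₁ z))) (proj₂ z)) (λ v z → edge-on v (proj₁ z)))
    where
    nonneg : ∀ v → OnEdge² j v → 0ℤ ≤ lo j v
    nonneg v fst-pt = 0≤-resp (lo-l j j) (ℕ≤⇒0≤ (ℕ.≤-refl {j}))
    nonneg v snd-pt = 0≤-resp (lo-l j (suc j)) (ℕ≤⇒0≤ (ℕ.n≤1+n j))
    nonneg v apex₀  = 0≤-resp (lo-ap j 0ℤ) ℤ.≤-refl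
    nonneg v apex₁  = 0≤-resp (lo-ap j 1ℤ) ℤ.≤-refl

  Meet-edges : ∀ i j → Meet (Vert (edgeTet i)) (Vert (edgeTet j))
  Meet-edges i j with ℕ.<-cmp i j
  ... | tri< p _ _ = Meet-edges< p
  ... | tri≈ _ refl _ = Meet-refl
  ... | tri> _ _ p = Meet-sym (Meet-edges< p)

  private
    ch-r0 : ch 0 1 1ℤ r0 ≡ 1ℤ
    ch-r0 = trans (cong (λ s → s * (1ℤ * 1ℤ - 0ℤ) + τ 1 * (0ℤ - 0ℤ * 1ℤ) - (1ℤ - 0ℤ) * (- 1ℤ + 1ℤ * (1ℤ - 1ℤ))) τ0) (eq (τ 1))
      where
      eq : ∀ t → 0ℤ * (1ℤ * 1ℤ - 0ℤ) + t * (0ℤ - 0ℤ * 1ℤ) - (1ℤ - 0ℤ) * (- 1ℤ + 1ℤ * (1ℤ - 1ℤ)) ≡ 1ℤ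
      eq = solve-∀

    lo-r0 : ∀ j → lo j r0 ≡ + 0 - + j
    lo-r0 j = cong (λ z → 0ℤ - z) (ℤ.*-identityʳ (+ j))

  corner-RightOf : RightOf 1ℤ (Vert cornerTet)
  corner-RightOf zero {ws} _ p L H = ⊩-pos p (λ v z → proj₁ (val v z)) ,
    λ S → PosOn-weaken (λ v z → proj₂ (val v (proj₁ z)) (proj₂ z)) (⊩-zero p (λ v z → proj₁ (val v z)) S)
    where
    val : ∀ v → Vert cornerTet v → 0ℤ ≤ ch 0 1 1ℤ v × (ch 0 1 1ℤ v ≡ 0ℤ → OnEdge 0 1 1ℤ v)
    val v at0 = ℤ.≤-reflexive (sym (ch-OnEdge {0} {1} {1ℤ} fst-pt)) , λ _ → fst-pt
    val v at1 = 0≤-resp ch-r0 (+≤+ z≤n) , λ z → ⊥-elim (1≢0 (trans (sym ch-r0) z))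
    val v at2 = ℤ.≤-reflexive (sym (ch-OnEdge {0} {1} {1ℤ} snd-pt)) , λ _ → snd-pt
    val v at3 = ℤ.≤-reflexive (sym (ch-OnEdge {0} {1} {1ℤ} apex)) , λ _ → apex
  corner-RightOf (suc j) {ws} _ p L H = ⊩-pos on (λ v z → ℤ.≤-reflexive (sym (ch-OnEdge z))) , λ _ → on
    where
    val : ∀ v → Vert cornerTet v → 0ℤ ≤ - lo (suc j) v × (- lo (suc j) v ≡ 0ℤ → OnEdge (suc j) (suc (suc j)) 1ℤ v)
    val v at0 = 0≤-resp (cong -_ (lo-l (suc j) 0)) (+≤+ z≤n) , λ z → ⊥-elim (ℕ.0≢1+n (same-index (trans (sym (lo-l (suc j) 0)) (ℤ.neg-injective z))))
    val v at1 = 0≤-resp (cong -_ (lo-r0 (suc j))) (+≤+ z≤n) , λ z → ⊥-elim (ℕ.0≢1+n {j} (same-index (trans (sym (lo-r0 (suc j))) (ℤ.neg-injective z))))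
    val v at2 = 0≤-resp (trans (cong -_ (lo-l (suc j) 1)) (rev (+ 1) (+ suc j))) (ℕ≤⇒0≤ (s≤s z≤n)) ,
      λ z → subst (λ k → OnEdge (suc j) (suc (suc j)) 1ℤ (l k)) (sym (same-index {1} (trans (sym (lo-l (suc j) 1)) (ℤ.neg-injective z)))) fst-pt
    val v at3 = 0≤-resp (cong -_ (lo-ap (suc j) 1ℤ)) ℤ.≤-refl , λ _ → apex
    on : PosOn (OnEdge (suc j) (suc (suc j)) 1ℤ) ws
    on = PosOn-weaken (λ v z → proj₂ (val v (proj₁ z)) (proj₂ z))
      (⊩-zero {φ = λ v → - lo (suc j) v} p (λ v z → proj₁ (val v z)) (⊩-cong (λ v → ℤ.neg-involutive _) L))

  ρ-r0 : ρ r0 ≡ l q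
  ρ-r0 = Pt-≡ (e₁ (+ q)) (trans (e₂ (+ r)) (sym τq)) refl
    where
    e₁ : ∀ q → q * 1ℤ - 0ℤ ≡ q
    e₁ = solve-∀
    e₂ : ∀ r → (r + 1ℤ) * 1ℤ - - 1ℤ - + 2 ≡ r
    e₂ = solve-∀

  private
    ch-ρl : ∀ j j′ → suc j ℕ.+ j′ ≡ q → ch j (suc j) 1ℤ (ρ (l j′)) ≡ δ (suc j) j′ × ch j (suc j) 1ℤ (ρ (l (suc j′))) ≡ δ j (suc j′)
    ch-ρl j j′ s = trans (ch-ρ j j′ 1ℤ s (ρ (l j′))) (fin (l j′) (trans (ch-l j′ (suc j′) 1ℤ j′) (d-start j′ (suc j′)))
          (trans (hi-ρ (suc j) j′ s (l j′)) (lo-l j′ j′)) (trans (lo-ρ j (suc j′) s₃ (l j′)) (hi-l (suc j′) j′)) (e₁ (+ j′) (δ j (suc j′)) (δ (suc j) j′)))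
      , trans (ch-ρ j j′ 1ℤ s (ρ (l (suc j′)))) (fin (l (suc j′)) (trans (ch-l j′ (suc j′) 1ℤ (suc j′)) (d-end j′ (suc j′)))
          (trans (hi-ρ (suc j) j′ s (l (suc j′))) (lo-l j′ (suc j′))) (trans (lo-ρ j (suc j′) s₃ (l (suc j′))) (hi-l (suc j′) (suc j′))) (e₂ (+ j′) (δ j (suc j′)) (δ (suc j) j′)))
      where
      s₃ : j ℕ.+ suc j′ ≡ q
      s₃ = trans (ℕ.+-suc j j′) s
      fin : ∀ v {c h k w} → ch j′ (suc j′) 1ℤ v ≡ c → hi (suc j) (ρ v) ≡ h → lo j (ρ v) ≡ k →
        - c + (δ j (suc j′) * h + δ (suc j) j′ * k) ≡ w →
        - ch j′ (suc j′) 1ℤ (ρ (ρ v)) + (δ j (suc j′) * hi (suc j) (ρ v) + δ (suc j) j′ * lo j (ρ v)) ≡ w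
      fin v refl refl refl e = trans (cong (λ u → - ch j′ (suc j′) 1ℤ u + (δ j (suc j′) * hi (suc j) (ρ v) + δ (suc j) j′ * lo j (ρ v))) (ρ-involutive v)) e
      e₁ : ∀ j a b → - 0ℤ + (a * (j - j) + b * (1ℤ + j - j)) ≡ b
      e₁ = solve-∀
      e₂ : ∀ j a b → - 0ℤ + (a * (1ℤ + j - j) + b * (1ℤ + j - (1ℤ + j))) ≡ a
      e₂ = solve-∀

    δ-start : δ q 0 ≡ 1ℤ
    δ-start = trans (cong₂ (λ s u → s + u + 1ℤ - + r) τq τ0) (eq (+ r))
      where
      eq : ∀ r → r + 0ℤ + 1ℤ - r ≡ 1ℤ
      eq = solve-∀

  reflected-corner : ∀ v → Vert (reflect cornerTet) v → v ≡ ρ (l 0) ⊎ v ≡ l q ⊎ v ≡ ρ (l 1) ⊎ v ≡ ap 1ℤ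
  reflected-corner v at0 = inj₁ refl
  reflected-corner v at1 = inj₂ (inj₁ ρ-r0)
  reflected-corner v at2 = inj₂ (inj₂ (inj₁ refl))
  reflected-corner v at3 = inj₂ (inj₂ (inj₂ (ρ-ap 1ℤ)))

  reflected-corner-RightOf : RightOf 1ℤ (Vert (reflect cornerTet))
  reflected-corner-RightOf j {ws} j<q p L H with suc j ℕ.≟ q
  ... | yes e = ⊩-pos p (λ v z → proj₁ (val v (reflected-corner v z))) ,
    λ S → PosOn-weaken (λ v z → proj₂ (val v (reflected-corner v (proj₁ z))) (proj₂ z)) (⊩-zero p (λ v z → proj₁ (val v (reflected-corner v z))) S)
    where
    s : suc j ℕ.+ 0 ≡ q
    s = trans (ℕ.+-identityʳ (suc j)) e
    val₀ : ch j (suc j) 1ℤ (ρ (l 0)) ≡ 1ℤ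
    val₀ = trans (proj₁ (ch-ρl j 0 s)) (trans (cong (λ k → δ k 0) e) δ-start)
    val₁ : ch j (suc j) 1ℤ (ρ (l 1)) ≡ δ j 1
    val₁ = proj₂ (ch-ρl j 0 s)
    s₃ : j ℕ.+ 1 ≡ q
    s₃ = trans (ℕ.+-suc j 0) s
    val : ∀ v → v ≡ ρ (l 0) ⊎ v ≡ l q ⊎ v ≡ ρ (l 1) ⊎ v ≡ ap 1ℤ → 0ℤ ≤ ch j (suc j) 1ℤ v × (ch j (suc j) 1ℤ v ≡ 0ℤ → OnEdge j (suc j) 1ℤ v)
    val v (inj₁ refl) = 0≤-resp val₀ (+≤+ z≤n) , λ z → ⊥-elim (1≢0 (trans (sym val₀) z))
    val v (inj₂ (inj₁ refl)) = subst (λ k → 0ℤ ≤ ch j (suc j) 1ℤ (l k) × (ch j (suc j) 1ℤ (l k) ≡ 0ℤ → OnEdge j (suc j) 1ℤ (l k))) e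
      (ℤ.≤-reflexive (sym (ch-OnEdge {j} {suc j} {1ℤ} snd-pt)) , λ _ → snd-pt)
    val v (inj₂ (inj₂ (inj₁ refl))) = 0≤-resp val₁ (δ≥0 j 1 s₃) ,
      λ z → subst (OnEdge j (suc j) 1ℤ) (sym (ρ-l j 1 s₃ (trans (sym val₁) z))) fst-pt
    val v (inj₂ (inj₂ (inj₂ refl))) = ℤ.≤-reflexive (sym (ch-OnEdge {j} {suc j} {1ℤ} apex)) , λ _ → apex
  ... | no ne = ⊩-pos on (λ v z → ℤ.≤-reflexive (sym (ch-OnEdge z))) , λ _ → on
    where
    2+j≤q : suc (suc j) ℕ.≤ q
    2+j≤q = ℕ.≤∧≢⇒< j<q ne
    j′ = q ℕ.∸ suc (suc j)
    s : suc j ℕ.+ suc j′ ≡ q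
    s = trans (ℕ.+-suc (suc j) j′) (ℕ.m+[n∸m]≡n 2+j≤q)
    hi-ρl : ∀ i → - hi (suc j) (ρ (l i)) ≡ + suc j′ - + i
    hi-ρl i = trans (cong -_ (trans (hi-ρ (suc j) (suc j′) s (l i)) (lo-l (suc j′) i))) (rev (+ i) (+ suc j′))
    val : ∀ v → v ≡ ρ (l 0) ⊎ v ≡ l q ⊎ v ≡ ρ (l 1) ⊎ v ≡ ap 1ℤ → 0ℤ ≤ - hi (suc j) v × (- hi (suc j) v ≡ 0ℤ → OnEdge j (suc j) 1ℤ v)
    val v (inj₁ refl) = 0≤-resp (hi-ρl 0) (ℕ≤⇒0≤ {0} {suc j′} z≤n) , λ z → ⊥-elim (ℕ.1+n≢0 (same-index {suc j′} {0} (trans (sym (hi-ρl 0)) z)))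
    val v (inj₂ (inj₁ refl)) = 0≤-resp (trans (cong -_ (hi-l (suc j) q)) (rev (+ suc j) (+ q))) (ℕ≤⇒0≤ j<q) ,
      λ z → ⊥-elim (ne (same-index (trans (sym (hi-l (suc j) q)) (ℤ.neg-injective z))))
    val v (inj₂ (inj₂ (inj₁ refl))) = 0≤-resp (hi-ρl 1) (ℕ≤⇒0≤ {1} {suc j′} (s≤s z≤n)) ,
      λ z → subst (OnEdge j (suc j) 1ℤ) (sym (ρ-l (suc j) 1 (s′ z) (δ-interior (suc j) 1 (s≤s z≤n) (s≤s z≤n) (s′ z)))) snd-pt
      where
      s′ : - hi (suc j) (ρ (l 1)) ≡ 0ℤ → suc j ℕ.+ 1 ≡ q
      s′ z = trans (cong (suc j ℕ.+_) (sym (same-index {suc j′} {1} (trans (sym (hi-ρl 1)) z)))) s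
    val v (inj₂ (inj₂ (inj₂ refl))) = 0≤-resp (cong -_ (hi-ap (suc j) 1ℤ)) ℤ.≤-refl , λ _ → apex
    on : PosOn (OnEdge j (suc j) 1ℤ) ws
    on = PosOn-weaken (λ v z → proj₂ (val v (reflected-corner v (proj₁ z))) (proj₂ z))
      (⊩-zero {φ = λ v → - hi (suc j) v} p (λ v z → proj₁ (val v (reflected-corner v z))) (⊩-cong (λ v → ℤ.neg-involutive _) H))

  -- One corner lies in `y ≤ z`, the other in `y ≥ (q - 1) z`, so the plane `y = z` separates them.
  Meet-corners-wide : 2 ℕ.≤ q → Meet (Vert cornerTet) (Vert (reflect cornerTet))
  Meet-corners-wide 2≤q = Meet-separate (lo 1) (aff-lo 1) (λ v z → proj₁ (below v z)) (λ v z → proj₁ (above v (reflected-corner v z)))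
    (Meet-edge {i = 1} {2} {1ℤ} (s≤s (s≤s z≤n)) (λ v z → proj₂ (below v (proj₁ z)) (proj₂ z)) (λ v z → proj₂ (above v (reflected-corner v (proj₁ z))) (proj₂ z)))
    where
    below : ∀ v → Vert cornerTet v → 0ℤ ≤ - lo 1 v × (lo 1 v ≡ 0ℤ → OnEdge 1 2 1ℤ v)
    below v at0 = +≤+ z≤n , λ ()
    below v at1 = +≤+ z≤n , λ ()
    below v at2 = +≤+ z≤n , λ _ → fst-pt
    below v at3 = +≤+ z≤n , λ _ → apex
    q′ = q ℕ.∸ 2
    s : 2 ℕ.+ q′ ≡ q
    s = ℕ.m+[n∸m]≡n 2≤q
    lo-ρl : ∀ i → lo 1 (ρ (l i)) ≡ + suc q′ - + i
    lo-ρl i = trans (lo-ρ 1 (suc q′) s (l i)) (hi-l (suc q′) i)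
    above : ∀ v → v ≡ ρ (l 0) ⊎ v ≡ l q ⊎ v ≡ ρ (l 1) ⊎ v ≡ ap 1ℤ → 0ℤ ≤ lo 1 v × (lo 1 v ≡ 0ℤ → OnEdge 1 2 1ℤ v)
    above v (inj₁ refl) = 0≤-resp (lo-ρl 0) (ℕ≤⇒0≤ {0} {suc q′} z≤n) , λ z → ⊥-elim (ℕ.1+n≢0 (same-index {suc q′} {0} (trans (sym (lo-ρl 0)) z)))
    above v (inj₂ (inj₁ refl)) = 0≤-resp (lo-l 1 q) (ℕ≤⇒0≤ q>0) , λ z → ⊥-elim (ℕ.<-irrefl (sym (same-index (trans (sym (lo-l 1 q)) z))) 2≤q)
    above v (inj₂ (inj₂ (inj₁ refl))) = 0≤-resp (lo-ρl 1) (ℕ≤⇒0≤ {1} {suc q′} (s≤s z≤n)) ,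
      λ z → subst (OnEdge 1 2 1ℤ) (sym (ρ-l 1 1 (s′ z) (δ-interior 1 1 (s≤s z≤n) (s≤s z≤n) (s′ z)))) fst-pt
      where
      s′ : lo 1 (ρ (l 1)) ≡ 0ℤ → 1 ℕ.+ 1 ≡ q
      s′ z = trans (cong (λ k → suc k) (sym (same-index {suc q′} {1} (trans (sym (lo-ρl 1)) z)))) s
    above v (inj₂ (inj₂ (inj₂ refl))) = +≤+ z≤n , λ _ → apex

  -- The path has no inner points, and the corners are the halves of the square along its diagonal
  -- from `r0` to `l 1`. The form `diag` vanishes at these two points and at `ap 1`.
  Meet-corners-unit : q ≡ 1 → Meet (Vert cornerTet) (Vert (reflect cornerTet))
  Meet-corners-unit refl = Meet-separate diag aff-diag (λ v z → proj₁ (below v z)) (λ v z → proj₁ (above v (reflected-corner v z)))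
      (Meet-exposed main)
    where
    diag : Pt → ℤ
    diag (y , t , z) = (+ r + 1ℤ) * y - t - 1ℤ
    aff-diag : Aff diag
    aff-diag = aff-- (aff-- (aff-* (+ r + 1ℤ) aff-1) aff-2) (aff-c 1ℤ)
    data Common : Pt → Set where
      c-r0 : Common r0
      c-l1 : Common (l 1)
      c-ap : Common (ap 1ℤ)
    diag-l1 : diag (l 1) ≡ 0ℤ
    diag-l1 = trans (cong (λ t → (+ r + 1ℤ) * 1ℤ - t - 1ℤ) τq) (eq (+ r))
      where
      eq : ∀ r → (r + 1ℤ) * 1ℤ - r - 1ℤ ≡ 0ℤ
      eq = solve-∀
    diag-y0 : ∀ t z → diag (0ℤ , t , z) ≡ - t - 1ℤ
    diag-y0 t z = eq (+ r) t
      where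
      eq : ∀ r t → (r + 1ℤ) * 0ℤ - t - 1ℤ ≡ - t - 1ℤ
      eq = solve-∀
    diag-l0 : - diag (l 0) ≡ 1ℤ
    diag-l0 = cong -_ (trans (diag-y0 (τ 0) 1ℤ) (cong (λ t → - t - 1ℤ) τ0))
    below : ∀ v → Vert cornerTet v → 0ℤ ≤ - diag v × (diag v ≡ 0ℤ → Common v)
    below v at0 = 0≤-resp diag-l0 (+≤+ z≤n) , λ z → ⊥-elim (1≢0 (trans (sym diag-l0) (cong -_ z)))
    below v at1 = 0≤-resp (cong -_ (diag-y0 (- 1ℤ) 1ℤ)) (+≤+ z≤n) , λ _ → c-r0
    below v at2 = 0≤-resp (cong -_ diag-l1) (+≤+ z≤n) , λ _ → c-l1
    below v at3 = 0≤-resp (cong -_ (diag-y0 (- 1ℤ) 0ℤ)) (+≤+ z≤n) , λ _ → c-ap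
    ρl0 : ρ (l 0) ≡ (1ℤ , + r - 1ℤ , 1ℤ)
    ρl0 = Pt-≡ refl (trans (cong (λ t → (+ r + 1ℤ) * 1ℤ - t - + 2) τ0) (eq (+ r))) refl
      where
      eq : ∀ r → (r + 1ℤ) * 1ℤ - 0ℤ - + 2 ≡ r - 1ℤ
      eq = solve-∀
    ρl1 : ρ (l 1) ≡ r0
    ρl1 = Pt-≡ refl (trans (cong (λ t → (+ r + 1ℤ) * 1ℤ - t - + 2) τq) (eq (+ r))) refl
      where
      eq : ∀ r → (r + 1ℤ) * 1ℤ - r - + 2 ≡ - 1ℤ
      eq = solve-∀
    diag-ρl0 : diag (ρ (l 0)) ≡ 1ℤ
    diag-ρl0 = trans (cong diag ρl0) (eq (+ r))
      where
      eq : ∀ r → (r + 1ℤ) * 1ℤ - (r - 1ℤ) - 1ℤ ≡ 1ℤ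
      eq = solve-∀
    above : ∀ v → v ≡ ρ (l 0) ⊎ v ≡ l 1 ⊎ v ≡ ρ (l 1) ⊎ v ≡ ap 1ℤ → 0ℤ ≤ diag v × (diag v ≡ 0ℤ → Common v)
    above v (inj₁ refl) = 0≤-resp diag-ρl0 (+≤+ z≤n) , λ z → ⊥-elim (1≢0 (trans (sym diag-ρl0) z))
    above v (inj₂ (inj₁ refl)) = 0≤-resp diag-l1 (+≤+ z≤n) , λ _ → c-l1
    above v (inj₂ (inj₂ (inj₁ refl))) = 0≤-resp (trans (cong diag ρl1) (diag-y0 (- 1ℤ) 1ℤ)) (+≤+ z≤n) , λ _ → subst Common (sym ρl1) c-r0
    above v (inj₂ (inj₂ (inj₂ refl))) = 0≤-resp (diag-y0 (- 1ℤ) 0ℤ) (+≤+ z≤n) , λ _ → c-ap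
    V₀ W₀ : Pt → Set
    V₀ v = Vert cornerTet v × diag v ≡ 0ℤ
    W₀ v = Vert (reflect cornerTet) v × diag v ≡ 0ℤ
    h : ∀ v → V₀ v ⊎ W₀ v → Common v
    h v (inj₁ (z , e)) = proj₂ (below v z) e
    h v (inj₂ (z , e)) = proj₂ (above v (reflected-corner v z)) e
    at-r0 : ∀ v → V₀ v ⊎ W₀ v → hi 1 v ≡ 0ℤ ⊎ v ≡ r0
    at-r0 v z with h v z
    ... | c-r0 = inj₂ refl
    ... | c-l1 = inj₁ refl
    ... | c-ap = inj₁ refl
    at-l1 : ∀ v → V₀ v ⊎ W₀ v → lo 0 v ≡ 0ℤ ⊎ v ≡ l 1
    at-l1 v z with h v z
    ... | c-r0 = inj₁ refl
    ... | c-l1 = inj₂ refl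
    ... | c-ap = inj₁ refl
    at-ap : ∀ v → V₀ v ⊎ W₀ v → colevel v ≡ 0ℤ ⊎ v ≡ ap 1ℤ
    at-ap v z with h v z
    ... | c-r0 = inj₁ refl
    ... | c-l1 = inj₁ refl
    ... | c-ap = inj₂ refl
    main : ∀ b → V₀ b ⊎ W₀ b → Σ (Pt → ℤ) λ φ → Aff φ × 0ℤ < φ b × (∀ v → V₀ v ⊎ W₀ v → 0ℤ ≤ φ v × (0ℤ < φ v → v ≡ b))
    main b z with h b z
    ... | c-r0 = exposes {V₀} {W₀} (hi 1) (aff-hi 1) (+<+ (s≤s z≤n)) at-r0
    ... | c-l1 = exposes {V₀} {W₀} (lo 0) (aff-lo 0) (+<+ (s≤s z≤n)) at-l1
    ... | c-ap = exposes {V₀} {W₀} colevel aff-colevel (+<+ (s≤s z≤n)) at-ap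

  Meet-corners : Meet (Vert cornerTet) (Vert (reflect cornerTet))
  Meet-corners with q ℕ.≟ 1
  ... | yes e = Meet-corners-unit e
  ... | no ne = Meet-corners-wide (ℕ.≤∧≢⇒< q>0 (λ e → ne (sym e)))

-- Integral barycentric coordinates

total4 : (Fin 4 → ℤ) → ℤ
total4 c = c i0 + (c i1 + (c i2 + c i3))

comb : (Fin 4 → Pt) → (Fin 4 → ℤ) → Pt
comb S c = total4 (λ i → c i * proj₁ (S i)) , total4 (λ i → c i * proj₁ (proj₂ (S i))) , total4 (λ i → c i * proj₂ (proj₂ (S i)))

aff-comb : Aff φ → ∀ S c → total4 c ≡ 1ℤ → total4 (λ i → c i * φ (S i)) ≡ φ (comb S c)
aff-comb {φ = φ} (aff k₀ k₁ k₂ k₃ e) S c h = trans (cong₂ _+_ (term i0) (cong₂ _+_ (term i1) (cong₂ _+_ (term i2) (term i3))))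
    (trans (eq k₀ k₁ k₂ k₃ (c i0) (c i1) (c i2) (c i3) _ _ _ _ _ _ _ _ _ _ _ _)
    (trans (cong (λ s → k₀ * s + (k₁ * proj₁ (comb S c) + (k₂ * proj₁ (proj₂ (comb S c)) + k₃ * proj₂ (proj₂ (comb S c))))) h)
    (trans (cong (_+ (k₁ * proj₁ (comb S c) + (k₂ * proj₁ (proj₂ (comb S c)) + k₃ * proj₂ (proj₂ (comb S c))))) (ℤ.*-identityʳ k₀)) (sym (e _ _ _)))))
  where
  term : ∀ i → c i * φ (S i) ≡ c i * (k₀ + (k₁ * proj₁ (S i) + (k₂ * proj₁ (proj₂ (S i)) + k₃ * proj₂ (proj₂ (S i)))))
  term i = cong (c i *_) (e _ _ _)
  eq : ∀ k₀ k₁ k₂ k₃ a b c d x₀ x₁ x₂ x₃ y₀ y₁ y₂ y₃ z₀ z₁ z₂ z₃ →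
    a * (k₀ + (k₁ * x₀ + (k₂ * y₀ + k₃ * z₀))) + (b * (k₀ + (k₁ * x₁ + (k₂ * y₁ + k₃ * z₁)))
      + (c * (k₀ + (k₁ * x₂ + (k₂ * y₂ + k₃ * z₂))) + d * (k₀ + (k₁ * x₃ + (k₂ * y₃ + k₃ * z₃))))) ≡
    k₀ * (a + (b + (c + d))) + (k₁ * (a * x₀ + (b * x₁ + (c * x₂ + d * x₃)))
      + (k₂ * (a * y₀ + (b * y₁ + (c * y₂ + d * y₃))) + k₃ * (a * z₀ + (b * z₁ + (c * z₂ + d * z₃)))))
  eq = solve-∀

affmap-comb : ∀ {g} → AffMap g → ∀ S c → total4 c ≡ 1ℤ → comb (λ i → g (S i)) c ≡ g (comb S c)
affmap-comb (a₁ , a₂ , a₃) S c h = Pt-≡ (aff-comb a₁ S c h) (aff-comb a₂ S c h) (aff-comb a₃ S c h)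

-- integral barycentric coordinates of a unimodular simplex
record Dual (S : Fin 4 → Pt) : Set where
  field
    coord  : Fin 4 → Pt → ℤ
    affine : ∀ i → Aff (coord i)
    total  : ∀ v → total4 (λ i → coord i v) ≡ 1ℤ
    repr   : ∀ v → comb S (λ i → coord i v) ≡ v

record Covers (S : Fin 4 → Pt) (ws : Meas) : Set where
  field
    dual   : Dual S
    nonneg : ∀ i → ws ⊩ Dual.coord dual i

Dual-map : ∀ {S g h} → AffMap g → AffMap h → (∀ v → g (h v) ≡ v) → Dual S → Dual (λ i → g (S i))
Dual-map {S} {g} {h} ag ah inv D = record
  { coord  = λ i v → Dual.coord D i (h v)
  ; affine = λ i → aff-∘ (Dual.affine D i) ah
  ; total  = λ v → Dual.total D (h v)
  ; repr   = λ v → trans (affmap-comb ag S (λ i → Dual.coord D i (h v)) (Dual.total D (h v))) (trans (cong g (Dual.repr D (h v))) (inv v)) }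

Covers-map : ∀ {S g h} → AffMap g → AffMap h → (∀ v → g (h v) ≡ v) → Covers S (pushforward h ws) → Covers (λ i → g (S i)) ws
Covers-map {h = h} ag ah inv C = record { dual = Dual-map ag ah inv (Covers.dual C) ; nonneg = λ i → ⊩-unmap h (Covers.nonneg C i) }

fin4 : ∀ {A : Fin 4 → Set} → A i0 → A i1 → A i2 → A i3 → ∀ i → A i
fin4 a b c d i0 = a
fin4 a b c d i1 = b
fin4 a b c d i2 = c
fin4 a b c d i3 = d

-- The triangulation of a half cell

module Triangulation {r q : ℕ} (chain : Chain r q) where
  open Chain chain
  open Strip chain
  open Path chain
  open HalfCell chain
  open Cells chain

  -- The apex of the region beside the path: the outer end `ap 0` when the bottom segment reaches
  -- it, the middle `ap 1` otherwise.
  a₀ : Bool → ℤ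
  a₀ true  = 0ℤ
  a₀ false = 1ℤ

  -- Up to the half turn these are all the pieces. An edge tetrahedron needs the step from `ap 0` to
  -- `ap 1`, hence the condition on α.
  data G (α : Bool) : (Fin 4 → Pt) → Set where
    g-tri    : ∀ {T} → InTree tree T → G α (coneTri (a₀ α) T)
    g-edge   : α ≡ true → ∀ {i} → i ℕ.< q → G α (edgeTet i)
    g-corner : G α cornerTet

  -- These simplices fill the part 0 ≤ z ≤ 1 of a cell; α and β tell whether the bottom segment
  -- extends to ap 0 on the left and to ap 2 on the right of ap 1.
  data HC (α β : Bool) : (Fin 4 → Pt) → Set where
    lft : ∀ {S} → G α S → HC α β S
    rgt : ∀ {S} → G β S → HC α β (reflect S)

  listG : Bool → List (Fin 4 → Pt)
  listG α = map (coneTri (a₀ α)) (tris tree) ++ (edges α ++ cornerTet ∷ [])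
    where
    edges : Bool → List (Fin 4 → Pt)
    edges true  = map edgeTet (upTo q)
    edges false = []

  listHC : Bool → Bool → List (Fin 4 → Pt)
  listHC α β = listG α ++ map reflect (listG β)

  listG-sound : ∀ α {S} → S ∈ listG α → G α S
  listG-sound α S∈ with ∈-++⁻ (map (coneTri (a₀ α)) (tris tree)) S∈
  listG-sound α S∈ | inj₁ i with ∈-map⁻ (coneTri (a₀ α)) i
  ... | T , T∈ , refl = g-tri (tris-sound tree T∈)
  listG-sound false S∈ | inj₂ (here refl) = g-corner
  listG-sound true S∈ | inj₂ i with ∈-++⁻ (map edgeTet (upTo q)) i
  ... | inj₂ (here refl) = g-corner
  ... | inj₁ j with ∈-map⁻ edgeTet j
  ... | k , k∈ , refl = g-edge refl (∈-upTo⁻ k∈)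

  listG-complete : ∀ {α S} → G α S → S ∈ listG α
  listG-complete {α} (g-tri i) = ∈-++⁺ˡ (∈-map⁺ (coneTri (a₀ α)) (tris-complete i))
  listG-complete (g-edge refl i<q) = ∈-++⁺ʳ (map (coneTri 0ℤ) (tris tree)) (∈-++⁺ˡ (∈-map⁺ edgeTet (∈-upTo⁺ i<q)))
  listG-complete {true} g-corner = ∈-++⁺ʳ (map (coneTri 0ℤ) (tris tree)) (∈-++⁺ʳ (map edgeTet (upTo q)) (here refl))
  listG-complete {false} g-corner = ∈-++⁺ʳ (map (coneTri 1ℤ) (tris tree)) (here refl)

  listHC-sound : ∀ α β {S} → S ∈ listHC α β → HC α β S
  listHC-sound α β S∈ with ∈-++⁻ (listG α) S∈
  ... | inj₁ i = lft (listG-sound α i)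
  ... | inj₂ i with ∈-map⁻ reflect i
  ... | S , S∈′ , refl = rgt (listG-sound β S∈′)

  listHC-complete : ∀ {α β S} → HC α β S → S ∈ listHC α β
  listHC-complete (lft g) = ∈-++⁺ˡ (listG-complete g)
  listHC-complete {α} (rgt g) = ∈-++⁺ʳ (listG α) (∈-map⁺ reflect (listG-complete g))

  data Vtx (α : Bool) : Pt → Set where
    v-path : ∀ i → i ℕ.≤ q → Vtx α (l i)
    v-r0   : Vtx α r0
    v-ap₀  : α ≡ true → Vtx α (ap 0ℤ)
    v-ap₁  : Vtx α (ap 1ℤ)

  v-ap : ∀ α → Vtx α (ap (a₀ α))
  v-ap true  = v-ap₀ refl
  v-ap false = v-ap₁

  G-vtx : ∀ {α S} → G α S → ∀ v → Vert S v → Vtx α v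
  G-vtx {α} (g-tri i) v z with inTree-chain i v z
  ... | pt i _ p = v-path i p
  ... | top      = v-ap α
  G-vtx (g-edge e p) v at0 = v-path _ (ℕ.<⇒≤ p)
  G-vtx (g-edge e p) v at1 = v-path _ p
  G-vtx (g-edge e p) v at2 = v-ap₀ e
  G-vtx (g-edge e p) v at3 = v-ap₁
  G-vtx g-corner v at0 = v-path 0 z≤n
  G-vtx g-corner v at1 = v-r0
  G-vtx g-corner v at2 = v-path 1 q>0
  G-vtx g-corner v at3 = v-ap₁

  vtx-colevel : ∀ {α v} → Vtx α v → 0ℤ ≤ colevel v
  vtx-colevel (v-path i _) = +≤+ z≤n
  vtx-colevel v-r0         = +≤+ z≤n
  vtx-colevel (v-ap₀ _)    = +≤+ z≤n
  vtx-colevel v-ap₁        = +≤+ z≤n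

  vtx-lo : ∀ {α v} → Vtx α v → 0ℤ ≤ lo 0 v
  vtx-lo (v-path i _) = 0≤-resp (lo-l 0 i) (ℕ≤⇒0≤ {0} {i} z≤n)
  vtx-lo v-r0         = +≤+ z≤n
  vtx-lo (v-ap₀ _)    = +≤+ z≤n
  vtx-lo v-ap₁        = +≤+ z≤n

  vtx-hi : ∀ {α v} → Vtx α v → 0ℤ ≤ hi q v
  vtx-hi (v-path i p) = 0≤-resp (hi-l q i) (ℕ≤⇒0≤ p)
  vtx-hi v-r0         = 0≤-resp (trans (cong (λ s → s - 0ℤ) (ℤ.*-identityʳ (+ q))) (ℤ.+-identityʳ (+ q))) (0≤+ᴺ q)
  vtx-hi (v-ap₀ _)    = 0≤-resp (hi-ap q 0ℤ) ℤ.≤-refl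
  vtx-hi v-ap₁        = 0≤-resp (hi-ap q 1ℤ) ℤ.≤-refl

  private
    G-strip : ∀ {α S} → G α S → InStrip (Vert S)
    G-strip g v z = vtx-lo (G-vtx g v z) , vtx-hi (G-vtx g v z)

    unreflect : ∀ {S} v → Vert (reflect S) v → Vert S (ρ v)
    unreflect {S} v (i , e) = i , trans (cong ρ e) (ρ-involutive (S i))

    reflect-colevel : ∀ {α S} → G α S → ∀ v → Vert (reflect S) v → 0ℤ ≤ colevel v
    reflect-colevel g v z = vtx-colevel (G-vtx g (ρ v) (unreflect v z))

    tri-mirror : ∀ β {T} → InTree tree T → RightOf 1ℤ (Vert (reflect (coneTri (a₀ β) T)))
    tri-mirror false i = mirror 1ℤ (tri-LeftOf 1ℤ (inTree-IsTri i)) unreflect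
    tri-mirror true i = RightOf-lower 1ℤ (reflect-colevel (g-tri {true} i)) (mirror 0ℤ (tri-LeftOf 0ℤ (inTree-IsTri i)) unreflect)

    G-right : ∀ {β S} → G β S → RightOf 1ℤ (Vert (reflect S))
    G-right {β} (g-tri i) = tri-mirror β i
    G-right (g-edge e {i} p) = mirror 1ℤ (edge-LeftOf i) unreflect
    G-right g-corner = reflected-corner-RightOf

    right-a₀ : ∀ α → (∀ v → V v → 0ℤ ≤ colevel v) → RightOf 1ℤ V → RightOf (a₀ α) V
    right-a₀ true  c r = RightOf-lower 0ℤ c r
    right-a₀ false c r = r

    corner-colevel : ∀ v → Vert cornerTet v → 0ℤ ≤ colevel v
    corner-colevel v z = vtx-colevel (G-vtx {true} g-corner v z)

  Meet-G : ∀ {α S S′} → G α S → G α S′ → Meet (Vert S) (Vert S′)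
  Meet-G (g-tri i) (g-tri j) = Meet-tris i j
  Meet-G g@(g-tri i) (g-edge refl {k} p) = Meet-sides 0ℤ (G-strip g) (tri-LeftOf 0ℤ (inTree-IsTri i)) (edge-RightOf k)
  Meet-G {α} g@(g-tri i) g-corner = Meet-sides (a₀ α) (G-strip g) (tri-LeftOf (a₀ α) (inTree-IsTri i)) (right-a₀ α corner-colevel corner-RightOf)
  Meet-G (g-edge refl {k} p) g@(g-tri i) = Meet-sym (Meet-sides 0ℤ (G-strip g) (tri-LeftOf 0ℤ (inTree-IsTri i)) (edge-RightOf k))
  Meet-G (g-edge e {i} p) (g-edge _ {j} _) = Meet-edges i j
  Meet-G g@(g-edge e {i} p) g-corner = Meet-sides 1ℤ (G-strip g) (edge-LeftOf i) corner-RightOf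
  Meet-G {α} g-corner g@(g-tri i) = Meet-sym (Meet-sides (a₀ α) (G-strip g) (tri-LeftOf (a₀ α) (inTree-IsTri i)) (right-a₀ α corner-colevel corner-RightOf))
  Meet-G g-corner g@(g-edge e {i} p) = Meet-sym (Meet-sides 1ℤ (G-strip g) (edge-LeftOf i) corner-RightOf)
  Meet-G g-corner g-corner = Meet-refl

  private
    double : ∀ {S} v → Vert (reflect (reflect S)) v → Vert S v
    double {S} v (i , e) = i , trans e (ρ-involutive (S i))
    undouble : ∀ {S} v → Vert S v → Vert (reflect (reflect S)) v
    undouble {S} v (i , e) = i , trans e (sym (ρ-involutive (S i)))

    swap-reflect : ∀ {S S′} → Meet (Vert S′) (Vert (reflect S)) → Meet (Vert S) (Vert (reflect S′))
    swap-reflect {S} {S′} m = Meet-sym (Meet-mono (λ _ z → z) (λ _ z → z) (double {S}) (undouble {S}) (Meet-ρ {S′} {reflect S} m))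

  private
    tri-reflect : ∀ α {β T S′} → InTree tree T → G β S′ → Meet (Vert (coneTri (a₀ α) T)) (Vert (reflect S′))
    tri-reflect α i g′ = Meet-sides (a₀ α) (G-strip (g-tri {α} i)) (tri-LeftOf (a₀ α) (inTree-IsTri i)) (right-a₀ α (reflect-colevel g′) (G-right g′))

    edge-reflect : ∀ {β i S′} → i ℕ.< q → G β S′ → Meet (Vert (edgeTet i)) (Vert (reflect S′))
    edge-reflect {i = i} p g′ = Meet-sides 1ℤ (G-strip (g-edge {true} refl p)) (edge-LeftOf i) (G-right g′)

  -- Cones and edge tetrahedra lie left of the path and all mirrored pieces right of it. A corner is
  -- not left of the path: against a mirrored cone or edge tetrahedron the half turn exchanges the
  -- roles, and the two corners are compared directly.
  Meet-G-reflect : ∀ {α β S S′} → G α S → G β S′ → Meet (Vert S) (Vert (reflect S′))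
  Meet-G-reflect {α} (g-tri i) g′ = tri-reflect α i g′
  Meet-G-reflect (g-edge _ p) g′ = edge-reflect p g′
  Meet-G-reflect g-corner g-corner = Meet-corners
  Meet-G-reflect {β = β} g-corner (g-tri {T} i) = swap-reflect {cornerTet} {coneTri (a₀ β) T} (tri-reflect β i (g-corner {true}))
  Meet-G-reflect g-corner (g-edge _ {i} p) = swap-reflect {cornerTet} {edgeTet i} (edge-reflect p (g-corner {true}))

  Meet-HC : ∀ {α β S S′} → HC α β S → HC α β S′ → Meet (Vert S) (Vert S′)
  Meet-HC (lft g) (lft g′) = Meet-G g g′
  Meet-HC (lft g) (rgt g′) = Meet-G-reflect g g′
  Meet-HC (rgt g) (lft g′) = Meet-sym (Meet-G-reflect g′ g)
  Meet-HC (rgt {S} g) (rgt {S′} g′) = Meet-ρ {S} {S′} (Meet-G g g′)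

  -- The faces in the square do not depend on α and β.
  SameFace : (S S′ : Fin 4 → Pt) → Set
  SameFace S S′ = ∀ v → level v ≡ 1ℤ → (Vert S v → Vert S′ v) × (Vert S′ v → Vert S v)

  tri-face : ∀ e e′ T → SameFace (coneTri e T) (coneTri e′ T)
  tri-face e e′ T v lv = go e e′ , go e′ e
    where
    go : ∀ e e′ → Vert (coneTri e T) v → Vert (coneTri e′ T) v
    go e e′ (i0 , p) = i0 , p
    go e e′ (i1 , p) = i1 , p
    go e e′ (i2 , p) = i2 , p
    go e e′ (i3 , p) with trans (sym lv) (cong level p)
    ... | ()

  G-face : ∀ {α S} → G α S → ∃ λ S′ → G true S′ × SameFace S S′
  G-face {α} (g-tri {T} i) = coneTri 0ℤ T , g-tri i , tri-face (a₀ α) 0ℤ T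
  G-face (g-edge e p) = _ , g-edge refl p , λ _ _ → (λ z → z) , (λ z → z)
  G-face g-corner = _ , g-corner , λ _ _ → (λ z → z) , (λ z → z)

  HC-face : ∀ {α β S} → HC α β S → ∃ λ S′ → HC true true S′ × SameFace S S′
  HC-face (lft g) with G-face g
  ... | S′ , g′ , f = S′ , lft g′ , f
  HC-face (rgt {S} g) with G-face g
  ... | S′ , g′ , f = reflect S′ , rgt g′ , λ v lv →
    (λ { (i , e) → rev S′ v (proj₁ (f (ρ v) lv) (unreflect v (i , e))) }) , (λ { (i , e) → rev S v (proj₂ (f (ρ v) lv) (unreflect v (i , e))) })
    where
    rev : ∀ S v → Vert S (ρ v) → Vert (reflect S) v
    rev S v (i , e) = i , trans (sym (ρ-involutive v)) (cong ρ e)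

  -- The triangulation of the square is invariant under the half turn. This is what makes the upper
  -- half of a cell, a point reflection of a lower half, fit onto the lower one.
  HC-reflect-face : ∀ {α β S} → HC α β S → ∃ λ S′ → HC true true S′ × SameFace (reflect S) S′
  HC-reflect-face (lft {S} g) with G-face g
  ... | S′ , g′ , f = reflect S′ , rgt g′ , λ v lv →
    (λ { (i , e) → rev S′ v (proj₁ (f (ρ v) lv) (unreflect v (i , e))) }) , (λ { (i , e) → rev S v (proj₂ (f (ρ v) lv) (unreflect v (i , e))) })
    where
    rev : ∀ S v → Vert S (ρ v) → Vert (reflect S) v
    rev S v (i , e) = i , trans (sym (ρ-involutive v)) (cong ρ e)
  HC-reflect-face (rgt {S} g) with G-face g
  ... | S′ , g′ , f = S′ , lft g′ , λ v lv → (λ z → proj₁ (f v lv) (double {S} v z)) , (λ z → undouble {S} v (proj₂ (f v lv) z))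

  -- Barycentric coordinates

  -- With D the determinant of the triangle, the four forms add up to `D z + (1 - z)` and reproduce
  -- D times y and z. Being a Farey triangle means D = 1.
  tri-dual : ∀ {a m b} e → IsTri a m b → Dual (coneTri e (a , m , b))
  tri-dual {a} {m} {b} e T = record
    { coord = fin4 (λ v → - ch m b e v) (ch a b e) (λ v → - ch a m e v) colevel
    ; affine = fin4 (aff-neg (aff-ch m b e)) (aff-ch a b e) (aff-neg (aff-ch a m e)) aff-colevel
    ; total = λ { (y , t , z) → trans (eq₀ (+ a) (+ m) (+ b) e (τ a) (τ m) (τ b) y t z)
        (trans (cong (λ D → D * z + (1ℤ - z)) (IsTri.unit T)) (fin₀ z)) }
    ; repr = λ { (y , t , z) → Pt-≡
        (trans (eq₁ (+ a) (+ m) (+ b) e (τ a) (τ m) (τ b) y t z) (trans (cong (_* y) (IsTri.unit T)) (ℤ.*-identityˡ y)))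
        (trans (eq₂ (+ a) (+ m) (+ b) e (τ a) (τ m) (τ b) y t z) (trans (cong (λ D → D * (t + e * (1ℤ - z)) + (1ℤ - z) * - e) (IsTri.unit T)) (fin₂ e t z)))
        (trans (eq₃ (+ a) (+ m) (+ b) e (τ a) (τ m) (τ b) y t z) (trans (cong (_* z) (IsTri.unit T)) (ℤ.*-identityˡ z))) } }
    where
    fin₀ : ∀ z → 1ℤ * z + (1ℤ - z) ≡ 1ℤ
    fin₀ = solve-∀
    fin₂ : ∀ e t z → 1ℤ * (t + e * (1ℤ - z)) + (1ℤ - z) * - e ≡ t
    fin₂ = solve-∀
    eq₀ : ∀ a m b e ta tm tb y t z →
      - (tm * (b * z - y) + tb * (y - m * z) - (b - m) * (t + e * (1ℤ - z))) + ((ta * (b * z - y) + tb * (y - a * z) - (b - a) * (t + e * (1ℤ - z)))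
        + (- (ta * (m * z - y) + tm * (y - a * z) - (m - a) * (t + e * (1ℤ - z))) + (1ℤ - z))) ≡ (ta * (b - m) + tb * (m - a) - (b - a) * tm) * z + (1ℤ - z)
    eq₀ = solve-∀
    eq₁ : ∀ a m b e ta tm tb y t z →
      - (tm * (b * z - y) + tb * (y - m * z) - (b - m) * (t + e * (1ℤ - z))) * a + ((ta * (b * z - y) + tb * (y - a * z) - (b - a) * (t + e * (1ℤ - z))) * m
        + (- (ta * (m * z - y) + tm * (y - a * z) - (m - a) * (t + e * (1ℤ - z))) * b + (1ℤ - z) * 0ℤ)) ≡ (ta * (b - m) + tb * (m - a) - (b - a) * tm) * y
    eq₁ = solve-∀
    eq₂ : ∀ a m b e ta tm tb y t z →
      - (tm * (b * z - y) + tb * (y - m * z) - (b - m) * (t + e * (1ℤ - z))) * ta + ((ta * (b * z - y) + tb * (y - a * z) - (b - a) * (t + e * (1ℤ - z))) * tm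
        + (- (ta * (m * z - y) + tm * (y - a * z) - (m - a) * (t + e * (1ℤ - z))) * tb + (1ℤ - z) * - e)) ≡ (ta * (b - m) + tb * (m - a) - (b - a) * tm) * (t + e * (1ℤ - z)) + (1ℤ - z) * - e
    eq₂ = solve-∀
    eq₃ : ∀ a m b e ta tm tb y t z →
      - (tm * (b * z - y) + tb * (y - m * z) - (b - m) * (t + e * (1ℤ - z))) * 1ℤ + ((ta * (b * z - y) + tb * (y - a * z) - (b - a) * (t + e * (1ℤ - z))) * 1ℤ
        + (- (ta * (m * z - y) + tm * (y - a * z) - (m - a) * (t + e * (1ℤ - z))) * 1ℤ + (1ℤ - z) * 0ℤ)) ≡ (ta * (b - m) + tb * (m - a) - (b - a) * tm) * z
    eq₃ = solve-∀

  edge-dual : ∀ j → Dual (edgeTet j)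
  edge-dual j = record
    { coord = fin4 (hi (suc j)) (lo j) (λ v → - ch j (suc j) 1ℤ v) (ch j (suc j) 0ℤ)
    ; affine = fin4 (aff-hi (suc j)) (aff-lo j) (aff-neg (aff-ch j (suc j) 1ℤ)) (aff-ch j (suc j) 0ℤ)
    ; total = λ { (y , t , z) → eq₀ (+ j) (τ j) (τ (suc j)) y t z }
    ; repr = λ { (y , t , z) → Pt-≡ (eq₁ (+ j) (τ j) (τ (suc j)) y t z) (eq₂ (+ j) (τ j) (τ (suc j)) y t z) (eq₃ (+ j) (τ j) (τ (suc j)) y t z) } }
    where
    eq₀ : ∀ j a b y t z → (1ℤ + j) * z - y + (y - j * z + (- (a * ((1ℤ + j) * z - y) + b * (y - j * z) - (1ℤ + j - j) * (t + 1ℤ * (1ℤ - z)))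
      + (a * ((1ℤ + j) * z - y) + b * (y - j * z) - (1ℤ + j - j) * (t + 0ℤ * (1ℤ - z))))) ≡ 1ℤ
    eq₀ = solve-∀
    eq₁ : ∀ j a b y t z → ((1ℤ + j) * z - y) * j + ((y - j * z) * (1ℤ + j) + (- (a * ((1ℤ + j) * z - y) + b * (y - j * z) - (1ℤ + j - j) * (t + 1ℤ * (1ℤ - z))) * 0ℤ
      + (a * ((1ℤ + j) * z - y) + b * (y - j * z) - (1ℤ + j - j) * (t + 0ℤ * (1ℤ - z))) * 0ℤ)) ≡ y
    eq₁ = solve-∀
    eq₂ : ∀ j a b y t z → ((1ℤ + j) * z - y) * a + ((y - j * z) * b + (- (a * ((1ℤ + j) * z - y) + b * (y - j * z) - (1ℤ + j - j) * (t + 1ℤ * (1ℤ - z))) * - 0ℤ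
      + (a * ((1ℤ + j) * z - y) + b * (y - j * z) - (1ℤ + j - j) * (t + 0ℤ * (1ℤ - z))) * - 1ℤ)) ≡ t
    eq₂ = solve-∀
    eq₃ : ∀ j a b y t z → ((1ℤ + j) * z - y) * 1ℤ + ((y - j * z) * 1ℤ + (- (a * ((1ℤ + j) * z - y) + b * (y - j * z) - (1ℤ + j - j) * (t + 1ℤ * (1ℤ - z))) * 0ℤ
      + (a * ((1ℤ + j) * z - y) + b * (y - j * z) - (1ℤ + j - j) * (t + 0ℤ * (1ℤ - z))) * 0ℤ)) ≡ z
    eq₃ = solve-∀

  corner-dual : Dual cornerTet
  corner-dual = record
    { coord = fin4 (λ v → hi 1 v - ch 0 1 1ℤ v) (ch 0 1 1ℤ) (lo 0) colevel
    ; affine = fin4 (aff-- (aff-hi 1) (aff-ch 0 1 1ℤ)) (aff-ch 0 1 1ℤ) (aff-lo 0) aff-colevel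
    ; total = λ { (y , t , z) → eq₀ (τ 0) (τ 1) y t z }
    ; repr = λ { (y , t , z) → Pt-≡ (eq₁ (τ 0) (τ 1) y t z)
        (trans (eq₂ (τ 0) (τ 1) y t z) (trans (cong (λ a → t - a * (a * (1ℤ * z - y) + τ 1 * (y - 0ℤ * z) - (t + 1ℤ * (1ℤ - z)))) τ0) (ℤ.+-identityʳ t)))
        (eq₃ (τ 0) (τ 1) y t z) } }
    where
    eq₀ : ∀ a b y t z → 1ℤ * z - y - (a * (1ℤ * z - y) + b * (y - 0ℤ * z) - (1ℤ - 0ℤ) * (t + 1ℤ * (1ℤ - z)))
      + ((a * (1ℤ * z - y) + b * (y - 0ℤ * z) - (1ℤ - 0ℤ) * (t + 1ℤ * (1ℤ - z))) + (y - 0ℤ * z + (1ℤ - z))) ≡ 1ℤ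
    eq₀ = solve-∀
    eq₁ : ∀ a b y t z → (1ℤ * z - y - (a * (1ℤ * z - y) + b * (y - 0ℤ * z) - (1ℤ - 0ℤ) * (t + 1ℤ * (1ℤ - z)))) * 0ℤ
      + ((a * (1ℤ * z - y) + b * (y - 0ℤ * z) - (1ℤ - 0ℤ) * (t + 1ℤ * (1ℤ - z))) * 0ℤ + ((y - 0ℤ * z) * 1ℤ + (1ℤ - z) * 0ℤ)) ≡ y
    eq₁ = solve-∀
    eq₂ : ∀ a b y t z → (1ℤ * z - y - (a * (1ℤ * z - y) + b * (y - 0ℤ * z) - (1ℤ - 0ℤ) * (t + 1ℤ * (1ℤ - z)))) * a
      + ((a * (1ℤ * z - y) + b * (y - 0ℤ * z) - (1ℤ - 0ℤ) * (t + 1ℤ * (1ℤ - z))) * - 1ℤ + ((y - 0ℤ * z) * b + (1ℤ - z) * - 1ℤ)) ≡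
      t - a * (a * (1ℤ * z - y) + b * (y - 0ℤ * z) - (t + 1ℤ * (1ℤ - z)))
    eq₂ = solve-∀
    eq₃ : ∀ a b y t z → (1ℤ * z - y - (a * (1ℤ * z - y) + b * (y - 0ℤ * z) - (1ℤ - 0ℤ) * (t + 1ℤ * (1ℤ - z)))) * 1ℤ
      + ((a * (1ℤ * z - y) + b * (y - 0ℤ * z) - (1ℤ - 0ℤ) * (t + 1ℤ * (1ℤ - z))) * 1ℤ + ((y - 0ℤ * z) * 1ℤ + (1ℤ - z) * 0ℤ)) ≡ z
    eq₃ = solve-∀

  G-dual : ∀ {α S} → G α S → Dual S
  G-dual {α} (g-tri i) = tri-dual (a₀ α) (inTree-IsTri i)
  G-dual (g-edge _ {j} _) = edge-dual j
  G-dual g-corner = corner-dual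

  HC-dual : ∀ {α β S} → HC α β S → Dual S
  HC-dual (lft g) = G-dual g
  HC-dual (rgt g) = Dual-map ρ-aff ρ-aff ρ-involutive (G-dual g)

-- The simplices cover the half cell

data Facet : Set where
  fX fY fW fU : Facet

module Coverage {r q : ℕ} (chain : Chain r q) where
  open Chain chain
  open Strip chain
  open Path chain
  open HalfCell chain
  open Cells chain
  open Triangulation chain

  private
    tri-rel₁ : ∀ a m b e v → (+ m - + a) * - ch m b e v ≡ d a b m * hi m v + (+ b - + m) * - ch a m e v
    tri-rel₁ a m b e (y , t , z) = eq (+ a) (+ m) (+ b) e (τ a) (τ m) (τ b) y t z
      where
      eq : ∀ a m b e ta tm tb y t z → (m - a) * - (tm * (b * z - y) + tb * (y - m * z) - (b - m) * (t + e * (1ℤ - z))) ≡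
        (ta * (b - m) + tb * (m - a) - (b - a) * tm) * (m * z - y) + (b - m) * - (ta * (m * z - y) + tm * (y - a * z) - (m - a) * (t + e * (1ℤ - z)))
      eq = solve-∀

    tri-rel₂ : ∀ a m b e v → (+ b - + m) * - ch a m e v ≡ d a b m * lo m v + (+ m - + a) * - ch m b e v
    tri-rel₂ a m b e (y , t , z) = eq (+ a) (+ m) (+ b) e (τ a) (τ m) (τ b) y t z
      where
      eq : ∀ a m b e ta tm tb y t z → (b - m) * - (ta * (m * z - y) + tm * (y - a * z) - (m - a) * (t + e * (1ℤ - z))) ≡
        (ta * (b - m) + tb * (m - a) - (b - a) * tm) * (y - m * z) + (m - a) * - (tm * (b * z - y) + tb * (y - m * z) - (b - m) * (t + e * (1ℤ - z)))
      eq = solve-∀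

  level-nonneg : ∀ j → ws ⊩ lo j → ws ⊩ hi (suc j) → ws ⊩ level
  level-nonneg j L H = ⊩-cong (λ { (y , t , z) → eq (+ j) y z }) (⊩-+ L H)
    where
    eq : ∀ j y z → z ≡ y - j * z + ((1ℤ + j) * z - y)
    eq = solve-∀

  hi-mono : ∀ a b → a ℕ.≤ b → ws ⊩ level → ws ⊩ hi a → ws ⊩ hi b
  hi-mono a b p Lv H = ⊩-cong (λ { (y , t , z) → eq (+ a) (+ b) y z }) (⊩-+ H (⊩-* (ℕ≤⇒0≤ p) Lv))
    where
    eq : ∀ a b y z → b * z - y ≡ a * z - y + (b - a) * z
    eq = solve-∀

  lo-mono : ∀ a b → a ℕ.≤ b → ws ⊩ level → ws ⊩ lo b → ws ⊩ lo a
  lo-mono a b p Lv L = ⊩-cong (λ { (y , t , z) → eq (+ a) (+ b) y z }) (⊩-+ L (⊩-* (ℕ≤⇒0≤ p) Lv))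
    where
    eq : ∀ a b y z → y - a * z ≡ y - b * z + (b - a) * z
    eq = solve-∀

  cover-tri : ∀ {a m b} e → IsTri a m b → ws ⊩ (λ v → - ch m b e v) → ws ⊩ ch a b e → ws ⊩ (λ v → - ch a m e v) → ws ⊩ colevel →
    Covers (coneTri e (a , m , b)) ws
  cover-tri e T p₀ p₁ p₂ p₃ = record { dual = tri-dual e T ; nonneg = fin4 p₀ p₁ p₂ p₃ }

  -- Descent: on the near side of both short chords we are in the root triangle.
  cover-tree : ∀ {a b} (t : Tree a b) e j → a ℕ.≤ j → suc j ℕ.≤ b → ws ⊩ lo j → ws ⊩ hi (suc j) → ws ⊩ colevel →
    ws ⊩ (λ v → - ch j (suc j) e v) → ws ⊩ ch a b e →
    (∃ λ T → InTree t T × Covers (coneTri e T) ws) ⊎ (b ≡ suc a)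
  -- A leaf encloses no triangle: its chord is the path edge, and the caller works with the plane
  -- over that edge.
  cover-tree leaf e j p p′ L H c path chord = inj₂ refl
  cover-tree {ws = ws} {a} {b} (node m a<m m<b u cv₁ cv₂ s t) e j p p′ L H c path chord = inj₁ (go (suc j ℕ.≤? m))
    where
    T : IsTri a m b
    T = isTri a<m m<b u cv₁ cv₂
    Lv : ws ⊩ level
    Lv = level-nonneg j L H
    -- Below the plane `y = m z`, the near side of the chord from a to m implies the near side of
    -- the chord from m to b, by `tri-rel₁`.
    low : suc j ℕ.≤ m → ws ⊩ (λ v → - ch a m e v) → ∃ λ T → InTree (node m a<m m<b u cv₁ cv₂ s t) T × Covers (coneTri e T) ws
    low j<m q = (a , m , b) , root , cover-tri e T (⊩-cancel (+ m - + a) (ℕ<⇒0< a<m)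
      (⊩-cong (tri-rel₁ a m b e) (⊩-+ (⊩-* (ℤ.≤-trans (+≤+ z≤n) (ℤ.≤-reflexive (sym u))) (hi-mono (suc j) m j<m Lv H)) (⊩-* (ℕ≤⇒0≤ (ℕ.<⇒≤ m<b)) q)))) chord q c
    high : m ℕ.≤ j → ws ⊩ (λ v → - ch m b e v) → ∃ λ T → InTree (node m a<m m<b u cv₁ cv₂ s t) T × Covers (coneTri e T) ws
    high m≤j q = (a , m , b) , root , cover-tri e T q chord (⊩-cancel (+ b - + m) (ℕ<⇒0< m<b)
      (⊩-cong (tri-rel₂ a m b e) (⊩-+ (⊩-* (ℤ.≤-trans (+≤+ z≤n) (ℤ.≤-reflexive (sym u))) (lo-mono m j m≤j Lv L)) (⊩-* (ℕ≤⇒0≤ (ℕ.<⇒≤ a<m)) q)))) c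
    go : Dec (suc j ℕ.≤ m) → ∃ λ T → InTree (node m a<m m<b u cv₁ cv₂ s t) T × Covers (coneTri e T) ws
    go (yes j<m) with ⊩-total ws (ch a m e)
    ... | inj₂ q = low j<m q
    ... | inj₁ q with cover-tree s e j p j<m L H c path q
    ...   | inj₁ (T , i , C) = T , left i , C
    ...   | inj₂ refl = low j<m (subst (λ k → ws ⊩ (λ v → - ch k (suc k) e v)) (ℕ.≤-antisym (ℕ.≤-pred j<m) p) path)
    go (no j≮m) with ⊩-total ws (ch m b e)
    ... | inj₂ q = high (ℕ.≤-pred (ℕ.≰⇒> j≮m)) q
    ... | inj₁ q with cover-tree t e j (ℕ.≤-pred (ℕ.≰⇒> j≮m)) p′ L H c path q
    ...   | inj₁ (T , i , C) = T , right i , C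
    ...   | inj₂ refl = high (ℕ.≤-pred (ℕ.≰⇒> j≮m)) (subst (λ k → ws ⊩ (λ v → - ch k (suc k) e v)) (ℕ.≤-antisym (ℕ.≤-pred p′) (ℕ.≤-pred (ℕ.≰⇒> j≮m))) path)

  cover-edge : ∀ j → ws ⊩ lo j → ws ⊩ hi (suc j) → ws ⊩ (λ v → - ch j (suc j) 1ℤ v) → ws ⊩ ch j (suc j) 0ℤ → Covers (edgeTet j) ws
  cover-edge j L H p₁ p₀ = record { dual = edge-dual j ; nonneg = fin4 H L p₁ p₀ }

  cover-corner : ws ⊩ (λ v → hi 1 v - ch 0 1 1ℤ v) → ws ⊩ ch 0 1 1ℤ → ws ⊩ lo 0 → ws ⊩ colevel → Covers cornerTet ws
  cover-corner p₀ p₁ p₂ p₃ = record { dual = corner-dual ; nonneg = fin4 p₀ p₁ p₂ p₃ }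

  only-strip : ∀ {n j} → n ≡ 1 → suc j ℕ.≤ n → j ≡ 0
  only-strip refl (s≤s z≤n) = refl

  cover-left : ∀ α j → suc j ℕ.≤ q → ws ⊩ lo j → ws ⊩ hi (suc j) → ws ⊩ colevel → ws ⊩ (λ v → - ch j (suc j) 1ℤ v) → ws ⊩ ch 0 q (a₀ α) →
    ∃ λ S → G α S × Covers S ws
  cover-left {ws = ws} true j j<q L H c path chord with ⊩-total ws (ch j (suc j) 0ℤ)
  ... | inj₁ p = edgeTet j , g-edge refl j<q , cover-edge j L H path p
  ... | inj₂ p with cover-tree tree 0ℤ j z≤n j<q L H c p chord
  ...   | inj₁ (T , i , C) = coneTri 0ℤ T , g-tri i , C
  -- Here q = 1. The initial chord is the only path edge, so the inequality for the chord is the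
  -- missing one for the edge tetrahedron.
  ...   | inj₂ e = edgeTet j , g-edge refl j<q , cover-edge j L H path
            (subst₂ (λ a b → ws ⊩ ch a b 0ℤ) (sym (only-strip e j<q)) (trans e (cong suc (sym (only-strip e j<q)))) chord)
  cover-left {ws = ws} false j j<q L H c path chord with cover-tree tree 1ℤ j z≤n j<q L H c path chord
  ...   | inj₁ (T , i , C) = coneTri 1ℤ T , g-tri i , C
  ...   | inj₂ e = cornerTet , g-corner , cover-corner
            (subst (λ k → ws ⊩ (λ v → hi (suc k) v - ch k (suc k) 1ℤ v)) (only-strip e j<q) (⊩-+ H path))
            (subst (λ k → ws ⊩ ch 0 k 1ℤ) e chord) (subst (λ k → ws ⊩ lo k) (only-strip e j<q) L) c

  private
    cover-reflected : ∀ {S} → Covers S (pushforward ρ ws) → Covers (reflect S) ws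
    cover-reflected = Covers-map ρ-aff ρ-aff ρ-involutive

  -- The point is left of the path, or left of it after the half turn, or between the path and the
  -- mirrored path. The last region has interior only in the first and the last strip, where the
  -- corners fill it.
  cover-strip : ∀ α β j → suc j ℕ.≤ q → ws ⊩ lo j → ws ⊩ hi (suc j) → ws ⊩ colevel → ws ⊩ ch 0 q (a₀ α) → ws ⊩ (λ v → ch 0 q (a₀ β) (ρ v)) →
    ∃ λ S → HC α β S × Covers S ws
  cover-strip {ws = ws} α β j j<q L H c chordL chordR with ⊩-total ws (ch j (suc j) 1ℤ)
  ... | inj₂ path = wrapL (cover-left α j j<q L H c path chordL)
    where
    wrapL : (∃ λ S → G α S × Covers S ws) → ∃ λ S → HC α β S × Covers S ws
    wrapL (S , g , C) = S , lft g , C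
  ... | inj₁ path with ⊩-total ws (λ v → ch (q ℕ.∸ suc j) (suc (q ℕ.∸ suc j)) 1ℤ (ρ v))
  ...   | inj₂ path′ = wrapR (cover-left β j′ j′<q (⊩-map ρ (⊩-cong (lo-ρ j′ (suc j) s₁) H)) (⊩-map ρ (⊩-cong (hi-ρ (suc j′) j s₂) L)) (⊩-map ρ c) (⊩-map ρ path′) (⊩-map ρ chordR))
    where
    j′ = q ℕ.∸ suc j
    s : suc j ℕ.+ j′ ≡ q
    s = ℕ.m+[n∸m]≡n j<q
    s₁ : j′ ℕ.+ suc j ≡ q
    s₁ = trans (ℕ.+-comm j′ (suc j)) s
    s₂ : suc j′ ℕ.+ j ≡ q
    s₂ = trans (cong suc (ℕ.+-comm j′ j)) s
    j′<q : suc j′ ℕ.≤ q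
    j′<q = subst (suc j′ ℕ.≤_) s₂ (ℕ.m≤m+n (suc j′) j)
    wrapR : (∃ λ S → G β S × Covers S (pushforward ρ ws)) → ∃ λ S → HC α β S × Covers S ws
    wrapR (S , g , C) = reflect S , rgt g , cover-reflected C
  ...   | inj₁ path′ = between j (q ℕ.∸ suc j) (ℕ.m+[n∸m]≡n j<q) L H path path′
    where
    Lv : ws ⊩ level
    Lv = level-nonneg j L H
    δ-end : δ 0 q ≡ 1ℤ
    δ-end = trans (cong₂ (λ s u → s + u + 1ℤ - + r) τ0 τq) (eq (+ r))
      where
      eq : ∀ r → 0ℤ + r + 1ℤ - r ≡ 1ℤ
      eq = solve-∀
    δ-start : δ q 0 ≡ 1ℤ
    δ-start = trans (cong₂ (λ s u → s + u + 1ℤ - + r) τq τ0) (eq (+ r))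
      where
      eq : ∀ r → r + 0ℤ + 1ℤ - r ≡ 1ℤ
      eq = solve-∀
    done : ∀ {S} → HC α β S → Covers S ws → ∃ λ S → HC α β S × Covers S ws
    done {S} h C = S , h , C
    between : ∀ j j′ → suc j ℕ.+ j′ ≡ q → ws ⊩ lo j → ws ⊩ hi (suc j) → ws ⊩ ch j (suc j) 1ℤ → ws ⊩ (λ v → ch j′ (suc j′) 1ℤ (ρ v)) →
      ∃ λ S → HC α β S × Covers S ws
    -- In an inner strip both defects vanish, the two planes coincide, and the point lies on this
    -- plane, hence also on the left.
    between (suc j) (suc j′) s L H path path′ = wrap (cover-left α (suc j) j<q′ L H c (⊩-cong rel path′) chordL)
      where
      j<q′ : suc (suc j) ℕ.≤ q
      j<q′ = subst (suc (suc j) ℕ.≤_) s (ℕ.m≤m+n (suc (suc j)) (suc j′))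
      wrap : (∃ λ S → G α S × Covers S ws) → ∃ λ S → HC α β S × Covers S ws
      wrap (S , g , C) = S , lft g , C
      eq : ∀ K a b → - (- K + (0ℤ * a + 0ℤ * b)) ≡ K
      eq = solve-∀
      rel : ∀ v → - ch (suc j) (suc (suc j)) 1ℤ v ≡ ch (suc j′) (suc (suc j′)) 1ℤ (ρ v)
      rel v = trans (cong -_ (ch-ρ (suc j) (suc j′) 1ℤ s v))
        (trans (cong₂ (λ x y → - (- ch (suc j′) (suc (suc j′)) 1ℤ (ρ v) + (x * hi (suc (suc j)) v + y * lo (suc j) v)))
            (δ-interior (suc j) (suc (suc j′)) (s≤s z≤n) (s≤s z≤n) (trans (ℕ.+-suc (suc j) (suc j′)) s))
            (δ-interior (suc (suc j)) (suc j′) (s≤s z≤n) (s≤s z≤n) s))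
          (eq (ch (suc j′) (suc (suc j′)) 1ℤ (ρ v)) (hi (suc (suc j)) v) (lo (suc j) v)))
    between zero (suc j′) s L H path path′ = done (lft g-corner) (cover-corner (⊩-cong rel path′) path L c)
      where
      eq : ∀ K a b → a - (- K + (1ℤ * a + 0ℤ * b)) ≡ K
      eq = solve-∀
      rel : ∀ v → hi 1 v - ch 0 1 1ℤ v ≡ ch (suc j′) (suc (suc j′)) 1ℤ (ρ v)
      rel v = trans (cong (λ z → hi 1 v - z) (ch-ρ 0 (suc j′) 1ℤ s v))
        (trans (cong₂ (λ x y → hi 1 v - (- ch (suc j′) (suc (suc j′)) 1ℤ (ρ v) + (x * hi 1 v + y * lo 0 v)))
            (trans (cong (δ 0) s) δ-end) (δ-interior 1 (suc j′) (s≤s z≤n) (s≤s z≤n) s))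
          (eq (ch (suc j′) (suc (suc j′)) 1ℤ (ρ v)) (hi 1 v) (lo 0 v)))
    between (suc j) zero s L H path path′ = done (rgt g-corner) (cover-reflected (cover-corner (⊩-map ρ (⊩-cong rel path)) (⊩-map ρ path′)
        (⊩-map ρ (⊩-cong (lo-ρ 0 q refl) (subst (λ k → ws ⊩ hi k) s′ H))) (⊩-map ρ c)))
      where
      s′ : suc (suc j) ≡ q
      s′ = trans (sym (ℕ.+-identityʳ (suc (suc j)))) s
      eq : ∀ K b a → b - K ≡ - K + (0ℤ * a + 1ℤ * b)
      eq = solve-∀
      rel : ∀ v → hi 1 (ρ v) - ch 0 1 1ℤ (ρ v) ≡ ch (suc j) (suc (suc j)) 1ℤ v
      rel v = trans (cong (λ z → z - ch 0 1 1ℤ (ρ v)) (hi-ρ 1 (suc j) s′ v)) (trans (eq (ch 0 1 1ℤ (ρ v)) (lo (suc j) v) (hi (suc (suc j)) v))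
        (sym (trans (ch-ρ (suc j) 0 1ℤ s v) (cong₂ (λ x y → - ch 0 1 1ℤ (ρ v) + (x * hi (suc (suc j)) v + y * lo (suc j) v))
            (δ-interior (suc j) 1 (s≤s z≤n) (s≤s z≤n) (trans (ℕ.+-comm (suc j) 1) s′)) (trans (cong (λ k → δ k 0) s′) δ-start)))))
    -- For q = 1 the plane through the diagonal and `ap 1` decides between the corners.
    between zero zero s L H path path′ with ⊩-total ws (λ v → hi 1 v - ch 0 1 1ℤ v)
    ... | inj₁ p = done (lft g-corner) (cover-corner p path L c)
    ... | inj₂ p = done (rgt g-corner) (cover-reflected (cover-corner (⊩-map ρ (⊩-cong rel p)) (⊩-map ρ path′)
        (⊩-map ρ (⊩-cong (lo-ρ 0 1 s) H)) (⊩-map ρ c)))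
      where
      eq : ∀ K b a → b - K ≡ - (a - (- K + (1ℤ * a + 1ℤ * b)))
      eq = solve-∀
      rel : ∀ v → hi 1 (ρ v) - ch 0 1 1ℤ (ρ v) ≡ - (hi 1 v - ch 0 1 1ℤ v)
      rel v = trans (cong (λ z → z - ch 0 1 1ℤ (ρ v)) (hi-ρ 1 0 s v)) (trans (eq (ch 0 1 1ℤ (ρ v)) (lo 0 v) (hi 1 v))
        (sym (cong (λ z → - (hi 1 v - z)) (trans (ch-ρ 0 0 1ℤ s v) (cong₂ (λ x y → - ch 0 1 1ℤ (ρ v) + (x * hi 1 v + y * lo 0 v))
            (trans (cong (δ 0) s) δ-end) (trans (cong (λ k → δ k 0) s) δ-start))))))

  cover-HC : ∀ α β → ws ⊩ lo 0 → ws ⊩ hi q → ws ⊩ colevel → ws ⊩ ch 0 q (a₀ α) → ws ⊩ (λ v → ch 0 q (a₀ β) (ρ v)) →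
    ∃ λ S → HC α β S × Covers S ws
  cover-HC {ws = ws} α β L H c chordL chordR = go (loc q q>0 H)
    where
    loc : ∀ q′ → 0 ℕ.< q′ → ws ⊩ hi q′ → ∃ λ j → suc j ℕ.≤ q′ × ws ⊩ lo j × ws ⊩ hi (suc j)
    loc (suc n) _ h = locate n L h
    go : (∃ λ j → suc j ℕ.≤ q × ws ⊩ lo j × ws ⊩ hi (suc j)) → ∃ λ S → HC α β S × Covers S ws
    go (j , j<q , L , H) = cover-strip α β j j<q L H c chordL chordR

  X : Pt → ℤ
  X (y , t , z) = + r * y - + q * t

  -- X, Y, w and X + z of the overview, multiplied by q to be integral on the lattice.
  form : Facet → Pt → ℤ
  form fX v = X v
  form fY (y , t , z) = y
  form fW v = hi q v
  form fU v = X v + + q * level v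

  aff-X : Aff X
  aff-X = aff-- (aff-* (+ r) aff-1) (aff-* (+ q) aff-2)

  aff-form : ∀ f → Aff (form f)
  aff-form fX = aff-X
  aff-form fY = aff-1
  aff-form fW = aff-hi q
  aff-form fU = aff-+ aff-X (aff-* (+ q) aff-3)

  ch-X : ∀ e v → ch 0 q e v ≡ X v - + q * (e * (1ℤ - level v))
  ch-X e (y , t , z) = trans (cong₂ (λ a b → a * (+ q * z - y) + b * (y - 0ℤ * z) - (+ q - 0ℤ) * (t + e * (1ℤ - z))) τ0 τq) (eq (+ r) (+ q) e y t z)
    where
    eq : ∀ r q e y t z → 0ℤ * (q * z - y) + r * (y - 0ℤ * z) - (q - 0ℤ) * (t + e * (1ℤ - z)) ≡ r * y - q * t - q * (e * (1ℤ - z))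
    eq = solve-∀

  X-ρ : ∀ v → X (ρ v) ≡ + q * + 2 - (X v + + q * level v)
  X-ρ (y , t , z) = eq (+ r) (+ q) y t z
    where
    eq : ∀ r q y t z → r * (q * z - y) - q * ((r + 1ℤ) * z - t - + 2) ≡ q * + 2 - (r * y - q * t + q * z)
    eq = solve-∀

  U-ρ : ∀ v → X (ρ v) + + q * level v ≡ + q * + 2 - X v
  U-ρ v = trans (cong (_+ + q * level v) (X-ρ v)) (eq (+ q * + 2) (X v) (+ q * level v))
    where
    eq : ∀ a b c → a - (b + c) + c ≡ a - b
    eq = solve-∀

  -- `X≤1` fails at `ap 2` and `U≥1` at `ap 0`, so each requires that the bottom segment stops at
  -- `ap 1` on that side. Under the point reflection of the upper half, `U≥1` turns into the
  -- truncation by the fourth facet.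
  record Bounds (α β : Bool) (v : Pt) : Set where
    field
      y≥0   : 0ℤ ≤ form fY v
      w≥0   : 0ℤ ≤ form fW v
      z≤1   : 0ℤ ≤ colevel v
      X≥0   : 0ℤ ≤ X v
      U≤2   : 0ℤ ≤ + q * + 2 - form fU v
      X≤1   : β ≡ false → 0ℤ ≤ + q - X v
      U≥1   : α ≡ false → 0ℤ ≤ form fU v - + q

  private
    X-ap : ∀ e → X (ap e) ≡ + q * e
    X-ap e = eq (+ r) (+ q) e
      where
      eq : ∀ r q e → r * 0ℤ - q * - e ≡ q * e
      eq = solve-∀
    X-r0 : X r0 ≡ + q
    X-r0 = eq (+ r) (+ q)
      where
      eq : ∀ r q → r * 0ℤ - q * - 1ℤ ≡ q
      eq = solve-∀

  record VBounds (α : Bool) (v : Pt) : Set where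
    constructor vb
    field
      vX≥0  : 0ℤ ≤ X v
      vX≤1  : 0ℤ ≤ + q - X v
      vU≤2  : 0ℤ ≤ + q * + 2 - form fU v
      vleft : α ≡ false → 0ℤ ≤ form fU v - + q
  open VBounds

  vtx-bounds : ∀ {α v} → Vtx α v → VBounds α v
  vtx-bounds (v-path i _) = vb (x≥0 i) up (0≤-resp (eq₁ (+ q) (x i)) up) (λ _ → 0≤-resp (eq₂ (+ q) (x i)) (x≥0 i))
    where
    up = ℤ.<⇒≤ (<⇒0< (x<q i))
    eq₁ : ∀ q x → q * + 2 - (x + q * 1ℤ) ≡ q - x
    eq₁ = solve-∀
    eq₂ : ∀ q x → x + q * 1ℤ - q ≡ x
    eq₂ = solve-∀
  vtx-bounds v-r0 = vb (0≤-resp X-r0 (0≤+ᴺ q)) (0≤-resp (trans (cong (λ z → + q - z) X-r0) (ℤ.+-inverseʳ (+ q))) ℤ.≤-refl)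
      (0≤-resp (trans (cong (λ z → + q * + 2 - (z + + q * 1ℤ)) X-r0) (eq₁ (+ q))) ℤ.≤-refl)
      (λ _ → 0≤-resp (trans (cong (λ z → z + + q * 1ℤ - + q) X-r0) (eq₂ (+ q))) (0≤+ᴺ q))
    where
    eq₁ : ∀ q → q * + 2 - (q + q * 1ℤ) ≡ 0ℤ
    eq₁ = solve-∀
    eq₂ : ∀ q → q + q * 1ℤ - q ≡ q
    eq₂ = solve-∀
  vtx-bounds (v-ap₀ refl) = vb (0≤-resp (trans (X-ap 0ℤ) (ℤ.*-zeroʳ (+ q))) ℤ.≤-refl) (0≤-resp (trans (cong (λ z → + q - z) (X-ap 0ℤ)) (eq₀ (+ q))) (0≤+ᴺ q))
      (0≤-resp (trans (cong (λ z → + q * + 2 - (z + + q * 0ℤ)) (X-ap 0ℤ)) (eq₁ (+ q))) (0≤* (0≤+ᴺ q) (+≤+ z≤n))) (λ ())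
    where
    eq₀ : ∀ q → q - q * 0ℤ ≡ q
    eq₀ = solve-∀
    eq₁ : ∀ q → q * + 2 - (q * 0ℤ + q * 0ℤ) ≡ q * + 2
    eq₁ = solve-∀
  vtx-bounds v-ap₁ = vb (0≤-resp (X-ap 1ℤ) (0≤* (0≤+ᴺ q) (+≤+ z≤n))) (0≤-resp (trans (cong (λ z → + q - z) (X-ap 1ℤ)) (eq₀ (+ q))) ℤ.≤-refl)
      (0≤-resp (trans (cong (λ z → + q * + 2 - (z + + q * 0ℤ)) (X-ap 1ℤ)) (eq₁ (+ q))) (0≤+ᴺ q))
      (λ _ → 0≤-resp (trans (cong (λ z → z + + q * 0ℤ - + q) (X-ap 1ℤ)) (eq₂ (+ q))) ℤ.≤-refl)
    where
    eq₀ : ∀ q → q - q * 1ℤ ≡ 0ℤ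
    eq₀ = solve-∀
    eq₁ : ∀ q → q * + 2 - (q * 1ℤ + q * 0ℤ) ≡ q
    eq₁ = solve-∀
    eq₂ : ∀ q → q * 1ℤ + q * 0ℤ - q ≡ 0ℤ
    eq₂ = solve-∀

  lo0 : ∀ v → form fY v ≡ lo 0 v
  lo0 (y , t , z) = eq y z
    where
    eq : ∀ y z → y ≡ y - 0ℤ * z
    eq = solve-∀

  W-ρ : ∀ v → form fW (ρ v) ≡ form fY v
  W-ρ v = trans (hi-ρ q 0 (ℕ.+-identityʳ q) v) (sym (lo0 v))

  HC-bounds : ∀ {α β S} → HC α β S → ∀ v → Vert S v → Bounds α β v
  HC-bounds (lft g) v z = record
    { y≥0 = 0≤-resp (lo0 v) (vtx-lo vx) ; w≥0 = vtx-hi vx ; z≤1 = vtx-colevel vx ; X≥0 = vX≥0 b ; U≤2 = vU≤2 b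
    ; X≤1 = λ _ → vX≤1 b ; U≥1 = vleft b }
    where
    vx = G-vtx g v z
    b = vtx-bounds vx
  HC-bounds (rgt {S} g) v (i , refl) = record
    { y≥0 = vtx-hi vx ; w≥0 = 0≤-resp (trans (W-ρ u) (lo0 u)) (vtx-lo vx) ; z≤1 = vtx-colevel vx
    ; X≥0 = 0≤-resp (X-ρ u) (vU≤2 b)
    ; U≤2 = 0≤-resp (trans (cong (λ z → + q * + 2 - z) (U-ρ u)) (eq₁ (+ q * + 2) (X u))) (vX≥0 b)
    ; X≤1 = λ e → 0≤-resp (trans (cong (λ z → + q - z) (X-ρ u)) (eq₂ (+ q) (form fU u))) (vleft b e)
    ; U≥1 = λ _ → 0≤-resp (trans (cong (λ z → z - + q) (U-ρ u)) (eq₃ (+ q) (X u))) (vX≤1 b) }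
    where
    u = S i
    vx = G-vtx g u (i , refl)
    b = vtx-bounds vx
    eq₁ : ∀ a x → a - (a - x) ≡ x
    eq₁ = solve-∀
    eq₂ : ∀ q x → q - (q * + 2 - x) ≡ x - q
    eq₂ = solve-∀
    eq₃ : ∀ q x → q * + 2 - x - q ≡ q - x
    eq₃ = solve-∀

+-cancelˡ : ∀ a {b c} → a + b ≡ a + c → b ≡ c
+-cancelˡ a {b} {c} e = trans (eq a b) (trans (cong (λ s → - a + s) e) (sym (eq a c)))
  where
  eq : ∀ a b → b ≡ - a + (a + b)
  eq = solve-∀

+-cancelʳ : ∀ a {b c} → b + a ≡ c + a → b ≡ c
+-cancelʳ a {b} {c} e = +-cancelˡ a (trans (ℤ.+-comm a b) (trans e (ℤ.+-comm c a)))

hex? : ∀ a b → Dec (Hex a b)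
hex? a b = map′ (λ { (p , p′ , s , z) → hex p p′ s z }) (λ { (hex p p′ s z) → p , p′ , s , z })
  ((a ℤ.≤? 1ℤ) ×-dec ((b ℤ.≤? 1ℤ) ×-dec ((a + b ℤ.≤? 1ℤ) ×-dec ((a ℤ.≟ 0ℤ) ⊎-dec ((b ℤ.≟ 0ℤ) ⊎-dec (a + b ℤ.≟ 0ℤ))))))

-- the unit tetrahedron in corner coordinates (x / q , y / q , z)
κ : Fin 4 → Pt
κ = tet (0ℤ , 0ℤ , 0ℤ) (1ℤ , 0ℤ , 0ℤ) (0ℤ , 0ℤ , 1ℤ) (0ℤ , 1ℤ , 1ℤ)

-- Standardness in planes parallel to the facets

module Facets {r q : ℕ} (chain : Chain r q) where
  open Chain chain
  open Strip chain
  open Path chain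
  open HalfCell chain
  open Cells chain
  open Triangulation chain
  open Coverage chain

  -- The sublattice of index q formed by the corners of the unit cells, in coordinates (X , Y , z).
  η : Pt → Pt
  η (a , b , c) = + q * b , + r * b - a , c

  -- u - v is 0 or an edge vector of the unit tetrahedron
  record StdDir (u v : Pt) : Set where
    constructor std
    field
      to from  : Fin 4
      parallel : u +Z η (κ to) ≡ v +Z η (κ from)

  +Z-comm : ∀ u v → u +Z v ≡ v +Z u
  +Z-comm (a , b , c) (a′ , b′ , c′) = Pt-≡ (ℤ.+-comm a a′) (ℤ.+-comm b b′) (ℤ.+-comm c c′)

  +Z-assoc : ∀ u v w → (u +Z v) +Z w ≡ u +Z (v +Z w)
  +Z-assoc (a , b , c) (a′ , b′ , c′) (a″ , b″ , c″) = Pt-≡ (ℤ.+-assoc a a′ a″) (ℤ.+-assoc b b′ b″) (ℤ.+-assoc c c′ c″)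

  StdDir-refl : ∀ {u v} → u ≡ v → StdDir u v
  StdDir-refl refl = std i0 i0 refl

  StdDir-sym : ∀ {u v} → StdDir u v → StdDir v u
  StdDir-sym (std i j e) = std j i (sym e)

  StdDir-κ : ∀ i j → StdDir (η (κ i)) (η (κ j))
  StdDir-κ i j = std j i (+Z-comm (η (κ i)) (η (κ j)))

  StdDir-shift : ∀ o {u v} → StdDir u v → StdDir (o +Z u) (o +Z v)
  StdDir-shift o {u} {v} (std i j e) = std i j (trans (+Z-assoc o u (η (κ i))) (trans (cong (o +Z_) e) (sym (+Z-assoc o v (η (κ j))))))

  private
    neg-move : ∀ o u v a b → u + a ≡ v + b → o - u + b ≡ o - v + a
    neg-move o u v a b e = trans (eq₁ o u a b) (trans (cong (λ s → o - s + (a + b)) e) (eq₂ o v a b))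
      where
      eq₁ : ∀ o u a b → o - u + b ≡ o - (u + a) + (a + b)
      eq₁ = solve-∀
      eq₂ : ∀ o v a b → o - (v + b) + (a + b) ≡ o - v + a
      eq₂ = solve-∀

  StdDir-neg : ∀ o {u v} → StdDir u v → StdDir (o -Z u) (o -Z v)
  StdDir-neg (o₁ , o₂ , o₃) {u₁ , u₂ , u₃} {v₁ , v₂ , v₃} (std i j e) = std j i (Pt-≡
    (neg-move o₁ u₁ v₁ _ _ (cong proj₁ e)) (neg-move o₂ u₂ v₂ _ _ (cong pr₂ e)) (neg-move o₃ u₃ v₃ _ _ (cong pr₃ e)))

  σ : Fin 4 → Fin 4
  σ = fin4 i1 i0 i3 i2

  private
    κ-σ : ∀ i → proj₁ (κ (σ i)) ≡ 1ℤ - proj₂ (proj₂ (κ i)) - proj₁ (κ i) × proj₁ (proj₂ (κ (σ i))) ≡ proj₂ (proj₂ (κ i)) - proj₁ (proj₂ (κ i)) × proj₂ (proj₂ (κ (σ i))) ≡ proj₂ (proj₂ (κ i))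
    κ-σ = fin4 (refl , refl , refl) (refl , refl , refl) (refl , refl , refl) (refl , refl , refl)

    ησ : ∀ i → η (κ (σ i)) ≡ (+ q * (proj₂ (proj₂ (κ i)) - proj₁ (proj₂ (κ i))) , + r * (proj₂ (proj₂ (κ i)) - proj₁ (proj₂ (κ i))) - (1ℤ - proj₂ (proj₂ (κ i)) - proj₁ (κ i)) , proj₂ (proj₂ (κ i)))
    ησ i with κ-σ i
    ... | e₁ , e₂ , e₃ = Pt-≡ (cong (+ q *_) e₂) (cong₂ (λ a b → + r * a - b) e₂ e₁) e₃

  StdDir-ρ : ∀ {u v} → StdDir u v → StdDir (ρ u) (ρ v)
  StdDir-ρ {u₁ , u₂ , u₃} {v₁ , v₂ , v₃} (std i j e) = std (σ i) (σ j) (trans (cong (ρ (u₁ , u₂ , u₃) +Z_) (ησ i)) (trans (Pt-≡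
      (trans (eq₁ (+ q) u₁ u₃ (proj₁ (proj₂ (κ i))) (proj₂ (proj₂ (κ i)))) (trans (cong₂ (λ a b → + q * a - b) E₃ E₁) (sym (eq₁ (+ q) v₁ v₃ (proj₁ (proj₂ (κ j))) (proj₂ (proj₂ (κ j)))))))
      (trans (eq₂ (+ r) u₂ u₃ (proj₁ (κ i)) (proj₁ (proj₂ (κ i))) (proj₂ (proj₂ (κ i)))) (trans (cong₂ (λ a b → (+ r + 1ℤ) * a - b - + 3) E₃ E₂) (sym (eq₂ (+ r) v₂ v₃ (proj₁ (κ j)) (proj₁ (proj₂ (κ j))) (proj₂ (proj₂ (κ j)))))))
      E₃) (sym (cong (ρ (v₁ , v₂ , v₃) +Z_) (ησ j)))))
    where
    E₁ = cong proj₁ e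
    E₂ = cong pr₂ e
    E₃ = cong pr₃ e
    eq₁ : ∀ q u₁ u₃ b c → q * u₃ - u₁ + q * (c - b) ≡ q * (u₃ + c) - (u₁ + q * b)
    eq₁ = solve-∀
    eq₂ : ∀ r u₂ u₃ a b c → (r + 1ℤ) * u₃ - u₂ - + 2 + (r * (c - b) - (1ℤ - c - a)) ≡ (r + 1ℤ) * (u₃ + c) - (u₂ + (r * b - a)) - + 3
    eq₂ = solve-∀

  -- All planes at integral height are included, so that one property serves the cutting planes and
  -- the boundary of the tetrahedron.
  FacetStd : (Fin 4 → Pt) → Set
  FacetStd S = ∀ f c u v → Vert S u → Vert S v → form f u ≡ + q * c → form f v ≡ + q * c → StdDir u v

  private
    no-interior : ∀ n c → 0ℤ < n → 0ℤ < + q - n → n ≡ + q * c → ⊥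
    no-interior n c p p′ refl with small-multiple (+ q) c 0<q (ℤ.<⇒≤ p) p′
    ... | refl = ℤ.<-irrefl (sym (ℤ.*-zeroʳ (+ q))) p

    -- At an inner path point neither x nor y is divisible by q, so every facet form lies strictly
    -- between consecutive multiples of q.
    chain-end : ∀ f c i → i ℕ.≤ q → form f (l i) ≡ + q * c → i ≡ 0 ⊎ i ≡ q
    chain-end f c i i≤q e with i ℕ.≟ 0 | i ℕ.≟ q
    ... | yes z | _ = inj₁ z
    ... | no _ | yes z = inj₂ z
    ... | no i≢0 | no i≢q = ⊥-elim (interior f c e)
      where
      0<i = ℕ.n≢0⇒n>0 i≢0
      i<q = ℕ.≤∧≢⇒< i≤q i≢q
      interior : ∀ f c → form f (l i) ≡ + q * c → ⊥
      interior fX c e = no-interior (x i) c (x>0 i 0<i i<q) (<⇒0< (x<q i)) e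
      interior fY c e = no-interior (+ i) c (+<+ 0<i) (ℕ<⇒0< i<q) e
      interior fW c e = no-interior (+ q - + i) c (ℕ<⇒0< i<q) (0<-resp (eq (+ q) (+ i)) (+<+ 0<i)) (trans (sym (hi-l q i)) e)
        where
        eq : ∀ q i → q - (q - i) ≡ i
        eq = solve-∀
      interior fU c e = no-interior (x i) (c - 1ℤ) (x>0 i 0<i i<q) (<⇒0< (x<q i)) (trans (eq₁ (x i) (+ q)) (trans (cong (λ z → z - + q) e) (eq₂ (+ q) c)))
        where
        eq₁ : ∀ x q → x ≡ x + q * 1ℤ - q
        eq₁ = solve-∀
        eq₂ : ∀ q c → q * c - q ≡ q * (c - 1ℤ)
        eq₂ = solve-∀

    l0-κ : l 0 ≡ η (κ i2)
    l0-κ = Pt-≡ (sym (ℤ.*-zeroʳ (+ q))) (trans τ0 (sym (trans (ℤ.+-identityʳ (+ r * 0ℤ)) (ℤ.*-zeroʳ (+ r))))) refl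

    lq-κ : l q ≡ η (κ i3)
    lq-κ = Pt-≡ (sym (ℤ.*-identityʳ (+ q))) (trans τq (sym (trans (ℤ.+-identityʳ (+ r * 1ℤ)) (ℤ.*-identityʳ (+ r))))) refl

    ap0-κ : ap 0ℤ ≡ η (κ i0)
    ap0-κ = Pt-≡ (sym (ℤ.*-zeroʳ (+ q))) (sym (trans (ℤ.+-identityʳ (+ r * 0ℤ)) (ℤ.*-zeroʳ (+ r)))) refl

    ap1-κ : ap 1ℤ ≡ η (κ i1)
    ap1-κ = Pt-≡ (sym (ℤ.*-zeroʳ (+ q))) (sym (cong (λ z → z - 1ℤ) (ℤ.*-zeroʳ (+ r)))) refl

    IsCorner : Pt → Set
    IsCorner v = ∃ λ i → v ≡ η (κ i)

    chain-corner : ∀ f c i → i ℕ.≤ q → form f (l i) ≡ + q * c → IsCorner (l i)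
    chain-corner f c i p e with chain-end f c i p e
    ... | inj₁ refl = i2 , l0-κ
    ... | inj₂ refl = i3 , lq-κ

    ap-corner : ∀ α → IsCorner (ap (a₀ α))
    ap-corner true  = i0 , ap0-κ
    ap-corner false = i1 , ap1-κ

    corners-std : ∀ {u v} → IsCorner u → IsCorner v → StdDir u v
    corners-std (i , refl) (j , refl) = StdDir-κ i j

    tri-corner : ∀ {α T} → InTree tree T → ∀ f c v → Vert (coneTri (a₀ α) T) v → form f v ≡ + q * c → IsCorner v
    tri-corner {α} i f c v z e with inTree-chain i v z
    ... | pt k _ p = chain-corner f c k p e
    ... | top      = ap-corner α

    edge-corner : ∀ {i} → i ℕ.< q → ∀ f c v → Vert (edgeTet i) v → form f v ≡ + q * c → IsCorner v
    edge-corner p f c v at0 e = chain-corner f c _ (ℕ.<⇒≤ p) e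
    edge-corner p f c v at1 e = chain-corner f c _ p e
    edge-corner p f c v at2 e = i0 , ap0-κ
    edge-corner p f c v at3 e = i1 , ap1-κ

    r0-l0 : StdDir r0 (l 0)
    r0-l0 = std i0 i1 (Pt-≡ refl (trans (eq₁ (+ r)) (cong (λ z → z + (+ r * 0ℤ - 1ℤ)) (sym τ0))) refl)
      where
      eq₁ : ∀ r → - 1ℤ + (r * 0ℤ - 0ℤ) ≡ 0ℤ + (r * 0ℤ - 1ℤ)
      eq₁ = solve-∀

    r0-ap1 : StdDir r0 (ap 1ℤ)
    r0-ap1 = std i0 i2 (Pt-≡ refl refl refl)

    -- This diagonal of the square is not a standard direction. It is an edge of `cornerTet` when q
    -- = 1, but no plane parallel to a facet contains both of its ends.
    r0≢lq : ∀ f → ¬ (form f r0 ≡ form f (l q))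
    r0≢lq f e = ℤ.<-irrefl (sym (diff f e)) 0<q
      where
      xq : x q ≡ 0ℤ
      xq = trans (cong (λ t → + r * + q - + q * t) τq) (eq (+ r) (+ q))
        where
        eq : ∀ r q → r * q - q * r ≡ 0ℤ
        eq = solve-∀
      diff : ∀ f → form f r0 ≡ form f (l q) → + q ≡ 0ℤ
      diff fX e = trans (eq (+ r) (+ q)) (trans e xq)
        where
        eq : ∀ r q → q ≡ r * 0ℤ - q * - 1ℤ
        eq = solve-∀
      diff fY e = sym e
      diff fW e = trans (eq (+ q)) (trans e (trans (hi-l q q) (ℤ.+-inverseʳ (+ q))))
        where
        eq : ∀ q → q ≡ q * 1ℤ - 0ℤ
        eq = solve-∀
      diff fU e = trans (eq (+ r) (+ q)) (trans (cong (λ z → z - + q * 1ℤ) e) (trans (eq₂ (x q) (+ q)) xq))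
        where
        eq : ∀ r q → q ≡ r * 0ℤ - q * - 1ℤ + q * 1ℤ - q * 1ℤ
        eq = solve-∀
        eq₂ : ∀ x q → x + q * 1ℤ - q * 1ℤ ≡ x
        eq₂ = solve-∀

    corner-kind : ∀ f c v → Vert cornerTet v → form f v ≡ + q * c → (IsCorner v × StdDir r0 v) ⊎ v ≡ r0 ⊎ v ≡ l q
    corner-kind f c v at0 e = inj₁ ((i2 , l0-κ) , r0-l0)
    corner-kind f c v at1 e = inj₂ (inj₁ refl)
    corner-kind f c v at2 e with chain-end f c 1 q>0 e
    ... | inj₂ z = inj₂ (inj₂ (cong l z))
    corner-kind f c v at3 e = inj₁ ((i1 , ap1-κ) , r0-ap1)

  G-FacetStd : ∀ {α S} → G α S → FacetStd S
  G-FacetStd {α} (g-tri i) f c u v zu zv eu ev = corners-std (tri-corner {α} i f c u zu eu) (tri-corner {α} i f c v zv ev)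
  G-FacetStd (g-edge _ p) f c u v zu zv eu ev = corners-std (edge-corner p f c u zu eu) (edge-corner p f c v zv ev)
  G-FacetStd g-corner f c u v zu zv eu ev with corner-kind f c u zu eu | corner-kind f c v zv ev
  ... | inj₁ (cu , su) | inj₁ (cv , sv) = corners-std cu cv
  ... | inj₁ (cu , su) | inj₂ (inj₁ refl) = StdDir-sym su
  ... | inj₁ (cu , su) | inj₂ (inj₂ refl) = corners-std cu (i3 , lq-κ)
  ... | inj₂ (inj₁ refl) | inj₁ (cv , sv) = sv
  ... | inj₂ (inj₁ refl) | inj₂ (inj₁ refl) = StdDir-refl refl
  ... | inj₂ (inj₁ refl) | inj₂ (inj₂ refl) = ⊥-elim (r0≢lq f (trans eu (sym ev)))
  ... | inj₂ (inj₂ refl) | inj₁ (cv , sv) = corners-std (i3 , lq-κ) cv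
  ... | inj₂ (inj₂ refl) | inj₂ (inj₁ refl) = ⊥-elim (r0≢lq f (trans ev (sym eu)))
  ... | inj₂ (inj₂ refl) | inj₂ (inj₂ refl) = StdDir-refl refl

  private
    mirror-facet : Facet → Facet
    mirror-facet fX = fU
    mirror-facet fY = fW
    mirror-facet fW = fY
    mirror-facet fU = fX

    mirror-value : Facet → ℤ → ℤ
    mirror-value fX c = + 2 - c
    mirror-value fY c = c
    mirror-value fW c = c
    mirror-value fU c = + 2 - c

    mirror-eq : ∀ f c u → form f (ρ u) ≡ + q * c → form (mirror-facet f) u ≡ + q * mirror-value f c
    mirror-eq fX c u e = solve₁ (+ q) c (form fU u) (trans (sym (X-ρ u)) e)
      where
      solve₁ : ∀ q c a → q * + 2 - a ≡ q * c → a ≡ q * (+ 2 - c)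
      solve₁ q c a e = trans (eq q a) (trans (cong (λ z → q * + 2 - z) e) (eq₂ q c))
        where
        eq : ∀ q a → a ≡ q * + 2 - (q * + 2 - a)
        eq = solve-∀
        eq₂ : ∀ q c → q * + 2 - q * c ≡ q * (+ 2 - c)
        eq₂ = solve-∀
    mirror-eq fY c u e = e
    mirror-eq fW c u e = trans (sym (W-ρ u)) e
    mirror-eq fU c u e = solve₁ (+ q) c (X u) (trans (sym (U-ρ u)) e)
      where
      solve₁ : ∀ q c a → q * + 2 - a ≡ q * c → a ≡ q * (+ 2 - c)
      solve₁ q c a e = trans (eq q a) (trans (cong (λ z → q * + 2 - z) e) (eq₂ q c))
        where
        eq : ∀ q a → a ≡ q * + 2 - (q * + 2 - a)
        eq = solve-∀
        eq₂ : ∀ q c → q * + 2 - q * c ≡ q * (+ 2 - c)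
        eq₂ = solve-∀

  HC-FacetStd : ∀ {α β S} → HC α β S → FacetStd S
  HC-FacetStd (lft g) = G-FacetStd g
  HC-FacetStd (rgt {S} g) f c u v (i , refl) (j , refl) eu ev = StdDir-ρ (G-FacetStd g (mirror-facet f) (mirror-value f c) (S i) (S j)
    (i , refl) (j , refl) (mirror-eq f c (S i) eu) (mirror-eq f c (S j) ev))

  -- Two vertex sets in a facet plane

  η-embedding : Embedding η
  η-embedding φ (aff c₀ c₁ c₂ c₃ e) = + q , φ′ , 0<q , affφ′ , λ { (a , b , c) → trans (eq (+ r) (+ q) c₀ c₁ c₂ c₃ a b c) (cong (+ q *_) (sym (e a b c))) }
    where
    φ′ : Pt → ℤ
    φ′ v = + q * c₀ + (c₁ * X v + (c₂ * form fY v + c₃ * (+ q * level v)))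
    affφ′ : Aff φ′
    affφ′ = aff-+ (aff-c (+ q * c₀)) (aff-+ (aff-* c₁ aff-X) (aff-+ (aff-* c₂ aff-1) (aff-* c₃ (aff-* (+ q) aff-3))))
    eq : ∀ r q c₀ c₁ c₂ c₃ a b c → q * c₀ + (c₁ * (r * (q * b) - q * (r * b - a)) + (c₂ * (q * b) + c₃ * (q * c))) ≡ q * (c₀ + (c₁ * a + (c₂ * b + c₃ * c)))
    eq = solve-∀

  -- The facets to which the cutting planes are parallel.
  data Inner : Facet → Set where
    inX : Inner fX
    inY : Inner fY
    inW : Inner fW

  corner-form : Facet → Pt → ℤ
  corner-form fX (a , b , c) = a
  corner-form fY (a , b , c) = b
  corner-form fW (a , b , c) = c - b
  corner-form fU (a , b , c) = a + c

  form-η : ∀ f v → form f (η v) ≡ + q * corner-form f v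
  form-η fX (a , b , c) = eq (+ r) (+ q) a b
    where
    eq : ∀ r q a b → r * (q * b) - q * (r * b - a) ≡ q * a
    eq = solve-∀
  form-η fY (a , b , c) = refl
  form-η fW (a , b , c) = eq (+ q) b c
    where
    eq : ∀ q b c → q * c - q * b ≡ q * (c - b)
    eq = solve-∀
  form-η fU (a , b , c) = eq (+ r) (+ q) a b c
    where
    eq : ∀ r q a b c → r * (q * b) - q * (r * b - a) + q * c ≡ q * (a + c)
    eq = solve-∀

  q-cancel : ∀ {a b} → + q * a ≡ + q * b → a ≡ b
  q-cancel {a} {b} e = ℤ.*-cancelˡ-≡ (+ q) a b {{ℤ.≢-nonZero (λ z → ℤ.<-irrefl (sym z) 0<q)}} e

  -- In a plane at integral height all lattice points are corners of cells, because the facets of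
  -- the empty tetrahedron are unimodular triangles. For `fX` this is coprimality: q divides r y,
  -- hence y.
  is-η : ∀ f → Inner f → ∀ c v → form f v ≡ + q * c → ∃ λ w → v ≡ η w
  is-η fY inY c (.(+ q * c) , t , z) refl = (+ r * c - t , c , z) , Pt-≡ refl (eq (+ r) c t) refl
    where
    eq : ∀ r c t → t ≡ r * c - (r * c - t)
    eq = solve-∀
  is-η fW inW c (y , t , z) e = (+ r * (z - c) - t , z - c , z) , Pt-≡ (trans (eq₁ (+ q) y z) (trans (cong (λ s → + q * z - s) e) (eq₂ (+ q) z c))) (eq (+ r) (z - c) t) refl
    where
    eq : ∀ r c t → t ≡ r * c - (r * c - t)
    eq = solve-∀
    eq₁ : ∀ q y z → y ≡ q * z - (q * z - y)
    eq₁ = solve-∀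
    eq₂ : ∀ q z c → q * z - q * c ≡ q * (z - c)
    eq₂ = solve-∀
  is-η fX inX c (y , t , z) e = (+ r * b - t , b , z) , Pt-≡ y≡ (eq (+ r) b t) refl
    where
    α = proj₁ bez
    β = proj₁ (proj₂ bez)
    b = α * (t + c) + β * y
    eq : ∀ r c t → t ≡ r * c - (r * c - t)
    eq = solve-∀
    eq₁ : ∀ r q α β y t → (α * r + β * q) * y ≡ α * (r * y - q * t + q * t) + β * (q * y)
    eq₁ = solve-∀
    eq₂ : ∀ q α β y t c → α * (q * c + q * t) + β * (q * y) ≡ q * (α * (t + c) + β * y)
    eq₂ = solve-∀
    y≡ : y ≡ + q * b
    y≡ = trans (sym (ℤ.*-identityˡ y)) (trans (cong (_* y) (sym (proj₂ (proj₂ bez)))) (trans (eq₁ (+ r) (+ q) α β y t)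
      (trans (cong (λ s → α * (s + + q * t) + β * (+ q * y)) e) (eq₂ (+ q) α β y t c))))

  -- Coordinates of the plane in which the sides of the facet become the directions of `Hex`;
  -- `table` checks this on all pairs of vertices.
  n₁ n₂ : Facet → Pt → ℤ
  n₁ fY (a , b , c) = a
  n₁ fW (a , b , c) = a
  n₁ _  (a , b , c) = c - b
  n₂ fY (a , b , c) = c
  n₂ _  (a , b , c) = b

  private
    aff-n₁ : ∀ f → Aff (n₁ f)
    aff-n₁ fX = aff-- aff-3 aff-2
    aff-n₁ fY = aff-1
    aff-n₁ fW = aff-1
    aff-n₁ fU = aff-- aff-3 aff-2

    aff-n₂ : ∀ f → Aff (n₂ f)
    aff-n₂ fX = aff-2
    aff-n₂ fY = aff-3
    aff-n₂ fW = aff-2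
    aff-n₂ fU = aff-2

    Table : Facet → Set
    Table f = ∀ i j → corner-form f (κ i) ≡ corner-form f (κ j) → Hex (n₁ f (κ j) - n₁ f (κ i)) (n₂ f (κ j) - n₂ f (κ i))

    table? : ∀ f → Dec (Table f)
    table? f = all? λ i → all? λ j → (corner-form f (κ i) ℤ.≟ corner-form f (κ j)) →-dec hex? _ _

    table : ∀ f → Inner f → Table f
    table fX inX = toWitness {a? = table? fX} tt
    table fY inY = toWitness {a? = table? fY} tt
    table fW inW = toWitness {a? = table? fW} tt

    η-injective : ∀ {u v} → η u ≡ η v → u ≡ v
    η-injective {a , b , c} {a′ , b′ , c′} e = Pt-≡ (ℤ.neg-injective (+-cancelˡ (+ r * b) (trans (cong pr₂ e) (cong (λ z → + r * z - a′) (sym eb))))) eb (cong pr₃ e)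
      where
      eb : b ≡ b′
      eb = q-cancel (cong proj₁ e)

    η-+ : ∀ u v → η (u +Z v) ≡ η u +Z η v
    η-+ (a , b , c) (a′ , b′ , c′) = Pt-≡ (ℤ.*-distribˡ-+ (+ q) b b′) (eq (+ r) a b a′ b′) refl
      where
      eq : ∀ r a b a′ b′ → r * (b + b′) - (a + a′) ≡ r * b - a + (r * b′ - a′)
      eq = solve-∀

    std-corner : ∀ {u v} → StdDir (η u) (η v) → ∃ λ i → ∃ λ j → u +Z κ i ≡ v +Z κ j
    std-corner {u} {v} (std i j e) = i , j , η-injective (trans (η-+ u (κ i)) (trans e (sym (η-+ v (κ j)))))

    move : ∀ u v a b → u + a ≡ v + b → u - v ≡ b - a
    move u v a b e = trans (eq₁ u v a) (trans (cong (λ s → s - (v + a)) e) (eq₂ v a b))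
      where
      eq₁ : ∀ u v a → u - v ≡ u + a - (v + a)
      eq₁ = solve-∀
      eq₂ : ∀ v a b → v + b - (v + a) ≡ b - a
      eq₂ = solve-∀

    move₂ : ∀ u₃ u₂ v₃ v₂ a₃ a₂ b₃ b₂ → u₃ + a₃ ≡ v₃ + b₃ → u₂ + a₂ ≡ v₂ + b₂ → (u₃ - u₂) - (v₃ - v₂) ≡ (b₃ - b₂) - (a₃ - a₂)
    move₂ u₃ u₂ v₃ v₂ a₃ a₂ b₃ b₂ e f = trans (eq₁ u₃ u₂ v₃ v₂) (trans (cong₂ _-_ (move u₃ v₃ a₃ b₃ e) (move u₂ v₂ a₂ b₂ f)) (eq₁ b₃ a₃ b₂ a₂))
      where
      eq₁ : ∀ u₃ u₂ v₃ v₂ → (u₃ - u₂) - (v₃ - v₂) ≡ (u₃ - v₃) - (u₂ - v₂)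
      eq₁ = solve-∀

    coords : ∀ f → Inner f → ∀ {u v} i j → u +Z κ i ≡ v +Z κ j →
      corner-form f u - corner-form f v ≡ corner-form f (κ j) - corner-form f (κ i) ×
      n₁ f u - n₁ f v ≡ n₁ f (κ j) - n₁ f (κ i) × n₂ f u - n₂ f v ≡ n₂ f (κ j) - n₂ f (κ i)
    coords fX inX {u₁ , u₂ , u₃} {v₁ , v₂ , v₃} i j e = move u₁ v₁ _ _ (cong proj₁ e) ,
      move₂ u₃ u₂ v₃ v₂ _ _ _ _ (cong pr₃ e) (cong pr₂ e) , move u₂ v₂ _ _ (cong pr₂ e)
    coords fY inY {u₁ , u₂ , u₃} {v₁ , v₂ , v₃} i j e = move u₂ v₂ _ _ (cong pr₂ e) , move u₁ v₁ _ _ (cong proj₁ e) , move u₃ v₃ _ _ (cong pr₃ e)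
    coords fW inW {u₁ , u₂ , u₃} {v₁ , v₂ , v₃} i j e = move₂ u₃ u₂ v₃ v₂ _ _ _ _ (cong pr₃ e) (cong pr₂ e) ,
      move u₁ v₁ _ _ (cong proj₁ e) , move u₂ v₂ _ _ (cong pr₂ e)

    hexed : ∀ f → Inner f → ∀ {u v} → corner-form f u ≡ corner-form f v → (∃ λ i → ∃ λ j → u +Z κ i ≡ v +Z κ j) → Hex (n₁ f u - n₁ f v) (n₂ f u - n₂ f v)
    hexed f inn {u} {v} e (i , j , p) = subst₂ Hex (sym (proj₁ (proj₂ C))) (sym (proj₂ (proj₂ C)))
        (table f inn i j (sym (ℤ.i-j≡0⇒i≡j _ _ (trans (sym (proj₁ C)) (ℤ.i≡j⇒i-j≡0 e)))))
      where
      C = coords f inn {u} {v} i j p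

    determined : ∀ f → Inner f → ∀ {u v} → corner-form f u ≡ corner-form f v → n₁ f u ≡ n₁ f v → n₂ f u ≡ n₂ f v → u ≡ v
    determined fX inX {a , b , c} refl p refl = Pt-≡ refl refl (+-cancelʳ (- b) p)
    determined fY inY refl refl refl = refl
    determined fW inW {a , b , c} e refl refl = Pt-≡ refl refl (+-cancelʳ (- b) e)

  -- In the coordinates of `η` both sets are cliques of one and the same standard triangulation of
  -- the plane, so `Meet-clique` applies.
  Meet-facet : ∀ f → Inner f → ∀ c → (∀ v → V v → form f v ≡ + q * c) → (∀ v → W v → form f v ≡ + q * c) →
    (∀ u v → V u → V v → StdDir u v) → (∀ u v → W u → W v → StdDir u v) → Meet V W
  Meet-facet {V = V} {W = W} f inn c hV hW sV sW = Meet-pullback η-embedding (λ v z → is-η f inn c v (hV v z)) (λ v z → is-η f inn c v (hW v z))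
    (Meet-clique (n₁ f) (n₂ f) (aff-n₁ f) (aff-n₂ f)
      (λ u v zu zv → hexed f inn {u} {v} (trans (val u (hV _ zu)) (sym (val v (hV _ zv)))) (std-corner {u} {v} (sV _ _ zu zv)))
      (λ u v zu zv → hexed f inn {u} {v} (trans (val u (hW _ zu)) (sym (val v (hW _ zv)))) (std-corner {u} {v} (sW _ _ zu zv)))
      (λ u v zu zv → determined f inn (trans (val u (hV _ zu)) (sym (val v (hW _ zv))))))
    where
    val : ∀ u → form f (η u) ≡ + q * c → corner-form f u ≡ c
    val u e = q-cancel (trans (sym (form-η f u)) e)

locate-form : (F : ℕ → Pt → ℤ) → ∀ n → ws ⊩ F 0 → ws ⊩ (λ v → - F (suc n) v) → ∃ λ i → i ℕ.≤ n × ws ⊩ F i × ws ⊩ (λ v → - F (suc i) v)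
locate-form F zero p p′ = 0 , z≤n , p , p′
locate-form {ws = ws} F (suc n) p p′ with ⊩-total ws (F (suc n))
... | inj₁ s = suc n , ℕ.≤-refl , s , p′
... | inj₂ s with locate-form F n p s
...   | i , i≤n , a , b = i , ℕ.m≤n⇒m≤1+n i≤n , a , b

-- Cells as translates and point reflections of half cells

module Placement {r q : ℕ} (chain : Chain r q) where
  open Chain chain
  open Strip chain
  open Path chain
  open HalfCell chain
  open Cells chain
  open Triangulation chain
  open Coverage chain
  open Facets chain

  form-+ : ∀ f u v → form f (u +Z v) ≡ form f u + form f v
  form-+ fX (a , b , c) (a′ , b′ , c′) = eq (+ r) (+ q) a b a′ b′
    where
    eq : ∀ r q a b a′ b′ → r * (a + a′) - q * (b + b′) ≡ r * a - q * b + (r * a′ - q * b′)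
    eq = solve-∀
  form-+ fY (a , b , c) (a′ , b′ , c′) = refl
  form-+ fW (a , b , c) (a′ , b′ , c′) = eq (+ q) a c a′ c′
    where
    eq : ∀ q a c a′ c′ → q * (c + c′) - (a + a′) ≡ q * c - a + (q * c′ - a′)
    eq = solve-∀
  form-+ fU (a , b , c) (a′ , b′ , c′) = eq (+ r) (+ q) a b c a′ b′ c′
    where
    eq : ∀ r q a b c a′ b′ c′ → r * (a + a′) - q * (b + b′) + q * (c + c′) ≡ r * a - q * b + q * c + (r * a′ - q * b′ + q * c′)
    eq = solve-∀

  form-- : ∀ f u v → form f (u -Z v) ≡ form f u - form f v
  form-- fX (a , b , c) (a′ , b′ , c′) = eq (+ r) (+ q) a b a′ b′
    where
    eq : ∀ r q a b a′ b′ → r * (a - a′) - q * (b - b′) ≡ r * a - q * b - (r * a′ - q * b′)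
    eq = solve-∀
  form-- fY (a , b , c) (a′ , b′ , c′) = refl
  form-- fW (a , b , c) (a′ , b′ , c′) = eq (+ q) a c a′ c′
    where
    eq : ∀ q a c a′ c′ → q * (c - c′) - (a - a′) ≡ q * c - a - (q * c′ - a′)
    eq = solve-∀
  form-- fU (a , b , c) (a′ , b′ , c′) = eq (+ r) (+ q) a b c a′ b′ c′
    where
    eq : ∀ r q a b c a′ b′ c′ → r * (a - a′) - q * (b - b′) + q * (c - c′) ≡ r * a - q * b + q * c - (r * a′ - q * b′ + q * c′)
    eq = solve-∀

  form-shift : ∀ f w v → form f (η w +Z v) ≡ + q * corner-form f w + form f v
  form-shift f w v = trans (form-+ f (η w) v) (cong (_+ form f v) (form-η f w))

  form-flip : ∀ f w v → form f (η w -Z v) ≡ + q * corner-form f w - form f v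
  form-flip f w v = trans (form-- f (η w) v) (cong (λ z → z - form f v) (form-η f w))

  shift-aff : ∀ o → AffMap (o +Z_)
  shift-aff (a , b , c) = aff-+ (aff-c a) aff-1 , aff-+ (aff-c b) aff-2 , aff-+ (aff-c c) aff-3

  unshift-aff : ∀ o → AffMap (_-Z o)
  unshift-aff (a , b , c) = aff-- aff-1 (aff-c a) , aff-- aff-2 (aff-c b) , aff-- aff-3 (aff-c c)

  flip-aff : ∀ o → AffMap (o -Z_)
  flip-aff (a , b , c) = aff-- (aff-c a) aff-1 , aff-- (aff-c b) aff-2 , aff-- (aff-c c) aff-3

  private
    z₁ : ∀ o a → o + a - o ≡ a
    z₁ = solve-∀
    z₂ : ∀ o a → o + (a - o) ≡ a
    z₂ = solve-∀
    z₃ : ∀ o a → o - (o - a) ≡ a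
    z₃ = solve-∀

  unshift-shift : ∀ o v → (o +Z v) -Z o ≡ v
  unshift-shift (a , b , c) (a′ , b′ , c′) = Pt-≡ (z₁ a a′) (z₁ b b′) (z₁ c c′)

  shift-unshift : ∀ o v → o +Z (v -Z o) ≡ v
  shift-unshift (a , b , c) (a′ , b′ , c′) = Pt-≡ (z₂ a a′) (z₂ b b′) (z₂ c c′)

  flip-flip : ∀ o v → o -Z (o -Z v) ≡ v
  flip-flip (a , b , c) (a′ , b′ , c′) = Pt-≡ (z₃ a a′) (z₃ b b′) (z₃ c c′)

  Meet-map : ∀ {g h : Pt → Pt} {S S′ : Fin 4 → Pt} → AffMap h → (∀ v → h (g v) ≡ v) → (∀ v → g (h v) ≡ v) →
    Meet (Vert S) (Vert S′) → Meet (Vert (λ i → g (S i))) (Vert (λ i → g (S′ i)))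
  Meet-map {g} {h} {S} {S′} ah hg gh m = Meet-pullback {g = g} (Embedding-inv ah hg) (λ v _ → h v , sym (gh v)) (λ v _ → h v , sym (gh v))
    (Meet-mono (λ { v (i , e) → i , cong g e }) (λ { v (i , e) → i , trans (sym (hg v)) (trans (cong h e) (hg (S i))) })
               (λ { v (i , e) → i , cong g e }) (λ { v (i , e) → i , trans (sym (hg v)) (trans (cong h e) (hg (S′ i))) }) m)

  FacetStdAt : Facet → ℤ → (Fin 4 → Pt) → Set
  FacetStdAt f c S = ∀ u v → Vert S u → Vert S v → form f u ≡ + q * c → form f v ≡ + q * c → StdDir u v

  private
    shift-value : ∀ f w c u → form f (η w +Z u) ≡ + q * c → form f u ≡ + q * (c - corner-form f w)
    shift-value f w c u e = trans (eq (+ q * corner-form f w) (form f u)) (trans (cong (λ z → z - + q * corner-form f w) (trans (sym (form-shift f w u)) e)) (eq₂ (+ q) c (corner-form f w)))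
      where
      eq : ∀ a b → b ≡ a + b - a
      eq = solve-∀
      eq₂ : ∀ q c a → q * c - q * a ≡ q * (c - a)
      eq₂ = solve-∀

    flip-value : ∀ f w c u → form f (η w -Z u) ≡ + q * c → form f u ≡ + q * (corner-form f w - c)
    flip-value f w c u e = trans (eq (+ q * corner-form f w) (form f u)) (trans (cong (λ z → + q * corner-form f w - z) (trans (sym (form-flip f w u)) e)) (eq₂ (+ q) c (corner-form f w)))
      where
      eq : ∀ a b → b ≡ a - (a - b)
      eq = solve-∀
      eq₂ : ∀ q c a → q * a - q * c ≡ q * (a - c)
      eq₂ = solve-∀

  FacetStdAt-shift : ∀ {f c S} w → FacetStdAt f (c - corner-form f w) S → FacetStdAt f c (λ i → η w +Z S i)
  FacetStdAt-shift {f} {c} {S} w h u v (i , refl) (j , refl) eu ev =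
    StdDir-shift (η w) (h (S i) (S j) (i , refl) (j , refl) (shift-value f w c (S i) eu) (shift-value f w c (S j) ev))

  FacetStdAt-flip : ∀ {f c S} w → FacetStdAt f (corner-form f w - c) S → FacetStdAt f c (λ i → η w -Z S i)
  FacetStdAt-flip {f} {c} {S} w h u v (i , refl) (j , refl) eu ev =
    StdDir-neg (η w) (h (S i) (S j) (i , refl) (j , refl) (flip-value f w c (S i) eu) (flip-value f w c (S j) ev))

  -- After separation by the cutting plane only the faces in it matter, and both are standard. All
  -- comparisons between distinct cells or boxes have this form.
  Meet-across : ∀ {S S′} f → Inner f → ∀ c → (∀ v → Vert S v → form f v ≤ + q * c) → (∀ v → Vert S′ v → + q * c ≤ form f v) →
    FacetStdAt f c S → FacetStdAt f c S′ → Meet (Vert S) (Vert S′)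
  Meet-across f inn c hS hS′ sS sS′ = Meet-separate (λ v → form f v - + q * c) (aff-- (aff-form f) (aff-c (+ q * c)))
      (λ v z → 0≤-resp (rev (form f v) (+ q * c)) (≤⇒0≤ (hS v z))) (λ v z → ≤⇒0≤ (hS′ v z))
      (Meet-facet f inn c (λ v z → ℤ.i-j≡0⇒i≡j _ _ (proj₂ z)) (λ v z → ℤ.i-j≡0⇒i≡j _ _ (proj₂ z))
        (λ u v zu zv → sS u v (proj₁ zu) (proj₁ zv) (ℤ.i-j≡0⇒i≡j _ _ (proj₂ zu)) (ℤ.i-j≡0⇒i≡j _ _ (proj₂ zv)))
        (λ u v zu zv → sS′ u v (proj₁ zu) (proj₁ zv) (ℤ.i-j≡0⇒i≡j _ _ (proj₂ zu)) (ℤ.i-j≡0⇒i≡j _ _ (proj₂ zv))))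
    where
    rev : ∀ a b → - (a - b) ≡ b - a
    rev = solve-∀

  -- The level is i + l because z = Y + w. `center` is the opposite corner of the untruncated cell,
  -- the image of `ap 0` under the point reflection that produces the upper half.
  origin center : ℕ → ℕ → ℕ → Pt
  origin c i l = + c , + i , + i + + l
  center c i l = + c + 1ℤ , + i + 1ℤ , + i + + l + + 2

  -- A cell at (c , i , l), with last = true for the cell touching the facet x + q z = q k.
  data InCell (c i l : ℕ) (last : Bool) : (Fin 4 → Pt) → Set where
    low : ∀ {S} → HC true last S → InCell c i l last (λ j → η (origin c i l) +Z S j)
    -- In the truncated cell the bottom segment has length 2 and the top segment is a point;
    -- otherwise both have length 1.
    up  : ∀ {S} → HC (not last) false S → InCell c i l last (λ j → η (center c i l) -Z S j)

  cell-FacetStdAt : ∀ {c i l last S} → InCell c i l last S → ∀ f a → FacetStdAt f a S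
  cell-FacetStdAt {c} {i} {l} (low h) f a = FacetStdAt-shift {f} {a} (origin c i l) (HC-FacetStd h f _)
  cell-FacetStdAt {c} {i} {l} (up h) f a = FacetStdAt-flip {f} {a} (center c i l) (HC-FacetStd h f _)

  cell-dual : ∀ {c i l last S} → InCell c i l last S → Dual S
  cell-dual {c} {i} {l} (low {S} h) = Dual-map {S} {η (origin c i l) +Z_} {_-Z η (origin c i l)} (shift-aff (η (origin c i l))) (unshift-aff (η (origin c i l))) (shift-unshift (η (origin c i l))) (HC-dual h)
  cell-dual {c} {i} {l} (up {S} h) = Dual-map {S} {η (center c i l) -Z_} {η (center c i l) -Z_} (flip-aff (η (center c i l))) (flip-aff (η (center c i l))) (flip-flip (η (center c i l))) (HC-dual h)

  private
    Y≤1 : ∀ {α β v} → Bounds α β v → 0ℤ ≤ + q - form fY v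
    Y≤1 {v = y , t , z} b = 0≤-resp (eq (+ q) y z) (0≤+ (0≤* (0≤+ᴺ q) (Bounds.z≤1 b)) (Bounds.w≥0 b))
      where
      eq : ∀ q y z → q - y ≡ q * (1ℤ - z) + (q * z - y)
      eq = solve-∀
    W≤1 : ∀ {α β v} → Bounds α β v → 0ℤ ≤ + q - form fW v
    W≤1 {v = y , t , z} b = 0≤-resp (eq (+ q) y z) (0≤+ (0≤* (0≤+ᴺ q) (Bounds.z≤1 b)) (Bounds.y≥0 b))
      where
      eq : ∀ q y z → q - (q * z - y) ≡ q * (1ℤ - z) + y
      eq = solve-∀
    U≥0 : ∀ {α β v} → Bounds α β v → 0ℤ ≤ form fU v
    U≥0 {v = v@(y , t , z)} b = 0≤+ (Bounds.X≥0 b) (0≤-resp (eq (+ q) y z) (0≤+ (Bounds.w≥0 b) (Bounds.y≥0 b)))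
      where
      eq : ∀ q y z → q * z ≡ q * z - y + y
      eq = solve-∀

  record CellBounds (c i l : ℕ) (last : Bool) (v : Pt) : Set where
    field
      Y-lo : + q * + i ≤ form fY v
      Y-hi : form fY v ≤ + q * + suc i
      W-lo : + q * + l ≤ form fW v
      W-hi : form fW v ≤ + q * + suc l
      X-lo : + q * + c ≤ form fX v
      X-hi : last ≡ false → form fX v ≤ + q * + suc c
      U-hi : ∀ k → (last ≡ true × c ℕ.+ (i ℕ.+ l) ℕ.+ 2 ≡ k) ⊎ (last ≡ false × c ℕ.+ (i ℕ.+ l) ℕ.+ 3 ℕ.≤ k) → form fU v ≤ + q * + k

  private
    lo-shift : ∀ q a x {y} → y ≡ q * a + x → 0ℤ ≤ x → q * a ≤ y
    lo-shift q a x refl p = ≤-by x p (eq (q * a) x)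
      where
      eq : ∀ a x → a + x - a ≡ x
      eq = solve-∀
    hi-shift : ∀ q a x {y} → y ≡ q * a + x → 0ℤ ≤ q - x → y ≤ q * (1ℤ + a)
    hi-shift q a x refl p = ≤-by (q - x) p (eq q a x)
      where
      eq : ∀ q a x → q * (1ℤ + a) - (q * a + x) ≡ q - x
      eq = solve-∀
    lo-flip : ∀ q a x {y} → y ≡ q * (a + 1ℤ) - x → 0ℤ ≤ q - x → q * a ≤ y
    lo-flip q a x refl p = ≤-by (q - x) p (eq q a x)
      where
      eq : ∀ q a x → q * (a + 1ℤ) - x - q * a ≡ q - x
      eq = solve-∀
    hi-flip : ∀ q a x {y} → y ≡ q * (a + 1ℤ) - x → 0ℤ ≤ x → y ≤ q * (1ℤ + a)
    hi-flip q a x refl p = ≤-by x p (eq q a x)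
      where
      eq : ∀ q a x → q * (1ℤ + a) - (q * (a + 1ℤ) - x) ≡ x
      eq = solve-∀
    W-origin : ∀ i l → i + l - i ≡ l
    W-origin = solve-∀
    W-center : ∀ i l → i + l + + 2 - (i + 1ℤ) ≡ l + 1ℤ
    W-center = solve-∀
    U-center : ∀ c i l → c + 1ℤ + (i + l + + 2) ≡ c + (i + l) + + 3
    U-center = solve-∀
    U-bound : ∀ q a m x n {y} → y ≡ q * a + x → 0ℤ ≤ q * n - x → 0ℤ ≤ q → a + n ≤ m → y ≤ q * m
    U-bound q a m x n refl p q≥0 le = ≤-by (q * (m - (a + n)) + (q * n - x)) (0≤+ (0≤* q≥0 (≤⇒0≤ le)) p) (eq q a m n x)
      where
      eq : ∀ q a m n x → q * m - (q * a + x) ≡ q * (m - (a + n)) + (q * n - x)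
      eq = solve-∀
    U-bound₂ : ∀ q a m x {y} → y ≡ q * (a + + 3) - x → 0ℤ ≤ x - q → 0ℤ ≤ q → a + + 2 ≤ m → y ≤ q * m
    U-bound₂ q a m x refl p q≥0 le = ≤-by (q * (m - (a + + 2)) + (x - q)) (0≤+ (0≤* q≥0 (≤⇒0≤ le)) p) (eq q a m x)
      where
      eq : ∀ q a m x → q * m - (q * (a + + 3) - x) ≡ q * (m - (a + + 2)) + (x - q)
      eq = solve-∀
    U-bound₃ : ∀ q a m x {y} → y ≡ q * (a + + 3) - x → 0ℤ ≤ x → 0ℤ ≤ q → a + + 3 ≤ m → y ≤ q * m
    U-bound₃ q a m x refl p q≥0 le = ≤-by (q * (m - (a + + 3)) + x) (0≤+ (0≤* q≥0 (≤⇒0≤ le)) p) (eq q a m x)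
      where
      eq : ∀ q a m x → q * m - (q * (a + + 3) - x) ≡ q * (m - (a + + 3)) + x
      eq = solve-∀

  private
    low-bounds : ∀ c i l last u → Bounds true last u → CellBounds c i l last (η (origin c i l) +Z u)
    low-bounds c i l last u b = record
      { Y-lo = lo-shift (+ q) (+ i) (form fY u) Yv (Bounds.y≥0 b)
      ; Y-hi = hi-shift (+ q) (+ i) (form fY u) Yv (Y≤1 b)
      ; W-lo = lo-shift (+ q) (+ l) (form fW u) Wv (Bounds.w≥0 b)
      ; W-hi = hi-shift (+ q) (+ l) (form fW u) Wv (W≤1 b)
      ; X-lo = lo-shift (+ q) (+ c) (form fX u) Xv (Bounds.X≥0 b)
      ; X-hi = λ e → hi-shift (+ q) (+ c) (form fX u) Xv (Bounds.X≤1 b e)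
      ; U-hi = U-hi }
      where
      o = origin c i l
      Yv : form fY (η o +Z u) ≡ + q * + i + form fY u
      Yv = form-shift fY o u
      Xv : form fX (η o +Z u) ≡ + q * + c + form fX u
      Xv = form-shift fX o u
      Wv : form fW (η o +Z u) ≡ + q * + l + form fW u
      Wv = trans (form-shift fW o u) (cong (λ z → + q * z + form fW u) (W-origin (+ i) (+ l)))
      Uv : form fU (η o +Z u) ≡ + q * (+ c + (+ i + + l)) + form fU u
      Uv = form-shift fU o u
      U-hi : ∀ k → (last ≡ true × c ℕ.+ (i ℕ.+ l) ℕ.+ 2 ≡ k) ⊎ (last ≡ false × c ℕ.+ (i ℕ.+ l) ℕ.+ 3 ℕ.≤ k) → form fU (η o +Z u) ≤ + q * + k
      U-hi k h = U-bound (+ q) (+ c + (+ i + + l)) (+ k) (form fU u) (+ 2) Uv (Bounds.U≤2 b) (0≤+ᴺ q) (+≤+ (le h))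
        where
        le : (last ≡ true × c ℕ.+ (i ℕ.+ l) ℕ.+ 2 ≡ k) ⊎ (last ≡ false × c ℕ.+ (i ℕ.+ l) ℕ.+ 3 ℕ.≤ k) → c ℕ.+ (i ℕ.+ l) ℕ.+ 2 ℕ.≤ k
        le (inj₁ (_ , e)) = ℕ.≤-reflexive e
        le (inj₂ (_ , p)) = ℕ.≤-trans (ℕ.+-monoʳ-≤ (c ℕ.+ (i ℕ.+ l)) (s≤s (s≤s z≤n))) p

    module Up (c i l : ℕ) (last : Bool) (u : Pt) (b : Bounds (not last) false u) where
      o = center c i l
      Yv : form fY (η o -Z u) ≡ + q * (+ i + 1ℤ) - form fY u
      Yv = form-flip fY o u
      Xv : form fX (η o -Z u) ≡ + q * (+ c + 1ℤ) - form fX u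
      Xv = form-flip fX o u
      Wv : form fW (η o -Z u) ≡ + q * (+ l + 1ℤ) - form fW u
      Wv = trans (form-flip fW o u) (cong (λ z → + q * z - form fW u) (W-center (+ i) (+ l)))
      Uv : form fU (η o -Z u) ≡ + q * (+ c + (+ i + + l) + + 3) - form fU u
      Uv = trans (form-flip fU o u) (cong (λ z → + q * z - form fU u) (U-center (+ c) (+ i) (+ l)))
      Y₁ : + q * + i ≤ form fY (η o -Z u)
      Y₁ = lo-flip (+ q) (+ i) (form fY u) Yv (Y≤1 b)
      Y₂ : form fY (η o -Z u) ≤ + q * + suc i
      Y₂ = hi-flip (+ q) (+ i) (form fY u) Yv (Bounds.y≥0 b)
      W₁ : + q * + l ≤ form fW (η o -Z u)
      W₁ = lo-flip (+ q) (+ l) (form fW u) Wv (W≤1 b)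
      W₂ : form fW (η o -Z u) ≤ + q * + suc l
      W₂ = hi-flip (+ q) (+ l) (form fW u) Wv (Bounds.w≥0 b)
      X₁ : + q * + c ≤ form fX (η o -Z u)
      X₁ = lo-flip (+ q) (+ c) (form fX u) Xv (Bounds.X≤1 b refl)
      X₂ : last ≡ false → form fX (η o -Z u) ≤ + q * + suc c
      X₂ _ = hi-flip (+ q) (+ c) (form fX u) Xv (Bounds.X≥0 b)
      U₂ : ∀ k → last ≡ true → c ℕ.+ (i ℕ.+ l) ℕ.+ 2 ≡ k → form fU (η o -Z u) ≤ + q * + k
      U₂ k e p = U-bound₂ (+ q) (+ c + (+ i + + l)) (+ k) (form fU u) Uv (Bounds.U≥1 b (cong not e)) (0≤+ᴺ q) (+≤+ (ℕ.≤-reflexive p))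
      U₃ : ∀ k → c ℕ.+ (i ℕ.+ l) ℕ.+ 3 ℕ.≤ k → form fU (η o -Z u) ≤ + q * + k
      U₃ k p = U-bound₃ (+ q) (+ c + (+ i + + l)) (+ k) (form fU u) Uv (U≥0 b) (0≤+ᴺ q) (+≤+ p)
      U₁ : ∀ k → (last ≡ true × c ℕ.+ (i ℕ.+ l) ℕ.+ 2 ≡ k) ⊎ (last ≡ false × c ℕ.+ (i ℕ.+ l) ℕ.+ 3 ℕ.≤ k) → form fU (η o -Z u) ≤ + q * + k
      U₁ k = [ (λ z → U₂ k (proj₁ z) (proj₂ z)) , (λ z → U₃ k (proj₂ z)) ]′

    up-bounds : ∀ c i l last u → Bounds (not last) false u → CellBounds c i l last (η (center c i l) -Z u)
    up-bounds c i l last u b = record { Y-lo = Y₁ ; Y-hi = Y₂ ; W-lo = W₁ ; W-hi = W₂ ; X-lo = X₁ ; X-hi = X₂ ; U-hi = U₁ }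
      where open Up c i l last u b

  cell-bounds : ∀ {c i l last S} → InCell c i l last S → ∀ v → Vert S v → CellBounds c i l last v
  cell-bounds {c} {i} {l} {last} (low {S} h) v (s , refl) = low-bounds c i l last (S s) (HC-bounds h (S s) (s , refl))
  cell-bounds {c} {i} {l} {last} (up {S} h) v (s , refl) = up-bounds c i l last (S s) (HC-bounds h (S s) (s , refl))

  private
    -- The halves meet in the square at level i + l + 1. There the point reflection acts as the half
    -- turn, so both faces come from the same triangulation `HC true true`, for which `Meet-HC` is
    -- known.
    Meet-halves : ∀ c i l {S S′ α β α′ β′} → HC α β S → HC α′ β′ S′ →
      Meet (Vert (λ j → η (origin c i l) +Z S j)) (Vert (λ j → η (center c i l) -Z S′ j))
    Meet-halves c i l {S} {S′} h h′ = Meet-separate (λ v → level v - mid) (aff-- aff-3 (aff-c mid)) below above faces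
      where
      o = origin c i l
      o′ = center c i l
      mid : ℤ
      mid = + i + + l + 1ℤ
      below : ∀ v → Vert (λ j → η o +Z S j) v → 0ℤ ≤ - (level v - mid)
      below v (s , refl) = 0≤-resp (eq (+ i + + l) (level (S s))) (Bounds.z≤1 (HC-bounds h (S s) (s , refl)))
        where
        eq : ∀ a z → - (a + z - (a + 1ℤ)) ≡ 1ℤ - z
        eq = solve-∀
      above : ∀ v → Vert (λ j → η o′ -Z S′ j) v → 0ℤ ≤ level v - mid
      above v (s , refl) = 0≤-resp (eq (+ i + + l) (level (S′ s))) (Bounds.z≤1 (HC-bounds h′ (S′ s) (s , refl)))
        where
        eq : ∀ a z → a + + 2 - z - (a + 1ℤ) ≡ 1ℤ - z
        eq = solve-∀
      F = HC-face h
      F′ = HC-reflect-face h′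
      square : Meet (Vert (proj₁ F)) (Vert (proj₁ F′))
      square = Meet-HC (proj₁ (proj₂ F)) (proj₁ (proj₂ F′))
      level-low : ∀ v → level (η o +Z v) - mid ≡ 0ℤ → level v ≡ 1ℤ
      level-low v e = trans (eq (+ i + + l) (level v)) (trans (cong (λ s → s + 1ℤ) e) refl)
        where
        eq : ∀ a z → z ≡ a + z - (a + 1ℤ) + 1ℤ
        eq = solve-∀
      level-low⁻ : ∀ v → level v ≡ 1ℤ → level (η o +Z v) - mid ≡ 0ℤ
      level-low⁻ v e = trans (cong (λ z → + i + + l + z - mid) e) (ℤ.+-inverseʳ mid)
      -- on the common square the upper half is the ρ-image
      flip-ρ : ∀ v → level v ≡ 1ℤ → η o +Z ρ v ≡ η o′ -Z v
      flip-ρ (y , t , .1ℤ) refl = Pt-≡ (e₁ (+ q) (+ i) y) (e₂ (+ r) (+ c) (+ i) t) (e₃ (+ i + + l))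
        where
        e₁ : ∀ q i y → q * i + (q * 1ℤ - y) ≡ q * (i + 1ℤ) - y
        e₁ = solve-∀
        e₂ : ∀ r c i t → r * i - c + ((r + 1ℤ) * 1ℤ - t - + 2) ≡ r * (i + 1ℤ) - (c + 1ℤ) - t
        e₂ = solve-∀
        e₃ : ∀ a → a + 1ℤ ≡ a + + 2 - 1ℤ
        e₃ = solve-∀
      level-up : ∀ v → level (η o′ -Z v) - mid ≡ 0ℤ → level v ≡ 1ℤ
      level-up v e = trans (eq (+ i + + l) (level v)) (trans (cong (λ s → 1ℤ - s) e) refl)
        where
        eq : ∀ a z → z ≡ 1ℤ - (a + + 2 - z - (a + 1ℤ))
        eq = solve-∀
      V₁ W₁ V₂ W₂ : Pt → Set
      V₁ v = Vert (proj₁ F) v × level v ≡ 1ℤ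
      W₁ v = Vert (proj₁ F′) v × level v ≡ 1ℤ
      V₂ v = Vert (λ j → η o +Z S j) v × level v - mid ≡ 0ℤ
      W₂ v = Vert (λ j → η o′ -Z S′ j) v × level v - mid ≡ 0ℤ
      shift-inj : ∀ {u v} → η o +Z u ≡ η o +Z v → u ≡ v
      shift-inj {u} {v} e = trans (sym (unshift-shift (η o) u)) (trans (cong (_-Z η o) e) (unshift-shift (η o) v))
      faces : Meet V₂ W₂
      faces = Meet-pullback {g = η o +Z_} (Embedding-inv (unshift-aff (η o)) (unshift-shift (η o)))
        (λ v _ → v -Z η o , sym (shift-unshift (η o) v)) (λ v _ → v -Z η o , sym (shift-unshift (η o) v))
        (Meet-mono V→ V← W→ W← (Meet-restrict (λ v → level v ≡ 1ℤ) square))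
        where
        V→ : ∀ v → V₁ v → V₂ (η o +Z v)
        V→ v (z , e) with proj₂ (proj₂ (proj₂ F) v e) z
        ... | s , refl = (s , refl) , level-low⁻ v e
        V← : ∀ v → V₂ (η o +Z v) → V₁ v
        V← v ((s , p) , e) = proj₁ (proj₂ (proj₂ F) v (level-low v e)) (s , shift-inj p) , level-low v e
        W→ : ∀ v → W₁ v → W₂ (η o +Z v)
        W→ v (z , e) with proj₂ (proj₂ (proj₂ F′) v e) z
        ... | s , refl = (s , flip-ρ (S′ s) e) , level-low⁻ v e
        W← : ∀ v → W₂ (η o +Z v) → W₁ v
        W← v ((s , p) , e) = proj₁ (proj₂ (proj₂ F′) v (level-low v e))
            (s , shift-inj (trans p (sym (flip-ρ (S′ s) (level-up (S′ s) (subst (λ w → level w - mid ≡ 0ℤ) p e)))))) , level-low v e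

  Meet-same-cell : ∀ {c i l last S S′} → InCell c i l last S → InCell c i l last S′ → Meet (Vert S) (Vert S′)
  Meet-same-cell {c} {i} {l} (low {S} h) (low {S′} h′) = Meet-map {g = η (origin c i l) +Z_} {h = _-Z η (origin c i l)} {S} {S′} (unshift-aff (η (origin c i l))) (unshift-shift (η (origin c i l))) (shift-unshift (η (origin c i l))) (Meet-HC h h′)
  Meet-same-cell {c} {i} {l} (up {S} h) (up {S′} h′) = Meet-map {g = η (center c i l) -Z_} {h = η (center c i l) -Z_} {S} {S′} (flip-aff (η (center c i l))) (flip-flip (η (center c i l))) (flip-flip (η (center c i l))) (Meet-HC h h′)
  Meet-same-cell {c} {i} {l} (low h) (up h′) = Meet-halves c i l h h′
  Meet-same-cell {c} {i} {l} (up h) (low h′) = Meet-sym (Meet-halves c i l h′ h)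

-- The cells between the two boxes

module Global {r q : ℕ} (chain : Chain r q) (k₁ k₂ : ℕ) where
  open Chain chain
  open Strip chain
  open Path chain
  open HalfCell chain
  open Cells chain
  open Triangulation chain
  open Coverage chain
  open Facets chain
  open Placement chain

  k : ℕ
  k = k₁ ℕ.+ k₂

  -- On a full cell X + z goes up to c + i + l + 3, which must not exceed k. The column ends with
  -- the cell for which c + i + l + 2 = k, and this one is truncated.
  Position : ℕ → ℕ → ℕ → Bool → Set
  Position c i l last = (last ≡ true × c ℕ.+ (i ℕ.+ l) ℕ.+ 2 ≡ k) ⊎ (last ≡ false × c ℕ.+ (i ℕ.+ l) ℕ.+ 3 ℕ.≤ k)

  record AnyCell (S : Fin 4 → Pt) : Set where
    constructor anyCell
    field
      {c i h} : ℕ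
      {last}  : Bool
      i<k₁    : i ℕ.< k₁
      h<k₂    : h ℕ.< k₂
      pos     : Position c i h last
      inCell  : InCell c i h last S

  private
    q-mono : ∀ {a b} → a ℕ.≤ b → + q * + a ≤ + q * + b
    q-mono {a} {b} p = ℤ.*-monoˡ-≤-nonNeg (+ q) (+≤+ p)

    pos-≤ : ∀ {c i l last} → Position c i l last → c ℕ.+ (i ℕ.+ l) ℕ.+ 2 ℕ.≤ k
    pos-≤ (inj₁ (_ , e)) = ℕ.≤-reflexive e
    pos-≤ {c} {i} {l} (inj₂ (_ , p)) = ℕ.≤-trans (ℕ.+-monoʳ-≤ (c ℕ.+ (i ℕ.+ l)) (s≤s (s≤s z≤n))) p

    -- Nothing follows the truncated cell in its column, so a cell with a successor is full and
    -- bounded by `X = c + 1`.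
    not-last : ∀ {c c′ i l last last′} → c ℕ.< c′ → Position c i l last → Position c′ i l last′ → last ≡ false
    not-last c<c′ (inj₂ (e , _)) _ = e
    not-last {c} {c′} {i} {l} c<c′ (inj₁ (_ , e)) p′ = ⊥-elim (ℕ.<-irrefl e
      (ℕ.<-≤-trans (ℕ.+-monoˡ-< 2 (ℕ.+-monoˡ-< (i ℕ.+ l) c<c′)) (pos-≤ {c′} {i} {l} p′)))

    same-last : ∀ {c i l last last′} → Position c i l last → Position c i l last′ → last ≡ last′
    same-last (inj₁ (e , _)) (inj₁ (e′ , _)) = trans e (sym e′)
    same-last (inj₂ (e , _)) (inj₂ (e′ , _)) = trans e (sym e′)
    same-last {c} {i} {l} (inj₁ (_ , e)) (inj₂ (_ , p)) = ⊥-elim (clash e p)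
      where
      clash : c ℕ.+ (i ℕ.+ l) ℕ.+ 2 ≡ k → c ℕ.+ (i ℕ.+ l) ℕ.+ 3 ℕ.≤ k → ⊥
      clash e p = ℕ.<-irrefl e (ℕ.<-≤-trans (ℕ.+-monoʳ-< (c ℕ.+ (i ℕ.+ l)) (ℕ.n<1+n 2)) p)
    same-last {c} {i} {l} (inj₂ (_ , p)) (inj₁ (_ , e)) = ⊥-elim (clash e p)
      where
      clash : c ℕ.+ (i ℕ.+ l) ℕ.+ 2 ≡ k → c ℕ.+ (i ℕ.+ l) ℕ.+ 3 ℕ.≤ k → ⊥
      clash e p = ℕ.<-irrefl e (ℕ.<-≤-trans (ℕ.+-monoʳ-< (c ℕ.+ (i ℕ.+ l)) (ℕ.n<1+n 2)) p)

    Meet-Y : ∀ {c i l last c′ i′ l′ last′ S S′} → i ℕ.< i′ → InCell c i l last S → InCell c′ i′ l′ last′ S′ → Meet (Vert S) (Vert S′)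
    Meet-Y {i′ = i′} p C C′ = Meet-across fY inY (+ i′)
      (λ v z → ℤ.≤-trans (CellBounds.Y-hi (cell-bounds C v z)) (q-mono p)) (λ v z → CellBounds.Y-lo (cell-bounds C′ v z))
      (cell-FacetStdAt C fY (+ i′)) (cell-FacetStdAt C′ fY (+ i′))

    Meet-W : ∀ {c i l last c′ i′ l′ last′ S S′} → l ℕ.< l′ → InCell c i l last S → InCell c′ i′ l′ last′ S′ → Meet (Vert S) (Vert S′)
    Meet-W {l′ = l′} p C C′ = Meet-across fW inW (+ l′)
      (λ v z → ℤ.≤-trans (CellBounds.W-hi (cell-bounds C v z)) (q-mono p)) (λ v z → CellBounds.W-lo (cell-bounds C′ v z))
      (cell-FacetStdAt C fW (+ l′)) (cell-FacetStdAt C′ fW (+ l′))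

    Meet-X : ∀ {c i l last c′ i′ l′ last′ S S′} → c ℕ.< c′ → last ≡ false → InCell c i l last S → InCell c′ i′ l′ last′ S′ → Meet (Vert S) (Vert S′)
    Meet-X {c′ = c′} p e C C′ = Meet-across fX inX (+ c′)
      (λ v z → ℤ.≤-trans (CellBounds.X-hi (cell-bounds C v z) e) (q-mono p)) (λ v z → CellBounds.X-lo (cell-bounds C′ v z))
      (cell-FacetStdAt C fX (+ c′)) (cell-FacetStdAt C′ fX (+ c′))

  -- Y and w are compared before X: a truncated cell extends beyond `X = c + 1`, so the planes
  -- `X = c` separate only within one column.
  Meet-cells : ∀ {S S′} → AnyCell S → AnyCell S′ → Meet (Vert S) (Vert S′)
  Meet-cells (anyCell {c} {i} {l} {la} _ _ P C) (anyCell {c′} {i′} {l′} {la′} _ _ P′ C′) with ℕ.<-cmp i i′ | ℕ.<-cmp l l′ | ℕ.<-cmp c c′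
  ... | tri< p _ _ | _ | _ = Meet-Y p C C′
  ... | tri> _ _ p | _ | _ = Meet-sym (Meet-Y p C′ C)
  ... | tri≈ _ _ _ | tri< p _ _ | _ = Meet-W p C C′
  ... | tri≈ _ _ _ | tri> _ _ p | _ = Meet-sym (Meet-W p C′ C)
  ... | tri≈ _ refl _ | tri≈ _ refl _ | tri< p _ _ = Meet-X p (not-last {c} {c′} {i} {l} p P P′) C C′
  ... | tri≈ _ refl _ | tri≈ _ refl _ | tri> _ _ p = Meet-sym (Meet-X p (not-last {c′} {c} {i} {l} p P′ P) C′ C)
  ... | tri≈ _ refl _ | tri≈ _ refl _ | tri≈ _ refl _ with same-last {c} {i} {l} P P′
  ... | refl = Meet-same-cell C C′

  listCell : ℕ → ℕ → ℕ → Bool → List (Fin 4 → Pt)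
  listCell c i l last = map (λ S j → η (origin c i l) +Z S j) (listHC true last) ++ map (λ S j → η (center c i l) -Z S j) (listHC (not last) false)

  -- The index c runs over all numbers below k in every column; positions behind the truncated cell
  -- contribute nothing.
  block : ℕ → ℕ → ℕ → List (Fin 4 → Pt)
  block i l c with c ℕ.+ (i ℕ.+ l) ℕ.+ 2 ℕ.≟ k | c ℕ.+ (i ℕ.+ l) ℕ.+ 3 ℕ.≤? k
  ... | yes _ | _     = listCell c i l true
  ... | no _  | yes _ = listCell c i l false
  ... | no _  | no _  = []

  column : ℕ → ℕ → List (Fin 4 → Pt)
  column i l = concatMap (block i l) (upTo k)

  row : ℕ → List (Fin 4 → Pt)
  row i = concatMap (column i) (upTo k₂)

  cells : List (Fin 4 → Pt)
  cells = concatMap row (upTo k₁)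

  private
    listCell-sound : ∀ c i l last {S} → S ∈ listCell c i l last → InCell c i l last S
    listCell-sound c i l last S∈ with ∈-++⁻ (map (λ S j → η (origin c i l) +Z S j) (listHC true last)) S∈
    ... | inj₁ m with ∈-map⁻ (λ S j → η (origin c i l) +Z S j) m
    ...   | S , S∈′ , refl = low (listHC-sound true last S∈′)
    listCell-sound c i l last S∈ | inj₂ m with ∈-map⁻ (λ S j → η (center c i l) -Z S j) m
    ...   | S , S∈′ , refl = up (listHC-sound (not last) false S∈′)

    listCell-complete : ∀ {c i l last S} → InCell c i l last S → S ∈ listCell c i l last
    listCell-complete {c} {i} {l} (low h) = ∈-++⁺ˡ (∈-map⁺ (λ S j → η (origin c i l) +Z S j) (listHC-complete h))
    listCell-complete {c} {i} {l} {last} (up h) = ∈-++⁺ʳ (map (λ S j → η (origin c i l) +Z S j) (listHC true last)) (∈-map⁺ (λ S j → η (center c i l) -Z S j) (listHC-complete h))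

    block-sound : ∀ i l c {S} → i ℕ.< k₁ → l ℕ.< k₂ → S ∈ block i l c → AnyCell S
    block-sound i l c p p′ S∈ with c ℕ.+ (i ℕ.+ l) ℕ.+ 2 ℕ.≟ k | c ℕ.+ (i ℕ.+ l) ℕ.+ 3 ℕ.≤? k
    ... | yes e | _     = anyCell p p′ (inj₁ (refl , e)) (listCell-sound c i l true S∈)
    ... | no _  | yes e = anyCell p p′ (inj₂ (refl , e)) (listCell-sound c i l false S∈)
    ... | no _  | no _  with S∈
    ... | ()

    block-complete : ∀ {i l c last S} → Position c i l last → InCell c i l last S → S ∈ block i l c
    block-complete {i} {l} {c} P C with c ℕ.+ (i ℕ.+ l) ℕ.+ 2 ℕ.≟ k | c ℕ.+ (i ℕ.+ l) ℕ.+ 3 ℕ.≤? k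
    block-complete (inj₁ (refl , e)) C | yes _ | _ = listCell-complete C
    block-complete (inj₂ (refl , p)) C | no _ | yes _ = listCell-complete C
    block-complete (inj₁ (_ , e)) C | no ¬e | _ = ⊥-elim (¬e e)
    block-complete (inj₂ (_ , p)) C | no _ | no ¬p = ⊥-elim (¬p p)
    block-complete {i} {l} {c} (inj₂ (_ , p)) C | yes e | _ = ⊥-elim (ℕ.<-irrefl e (ℕ.<-≤-trans (ℕ.+-monoʳ-< (c ℕ.+ (i ℕ.+ l)) (ℕ.n<1+n 2)) p))

  cells-sound : ∀ {S} → S ∈ cells → AnyCell S
  cells-sound S∈ with find (∈-concatMap⁻ row {xs = upTo k₁} S∈)
  ... | i , i∈ , S∈₁ with find (∈-concatMap⁻ (column i) {xs = upTo k₂} S∈₁)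
  ... | l , l∈ , S∈₂ with find (∈-concatMap⁻ (block i l) {xs = upTo k} S∈₂)
  ... | c , c∈ , S∈₃ = block-sound i l c (∈-upTo⁻ i∈) (∈-upTo⁻ l∈) S∈₃

  cells-complete : ∀ {S} → AnyCell S → S ∈ cells
  cells-complete (anyCell {c} {i} {l} p p′ P C) = ∈-concatMap⁺ row (lose (∈-upTo⁺ p) (∈-concatMap⁺ (column i) (lose (∈-upTo⁺ p′)
    (∈-concatMap⁺ (block i l) (lose (∈-upTo⁺ c<k) (block-complete P C))))))
    where
    c<k : c ℕ.< k
    c<k = ℕ.≤-trans (ℕ.≤-trans (ℕ.≤-reflexive (ℕ.+-comm 1 c)) (ℕ.≤-trans (ℕ.+-mono-≤ (ℕ.m≤m+n c (i ℕ.+ l)) (s≤s z≤n)) ℕ.≤-refl)) (pos-≤ {c} {i} {l} P)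

  private
    form-unshift : ∀ f w v → form f (v -Z η w) ≡ form f v - + q * corner-form f w
    form-unshift f w v = trans (form-- f v (η w)) (cong (λ z → form f v - z) (form-η f w))

    cover-low : ∀ c i l last → ws ⊩ (λ v → form fY v - + q * + i) → ws ⊩ (λ v → form fW v - + q * + l) → ws ⊩ (λ v → form fX v - + q * + c) →
      ws ⊩ (λ v → + i + + l + 1ℤ - level v) →
      (last ≡ true → ws ⊩ (λ v → + q * (+ c + (+ i + + l) + + 2) - form fU v)) → (last ≡ false → ws ⊩ (λ v → + q * (+ c + 1ℤ) - form fX v)) →
      ∃ λ S → InCell c i l last S × Covers S ws
    cover-low {ws = ws} c i l last Y₁ W₁ X₁ Z U X₂ = wrap (cover-HC true last
        (⊩-map h (⊩-cong (λ v → trans (sym (lo0 (h v))) (form-unshift fY o v)) Y₁))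
        (⊩-map h (⊩-cong (λ v → trans (form-unshift fW o v) (cong (λ z → form fW v - + q * z) (eqW (+ i) (+ l)))) W₁))
        (⊩-map h (⊩-cong (λ v → eqZ (+ i + + l) (level v)) Z))
        (⊩-map h (⊩-cong (λ v → trans (ch-X 0ℤ (h v)) (trans (eq₀ (X (h v)) (+ q) (level (h v))) (form-unshift fX o v))) X₁))
        (⊩-map h (right′ last U X₂)))
      where
      o = origin c i l
      h : Pt → Pt
      h = _-Z η o
      wrap : (∃ λ S → HC true last S × Covers S (pushforward h ws)) → ∃ λ S → InCell c i l last S × Covers S ws
      wrap (S , hc , C) = (λ j → η o +Z S j) , low hc , Covers-map {g = η o +Z_} {h = h} (shift-aff (η o)) (unshift-aff (η o)) (shift-unshift (η o)) C
      eqW : ∀ i l → i + l - i ≡ l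
      eqW = solve-∀
      eqZ : ∀ a z → 1ℤ - (z - a) ≡ a + 1ℤ - z
      eqZ = solve-∀
      eq₀ : ∀ x q z → x - q * (0ℤ * (1ℤ - z)) ≡ x
      eq₀ = solve-∀
      right′ : ∀ last → (last ≡ true → ws ⊩ (λ v → + q * (+ c + (+ i + + l) + + 2) - form fU v)) → (last ≡ false → ws ⊩ (λ v → + q * (+ c + 1ℤ) - form fX v)) →
        ws ⊩ (λ v → ch 0 q (a₀ last) (ρ (h v)))
      right′ true U _ = ⊩-cong (λ v → trans (ch-X 0ℤ (ρ (h v))) (trans (eq₀ (X (ρ (h v))) (+ q) (level (h v)))
          (trans (X-ρ (h v)) (trans (cong (λ z → + q * + 2 - z) (form-unshift fU o v)) (eq (+ q) (+ c) (+ i + + l) (form fU v)))))) (U refl)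
        where
        eq : ∀ q c a u → q * + 2 - (u - q * (c + a)) ≡ q * (c + a + + 2) - u
        eq = solve-∀
      right′ false _ X₂ = ⊩-cong (λ v → trans (ch-X 1ℤ (ρ (h v))) (trans (cong (λ z → z - + q * (1ℤ * (1ℤ - level (h v)))) (X-ρ (h v)))
          (trans (eq₁ (+ q) (X (h v)) (level (h v))) (trans (cong (λ z → + q - z) (form-unshift fX o v)) (eq₂ (+ q) (+ c) (X v)))))) (X₂ refl)
        where
        eq₁ : ∀ q x z → q * + 2 - (x + q * z) - q * (1ℤ * (1ℤ - z)) ≡ q - x
        eq₁ = solve-∀
        eq₂ : ∀ q c x → q - (x - q * c) ≡ q * (c + 1ℤ) - x
        eq₂ = solve-∀

    cover-up : ∀ c i l last → ws ⊩ (λ v → + q * (+ i + 1ℤ) - form fY v) → ws ⊩ (λ v → + q * (+ l + 1ℤ) - form fW v) → ws ⊩ (λ v → form fX v - + q * + c) →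
      ws ⊩ (λ v → - (+ i + + l + 1ℤ - level v)) →
      (last ≡ true → ws ⊩ (λ v → + q * (+ c + (+ i + + l) + + 2) - form fU v)) → (last ≡ false → ws ⊩ (λ v → + q * (+ c + 1ℤ) - form fX v)) →
      ∃ λ S → InCell c i l last S × Covers S ws
    cover-up {ws = ws} c i l last Y₂ W₂ X₁ Z U X₂ = wrap (cover-HC (not last) false
        (⊩-map h (⊩-cong (λ v → trans (sym (lo0 (h v))) (form-flip fY o v)) Y₂))
        (⊩-map h (⊩-cong (λ v → trans (form-flip fW o v) (cong (λ z → + q * z - form fW v) (eqW (+ i) (+ l)))) W₂))
        (⊩-map h (⊩-cong (λ v → eqZ (+ i + + l) (level v)) Z))
        (⊩-map h (left′ last U X₂))
        (⊩-map h (⊩-cong (λ v → trans (ch-X 1ℤ (ρ (h v))) (trans (cong (λ z → z - + q * (1ℤ * (1ℤ - level (h v)))) (X-ρ (h v)))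
          (trans (eq₁ (+ q) (X (h v)) (level (h v))) (trans (cong (λ z → + q - z) (form-flip fX o v)) (eq₂ (+ q) (+ c) (X v)))))) X₁)))
      where
      o = center c i l
      h : Pt → Pt
      h = η o -Z_
      wrap : (∃ λ S → HC (not last) false S × Covers S (pushforward h ws)) → ∃ λ S → InCell c i l last S × Covers S ws
      wrap (S , hc , C) = (λ j → η o -Z S j) , up hc , Covers-map {g = η o -Z_} {h = h} (flip-aff (η o)) (flip-aff (η o)) (flip-flip (η o)) C
      eqW : ∀ i l → i + l + + 2 - (i + 1ℤ) ≡ l + 1ℤ
      eqW = solve-∀
      eqZ : ∀ a z → 1ℤ - (a + + 2 - z) ≡ - (a + 1ℤ - z)
      eqZ = solve-∀
      eq₀ : ∀ x q z → x - q * (0ℤ * (1ℤ - z)) ≡ x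
      eq₀ = solve-∀
      eq₁ : ∀ q x z → q * + 2 - (x + q * z) - q * (1ℤ * (1ℤ - z)) ≡ q - x
      eq₁ = solve-∀
      eq₂ : ∀ q c x → q - (q * (c + 1ℤ) - x) ≡ x - q * c
      eq₂ = solve-∀
      left′ : ∀ last → (last ≡ true → ws ⊩ (λ v → + q * (+ c + (+ i + + l) + + 2) - form fU v)) → (last ≡ false → ws ⊩ (λ v → + q * (+ c + 1ℤ) - form fX v)) →
        ws ⊩ (λ v → ch 0 q (a₀ (not last)) (h v))
      left′ true U _ = ⊩-cong (λ v → trans (ch-X 1ℤ (h v)) (trans (eq₃ (+ q) (X (h v)) (level (h v)))
          (trans (cong (λ z → z - + q) (form-flip fU o v)) (eq₄ (+ q) (+ c) (+ i + + l) (form fU v))))) (U refl)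
        where
        eq₃ : ∀ q x z → x - q * (1ℤ * (1ℤ - z)) ≡ x + q * z - q
        eq₃ = solve-∀
        eq₄ : ∀ q c a u → q * (c + 1ℤ + (a + + 2)) - u - q ≡ q * (c + a + + 2) - u
        eq₄ = solve-∀
      left′ false _ X₂ = ⊩-cong (λ v → trans (ch-X 0ℤ (h v)) (trans (eq₀ (X (h v)) (+ q) (level (h v))) (form-flip fX o v))) (X₂ refl)

  cover-cell : ∀ c i l last → ws ⊩ (λ v → form fY v - + q * + i) → ws ⊩ (λ v → + q * (+ i + 1ℤ) - form fY v) →
    ws ⊩ (λ v → form fW v - + q * + l) → ws ⊩ (λ v → + q * (+ l + 1ℤ) - form fW v) → ws ⊩ (λ v → form fX v - + q * + c) →
    (last ≡ true → ws ⊩ (λ v → + q * (+ c + (+ i + + l) + + 2) - form fU v)) → (last ≡ false → ws ⊩ (λ v → + q * (+ c + 1ℤ) - form fX v)) →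
    ∃ λ S → InCell c i l last S × Covers S ws
  cover-cell {ws = ws} c i l last Y₁ Y₂ W₁ W₂ X₁ U X₂ with ⊩-total ws (λ v → + i + + l + 1ℤ - level v)
  ... | inj₁ Z = cover-low c i l last Y₁ W₁ X₁ Z U X₂
  ... | inj₂ Z = cover-up c i l last Y₂ W₂ X₁ Z U X₂

  private
    zero-form : ∀ f v → form f v - + q * 0ℤ ≡ form f v
    zero-form f v = trans (cong (λ z → form f v - z) (ℤ.*-zeroʳ (+ q))) (ℤ.+-identityʳ (form f v))

    next : ∀ q x a → q * (a + 1ℤ) - x ≡ - (x - q * (1ℤ + a))
    next = solve-∀

    slab : ∀ f n → 0 ℕ.< n → ws ⊩ form f → ws ⊩ (λ v → + q * + n - form f v) →
      ∃ λ i → i ℕ.< n × ws ⊩ (λ v → form f v - + q * + i) × ws ⊩ (λ v → + q * (+ i + 1ℤ) - form f v)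
    slab {ws = ws} f (suc n) _ p p′ = go (locate-form (λ i v → form f v - + q * + i) n (⊩-cong (zero-form f) p) (⊩-cong (λ v → eq (form f v) (+ q * + suc n)) p′))
      where
      eq : ∀ x a → - (x - a) ≡ a - x
      eq = solve-∀
      go : (∃ λ i → i ℕ.≤ n × ws ⊩ (λ v → form f v - + q * + i) × ws ⊩ (λ v → - (form f v - + q * + suc i))) →
        ∃ λ i → i ℕ.< suc n × ws ⊩ (λ v → form f v - + q * + i) × ws ⊩ (λ v → + q * (+ i + 1ℤ) - form f v)
      go (i , i≤n , a , b) = i , s≤s i≤n , a , ⊩-cong (λ v → next (+ q) (form f v) (+ i)) b

  cover-cells : 0 ℕ.< k₁ → 0 ℕ.< k₂ → ws ⊩ form fX → ws ⊩ form fY → ws ⊩ form fW → ws ⊩ (λ v → + q * + k - form fU v) →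
    ws ⊩ (λ v → + q * + k₁ - form fY v) → ws ⊩ (λ v → + q * + k₂ - form fW v) → ∃ λ S → AnyCell S × Covers S ws
  cover-cells {ws = ws} k₁>0 k₂>0 Xp Yp Wp Up Yk Wk = go₁ (slab fY k₁ k₁>0 Yp Yk) (slab fW k₂ k₂>0 Wp Wk)
    where
    go₁ : (∃ λ i → i ℕ.< k₁ × ws ⊩ (λ v → form fY v - + q * + i) × ws ⊩ (λ v → + q * (+ i + 1ℤ) - form fY v)) →
          (∃ λ l → l ℕ.< k₂ × ws ⊩ (λ v → form fW v - + q * + l) × ws ⊩ (λ v → + q * (+ l + 1ℤ) - form fW v)) →
          ∃ λ S → AnyCell S × Covers S ws
    -- This number is the index of the truncated cell of the column. The subtraction is exact since
    -- i < k₁ and l < k₂.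
    go₁ (i , i<k₁ , Y₁ , Y₂) (l , l<k₂ , W₁ , W₂) = go₂ (k ℕ.∸ (i ℕ.+ l ℕ.+ 2)) eqn
      where
      room : i ℕ.+ l ℕ.+ 2 ℕ.≤ k
      room = ℕ.≤-trans (ℕ.≤-reflexive (trans (ℕ.+-comm (i ℕ.+ l) 2) (cong suc (sym (ℕ.+-suc i l))))) (ℕ.+-mono-≤ i<k₁ l<k₂)
      eqn : k ℕ.∸ (i ℕ.+ l ℕ.+ 2) ℕ.+ (i ℕ.+ l) ℕ.+ 2 ≡ k
      eqn = trans (ℕ.+-assoc (k ℕ.∸ (i ℕ.+ l ℕ.+ 2)) (i ℕ.+ l) 2) (ℕ.m∸n+n≡m room)
      wrap : ∀ {c last} → Position c i l last → (∃ λ S → InCell c i l last S × Covers S ws) → ∃ λ S → AnyCell S × Covers S ws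
      wrap P (S , C , cov) = S , anyCell i<k₁ l<k₂ P C , cov
      final : ∀ n → n ℕ.+ (i ℕ.+ l) ℕ.+ 2 ≡ k → ws ⊩ (λ v → form fX v - + q * + n) → ∃ λ S → AnyCell S × Covers S ws
      final n e p = wrap {n} {true} (inj₁ (refl , e)) (cover-cell n i l true Y₁ Y₂ W₁ W₂ p
        (λ _ → ⊩-cong (λ v → cong (λ m → + q * + m - form fU v) e) Up) (λ ()))
      go₂ : ∀ n → n ℕ.+ (i ℕ.+ l) ℕ.+ 2 ≡ k → ∃ λ S → AnyCell S × Covers S ws
      go₂ zero e = final zero e (⊩-cong (zero-form fX) Xp)
      go₂ (suc n) e with ⊩-total ws (λ v → form fX v - + q * + suc n)
      ... | inj₁ p = final (suc n) e p
      ... | inj₂ p = go₃ (slab fX (suc n) (s≤s z≤n) Xp (⊩-cong (λ v → rev (form fX v) (+ q * + suc n)) p))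
        where
        rev : ∀ x a → a - x ≡ - (x - a)
        rev = solve-∀
        go₃ : (∃ λ c → c ℕ.< suc n × ws ⊩ (λ v → form fX v - + q * + c) × ws ⊩ (λ v → + q * (+ c + 1ℤ) - form fX v)) → ∃ λ S → AnyCell S × Covers S ws
        go₃ (c , c<n , X₁ , X₂) = wrap {c} {false} (inj₂ (refl , le)) (cover-cell c i l false Y₁ Y₂ W₁ W₂ X₁ (λ ()) (λ _ → X₂))
          where
          le : c ℕ.+ (i ℕ.+ l) ℕ.+ 3 ℕ.≤ k
          le = ℕ.≤-trans (ℕ.≤-reflexive (ℕ.+-suc (c ℕ.+ (i ℕ.+ l)) 2)) (ℕ.≤-trans (ℕ.+-monoˡ-≤ 2 (ℕ.+-monoˡ-≤ (i ℕ.+ l) c<n)) (ℕ.≤-reflexive e))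

-- Primitive edges

det3 : Pt → Pt → Pt → ℤ
det3 (a₁ , a₂ , a₃) (b₁ , b₂ , b₃) (c₁ , c₂ , c₃) = a₁ * (b₂ * c₃ - b₃ * c₂) - a₂ * (b₁ * c₃ - b₃ * c₁) + a₃ * (b₁ * c₂ - b₂ * c₁)

lin3 : Pt → Pt → Pt → Pt → Pt
lin3 (a , b , c) (u₁ , u₂ , u₃) (v₁ , v₂ , v₃) (w₁ , w₂ , w₃) = a * u₁ + (b * v₁ + c * w₁) , a * u₂ + (b * v₂ + c * w₂) , a * u₃ + (b * v₃ + c * w₃)

det3-mult : ∀ A B C u v w → det3 (lin3 A u v w) (lin3 B u v w) (lin3 C u v w) ≡ det3 A B C * det3 u v w
det3-mult (a₁ , a₂ , a₃) (b₁ , b₂ , b₃) (c₁ , c₂ , c₃) (u₁ , u₂ , u₃) (v₁ , v₂ , v₃) (w₁ , w₂ , w₃) =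
    eq a₁ a₂ a₃ b₁ b₂ b₃ c₁ c₂ c₃ u₁ u₂ u₃ v₁ v₂ v₃ w₁ w₂ w₃
  where
  eq : ∀ a₁ a₂ a₃ b₁ b₂ b₃ c₁ c₂ c₃ u₁ u₂ u₃ v₁ v₂ v₃ w₁ w₂ w₃ →
    (a₁ * u₁ + (a₂ * v₁ + a₃ * w₁)) * ((b₁ * u₂ + (b₂ * v₂ + b₃ * w₂)) * (c₁ * u₃ + (c₂ * v₃ + c₃ * w₃)) - (b₁ * u₃ + (b₂ * v₃ + b₃ * w₃)) * (c₁ * u₂ + (c₂ * v₂ + c₃ * w₂)))
    - (a₁ * u₂ + (a₂ * v₂ + a₃ * w₂)) * ((b₁ * u₁ + (b₂ * v₁ + b₃ * w₁)) * (c₁ * u₃ + (c₂ * v₃ + c₃ * w₃)) - (b₁ * u₃ + (b₂ * v₃ + b₃ * w₃)) * (c₁ * u₁ + (c₂ * v₁ + c₃ * w₁)))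
    + (a₁ * u₃ + (a₂ * v₃ + a₃ * w₃)) * ((b₁ * u₁ + (b₂ * v₁ + b₃ * w₁)) * (c₁ * u₂ + (c₂ * v₂ + c₃ * w₂)) - (b₁ * u₂ + (b₂ * v₂ + b₃ * w₂)) * (c₁ * u₁ + (c₂ * v₁ + c₃ * w₁)))
    ≡ (a₁ * (b₂ * c₃ - b₃ * c₂) - a₂ * (b₁ * c₃ - b₃ * c₁) + a₃ * (b₁ * c₂ - b₂ * c₁)) * (u₁ * (v₂ * w₃ - v₃ * w₂) - u₂ * (v₁ * w₃ - v₃ * w₁) + u₃ * (v₁ * w₂ - v₂ * w₁))
  eq = solve-∀

Span : (Fin 4 → Pt) → Set
Span S = ∀ w → Σ (Fin 4 → ℤ) λ c → total4 c ≡ 1ℤ × comb S c ≡ w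

private
  diff-coord : ∀ c₀ c₁ c₂ c₃ d₀ d₁ d₂ d₃ s₀ s₁ s₂ s₃ → c₀ + (c₁ + (c₂ + c₃)) ≡ 1ℤ → d₀ + (d₁ + (d₂ + d₃)) ≡ 1ℤ →
    (c₁ - d₁) * (s₁ - s₀) + ((c₂ - d₂) * (s₂ - s₀) + (c₃ - d₃) * (s₃ - s₀)) ≡
    (c₀ * s₀ + (c₁ * s₁ + (c₂ * s₂ + c₃ * s₃))) - (d₀ * s₀ + (d₁ * s₁ + (d₂ * s₂ + d₃ * s₃)))
  diff-coord c₀ c₁ c₂ c₃ d₀ d₁ d₂ d₃ s₀ s₁ s₂ s₃ p p′ = trans (eq c₀ c₁ c₂ c₃ d₀ d₁ d₂ d₃ s₀ s₁ s₂ s₃)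
      (trans (cong₂ (λ x y → (c₀ * s₀ + (c₁ * s₁ + (c₂ * s₂ + c₃ * s₃))) - (d₀ * s₀ + (d₁ * s₁ + (d₂ * s₂ + d₃ * s₃))) - (x - y) * s₀) p p′)
             (eq₂ ((c₀ * s₀ + (c₁ * s₁ + (c₂ * s₂ + c₃ * s₃))) - (d₀ * s₀ + (d₁ * s₁ + (d₂ * s₂ + d₃ * s₃)))) s₀))
    where
    eq : ∀ c₀ c₁ c₂ c₃ d₀ d₁ d₂ d₃ s₀ s₁ s₂ s₃ → (c₁ - d₁) * (s₁ - s₀) + ((c₂ - d₂) * (s₂ - s₀) + (c₃ - d₃) * (s₃ - s₀)) ≡
      (c₀ * s₀ + (c₁ * s₁ + (c₂ * s₂ + c₃ * s₃))) - (d₀ * s₀ + (d₁ * s₁ + (d₂ * s₂ + d₃ * s₃))) - (c₀ + (c₁ + (c₂ + c₃)) - (d₀ + (d₁ + (d₂ + d₃)))) * s₀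
    eq = solve-∀
    eq₂ : ∀ a s → a - (1ℤ - 1ℤ) * s ≡ a
    eq₂ = solve-∀

  unit-factor : ∀ n m → n * m ≡ 1ℤ → n ≡ 1ℤ ⊎ n ≡ - 1ℤ
  unit-factor n m e with ℕ.m*n≡1⇒m≡1 ∣ n ∣ ∣ m ∣ (trans (sym (ℤ.∣i*j∣≡∣i∣*∣j∣ n m)) (cong ∣_∣ e))
  unit-factor (+ .1) m e | refl = inj₁ refl
  unit-factor -[1+ zero ] m e | _ = inj₂ refl

-- The edge vectors D of a spanning simplex satisfy A D = 1 for an integral A, and n divides det D.
primitive-first : ∀ S n e → Span S → S i1 -Z S i0 ≡ n ·Z e → n ≡ 1ℤ ⊎ n ≡ - 1ℤ
primitive-first S n e@(e₁ , e₂ , e₃) sp h = unit-factor n (m * det3 e D₂ D₃) (trans (assoc n m (det3 e D₂ D₃)) (trans (cong (m *_) (sym detD)) (trans (sym (det3-mult (row u₁) (row u₂) (row u₃) D₁ D₂ D₃)) identity)))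
  where
  D₁ = S i1 -Z S i0
  D₂ = S i2 -Z S i0
  D₃ = S i3 -Z S i0
  z : Fin 4 → ℤ
  z = proj₁ (sp (0ℤ , 0ℤ , 0ℤ))
  u₁ u₂ u₃ : Pt
  u₁ = 1ℤ , 0ℤ , 0ℤ
  u₂ = 0ℤ , 1ℤ , 0ℤ
  u₃ = 0ℤ , 0ℤ , 1ℤ
  row : Pt → Pt
  row w = proj₁ (sp w) i1 - z i1 , proj₁ (sp w) i2 - z i2 , proj₁ (sp w) i3 - z i3
  spans : ∀ w → lin3 (row w) D₁ D₂ D₃ ≡ w -Z (0ℤ , 0ℤ , 0ℤ)
  spans w = Pt-≡ (trans (go′ (λ i → proj₁ (S i))) (cong₂ _-_ (cong proj₁ E₁) (cong proj₁ E₀)))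
                 (trans (go′ (λ i → proj₁ (proj₂ (S i)))) (cong₂ _-_ (cong pr₂ E₁) (cong pr₂ E₀)))
                 (trans (go′ (λ i → proj₂ (proj₂ (S i)))) (cong₂ _-_ (cong pr₃ E₁) (cong pr₃ E₀)))
    where
    c = proj₁ (sp w)
    go′ : ∀ (s : Fin 4 → ℤ) → (c i1 - z i1) * (s i1 - s i0) + ((c i2 - z i2) * (s i2 - s i0) + (c i3 - z i3) * (s i3 - s i0)) ≡
      total4 (λ i → c i * s i) - total4 (λ i → z i * s i)
    go′ s = diff-coord (c i0) (c i1) (c i2) (c i3) (z i0) (z i1) (z i2) (z i3) (s i0) (s i1) (s i2) (s i3) (proj₁ (proj₂ (sp w))) (proj₁ (proj₂ (sp (0ℤ , 0ℤ , 0ℤ))))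
    E₁ = proj₂ (proj₂ (sp w))
    E₀ = proj₂ (proj₂ (sp (0ℤ , 0ℤ , 0ℤ)))
  m = det3 (row u₁) (row u₂) (row u₃)
  identity : det3 (lin3 (row u₁) D₁ D₂ D₃) (lin3 (row u₂) D₁ D₂ D₃) (lin3 (row u₃) D₁ D₂ D₃) ≡ 1ℤ
  identity = trans (cong₂ (λ a f → f a) (spans u₁) (cong₂ (λ b c a → det3 a b c) (spans u₂) (spans u₃))) refl
  detD : det3 D₁ D₂ D₃ ≡ n * det3 e D₂ D₃
  detD = trans (cong (λ d → det3 d D₂ D₃) h) (eq n e₁ e₂ e₃ (proj₁ D₂) (proj₁ (proj₂ D₂)) (proj₂ (proj₂ D₂)) (proj₁ D₃) (proj₁ (proj₂ D₃)) (proj₂ (proj₂ D₃)))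
    where
    eq : ∀ n e₁ e₂ e₃ b₁ b₂ b₃ c₁ c₂ c₃ → n * e₁ * (b₂ * c₃ - b₃ * c₂) - n * e₂ * (b₁ * c₃ - b₃ * c₁) + n * e₃ * (b₁ * c₂ - b₂ * c₁) ≡
      n * (e₁ * (b₂ * c₃ - b₃ * c₂) - e₂ * (b₁ * c₃ - b₃ * c₁) + e₃ * (b₁ * c₂ - b₂ * c₁))
    eq = solve-∀
  assoc : ∀ n m d → n * (m * d) ≡ m * (n * d)
  assoc = solve-∀

private
  permuted : ∀ {S} (π : Fin 4 → Fin 4) → (∀ f → total4 (λ i → f (π i)) ≡ total4 f) → Span S → Span (λ i → S (π i))
  permuted {S} π h sp w = (λ i → proj₁ (sp w) (π i)) , trans (h (proj₁ (sp w))) (proj₁ (proj₂ (sp w))) ,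
    trans (Pt-≡ (h (λ i → proj₁ (sp w) i * proj₁ (S i))) (h (λ i → proj₁ (sp w) i * proj₁ (proj₂ (S i)))) (h (λ i → proj₁ (sp w) i * proj₂ (proj₂ (S i))))) (proj₂ (proj₂ (sp w)))

  -- Spanning does not depend on the order of the vertices, so a permutation moves the edge from a
  -- to b to the front.
  primitive-via : ∀ S n e c d a b → (∀ f → f a + (f b + (f c + f d)) ≡ total4 f) → Span S → S b -Z S a ≡ n ·Z e → n ≡ 1ℤ ⊎ n ≡ - 1ℤ
  primitive-via S n e c d a b h sp = primitive-first (λ i → S (fin4 a b c d i)) n e (permuted {S} (fin4 a b c d) h sp)

  perm₁ : ∀ a b c d → a + (c + (b + d)) ≡ a + (b + (c + d))
  perm₁ = solve-∀
  perm₂ : ∀ a b c d → a + (d + (b + c)) ≡ a + (b + (c + d))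
  perm₂ = solve-∀
  perm₃ : ∀ a b c d → b + (a + (c + d)) ≡ a + (b + (c + d))
  perm₃ = solve-∀
  perm₄ : ∀ a b c d → b + (c + (a + d)) ≡ a + (b + (c + d))
  perm₄ = solve-∀
  perm₅ : ∀ a b c d → b + (d + (a + c)) ≡ a + (b + (c + d))
  perm₅ = solve-∀
  perm₆ : ∀ a b c d → c + (a + (b + d)) ≡ a + (b + (c + d))
  perm₆ = solve-∀
  perm₇ : ∀ a b c d → c + (b + (a + d)) ≡ a + (b + (c + d))
  perm₇ = solve-∀
  perm₈ : ∀ a b c d → c + (d + (a + b)) ≡ a + (b + (c + d))
  perm₈ = solve-∀
  perm₉ : ∀ a b c d → d + (a + (b + c)) ≡ a + (b + (c + d))
  perm₉ = solve-∀
  perm₁₀ : ∀ a b c d → d + (b + (a + c)) ≡ a + (b + (c + d))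
  perm₁₀ = solve-∀
  perm₁₁ : ∀ a b c d → d + (c + (a + b)) ≡ a + (b + (c + d))
  perm₁₁ = solve-∀

primitive-edge : ∀ S n e a b → a ≢ b → Span S → S b -Z S a ≡ n ·Z e → n ≡ 1ℤ ⊎ n ≡ - 1ℤ
primitive-edge S n e i0 i0 ne sp = ⊥-elim (ne refl)
primitive-edge S n e i0 i1 ne sp = primitive-first S n e sp
primitive-edge S n e i0 i2 ne sp = primitive-via S n e i1 i3 i0 i2 (λ f → perm₁ (f i0) (f i1) (f i2) (f i3)) sp
primitive-edge S n e i0 i3 ne sp = primitive-via S n e i1 i2 i0 i3 (λ f → perm₂ (f i0) (f i1) (f i2) (f i3)) sp
primitive-edge S n e i1 i0 ne sp = primitive-via S n e i2 i3 i1 i0 (λ f → perm₃ (f i0) (f i1) (f i2) (f i3)) sp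
primitive-edge S n e i1 i1 ne sp = ⊥-elim (ne refl)
primitive-edge S n e i1 i2 ne sp = primitive-via S n e i0 i3 i1 i2 (λ f → perm₄ (f i0) (f i1) (f i2) (f i3)) sp
primitive-edge S n e i1 i3 ne sp = primitive-via S n e i0 i2 i1 i3 (λ f → perm₅ (f i0) (f i1) (f i2) (f i3)) sp
primitive-edge S n e i2 i0 ne sp = primitive-via S n e i1 i3 i2 i0 (λ f → perm₆ (f i0) (f i1) (f i2) (f i3)) sp
primitive-edge S n e i2 i1 ne sp = primitive-via S n e i0 i3 i2 i1 (λ f → perm₇ (f i0) (f i1) (f i2) (f i3)) sp
primitive-edge S n e i2 i2 ne sp = ⊥-elim (ne refl)
primitive-edge S n e i2 i3 ne sp = primitive-via S n e i0 i1 i2 i3 (λ f → perm₈ (f i0) (f i1) (f i2) (f i3)) sp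
primitive-edge S n e i3 i0 ne sp = primitive-via S n e i1 i2 i3 i0 (λ f → perm₉ (f i0) (f i1) (f i2) (f i3)) sp
primitive-edge S n e i3 i1 ne sp = primitive-via S n e i0 i2 i3 i1 (λ f → perm₁₀ (f i0) (f i1) (f i2) (f i3)) sp
primitive-edge S n e i3 i2 ne sp = primitive-via S n e i0 i1 i3 i2 (λ f → perm₁₁ (f i0) (f i1) (f i2) (f i3)) sp
primitive-edge S n e i3 i3 ne sp = ⊥-elim (ne refl)

-- From measures on lattice coordinates to rational convex hulls

module Interface (p : ℤ) (q : ℕ) .{{_ : NonZero q}} (chain : Chain (p′ p q) q) where
  open Chain chain
  open Strip chain
  open Path chain using (level; hi)
  open Coverage chain
  open Facets chain
  open Placement chain

  private
    r : ℕ
    r = p′ p q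

  -- An isomorphism from integer triples to the given lattice: substituting `x = r y - q t` turns
  -- the congruence between x and y into a free parameter t.
  ψ : Pt → Pt
  ψ v@(y , t , z) = X v , y , z

  ψ-aff : AffMap ψ
  ψ-aff = aff-X , aff-1 , aff-3

  ψ-+ : ∀ u v → ψ (u +Z v) ≡ ψ u +Z ψ v
  ψ-+ u v = Pt-≡ (form-+ fX u v) refl refl

  ψ-injective : ∀ {u v} → ψ u ≡ ψ v → u ≡ v
  ψ-injective {y , t , z} {y′ , t′ , z′} e = Pt-≡ ey (q-cancel (ℤ.neg-injective (+-cancelˡ (+ r * y) (trans (cong proj₁ e) (cong (λ s → + r * s - + q * t′) (sym ey)))))) (cong pr₃ e)
    where
    ey : y ≡ y′
    ey = cong pr₂ e

  ψ∈Λ : ∀ v → InΛ p q (ψ v)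
  ψ∈Λ (y , t , z) = - t , 0ℤ , z , y , Pt-≡ (eq (+ r) (+ q) y t) (sym (ℤ.+-identityˡ y)) refl
    where
    eq : ∀ r q y t → r * y - q * t ≡ - t * q + y * r
    eq = solve-∀

  Λ-ψ : ∀ v → InΛ p q v → ∃ λ u → v ≡ ψ u
  Λ-ψ v (a , b , c , d , refl) = (b * + q + d , + r * b - a , c) , Pt-≡ (eq (+ r) (+ q) a b d) refl refl
    where
    eq : ∀ r q a b d → a * q + d * r ≡ r * (b * q + d) - q * (r * b - a)
    eq = solve-∀

  one : Pt → ℤ
  one _ = 1ℤ

  bary : Meas → PtQ
  bary ws = E X ws , E (form fY) ws , E level ws

  record At (ws : Meas) (x : PtQ) : Set where
    constructor at
    field
      mass : E one ws ≡ 1ℚ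
      bar  : bary ws ≡ x
  open At

  private
    PtQ-≡ : ∀ {a b c a′ b′ c′ : ℚ} → a ≡ a′ → b ≡ b′ → c ≡ c′ → _≡_ {A = PtQ} (a , b , c) (a′ , b′ , c′)
    PtQ-≡ refl refl refl = refl

    E-lin : ∀ k₀ k₁ k₂ k₃ ws → E (λ v → k₀ * one v + (k₁ * X v + (k₂ * form fY v + k₃ * level v))) ws ≡
      ι k₀ ℚ.* E one ws ℚ.+ (ι k₁ ℚ.* E X ws ℚ.+ (ι k₂ ℚ.* E (form fY) ws ℚ.+ ι k₃ ℚ.* E level ws))
    E-lin k₀ k₁ k₂ k₃ ws = trans (E-+ (λ v → k₀ * one v) (λ v → k₁ * X v + (k₂ * form fY v + k₃ * level v)) ws) (cong₂ ℚ._+_ (E-* k₀ one ws)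
      (trans (E-+ (λ v → k₁ * X v) (λ v → k₂ * form fY v + k₃ * level v) ws) (cong₂ ℚ._+_ (E-* k₁ X ws)
        (trans (E-+ (λ v → k₂ * form fY v) (λ v → k₃ * level v) ws) (cong₂ ℚ._+_ (E-* k₂ (form fY) ws) (E-* k₃ level ws))))))

  -- For every integral affine form φ, the multiple q φ is an integral combination of 1, x, y and z,
  -- whose expectations are determined by mass and barycentre.
  At-≈ : ∀ {x} → At ws x → At us x → ws ≈ us
  At-≈ {ws = ws} {us = us} (at m refl) (at m′ b′) = mom go
    where
    lin : ∀ (φ : Pt → ℤ) k₀ k₁ k₂ k₃ → (∀ v → φ v ≡ k₀ * one v + (k₁ * X v + (k₂ * form fY v + k₃ * level v))) → E φ ws ≡ E φ us
    lin φ k₀ k₁ k₂ k₃ h = trans (E-cong h ws) (trans (E-lin k₀ k₁ k₂ k₃ ws) (trans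
      (cong₂ ℚ._+_ (cong (ι k₀ ℚ.*_) (trans m (sym m′))) (cong₂ ℚ._+_ (cong (λ x → ι k₁ ℚ.* proj₁ x) (sym b′))
        (cong₂ ℚ._+_ (cong (λ x → ι k₂ ℚ.* proj₁ (proj₂ x)) (sym b′)) (cong (λ x → ι k₃ ℚ.* proj₂ (proj₂ x)) (sym b′)))))
      (sym (trans (E-cong h us) (E-lin k₀ k₁ k₂ k₃ us)))))
    eq : ∀ r q c₀ c₁ c₂ c₃ y t z → q * (c₀ + (c₁ * y + (c₂ * t + c₃ * z))) ≡ q * c₀ * 1ℤ + (- c₂ * (r * y - q * t) + ((q * c₁ + c₂ * r) * y + q * c₃ * z))
    eq = solve-∀
    go : ∀ φ → Aff φ → E φ ws ≡ E φ us
    go φ (aff c₀ c₁ c₂ c₃ h) = ℚ-*-cancelˡ (0<ι 0<q) (trans (sym (E-* (+ q) φ ws)) (trans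
      (lin (λ v → + q * φ v) (+ q * c₀) (- c₂) (+ q * c₁ + c₂ * + r) (+ q * c₃)
        (λ { (y , t , z) → trans (cong (+ q *_) (h y t z)) (eq (+ r) (+ q) c₀ c₁ c₂ c₃ y t z) }))
      (E-* (+ q) φ us)))

  At-cong : ∀ {x} → ws ≈ us → At us x → At ws x
  At-cong e (at m refl) = at (trans (_≈_.same e one (aff-c 1ℤ)) m) (PtQ-≡ (_≈_.same e X aff-X) (_≈_.same e (form fY) aff-1) (_≈_.same e level aff-3))

  toMeas : ∀ {A : PtQ → Set} {x} → (∀ a → A a → ∃ λ v → V v × a ≡ ιP (ψ v)) → InConv A x → ∃ λ ws → NonNegOn V ws × At ws x
  toMeas {V = V} {A} h (ls , all , tot , sum) = proj₁ R , proj₁ (proj₂ R) , at (trans (proj₁ (proj₂ (proj₂ R))) tot) (trans (proj₂ (proj₂ (proj₂ R))) sum)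
    where
    go : ∀ ls → All (λ w → (0ℚ ℚ.≤ proj₁ w) × A (proj₂ w)) ls → ∃ λ ws → NonNegOn V ws × E one ws ≡ wtot ls × bary ws ≡ wsum ls
    go [] [] = [] , [] , refl , refl
    go ((t , a) ∷ ls) ((t≥0 , Aa) ∷ all) with h a Aa | go ls all
    ... | v , Vv , refl | ws , ps₀ , e₁ , e₂ = (t , v) ∷ ws , (t≥0 , Vv) ∷ ps₀ , cong₂ ℚ._+_ (ℚ.*-identityʳ t) e₁ , cong ((t ·Q ιP (ψ v)) +Q_) e₂
    R = go ls all

  fromMeas : ∀ {A : PtQ → Set} {x} → (∀ v → V v → A (ιP (ψ v))) → NonNegOn V ws → At ws x → InConv A x
  fromMeas {V = V} {ws = ws} {A} h ps₀ (at m b) = proj₁ R , proj₁ (proj₂ R) , trans (proj₁ (proj₂ (proj₂ R))) m , trans (proj₂ (proj₂ (proj₂ R))) b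
    where
    go : ∀ ws → NonNegOn V ws → ∃ λ ls → All (λ w → (0ℚ ℚ.≤ proj₁ w) × A (proj₂ w)) ls × wtot ls ≡ E one ws × wsum ls ≡ bary ws
    go [] [] = [] , [] , refl , refl
    go ((t , v) ∷ ws) ((t≥0 , Vv) ∷ ps₀) with go ws ps₀
    ... | ls , all , e₁ , e₂ = (t , ιP (ψ v)) ∷ ls , (t≥0 , h v Vv) ∷ all , cong₂ ℚ._+_ (sym (ℚ.*-identityʳ t)) e₁ , cong ((t ·Q ιP (ψ v)) +Q_) e₂
    R = go ws ps₀

  -- Convex combinations allow zero weights, whereas `Meet` requires positive ones.
  dropZeros : NonNegOn V ws → ∃ λ us → PosOn V us × us ≈ ws
  dropZeros [] = [] , [] , mom (λ _ _ → refl)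
  dropZeros {V = V} {ws = (t , v) ∷ ws} ((t≥0 , Vv) ∷ ps₀) with ℚ.<-cmp 0ℚ t | dropZeros ps₀
  ... | tri< l _ _ | us , ps , e = (t , v) ∷ us , (l , Vv) ∷ ps , mom (λ φ a → cong (t ℚ.* ι (φ v) ℚ.+_) (_≈_.same e φ a))
  ... | tri≈ _ refl _ | us , ps , e = us , ps , mom (λ φ a → trans (_≈_.same e φ a) (sym (trans (cong (ℚ._+ E φ ws) (ℚ.*-zeroˡ (ι (φ v)))) (ℚ.+-identityˡ (E φ ws)))))
  ... | tri> _ _ g | _ = ⊥-elim (ℚ.<-irrefl refl (ℚ.<-≤-trans g t≥0))

  Lat : Tet p q → (Fin 4 → Pt) → Set
  Lat S S′ = ∀ i → S i ≡ ψ (S′ i)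

  tet-measure : ∀ {S S′ x} → Lat S S′ → InTet p q S x → ∃ λ ws → PosOn (Vert S′) ws × At ws x
  tet-measure {S} {S′} {x} lat t = go (toMeas vertex t)
    where
    vertex : ∀ a → (∃ λ v → IsVertexOf p q v S × a ≡ ιP v) → ∃ λ v → Vert S′ v × a ≡ ιP (ψ v)
    vertex a (v , (i , refl) , e) = S′ i , (i , refl) , trans e (cong ιP (lat i))
    go : (∃ λ ws → NonNegOn (Vert S′) ws × At ws x) → ∃ λ ws → PosOn (Vert S′) ws × At ws x
    go (ws , ps₀ , a) with dropZeros ps₀
    ... | us , ps , e = us , ps , At-cong e a

  measure-tet : ∀ {S S′ x} → Lat S S′ → NonNegOn (Vert S′) ws → At ws x → InTet p q S x
  measure-tet {S = S} {S′} lat = fromMeas (λ { v (i , refl) → S i , (i , refl) , cong ιP (sym (lat i)) })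

  common-face : ∀ {S R S′ R′ x} → Lat S S′ → Lat R R′ → Meet (Vert S′) (Vert R′) → InTet p q S x → InTet p q R x →
    InConv (λ y → ∃ λ v → IsVertexOf p q v S × IsVertexOf p q v R × y ≡ ιP v) x
  common-face {S} {R} {S′} {R′} {x} lS lR meet tS tR = go (tet-measure lS tS) (tet-measure lR tR)
    where
    go : (∃ λ ws → PosOn (Vert S′) ws × At ws x) → (∃ λ ws → PosOn (Vert R′) ws × At ws x) →
      InConv (λ y → ∃ λ v → IsVertexOf p q v S × IsVertexOf p q v R × y ≡ ιP v) x
    go (ws , ps , a) (us , ps′ , a′) = fromMeas {V = λ v → Vert S′ v × Vert R′ v} vertex
        (All.zipWith (λ { ((t , s) , r) → ℚ.<⇒≤ t , s , r }) (ps , proj₁ (meet ps ps′ (At-≈ a a′)))) a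
      where
      vertex : ∀ v → Vert S′ v × Vert R′ v → ∃ λ u → IsVertexOf p q u S × IsVertexOf p q u R × ιP (ψ v) ≡ ιP u
      vertex v ((i , refl) , (j , e)) = S i , (i , refl) , (j , trans (lS i) (trans (cong ψ e) (sym (lR j)))) , cong ιP (sym (lS i))

  -- The forms divided by N are barycentric coordinates of S, so their expectations are the weights
  -- of the barycentre. N is 1 for a simplex with integral coordinates and q m for the dilated
  -- tetrahedron.
  represent : ∀ {S : Fin 4 → Pt} N (f : Fin 4 → Pt → ℤ) → 0ℤ < N → (∀ φ → Aff φ → ∀ v → total4 (λ i → φ (S i) * f i v) ≡ N * φ v) →
    (∀ i → ws ⊩ f i) → ∃ λ us → NonNegOn (Vert S) us × us ≈ ws
  represent {ws = ws} {S} N f N>0 h pos = out , nonneg , mom same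
    where
    instance
      N≢0 : ℚ.NonZero (ι N)
      N≢0 = ℚ.pos⇒nonZero (ι N) {{ℚ.positive (0<ι N>0)}}
    c : ℚ
    c = ℚ.1/ ι N
    c≥0 : 0ℚ ℚ.≤ c
    c≥0 = ℚ.<⇒≤ (ℚ.positive⁻¹ c {{ℚ.1/pos⇒pos (ι N) {{ℚ.positive (0<ι N>0)}}}})
    wt : Fin 4 → ℚ
    wt i = c ℚ.* E (f i) ws
    wt≥0 : ∀ i → 0ℚ ℚ.≤ wt i
    wt≥0 i = 0≤-ℚ* c≥0 (_⊩_.get (pos i))
    out : Meas
    out = (wt i0 , S i0) ∷ (wt i1 , S i1) ∷ (wt i2 , S i2) ∷ (wt i3 , S i3) ∷ []
    nonneg : NonNegOn (Vert S) out
    nonneg = (wt≥0 i0 , i0 , refl) ∷ (wt≥0 i1 , i1 , refl) ∷ (wt≥0 i2 , i2 , refl) ∷ (wt≥0 i3 , i3 , refl) ∷ []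
    open ℚSolver.+-*-Solver
    factor : ∀ c e₀ e₁ e₂ e₃ s₀ s₁ s₂ s₃ → c ℚ.* e₀ ℚ.* s₀ ℚ.+ (c ℚ.* e₁ ℚ.* s₁ ℚ.+ (c ℚ.* e₂ ℚ.* s₂ ℚ.+ (c ℚ.* e₃ ℚ.* s₃ ℚ.+ 0ℚ))) ≡
      c ℚ.* (s₀ ℚ.* e₀ ℚ.+ (s₁ ℚ.* e₁ ℚ.+ (s₂ ℚ.* e₂ ℚ.+ s₃ ℚ.* e₃)))
    factor = solve 9 (λ c e₀ e₁ e₂ e₃ s₀ s₁ s₂ s₃ → c :* e₀ :* s₀ :+ (c :* e₁ :* s₁ :+ (c :* e₂ :* s₂ :+ (c :* e₃ :* s₃ :+ con 0ℚ))) :=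
      c :* (s₀ :* e₀ :+ (s₁ :* e₁ :+ (s₂ :* e₂ :+ s₃ :* e₃)))) refl
    same : ∀ φ → Aff φ → E φ out ≡ E φ ws
    same φ a = trans (factor c (E (f i0) ws) (E (f i1) ws) (E (f i2) ws) (E (f i3) ws) (ι (φ (S i0))) (ι (φ (S i1))) (ι (φ (S i2))) (ι (φ (S i3))))
      (trans (cong (c ℚ.*_) (trans (sym split) (trans (E-cong (h φ a) ws) (E-* N φ ws))))
      (trans (sym (ℚ.*-assoc c (ι N) (E φ ws))) (trans (cong (ℚ._* E φ ws) (ℚ.*-inverseˡ (ι N))) (ℚ.*-identityˡ (E φ ws)))))
      where
      split : E (λ v → total4 (λ i → φ (S i) * f i v)) ws ≡ ι (φ (S i0)) ℚ.* E (f i0) ws ℚ.+ (ι (φ (S i1)) ℚ.* E (f i1) ws ℚ.+ (ι (φ (S i2)) ℚ.* E (f i2) ws ℚ.+ ι (φ (S i3)) ℚ.* E (f i3) ws))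
      split = trans (E-+ (λ v → φ (S i0) * f i0 v) (λ v → φ (S i1) * f i1 v + (φ (S i2) * f i2 v + φ (S i3) * f i3 v)) ws) (cong₂ ℚ._+_ (E-* (φ (S i0)) (f i0) ws)
        (trans (E-+ (λ v → φ (S i1) * f i1 v) (λ v → φ (S i2) * f i2 v + φ (S i3) * f i3 v) ws) (cong₂ ℚ._+_ (E-* (φ (S i1)) (f i1) ws)
          (trans (E-+ (λ v → φ (S i2) * f i2 v) (λ v → φ (S i3) * f i3 v) ws) (cong₂ ℚ._+_ (E-* (φ (S i2)) (f i2) ws) (E-* (φ (S i3)) (f i3) ws))))))

  covers-tet : ∀ {S S′ x} → Lat S S′ → Covers S′ ws → At ws x → InTet p q S x
  covers-tet {ws = ws} {S} {S′} {x} lat C a = go (represent {S = S′} 1ℤ (coord (dual C)) (+<+ (s≤s z≤n)) bar′ (nonneg C))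
    where
    open Covers
    open Dual
    bar′ : ∀ φ → Aff φ → ∀ v → total4 (λ i → φ (S′ i) * coord (dual C) i v) ≡ 1ℤ * φ v
    bar′ φ af v = trans (cong₂ _+_ (ℤ.*-comm (φ (S′ i0)) _) (cong₂ _+_ (ℤ.*-comm (φ (S′ i1)) _) (cong₂ _+_ (ℤ.*-comm (φ (S′ i2)) _) (ℤ.*-comm (φ (S′ i3)) _))))
      (trans (aff-comb af S′ (λ i → coord (dual C) i v) (total (dual C) v)) (trans (cong φ (repr (dual C) v)) (sym (ℤ.*-identityˡ (φ v)))))
    go : (∃ λ us → NonNegOn (Vert S′) us × us ≈ ws) → InTet p q S x
    go (us , ps₀ , e) = measure-tet lat ps₀ (At-cong e a)

  -- The dilated tetrahedron

  vertL : ℕ → Fin 4 → Pt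
  vertL m = tet (η (0ℤ , 0ℤ , 0ℤ)) (η (+ m , 0ℤ , 0ℤ)) (η (0ℤ , 0ℤ , + m)) (η (0ℤ , + m , + m))

  private
    qm : ∀ m → + q * + m ≡ + (m ℕ.* q)
    qm m = trans (sym (ℤ.pos-* q m)) (cong +_ (ℕ.*-comm q m))

    qz : + q * 0ℤ ≡ 0ℤ
    qz = ℤ.*-zeroʳ (+ q)

  vert-ψ : ∀ m i → vert p q m i ≡ ψ (vertL m i)
  vert-ψ m i0 = sym (Pt-≡ (trans (form-η fX (0ℤ , 0ℤ , 0ℤ)) qz) qz refl)
  vert-ψ m i1 = sym (Pt-≡ (trans (form-η fX (+ m , 0ℤ , 0ℤ)) (qm m)) qz refl)
  vert-ψ m i2 = sym (Pt-≡ (trans (form-η fX (0ℤ , 0ℤ , + m)) qz) qz refl)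
  vert-ψ m i3 = sym (Pt-≡ (trans (form-η fX (0ℤ , + m , + m)) qz) (qm m) refl)

  -- facet i lies opposite to vertex i
  bform : ℕ → Fin 4 → Pt → ℤ
  bform m = fin4 (λ v → + q * + m - form fU v) (form fX) (form fW) (form fY)

  aff-bform : ∀ m i → Aff (bform m i)
  aff-bform m = fin4 (aff-- (aff-c (+ q * + m)) (aff-form fU)) (aff-form fX) (aff-form fW) (aff-form fY)

  bform-η : ∀ m i w → bform m i (η w) ≡ + q * fin4 {A = λ _ → ℤ} (+ m - corner-form fU w) (corner-form fX w) (corner-form fW w) (corner-form fY w) i
  bform-η m i0 w = trans (cong (λ z → + q * + m - z) (form-η fU w)) (eq (+ q) (+ m) (corner-form fU w))
    where
    eq : ∀ q m u → q * m - q * u ≡ q * (m - u)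
    eq = solve-∀
  bform-η m i1 w = form-η fX w
  bform-η m i2 w = form-η fW w
  bform-η m i3 w = form-η fY w

  Ineq : ℕ → Meas → Set
  Ineq m ws = ∀ i → ws ⊩ bform m i

  private
    m-m : ∀ m → + m - + m ≡ 0ℤ
    m-m m = ℤ.+-inverseʳ (+ m)

    0+m : ∀ m → + m - (0ℤ + + m) ≡ 0ℤ
    0+m m = trans (cong (λ z → + m - z) (ℤ.+-identityˡ (+ m))) (m-m m)

    m+0 : ∀ m → + m - (+ m + 0ℤ) ≡ 0ℤ
    m+0 m = trans (cong (λ z → + m - z) (ℤ.+-identityʳ (+ m))) (m-m m)

    zeroq : ∀ {a b} → a ≡ + q * b → b ≡ 0ℤ → a ≡ 0ℤ
    zeroq e refl = trans e qz

  bform-diag : ∀ m i → bform m i (vertL m i) ≡ + q * + m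
  bform-diag m i0 = trans (bform-η m i0 (0ℤ , 0ℤ , 0ℤ)) (cong (+ q *_) (ℤ.+-identityʳ (+ m)))
  bform-diag m i1 = bform-η m i1 (+ m , 0ℤ , 0ℤ)
  bform-diag m i2 = trans (bform-η m i2 (0ℤ , 0ℤ , + m)) (cong (+ q *_) (ℤ.+-identityʳ (+ m)))
  bform-diag m i3 = bform-η m i3 (0ℤ , + m , + m)

  bform-vert : ∀ m i j → bform m j (vertL m i) ≡ 0ℤ ⊎ i ≡ j
  bform-vert m i0 i0 = inj₂ refl
  bform-vert m i0 i1 = inj₁ (zeroq (bform-η m i1 (0ℤ , 0ℤ , 0ℤ)) refl)
  bform-vert m i0 i2 = inj₁ (zeroq (bform-η m i2 (0ℤ , 0ℤ , 0ℤ)) refl)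
  bform-vert m i0 i3 = inj₁ (zeroq (bform-η m i3 (0ℤ , 0ℤ , 0ℤ)) refl)
  bform-vert m i1 i0 = inj₁ (zeroq (bform-η m i0 (+ m , 0ℤ , 0ℤ)) (m+0 m))
  bform-vert m i1 i1 = inj₂ refl
  bform-vert m i1 i2 = inj₁ (zeroq (bform-η m i2 (+ m , 0ℤ , 0ℤ)) refl)
  bform-vert m i1 i3 = inj₁ (zeroq (bform-η m i3 (+ m , 0ℤ , 0ℤ)) refl)
  bform-vert m i2 i0 = inj₁ (zeroq (bform-η m i0 (0ℤ , 0ℤ , + m)) (0+m m))
  bform-vert m i2 i1 = inj₁ (zeroq (bform-η m i1 (0ℤ , 0ℤ , + m)) refl)
  bform-vert m i2 i2 = inj₂ refl
  bform-vert m i2 i3 = inj₁ (zeroq (bform-η m i3 (0ℤ , 0ℤ , + m)) refl)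
  bform-vert m i3 i0 = inj₁ (zeroq (bform-η m i0 (0ℤ , + m , + m)) (0+m m))
  bform-vert m i3 i1 = inj₁ (zeroq (bform-η m i1 (0ℤ , + m , + m)) refl)
  bform-vert m i3 i2 = inj₁ (zeroq (bform-η m i2 (0ℤ , + m , + m)) (m-m m))
  bform-vert m i3 i3 = inj₂ refl

  bform-vert≥0 : ∀ m i j → 0ℤ ≤ bform m j (vertL m i)
  bform-vert≥0 m i j with bform-vert m i j
  ... | inj₁ e = ℤ.≤-reflexive (sym e)
  ... | inj₂ refl = 0≤-resp (bform-diag m i) (0≤* (0≤+ᴺ q) (0≤+ᴺ m))

  poly-measure : ∀ {m x} → InPoly p q m x → ∃ λ ws → At ws x × Ineq m ws
  poly-measure {m} {x} t = go (toMeas {V = Vert (vertL m)} (λ { a (i , refl) → vertL m i , (i , refl) , cong ιP (vert-ψ m i) }) t)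
    where
    go : (∃ λ ws → NonNegOn (Vert (vertL m)) ws × At ws x) → ∃ λ ws → At ws x × Ineq m ws
    go (ws , ps₀ , a) = ws , a , λ j → ⊩-all ps₀ (λ { v (i , refl) → bform-vert≥0 m i j })

  private
    bary-eq : ∀ m φ → Aff φ → ∀ v → total4 (λ i → φ (vertL m i) * bform m i v) ≡ (+ q * + m) * φ v
    bary-eq m φ (aff c₀ c₁ c₂ c₃ e) (y , t , z) = trans (cong₂ _+_ (cong (_* bform m i0 (y , t , z)) (e _ _ _)) (cong₂ _+_ (cong (_* bform m i1 (y , t , z)) (e _ _ _))
        (cong₂ _+_ (cong (_* bform m i2 (y , t , z)) (e _ _ _)) (cong (_* bform m i3 (y , t , z)) (e _ _ _)))))
        (trans (eq (+ r) (+ q) (+ m) c₀ c₁ c₂ c₃ y t z) (cong ((+ q * + m) *_) (sym (e y t z))))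
      where
      eq : ∀ r q m c₀ c₁ c₂ c₃ y t z →
        (c₀ + (c₁ * (q * 0ℤ) + (c₂ * (r * 0ℤ - 0ℤ) + c₃ * 0ℤ))) * (q * m - (r * y - q * t + q * z))
        + ((c₀ + (c₁ * (q * 0ℤ) + (c₂ * (r * 0ℤ - m) + c₃ * 0ℤ))) * (r * y - q * t)
        + ((c₀ + (c₁ * (q * 0ℤ) + (c₂ * (r * 0ℤ - 0ℤ) + c₃ * m))) * (q * z - y)
        + (c₀ + (c₁ * (q * m) + (c₂ * (r * m - 0ℤ) + c₃ * m))) * y)) ≡ q * m * (c₀ + (c₁ * y + (c₂ * t + c₃ * z)))
      eq = solve-∀

    qm>0 : ∀ {m} → 0 ℕ.< m → 0ℤ < + q * + m
    qm>0 p = 0<* 0<q (+<+ p)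

  measure-poly : ∀ {m x} → 0 ℕ.< m → At ws x → Ineq m ws → InPoly p q m x
  measure-poly {ws = ws} {m} {x} m>0 a h = go (represent {S = vertL m} (+ q * + m) (bform m) (qm>0 m>0) (bary-eq m) h)
    where
    go : (∃ λ us → NonNegOn (Vert (vertL m)) us × us ≈ ws) → InPoly p q m x
    go (us , ps₀ , e) = fromMeas {V = Vert (vertL m)} (λ { v (i , refl) → i , cong ιP (sym (vert-ψ m i)) }) ps₀ (At-cong e a)

  boundary-measure : ∀ {m x} → InBoundary p q m x → ∃ λ j → ∀ {ws} → At ws x → ws ⊩ (λ v → - bform m j v)
  boundary-measure {m} {x} (j , t) = go (toMeas {V = λ v → ∃ λ i → ¬ (i ≡ j) × v ≡ vertL m i} (λ { a (i , ne , refl) → vertL m i , (i , ne , refl) , cong ιP (vert-ψ m i) }) t)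
    where
    nonneg : ∀ v → (∃ λ i → ¬ (i ≡ j) × v ≡ vertL m i) → 0ℤ ≤ - bform m j v
    nonneg v (i , ne , refl) with bform-vert m i j
    ... | inj₁ e = 0≤-resp (cong -_ e) ℤ.≤-refl
    ... | inj₂ e = ⊥-elim (ne e)
    go : (∃ λ ws → NonNegOn (λ v → ∃ λ i → ¬ (i ≡ j) × v ≡ vertL m i) ws × At ws x) → ∃ λ j → ∀ {ws} → At ws x → ws ⊩ (λ v → - bform m j v)
    go (us , ps₀ , a) = j , λ a′ → ⊩-≈ (aff-neg (aff-bform m j)) (At-≈ a a′) (⊩-all ps₀ nonneg)

  measure-boundary : ∀ {m x} → 0 ℕ.< m → At ws x → Ineq m ws → ∀ j → ws ⊩ (λ v → - bform m j v) → InBoundary p q m x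
  measure-boundary {ws = ws} {m} {x} m>0 a h j z = j , go (represent {S = vertL m} (+ q * + m) (bform m) (qm>0 m>0) (bary-eq m) h)
    where
    A : PtQ → Set
    A = λ v → ∃ λ i → ¬ (i ≡ j) × v ≡ ιP (vert p q m i)
    keep : ∀ v → Vert (vertL m) v × bform m j v ≡ 0ℤ → A (ιP (ψ v))
    keep v ((i , refl) , e) = i , differ , cong ιP (sym (vert-ψ m i))
      where
      differ : ¬ (i ≡ j)
      differ refl = ℤ.<-irrefl (sym (trans (sym (bform-diag m i)) e)) (qm>0 m>0)
    go : (∃ λ us → NonNegOn (Vert (vertL m)) us × us ≈ ws) → InConv A x
    go (us , ps₀ , e) with dropZeros ps₀
    ... | us′ , ps , e′ = fromMeas {V = λ v → Vert (vertL m) v × bform m j v ≡ 0ℤ} {ws = us′} keep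
        (PosOn⇒NonNegOn (⊩-zero ps (λ { v (i , refl) → bform-vert≥0 m i j })
          (⊩-≈ (aff-neg (aff-bform m j)) (≈-sym e′) (⊩-≈ (aff-neg (aff-bform m j)) (≈-sym e) z))))
        (At-cong e′ (At-cong e a))

-- Covering and face-to-face incidence of the given triangulations are known only for rational
-- points, so the boxes are moved into place on this level.
InConv-translate : ∀ {A B : PtQ → Set} {x} s → (∀ a → A a → B (s +Q a)) → InConv A x → InConv B (s +Q x)
InConv-translate {A} {B} s h (ls , all , tot , sum) = proj₁ R , proj₁ (proj₂ R) , trans (proj₁ (proj₂ (proj₂ R))) tot ,
    trans (proj₂ (proj₂ (proj₂ R))) (trans (cong₂ (λ t y → (t ·Q s) +Q y) tot sum) (cong (_+Q _) (unit-scale s)))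
  where
  open ℚSolver.+-*-Solver
  unit-scale : ∀ s → 1ℚ ·Q s ≡ s
  unit-scale (a , b , c) = cong₂ _,_ (ℚ.*-identityˡ a) (cong₂ _,_ (ℚ.*-identityˡ b) (ℚ.*-identityˡ c))
  eq : ∀ t s a T x → t ℚ.* (s ℚ.+ a) ℚ.+ (T ℚ.* s ℚ.+ x) ≡ (t ℚ.+ T) ℚ.* s ℚ.+ (t ℚ.* a ℚ.+ x)
  eq = solve 5 (λ t s a T x → t :* (s :+ a) :+ (T :* s :+ x) := (t :+ T) :* s :+ (t :* a :+ x)) refl
  eqQ : ∀ t s a T x → (t ·Q (s +Q a)) +Q ((T ·Q s) +Q x) ≡ ((t ℚ.+ T) ·Q s) +Q ((t ·Q a) +Q x)
  eqQ t (s₁ , s₂ , s₃) (a₁ , a₂ , a₃) T (x₁ , x₂ , x₃) = cong₂ _,_ (eq t s₁ a₁ T x₁) (cong₂ _,_ (eq t s₂ a₂ T x₂) (eq t s₃ a₃ T x₃))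
  zero-eq : ∀ s → 0Q ≡ (0ℚ ·Q s) +Q 0Q
  zero-eq (a , b , c) = cong₂ _,_ (z a) (cong₂ _,_ (z b) (z c))
    where
    z : ∀ a → 0ℚ ≡ 0ℚ ℚ.* a ℚ.+ 0ℚ
    z a = sym (trans (ℚ.+-identityʳ _) (ℚ.*-zeroˡ a))
  go : ∀ ls → All (λ w → (0ℚ ℚ.≤ proj₁ w) × A (proj₂ w)) ls →
    ∃ λ ks → All (λ w → (0ℚ ℚ.≤ proj₁ w) × B (proj₂ w)) ks × wtot ks ≡ wtot ls × wsum ks ≡ (wtot ls ·Q s) +Q wsum ls
  go [] [] = [] , [] , refl , zero-eq s
  go ((t , a) ∷ ls) ((t≥0 , Aa) ∷ all) with go ls all
  ... | ks , all′ , e₁ , e₂ = (t , s +Q a) ∷ ks , (t≥0 , h a Aa) ∷ all′ , cong (t ℚ.+_) e₁ ,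
    trans (cong ((t ·Q (s +Q a)) +Q_) e₂) (eqQ t s a (wtot ls) (wsum ls))
  R = go ls all

ι-neg : ∀ a → ι (- a) ≡ ℚ.- ι a
ι-neg a = trans (cong ι (sym (ℤ.-1*i≡-i a))) (trans (ι-* ℤ.-1ℤ a) (trans (sym (ℚ.neg-distribˡ-* 1ℚ (ι a))) (cong ℚ.-_ (ℚ.*-identityˡ (ι a)))))

ι-sub : ∀ a b → ι (a - b) ≡ ι a ℚ.- ι b
ι-sub a b = trans (ι-+ a (- b)) (cong (ι a ℚ.+_) (ι-neg b))

-- The given triangulations in lattice coordinates

module Boxes (p : ℤ) (q : ℕ) .{{_ : NonZero q}} (chain : Chain (p′ p q) q) where
  open Chain chain
  open Strip chain
  open Path chain using (level; hi)
  open Coverage chain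
  open Facets chain
  open Placement chain
  open Interface p q chain

  private
    r : ℕ
    r = p′ p q

  point : Pt → Meas
  point v = (1ℚ , v) ∷ []

  segment : ℚ → Pt → Pt → Meas
  segment t u v = (1ℚ ℚ.- t , u) ∷ (t , v) ∷ []

  private
    E-point : ∀ φ v → E φ (point v) ≡ ι (φ v)
    E-point φ v = trans (ℚ.+-identityʳ (1ℚ ℚ.* ι (φ v))) (ℚ.*-identityˡ (ι (φ v)))

  point-At : ∀ v → At (point v) (ιP (ψ v))
  point-At v = at (E-point one v) (cong₂ _,_ (E-point X v) (cong₂ _,_ (E-point (form fY) v) (E-point level v)))

  point-⊩ : ∀ {φ : Pt → ℤ} {v} → point v ⊩ φ → 0ℤ ≤ φ v
  point-⊩ {φ} {v} h = ι-cancel-≤ {0ℤ} {φ v} (subst (0ℚ ℚ.≤_) (E-point φ v) (_⊩_.get h))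

  segment-At : ∀ t u v → At (segment t u v) (ιP (ψ u) +Q (t ·Q (ιP (ψ v) -Q ιP (ψ u))))
  segment-At t u v = at (mass-eq t) (cong₂ _,_ (eq t (ι (X u)) (ι (X v))) (cong₂ _,_ (eq t (ι (form fY u)) (ι (form fY v))) (eq t (ι (level u)) (ι (level v)))))
    where
    open ℚSolver.+-*-Solver
    mass-eq : ∀ t → (1ℚ ℚ.- t) ℚ.* 1ℚ ℚ.+ (t ℚ.* 1ℚ ℚ.+ 0ℚ) ≡ 1ℚ
    mass-eq = solve 1 (λ t → (con 1ℚ :- t) :* con 1ℚ :+ (t :* con 1ℚ :+ con 0ℚ) := con 1ℚ) refl
    eq : ∀ t a b → (1ℚ ℚ.- t) ℚ.* a ℚ.+ (t ℚ.* b ℚ.+ 0ℚ) ≡ a ℚ.+ t ℚ.* (b ℚ.- a)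
    eq = solve 3 (λ t a b → (con 1ℚ :- t) :* a :+ (t :* b :+ con 0ℚ) := a :+ t :* (b :- a)) refl

  segment-on : ∀ {t u v} → 0ℚ ℚ.≤ t → t ℚ.≤ 1ℚ → NonNegOn (λ w → w ≡ u ⊎ w ≡ v) (segment t u v)
  segment-on {t} p p′ = (subst (ℚ._≤ 1ℚ ℚ.- t) (ℚ.+-inverseʳ t) (ℚ.+-monoˡ-≤ (ℚ.- t) p′) , inj₁ refl) ∷ (p , inj₂ refl) ∷ []

  private
    affine-form : ∀ a₁ a₂ a₃ s₀ s₁ s₂ s₃ → (1ℤ - (a₁ + (a₂ + a₃))) * s₀ + (a₁ * s₁ + (a₂ * s₂ + a₃ * s₃)) ≡
      s₀ + (a₁ * (s₁ - s₀) + (a₂ * (s₂ - s₀) + a₃ * (s₃ - s₀)))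
    affine-form = solve-∀

    affine-form′ : ∀ c₀ a₁ a₂ a₃ s₀ s₁ s₂ s₃ → c₀ + (a₁ + (a₂ + a₃)) ≡ 1ℤ → c₀ * s₀ + (a₁ * s₁ + (a₂ * s₂ + a₃ * s₃)) ≡
      s₀ + (a₁ * (s₁ - s₀) + (a₂ * (s₂ - s₀) + a₃ * (s₃ - s₀)))
    affine-form′ c₀ a₁ a₂ a₃ s₀ s₁ s₂ s₃ e = trans (cong (λ c → c * s₀ + (a₁ * s₁ + (a₂ * s₂ + a₃ * s₃)))
      (trans (eq c₀ (a₁ + (a₂ + a₃))) (cong (λ s → s - (a₁ + (a₂ + a₃))) e))) (affine-form a₁ a₂ a₃ s₀ s₁ s₂ s₃)
      where
      eq : ∀ c a → c ≡ c + a - a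
      eq = solve-∀

    comb-cong : ∀ {S R : Fin 4 → Pt} c → (∀ i → S i ≡ R i) → comb S c ≡ comb R c
    comb-cong c h = Pt-≡
      (cong₂ _+_ (f proj₁ i0) (cong₂ _+_ (f proj₁ i1) (cong₂ _+_ (f proj₁ i2) (f proj₁ i3))))
      (cong₂ _+_ (f pr₂ i0) (cong₂ _+_ (f pr₂ i1) (cong₂ _+_ (f pr₂ i2) (f pr₂ i3))))
      (cong₂ _+_ (f pr₃ i0) (cong₂ _+_ (f pr₃ i1) (cong₂ _+_ (f pr₃ i2) (f pr₃ i3))))
      where
      f : ∀ (π : Pt → ℤ) i → _
      f π i = cong (λ v → c i * π v) (h i)

  unimodular-span : ∀ {S S′} → Lat S S′ → Unimodular p q S → Span S′
  unimodular-span {S} {S′} lat (_ , gen) w with gen (ψ w) (ψ∈Λ w)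
  ... | a₁ , a₂ , a₃ , e = c , eq a₁ a₂ a₃ , ψ-injective (trans (sym (affmap-comb ψ-aff S′ c (eq a₁ a₂ a₃)))
        (trans (sym (comb-cong c lat)) (trans (Pt-≡ (af proj₁) (af pr₂) (af pr₃)) (sym e))))
    where
    c : Fin 4 → ℤ
    c = fin4 (1ℤ - (a₁ + (a₂ + a₃))) a₁ a₂ a₃
    eq : ∀ a b c → 1ℤ - (a + (b + c)) + (a + (b + c)) ≡ 1ℤ
    eq = solve-∀
    af : ∀ (π : Pt → ℤ) → _
    af π = affine-form a₁ a₂ a₃ (π (S i0)) (π (S i1)) (π (S i2)) (π (S i3))

  span-unimodular : ∀ {S S′} → Lat S S′ → Span S′ → Unimodular p q S
  span-unimodular {S} {S′} lat sp = (λ i → subst (InΛ p q) (sym (lat i)) (ψ∈Λ (S′ i))) , gen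
    where
    gen : (w : Pt) → InΛ p q w → Σ ℤ λ a₁ → Σ ℤ λ a₂ → Σ ℤ λ a₃ →
       w ≡ S i0 +Z ((a₁ ·Z (S i1 -Z S i0)) +Z ((a₂ ·Z (S i2 -Z S i0)) +Z (a₃ ·Z (S i3 -Z S i0))))
    gen w w∈ with Λ-ψ w w∈
    ... | u , refl with sp u
    ... | c , tot , e = c i1 , c i2 , c i3 , trans (cong ψ (sym e)) (trans (sym (affmap-comb ψ-aff S′ c tot)) (trans (sym (comb-cong c lat))
          (Pt-≡ (af proj₁) (af pr₂) (af pr₃))))
      where
      af : ∀ (π : Pt → ℤ) → _
      af π = affine-form′ (c i0) (c i1) (c i2) (c i3) (π (S i0)) (π (S i1)) (π (S i2)) (π (S i3)) tot

  Span-shift : ∀ {S} o → Span S → Span (λ i → o +Z S i)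
  Span-shift {S} o sp w with sp (w -Z o)
  ... | c , tot , e = c , tot , trans (affmap-comb (shift-aff o) S c tot) (trans (cong (o +Z_) e) (shift-unshift o w))

  Dual-span : ∀ {S} → Dual S → Span S
  Dual-span D w = (λ i → Dual.coord D i w) , Dual.total D w , Dual.repr D w

  private
    -- For an edge of the unit tetrahedron: a facet parallel to it that `is-η` can handle, and a
    -- coordinate in which the edge vector is 1 or -1, from which a rational factor can be read off.
    record Direction (i j : Fin 4) : Set where
      field
        facet : Facet
        inner : Inner facet
        flat  : corner-form facet (κ j -Z κ i) ≡ 0ℤ
        unit  : Σ (Pt → ℤ) λ π → π (κ j -Z κ i) * π (κ j -Z κ i) ≡ 1ℤ × (π ≡ proj₁ ⊎ π ≡ pr₂ ⊎ π ≡ pr₃)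

    via : ∀ {i j} f → Inner f → corner-form f (κ j -Z κ i) ≡ 0ℤ → (Σ (Pt → ℤ) λ π → π (κ j -Z κ i) * π (κ j -Z κ i) ≡ 1ℤ × (π ≡ proj₁ ⊎ π ≡ pr₂ ⊎ π ≡ pr₃)) → Direction i j
    via f i z u = record { facet = f ; inner = i ; flat = z ; unit = u }

    direction : ∀ i j → i ≢ j → Direction i j
    direction i0 i0 ne = ⊥-elim (ne refl)
    direction i0 i1 ne = via fY inY refl (proj₁ , refl , inj₁ refl)
    direction i0 i2 ne = via fX inX refl (_ , refl , inj₂ (inj₂ refl))
    direction i0 i3 ne = via fX inX refl (_ , refl , inj₂ (inj₂ refl))
    direction i1 i0 ne = via fY inY refl (proj₁ , refl , inj₁ refl)
    direction i1 i1 ne = ⊥-elim (ne refl)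
    direction i1 i2 ne = via fY inY refl (_ , refl , inj₂ (inj₂ refl))
    direction i1 i3 ne = via fW inW refl (_ , refl , inj₂ (inj₂ refl))
    direction i2 i0 ne = via fX inX refl (_ , refl , inj₂ (inj₂ refl))
    direction i2 i1 ne = via fY inY refl (_ , refl , inj₂ (inj₂ refl))
    direction i2 i2 ne = ⊥-elim (ne refl)
    direction i2 i3 ne = via fX inX refl (_ , refl , inj₂ (inj₁ refl))
    direction i3 i0 ne = via fX inX refl (_ , refl , inj₂ (inj₂ refl))
    direction i3 i1 ne = via fW inW refl (_ , refl , inj₂ (inj₂ refl))
    direction i3 i2 ne = via fX inX refl (_ , refl , inj₂ (inj₁ refl))
    direction i3 i3 ne = ⊥-elim (ne refl)

    vertL-κ : ∀ i → vertL 1 i ≡ η (κ i)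
    vertL-κ = fin4 refl refl refl refl

    ι-zero : ∀ {a t} → ι a ≡ t ℚ.* ι 0ℤ → a ≡ 0ℤ
    ι-zero {a} {t} e = ι-injective {a} {0ℤ} (trans e (ℚ.*-zeroʳ t))

    q-scale : ∀ {w a t} → ι (+ q * w) ≡ t ℚ.* ι (+ q * a) → ι w ≡ t ℚ.* ι a
    q-scale {w} {a} {t} e = ℚ-*-cancelˡ (0<ι 0<q) (trans (sym (ι-* (+ q) w)) (trans e (trans (cong (t ℚ.*_) (ι-* (+ q) a)) (eq t (ι (+ q)) (ι a)))))
      where
      open ℚSolver.+-*-Solver
      eq : ∀ t q a → t ℚ.* (q ℚ.* a) ≡ q ℚ.* (t ℚ.* a)
      eq = solve 3 (λ t q a → t :* (q :* a) := q :* (t :* a)) refl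

    integral : ∀ {w a t} → ι w ≡ t ℚ.* ι a → a * a ≡ 1ℤ → t ≡ ι (w * a)
    integral {w} {a} {t} e u = sym (trans (ι-* w a) (trans (cong (ℚ._* ι a) e) (trans (ℚ.*-assoc t (ι a) (ι a)) (trans (cong (t ℚ.*_) (trans (sym (ι-* a a)) (cong ι u))) (ℚ.*-identityʳ t)))))

    multiple : ∀ {w a n t} → ι w ≡ t ℚ.* ι a → t ≡ ι n → w ≡ n * a
    multiple {w} {a} {n} e refl = ι-injective {w} {n * a} (trans e (sym (ι-* n a)))

  -- The difference lies in a facet plane through the origin and therefore in the corner lattice.
  -- There a coordinate equal to 1 or -1 of the edge vector shows that the rational factor is an
  -- integer.
  parallel-multiple : ∀ {u v} → ParallelToEdge p q (ψ u) (ψ v) → ∃ λ i → ∃ λ j → Σ ℤ λ n → v -Z u ≡ n ·Z (η (κ j) -Z η (κ i))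
  parallel-multiple {u} {v} (i , j , ne , t , e) = i , j , n , D≡
    where
    dir = direction i j ne
    open Direction dir
    D = v -Z u
    k = κ j -Z κ i
    e′ : (ιP (ψ v) -Q ιP (ψ u)) ≡ t ·Q (ιP (ψ (η (κ j))) -Q ιP (ψ (η (κ i))))
    e′ = trans e (cong₂ (λ a b → t ·Q (ιP a -Q ιP b)) (trans (vert-ψ 1 j) (cong ψ (vertL-κ j))) (trans (vert-ψ 1 i) (cong ψ (vertL-κ i))))
    dist : ∀ q a b → q * a - q * b ≡ q * (a - b)
    dist = solve-∀
    eX : ι (X D) ≡ t ℚ.* ι (+ q * proj₁ k)
    eX = trans (cong ι (form-- fX v u)) (trans (ι-sub (X v) (X u)) (trans (cong proj₁ e′) (cong (t ℚ.*_) (trans (sym (ι-sub (X (η (κ j))) (X (η (κ i)))))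
      (cong ι (trans (cong₂ _-_ (form-η fX (κ j)) (form-η fX (κ i))) (dist (+ q) (proj₁ (κ j)) (proj₁ (κ i)))))))))
    eY : ι (form fY D) ≡ t ℚ.* ι (+ q * proj₁ (proj₂ k))
    eY = trans (ι-sub (form fY v) (form fY u)) (trans (cong pr₂ e′) (cong (t ℚ.*_) (trans (sym (ι-sub (form fY (η (κ j))) (form fY (η (κ i)))))
      (cong ι (dist (+ q) (proj₁ (proj₂ (κ j))) (proj₁ (proj₂ (κ i))))))))
    eZ : ι (level D) ≡ t ℚ.* ι (proj₂ (proj₂ k))
    eZ = trans (ι-sub (level v) (level u)) (trans (cong pr₃ e′) (cong (t ℚ.*_) (sym (ι-sub (level (κ j)) (level (κ i))))))
    flat-form : ∀ f → corner-form f k ≡ 0ℤ → Inner f → form f D ≡ 0ℤ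
    flat-form fX z inX = ι-zero {X D} {t} (trans eX (cong (λ a → t ℚ.* ι a) (trans (cong (+ q *_) z) (ℤ.*-zeroʳ (+ q)))))
    flat-form fY z inY = ι-zero {form fY D} {t} (trans eY (cong (λ a → t ℚ.* ι a) (trans (cong (+ q *_) z) (ℤ.*-zeroʳ (+ q)))))
    flat-form fW z inW = ι-zero {form fW D} {t} (trans (ι-sub (+ q * level D) (form fY D)) (trans (cong₂ ℚ._-_ (trans (ι-* (+ q) (level D)) (cong (ι (+ q) ℚ.*_) eZ)) eY)
        (trans (cong₂ (λ a b → ι (+ q) ℚ.* (t ℚ.* a) ℚ.- t ℚ.* b) refl (ι-* (+ q) (proj₁ (proj₂ k)))) (trans (eq (ι (+ q)) t (ι (proj₂ (proj₂ k))) (ι (proj₁ (proj₂ k))))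
        (cong (t ℚ.*_) (trans (cong (ι (+ q) ℚ.*_) (trans (sym (ι-sub (proj₂ (proj₂ k)) (proj₁ (proj₂ k)))) (cong ι z))) (ℚ.*-zeroʳ (ι (+ q)))))))))
      where
      open ℚSolver.+-*-Solver
      eq : ∀ q t c b → q ℚ.* (t ℚ.* c) ℚ.- t ℚ.* (q ℚ.* b) ≡ t ℚ.* (q ℚ.* (c ℚ.- b))
      eq = solve 4 (λ q t c b → q :* (t :* c) :- t :* (q :* b) := t :* (q :* (c :- b))) refl
    lattice = is-η facet inner 0ℤ D (trans (flat-form facet flat inner) (sym (ℤ.*-zeroʳ (+ q))))
    w = proj₁ lattice
    D≡η : D ≡ η w
    D≡η = proj₂ lattice
    w₁ : ι (proj₁ w) ≡ t ℚ.* ι (proj₁ k)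
    w₁ = q-scale {proj₁ w} {proj₁ k} {t} (trans (cong ι (sym (trans (cong X D≡η) (form-η fX w)))) eX)
    w₂ : ι (proj₁ (proj₂ w)) ≡ t ℚ.* ι (proj₁ (proj₂ k))
    w₂ = q-scale {proj₁ (proj₂ w)} {proj₁ (proj₂ k)} {t} (trans (cong ι (sym (cong (form fY) D≡η))) eY)
    w₃ : ι (proj₂ (proj₂ w)) ≡ t ℚ.* ι (proj₂ (proj₂ k))
    w₃ = trans (cong ι (sym (cong level D≡η))) eZ
    coords : ∀ π → (π ≡ proj₁ ⊎ π ≡ pr₂ ⊎ π ≡ pr₃) → ι (π w) ≡ t ℚ.* ι (π k)
    coords π (inj₁ refl) = w₁
    coords π (inj₂ (inj₁ refl)) = w₂
    coords π (inj₂ (inj₂ refl)) = w₃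
    n : ℤ
    n = proj₁ unit w * proj₁ unit k
    t≡n : t ≡ ι n
    t≡n = integral {proj₁ unit w} {proj₁ unit k} {t} (coords (proj₁ unit) (proj₂ (proj₂ unit))) (proj₁ (proj₂ unit))
    m₁ = multiple {proj₁ w} {proj₁ k} {n} {t} w₁ t≡n
    m₂ = multiple {proj₁ (proj₂ w)} {proj₁ (proj₂ k)} {n} {t} w₂ t≡n
    m₃ = multiple {proj₂ (proj₂ w)} {proj₂ (proj₂ k)} {n} {t} w₃ t≡n
    D≡ : D ≡ n ·Z (η (κ j) -Z η (κ i))
    D≡ = trans D≡η (Pt-≡ (trans (cong (+ q *_) m₂) (eq₁ (+ q) n (proj₁ (proj₂ (κ j))) (proj₁ (proj₂ (κ i)))))
        (trans (cong₂ (λ a b → + r * a - b) m₂ m₁) (eq₂ (+ r) n (proj₁ (κ j)) (proj₁ (κ i)) (proj₁ (proj₂ (κ j))) (proj₁ (proj₂ (κ i))))) m₃)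
      where
      eq₁ : ∀ q n b b′ → q * (n * (b - b′)) ≡ n * (q * b - q * b′)
      eq₁ = solve-∀
      eq₂ : ∀ r n a a′ b b′ → r * (n * (b - b′)) - n * (a - a′) ≡ n * (r * b - a - (r * b′ - a′))
      eq₂ = solve-∀

  parallel-std : ∀ {S a b} → Span S → a ≢ b → ParallelToEdge p q (ψ (S a)) (ψ (S b)) → StdDir (S a) (S b)
  parallel-std {S} {a} {b} sp ne par = go (parallel-multiple {S a} {S b} par)
    where
    go : (∃ λ i → ∃ λ j → Σ ℤ λ n → S b -Z S a ≡ n ·Z (η (κ j) -Z η (κ i))) → StdDir (S a) (S b)
    go (i , j , n , e) with primitive-edge S n (η (κ j) -Z η (κ i)) a b ne sp e
    ... | inj₁ refl = StdDir-sym (std i j (Pt-≡ (f (proj₁ (S b)) (proj₁ (S a)) (proj₁ (η (κ j))) (proj₁ (η (κ i))) (cong proj₁ e))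
                                                (f (proj₁ (proj₂ (S b))) (proj₁ (proj₂ (S a))) (proj₁ (proj₂ (η (κ j)))) (proj₁ (proj₂ (η (κ i)))) (cong pr₂ e))
                                                (f (level (S b)) (level (S a)) (level (η (κ j))) (level (η (κ i))) (cong level e))))
      where
      f : ∀ x y c d → x - y ≡ 1ℤ * (c - d) → x + d ≡ y + c
      f x y c d e = trans (g₁ x y d) (trans (cong (λ s → s + (y + d)) e) (g₂ y c d))
        where
        g₁ : ∀ x y d → x + d ≡ x - y + (y + d)
        g₁ = solve-∀
        g₂ : ∀ y c d → 1ℤ * (c - d) + (y + d) ≡ y + c
        g₂ = solve-∀
    ... | inj₂ refl = StdDir-sym (std j i (Pt-≡ (f (proj₁ (S b)) (proj₁ (S a)) (proj₁ (η (κ j))) (proj₁ (η (κ i))) (cong proj₁ e))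
                                                (f (proj₁ (proj₂ (S b))) (proj₁ (proj₂ (S a))) (proj₁ (proj₂ (η (κ j)))) (proj₁ (proj₂ (η (κ i)))) (cong pr₂ e))
                                                (f (level (S b)) (level (S a)) (level (η (κ j))) (level (η (κ i))) (cong level e))))
      where
      f : ∀ x y c d → x - y ≡ - 1ℤ * (c - d) → x + c ≡ y + d
      f x y c d e = trans (g₁ x y c) (trans (cong (λ s → s + (y + c)) e) (g₂ y c d))
        where
        g₁ : ∀ x y d → x + d ≡ x - y + (y + d)
        g₁ = solve-∀
        g₂ : ∀ y c d → - 1ℤ * (c - d) + (y + c) ≡ y + d
        g₂ = solve-∀

  std-parallel : ∀ {u v} → StdDir u v → ¬ (u ≡ v) → ParallelToEdge p q (ψ u) (ψ v)
  std-parallel {u} {v} (std i j e) ne = j , i , differ , 1ℚ , goal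
    where
    e′ : ψ u +Z ψ (η (κ i)) ≡ ψ v +Z ψ (η (κ j))
    e′ = trans (sym (ψ-+ u (η (κ i)))) (trans (cong ψ e) (ψ-+ v (η (κ j))))
    differ : ¬ (j ≡ i)
    differ refl = ne (trans (sym (unshift-shift (η (κ i)) u)) (trans (cong (_-Z η (κ i)) (trans (+Z-comm (η (κ i)) u) (trans e (+Z-comm v (η (κ i)))))) (unshift-shift (η (κ i)) v)))
    f : ∀ a b c d → a + c ≡ b + d → ι b ℚ.- ι a ≡ 1ℚ ℚ.* (ι c ℚ.- ι d)
    f a b c d h = trans (sym (ι-sub b a)) (trans (cong ι (g a b c d h)) (trans (ι-sub c d) (sym (ℚ.*-identityˡ (ι c ℚ.- ι d)))))
      where
      g : ∀ a b c d → a + c ≡ b + d → b - a ≡ c - d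
      g a b c d h = trans (g₁ a b d) (trans (cong (λ s → s - (a + d)) (sym h)) (g₂ a c d))
        where
        g₁ : ∀ a b d → b - a ≡ b + d - (a + d)
        g₁ = solve-∀
        g₂ : ∀ a c d → a + c - (a + d) ≡ c - d
        g₂ = solve-∀
    goal : (ιP (ψ v) -Q ιP (ψ u)) ≡ 1ℚ ·Q (ιP (vert p q 1 i) -Q ιP (vert p q 1 j))
    goal = trans (cong₂ _,_ (f (X u) (X v) (X (η (κ i))) (X (η (κ j))) (cong proj₁ e′)) (cong₂ _,_ (f (form fY u) (form fY v) (form fY (η (κ i))) (form fY (η (κ j))) (cong pr₂ e′)) (f (level u) (level v) (level (η (κ i))) (level (η (κ j))) (cong pr₃ e′))))
      (cong₂ (λ a b → 1ℚ ·Q (ιP a -Q ιP b)) (sym (trans (vert-ψ 1 i) (cong ψ (vertL-κ i)))) (sym (trans (vert-ψ 1 j) (cong ψ (vertL-κ j)))))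

  -- What the matching needs to know about a simplex of a given triangulation. Cells satisfy it as
  -- well, so unimodularity, containment and the boundary condition of the result are derived from
  -- it uniformly.
  record Boxed (m : ℕ) (S : Fin 4 → Pt) : Set where
    field
      inside : ∀ i j → 0ℤ ≤ bform m j (S i)
      spans  : Span S
      std-on : ∀ j a b → bform m j (S a) ≡ 0ℤ → bform m j (S b) ≡ 0ℤ → StdDir (S a) (S b)
  open Boxed

  private
    Pt-≟ : (u v : Pt) → Dec (u ≡ v)
    Pt-≟ (a , b , c) (a′ , b′ , c′) = map′ (λ { (refl , refl , refl) → refl }) (λ { refl → refl , refl , refl }) ((a ℤ.≟ a′) ×-dec ((b ℤ.≟ b′) ×-dec (c ℤ.≟ c′)))

    vertex-in : ∀ (S : Tet p q) i → InTet p q S (ιP (S i))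
    vertex-in S i = (1ℚ , ιP (S i)) ∷ [] , (ι-mono-≤ {0ℤ} {1ℤ} (+≤+ z≤n) , S i , (i , refl) , refl) ∷ [] , refl ,
      cong₂ _,_ (z _) (cong₂ _,_ (z _) (z _))
      where
      z : ∀ a → 1ℚ ℚ.* a ℚ.+ 0ℚ ≡ a
      z a = trans (ℚ.+-identityʳ _) (ℚ.*-identityˡ a)

  -- If both ends of an edge lie in one facet, every point of the segment does, so the boundary
  -- hypothesis makes the edge parallel to an edge of the tetrahedron; primitivity then gives the
  -- exact length.
  boxed : ∀ {m T S} → 0 ℕ.< m → IsUnimodTriang p q m T → StandardOnBoundary p q m T → S ∈ T → ∃ λ S′ → Lat S S′ × Boxed m S′
  boxed {m} {T} {S} m>0 (uni , sub , _ , _) std-bd S∈ = S′ , lat , record { inside = ins ; spans = spn ; std-on = stdn }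
    where
    U : Unimodular p q S
    U = All.lookup uni S∈
    S′ : Fin 4 → Pt
    S′ i = proj₁ (Λ-ψ (S i) (proj₁ U i))
    lat : Lat S S′
    lat i = proj₂ (Λ-ψ (S i) (proj₁ U i))
    spn : Span S′
    spn = unimodular-span lat U
    ins : ∀ i j → 0ℤ ≤ bform m j (S′ i)
    ins i j = go (poly-measure (subst (λ v → InPoly p q m (ιP v)) (lat i) (All.lookup sub S∈ (ιP (S i)) (vertex-in S i))))
      where
      go : (∃ λ ws → At ws (ιP (ψ (S′ i))) × Ineq m ws) → 0ℤ ≤ bform m j (S′ i)
      go (ws , a , h) = point-⊩ (⊩-≈ (aff-bform m j) (At-≈ a (point-At (S′ i))) (h j))
    stdn : ∀ j a b → bform m j (S′ a) ≡ 0ℤ → bform m j (S′ b) ≡ 0ℤ → StdDir (S′ a) (S′ b)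
    -- The boundary hypothesis concerns edges with distinct ends; coinciding vertices differ by the
    -- zero vector, which is allowed in `StdDir`.
    stdn j a b ea eb with Pt-≟ (S a) (S b)
    ... | yes e = StdDir-refl (ψ-injective (trans (sym (lat a)) (trans e (lat b))))
    ... | no ne = parallel-std {S′} {a} {b} spn (λ { refl → ne refl }) (subst₂ (ParallelToEdge p q) (lat a) (lat b) (std-bd (S a) (S b) (S , S∈ , (a , refl) , (b , refl) , ne) edge))
      where
      edge : EdgeInBoundary p q m (S a) (S b)
      edge t t≥0 t≤1 = subst₂ (λ u v → InBoundary p q m (ιP u +Q (t ·Q (ιP v -Q ιP u)))) (sym (lat a)) (sym (lat b))
        (measure-boundary m>0 (segment-At t (S′ a) (S′ b))
          (λ i → ⊩-all (segment-on t≥0 t≤1) (λ { v (inj₁ refl) → ins a i ; v (inj₂ refl) → ins b i })) j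
          (⊩-all (segment-on t≥0 t≤1) (λ { v (inj₁ refl) → 0≤-resp (cong -_ ea) ℤ.≤-refl ; v (inj₂ refl) → 0≤-resp (cong -_ eb) ℤ.≤-refl })))

-- Gluing the two boxes and the cells

module Assembly (p : ℤ) (q : ℕ) .{{_ : NonZero q}} (chain : Chain (p′ p q) q) (k₁ k₂ : ℕ) (k₁>0 : 0 ℕ.< k₁) (k₂>0 : 0 ℕ.< k₂) where
  open Chain chain
  open Strip chain
  open Path chain using (level; hi)
  open Coverage chain
  open Facets chain
  open Placement chain
  open Interface p q chain
  open Boxes p q chain
  open Global chain k₁ k₂
  open Boxed

  -- In coordinates (X , Y , z). The first raises w by k₂ and fixes Y; the second raises Y and z by
  -- k₁ and hence fixes w.
  shift-C shift-D : Pt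
  shift-C = 0ℤ , 0ℤ , + k₂
  shift-D = 0ℤ , + k₁ , + k₁

  shiftTet : Pt → Tet p q → Tet p q
  shiftTet w S i = ψ (η w) +Z S i

  Lat-shift : ∀ w {S S′} → Lat S S′ → Lat (shiftTet w S) (λ i → η w +Z S′ i)
  Lat-shift w {S} {S′} lat i = trans (cong (ψ (η w) +Z_) (lat i)) (sym (ψ-+ (η w) (S′ i)))

  -- How much (in units of q) moving a box into place raises each facet form.
  lift-C lift-D : Fin 4 → ℕ
  lift-C = fin4 0 0 k₂ 0
  lift-D = fin4 0 0 0 k₁

  Lifts : ℕ → Pt → (Fin 4 → ℕ) → Set
  Lifts m w x = ∀ j u → bform k j (η w +Z u) ≡ bform m j u + + q * + x j

  private
    zero-lift : ∀ q a → q * 0ℤ + a ≡ a + q * 0ℤ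
    zero-lift = solve-∀

  lifts-C : Lifts k₁ shift-C lift-C
  lifts-C i0 u = trans (cong (λ z → + q * + k - z) (form-shift fU shift-C u)) (eq (+ q) (+ k₁) (+ k₂) (form fU u))
    where
    eq : ∀ q a b u → q * (a + b) - (q * (0ℤ + b) + u) ≡ q * a - u + q * 0ℤ
    eq = solve-∀
  lifts-C i1 u = trans (form-shift fX shift-C u) (zero-lift (+ q) (form fX u))
  lifts-C i2 u = trans (form-shift fW shift-C u) (eq (+ q) (+ k₂) (form fW u))
    where
    eq : ∀ q b u → q * (b - 0ℤ) + u ≡ u + q * b
    eq = solve-∀
  lifts-C i3 u = trans (form-shift fY shift-C u) (zero-lift (+ q) (form fY u))

  lifts-D : Lifts k₂ shift-D lift-D
  lifts-D i0 u = trans (cong (λ z → + q * + k - z) (form-shift fU shift-D u)) (eq (+ q) (+ k₁) (+ k₂) (form fU u))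
    where
    eq : ∀ q a b u → q * (a + b) - (q * (0ℤ + a) + u) ≡ q * b - u + q * 0ℤ
    eq = solve-∀
  lifts-D i1 u = trans (form-shift fX shift-D u) (zero-lift (+ q) (form fX u))
  lifts-D i2 u = trans (form-shift fW shift-D u) (eq (+ q) (+ k₁) (form fW u))
    where
    eq : ∀ q a u → q * (a - a) + u ≡ u + q * 0ℤ
    eq = solve-∀
  lifts-D i3 u = trans (form-shift fY shift-D u) (ℤ.+-comm (+ q * + k₁) (form fY u))

  private
    lift≥0 : ∀ n → 0ℤ ≤ + q * + n
    lift≥0 n = 0≤* (0≤+ᴺ q) (0≤+ᴺ n)

    sum-zero : ∀ {a b} → 0ℤ ≤ a → 0ℤ ≤ b → a + b ≡ 0ℤ → a ≡ 0ℤ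
    sum-zero {a} {b} p p′ e = 0≤∧≤0⇒≡0 p (0≤-resp (trans (eq a b) (trans (cong (λ s → b - s) e) (ℤ.+-identityʳ b))) p′)
      where
      eq : ∀ a b → - a ≡ b - (a + b)
      eq = solve-∀

  -- The shift adds a nonnegative constant to each facet form, so a facet of the large tetrahedron
  -- touches the shifted box at most in the corresponding facet of the box.
  Boxed-shift : ∀ {m w x S} → Lifts m w x → Boxed m S → Boxed k (λ i → η w +Z S i)
  Boxed-shift {m} {w} {x} {S} lift B = record
    { inside = λ i j → 0≤-resp (lift j (S i)) (0≤+ (inside B i j) (lift≥0 (x j)))
    ; spans = Span-shift {S} (η w) (spans B)
    ; std-on = λ j a b ea eb → StdDir-shift (η w) (std-on B j a b (sum-zero (inside B a j) (lift≥0 (x j)) (trans (sym (lift j (S a))) ea))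
                                                                   (sum-zero (inside B b j) (lift≥0 (x j)) (trans (sym (lift j (S b))) eb))) }

  Boxed-cell : ∀ {S} → AnyCell S → Boxed k S
  Boxed-cell {S} (anyCell {c} {i} {h} _ _ P C) = record { inside = ins ; spans = Dual-span (cell-dual C) ; std-on = stdn }
    where
    B : ∀ a → CellBounds c i h _ (S a)
    B a = cell-bounds C (S a) (a , refl)
    ins : ∀ a j → 0ℤ ≤ bform k j (S a)
    ins a i0 = ≤⇒0≤ (CellBounds.U-hi (B a) k P)
    ins a i1 = ℤ.≤-trans (lift≥0 c) (CellBounds.X-lo (B a))
    ins a i2 = ℤ.≤-trans (lift≥0 h) (CellBounds.W-lo (B a))
    ins a i3 = ℤ.≤-trans (lift≥0 i) (CellBounds.Y-lo (B a))
    zq : ∀ {a} → a ≡ 0ℤ → a ≡ + q * 0ℤ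
    zq e = trans e (sym (ℤ.*-zeroʳ (+ q)))
    stdn : ∀ j a b → bform k j (S a) ≡ 0ℤ → bform k j (S b) ≡ 0ℤ → StdDir (S a) (S b)
    stdn i0 a b ea eb = cell-FacetStdAt C fU (+ k) (S a) (S b) (a , refl) (b , refl) (sym (ℤ.i-j≡0⇒i≡j _ _ ea)) (sym (ℤ.i-j≡0⇒i≡j _ _ eb))
    stdn i1 a b ea eb = cell-FacetStdAt C fX 0ℤ (S a) (S b) (a , refl) (b , refl) (zq ea) (zq eb)
    stdn i2 a b ea eb = cell-FacetStdAt C fW 0ℤ (S a) (S b) (a , refl) (b , refl) (zq ea) (zq eb)
    stdn i3 a b ea eb = cell-FacetStdAt C fY 0ℤ (S a) (S b) (a , refl) (b , refl) (zq ea) (zq eb)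

  private
    lifted-zero : ∀ {a b} n → a ≡ b + + q * + n → a ≡ + q * + n → b ≡ 0ℤ
    lifted-zero {a} {b} n e f = trans (eq b (+ q * + n)) (trans (cong (λ s → s - + q * + n) (trans (sym e) f)) (ℤ.+-inverseʳ (+ q * + n)))
      where
      eq : ∀ b c → b ≡ b + c - c
      eq = solve-∀

    lifted-≤ : ∀ {a b} n → a ≡ b + + q * + n → 0ℤ ≤ b → + q * + n ≤ a
    lifted-≤ {a} {b} n refl p = ≤-by b p (eq b (+ q * + n))
      where
      eq : ∀ b c → b + c - c ≡ b
      eq = solve-∀

    q-mono : ∀ {a b} → a ℕ.≤ b → + q * + a ≤ + q * + b
    q-mono {a} {b} p = ℤ.*-monoˡ-≤-nonNeg (+ q) (+≤+ p)

  Meet-C-cell : ∀ {S R} → Boxed k₁ S → AnyCell R → Meet (Vert R) (Vert (λ i → η shift-C +Z S i))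
  Meet-C-cell {S} B (anyCell {c} {i} {h} _ h<k₂ P C) = Meet-across fW inW (+ k₂)
    (λ v z → ℤ.≤-trans (CellBounds.W-hi (cell-bounds C v z)) (q-mono h<k₂))
    (λ { v (a , refl) → lifted-≤ k₂ (lifts-C i2 (S a)) (inside B a i2) })
    (cell-FacetStdAt C fW (+ k₂))
    (λ { u v (a , refl) (b , refl) ea eb → StdDir-shift (η shift-C) (std-on B i2 a b (lifted-zero k₂ (lifts-C i2 (S a)) ea) (lifted-zero k₂ (lifts-C i2 (S b)) eb)) })

  Meet-D-cell : ∀ {S R} → Boxed k₂ S → AnyCell R → Meet (Vert R) (Vert (λ i → η shift-D +Z S i))
  Meet-D-cell {S} B (anyCell {c} {i} {h} i<k₁ _ P C) = Meet-across fY inY (+ k₁)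
    (λ v z → ℤ.≤-trans (CellBounds.Y-hi (cell-bounds C v z)) (q-mono i<k₁))
    (λ { v (a , refl) → lifted-≤ k₁ (lifts-D i3 (S a)) (inside B a i3) })
    (cell-FacetStdAt C fY (+ k₁))
    (λ { u v (a , refl) (b , refl) ea eb → StdDir-shift (η shift-D) (std-on B i3 a b (lifted-zero k₁ (lifts-D i3 (S a)) ea) (lifted-zero k₁ (lifts-D i3 (S b)) eb)) })

  private
    facet-sum : ∀ m v → + q * + m - form fY v ≡ bform m i0 v + (bform m i1 v + bform m i2 v)
    facet-sum m (y , t , z) = eq (+ p′ p q) (+ q) (+ m) y t z
      where
      eq : ∀ r q m y t z → q * m - y ≡ q * m - (r * y - q * t + q * z) + (r * y - q * t + (q * z - y))
      eq = solve-∀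

    Y≤m : ∀ {m S} → Boxed m S → ∀ a → 0ℤ ≤ + q * + m - form fY (S a)
    Y≤m {m} {S} B a = 0≤-resp (facet-sum m (S a)) (0≤+ (inside B a i0) (0≤+ (inside B a i1) (inside B a i2)))

    -- the only point with y = q m is the last vertex
    tip : ∀ {m S} → Boxed m S → ∀ a → form fY (S a) ≡ + q * + m → X (S a) ≡ 0ℤ × + q * level (S a) ≡ + q * + m
    tip {m} {S} B a e = sum-zero (inside B a i1) (inside B a i2) tail , trans (eq (+ q * level (S a)) (form fY (S a))) (trans (cong (_+ form fY (S a)) (sum-zero (inside B a i2) (inside B a i1) (trans (ℤ.+-comm (bform m i2 (S a)) (bform m i1 (S a))) tail))) (trans (ℤ.+-identityˡ _) e))
      where
      zero-sum : bform m i0 (S a) + (bform m i1 (S a) + bform m i2 (S a)) ≡ 0ℤ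
      zero-sum = trans (sym (facet-sum m (S a))) (trans (cong (λ s → + q * + m - s) e) (ℤ.+-inverseʳ (+ q * + m)))
      tail : bform m i1 (S a) + bform m i2 (S a) ≡ 0ℤ
      tail = sum-zero (0≤+ (inside B a i1) (inside B a i2)) (inside B a i0) (trans (ℤ.+-comm (bform m i1 (S a) + bform m i2 (S a)) (bform m i0 (S a))) zero-sum)
      eq : ∀ z y → z ≡ z - y + y
      eq = solve-∀

    tip-std : ∀ {m S} → Boxed m S → ∀ a b → form fY (S a) ≡ + q * + m → form fY (S b) ≡ + q * + m → StdDir (S a) (S b)
    tip-std B a b ea eb = StdDir-refl (ψ-injective (Pt-≡ (trans (proj₁ (tip B a ea)) (sym (proj₁ (tip B b eb)))) (trans ea (sym eb))
      (q-cancel (trans (proj₂ (tip B a ea)) (sym (proj₂ (tip B b eb)))))))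

    Y-C : ∀ u → form fY (η shift-C +Z u) ≡ form fY u
    Y-C u = trans (lifts-C i3 u) (trans (cong (λ z → form fY u + z) (ℤ.*-zeroʳ (+ q))) (ℤ.+-identityʳ (form fY u)))

  -- The plane `Y = k₁` meets the first box in a single vertex, where any face is trivially
  -- standard, and the second one in a facet.
  Meet-C-D : ∀ {S R} → Boxed k₁ S → Boxed k₂ R → Meet (Vert (λ i → η shift-C +Z S i)) (Vert (λ i → η shift-D +Z R i))
  Meet-C-D {S} {R} B B′ = Meet-across fY inY (+ k₁)
    (λ { v (a , refl) → 0≤⇒≤ (0≤-resp (cong (λ z → + q * + k₁ - z) (Y-C (S a))) (Y≤m B a)) })
    (λ { v (a , refl) → lifted-≤ k₁ (lifts-D i3 (R a)) (inside B′ a i3) })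
    (λ { u v (a , refl) (b , refl) ea eb → StdDir-shift (η shift-C) (tip-std B a b (trans (sym (Y-C (S a))) ea) (trans (sym (Y-C (S b))) eb)) })
    (λ { u v (a , refl) (b , refl) ea eb → StdDir-shift (η shift-D) (std-on B′ i3 a b (lifted-zero k₁ (lifts-D i3 (R a)) ea) (lifted-zero k₁ (lifts-D i3 (R b)) eb)) })

  private
    back : Pt → PtQ
    back w = 0Q -Q ιP (ψ (η w))

    back-vertex : ∀ w v → back w +Q ιP (ψ (η w) +Z v) ≡ ιP v
    back-vertex w (a , b , c) = cong₂ _,_ (eq (X (η w)) a) (cong₂ _,_ (eq (form fY (η w)) b) (eq (level (η w)) c))
      where
      open ℚSolver.+-*-Solver
      alg : ∀ s a → 0ℚ ℚ.- s ℚ.+ (s ℚ.+ a) ≡ a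
      alg = solve 2 (λ s a → con 0ℚ :- s :+ (s :+ a) := a) refl
      eq : ∀ s a → 0ℚ ℚ.- ι s ℚ.+ ι (s + a) ≡ ι a
      eq s a = trans (cong (λ z → 0ℚ ℚ.- ι s ℚ.+ z) (ι-+ s a)) (alg (ι s) (ι a))

    forth-vertex : ∀ w v → ιP (ψ (η w)) +Q ιP v ≡ ιP (ψ (η w) +Z v)
    forth-vertex w (a , b , c) = cong₂ _,_ (sym (ι-+ (X (η w)) a)) (cong₂ _,_ (sym (ι-+ (form fY (η w)) b)) (sym (ι-+ (level (η w)) c)))

    forth-back : ∀ w x → ιP (ψ (η w)) +Q (back w +Q x) ≡ x
    forth-back w (a , b , c) = cong₂ _,_ (eq (ι (X (η w))) a) (cong₂ _,_ (eq (ι (form fY (η w))) b) (eq (ι (level (η w))) c))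
      where
      open ℚSolver.+-*-Solver
      eq : ∀ s a → s ℚ.+ (0ℚ ℚ.- s ℚ.+ a) ≡ a
      eq = solve 2 (λ s a → s :+ (con 0ℚ :- s :+ a) := a) refl

  InTet-back : ∀ w {S x} → InTet p q (shiftTet w S) x → InTet p q S (back w +Q x)
  InTet-back w {S} = InConv-translate (back w) (λ { a (v , (i , refl) , refl) → S i , (i , refl) , back-vertex w (S i) })

  InTet-forth : ∀ w {S x} → InTet p q S (back w +Q x) → InTet p q (shiftTet w S) x
  InTet-forth w {S} {x} t = subst (InTet p q (shiftTet w S)) (forth-back w x)
    (InConv-translate (ιP (ψ (η w))) (λ { a (v , (i , refl) , refl) → ψ (η w) +Z S i , (i , refl) , forth-vertex w (S i) }) t)

  common-shift : ∀ w {S R x} → InConv (λ y → ∃ λ v → IsVertexOf p q v S × IsVertexOf p q v R × y ≡ ιP v) (back w +Q x) →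
    InConv (λ y → ∃ λ v → IsVertexOf p q v (shiftTet w S) × IsVertexOf p q v (shiftTet w R) × y ≡ ιP v) x
  common-shift w {S} {R} {x} t = subst (InConv _) (forth-back w x) (InConv-translate (ιP (ψ (η w)))
    (λ { a (v , (i , refl) , (j , e) , refl) → ψ (η w) +Z S i , (i , refl) , (j , cong (ψ (η w) +Z_) e) , forth-vertex w (S i) }) t)

  At-back : ∀ w {x} → At ws x → At (pushforward (_-Z η w) ws) (back w +Q x)
  At-back {ws = ws} w (at m refl) = at (trans (E-map (_-Z η w) one ws) m)
      (cong₂ _,_ (comp X (form-- fX) ) (cong₂ _,_ (comp (form fY) (λ _ _ → refl)) (comp level (λ _ _ → refl))))
    where
    open ℚSolver.+-*-Solver
    alg : ∀ s a → a ℚ.+ ℚ.- s ≡ 0ℚ ℚ.- s ℚ.+ a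
    alg = solve 2 (λ s a → a :+ :- s := con 0ℚ :- s :+ a) refl
    const : ∀ s → E (λ _ → - s) ws ≡ ℚ.- ι s
    const s = trans (E-cong {φ = λ _ → - s} {χ = λ v → - s * one v} (λ _ → sym (ℤ.*-identityʳ (- s))) ws) (trans (E-* (- s) one ws) (trans (cong (ι (- s) ℚ.*_) m) (trans (ℚ.*-identityʳ _) (ι-neg s))))
    comp : ∀ (φ : Pt → ℤ) → (∀ u v → φ (u -Z v) ≡ φ u - φ v) → E φ (pushforward (_-Z η w) ws) ≡ 0ℚ ℚ.- ι (φ (η w)) ℚ.+ E φ ws
    comp φ h = trans (E-map (_-Z η w) φ ws) (trans (E-cong (λ v → h v (η w)) ws) (trans (E-+ φ (λ _ → - φ (η w)) ws)
      (trans (cong (E φ ws ℚ.+_) (const (φ (η w)))) (alg (ι (φ (η w))) (E φ ws)))))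

  Ineq-back : ∀ {m w x} → Lifts m w x → (∀ j → ws ⊩ (λ v → bform k j v - + q * + x j)) → Ineq m (pushforward (_-Z η w) ws)
  Ineq-back {ws = ws} {m} {w} {x} lift h j = ⊩-map (_-Z η w) (⊩-cong (λ v → trans (eq (bform m j (v -Z η w)) (+ q * + x j))
      (cong (λ s → s - + q * + x j) (trans (sym (lift j (v -Z η w))) (cong (bform k j) (shift-unshift (η w) v))))) (h j))
    where
    eq : ∀ b c → b ≡ b + c - c
    eq = solve-∀

  -- The triangulation

  module _ (T₁ T₂ : List (Tet p q)) (tri₁ : IsUnimodTriang p q k₁ T₁) (tri₂ : IsUnimodTriang p q k₂ T₂)
           (std₁ : StandardOnBoundary p q k₁ T₁) (std₂ : StandardOnBoundary p q k₂ T₂) where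

    cellTet : (Fin 4 → Pt) → Tet p q
    cellTet S i = ψ (S i)

    T : List (Tet p q)
    T = map (shiftTet shift-C) T₁ ++ (map (shiftTet shift-D) T₂ ++ map cellTet cells)

    data Member : Tet p q → Set where
      in-C    : ∀ {S S′} → S ∈ T₁ → Lat S S′ → Boxed k₁ S′ → Member (shiftTet shift-C S)
      in-D    : ∀ {S S′} → S ∈ T₂ → Lat S S′ → Boxed k₂ S′ → Member (shiftTet shift-D S)
      in-cell : ∀ {S} → AnyCell S → Member (cellTet S)

    private
      C∈ : ∀ {S} → S ∈ T₁ → Member (shiftTet shift-C S)
      C∈ {S} S∈ = go (boxed k₁>0 tri₁ std₁ S∈)
        where
        go : (∃ λ S′ → Lat S S′ × Boxed k₁ S′) → Member (shiftTet shift-C S)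
        go (S′ , lat , B) = in-C S∈ lat B

      D∈ : ∀ {S} → S ∈ T₂ → Member (shiftTet shift-D S)
      D∈ {S} S∈ = go (boxed k₂>0 tri₂ std₂ S∈)
        where
        go : (∃ λ S′ → Lat S S′ × Boxed k₂ S′) → Member (shiftTet shift-D S)
        go (S′ , lat , B) = in-D S∈ lat B

    member : ∀ {S} → S ∈ T → Member S
    member S∈ with ∈-++⁻ (map (shiftTet shift-C) T₁) S∈
    ... | inj₁ m with ∈-map⁻ (shiftTet shift-C) m
    ...   | S , S∈′ , refl = C∈ S∈′
    member S∈ | inj₂ m with ∈-++⁻ (map (shiftTet shift-D) T₂) m
    ... | inj₁ m′ with ∈-map⁻ (shiftTet shift-D) m′
    ...   | S , S∈′ , refl = D∈ S∈′
    member S∈ | inj₂ m | inj₂ m′ with ∈-map⁻ cellTet m′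
    ...   | S , S∈′ , refl = in-cell (cells-sound S∈′)

    member-boxed : ∀ {S} → Member S → ∃ λ S′ → Lat S S′ × Boxed k S′
    member-boxed (in-C _ lat B) = _ , Lat-shift shift-C lat , Boxed-shift {k₁} {shift-C} {lift-C} lifts-C B
    member-boxed (in-D _ lat B) = _ , Lat-shift shift-D lat , Boxed-shift {k₂} {shift-D} {lift-D} lifts-D B
    member-boxed (in-cell {S} C) = S , (λ _ → refl) , Boxed-cell C

    private
      k>0 : 0 ℕ.< k
      k>0 = ℕ.≤-trans k₁>0 (ℕ.m≤m+n k₁ k₂)

    unimodular : ∀ {S} → Member S → Unimodular p q S
    unimodular {S} m = go (member-boxed m)
      where
      go : (∃ λ S′ → Lat S S′ × Boxed k S′) → Unimodular p q S
      go (S′ , lat , B) = span-unimodular lat (spans B)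

    contained : ∀ {S} → Member S → ∀ x → InTet p q S x → InPoly p q k x
    contained {S} m x t = go (member-boxed m)
      where
      go : (∃ λ S′ → Lat S S′ × Boxed k S′) → InPoly p q k x
      go (S′ , lat , B) = inner (tet-measure lat t)
        where
        inner : (∃ λ ws → PosOn (Vert S′) ws × At ws x) → InPoly p q k x
        inner (ws , ps , a) = measure-poly k>0 a (λ j → ⊩-pos ps (λ { v (i , refl) → inside B i j }))

    covering : ∀ x → InPoly p q k x → ∃ λ S → S ∈ T × InTet p q S x
    covering x t = go (poly-measure t)
      where
      Cover : Set
      Cover = ∃ λ S → S ∈ T × InTet p q S x
      zero-lifted : ∀ {ws} j → ws ⊩ bform k j → ws ⊩ (λ v → bform k j v - + q * 0ℤ)
      zero-lifted j h = ⊩-cong (λ v → trans (cong (λ z → bform k j v - z) (ℤ.*-zeroʳ (+ q))) (ℤ.+-identityʳ (bform k j v))) h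
      from-C : (∃ λ S → S ∈ T₁ × InTet p q S (back shift-C +Q x)) → Cover
      from-C (S , S∈ , t) = shiftTet shift-C S , ∈-++⁺ˡ (∈-map⁺ (shiftTet shift-C) S∈) , InTet-forth shift-C t
      from-D : (∃ λ S → S ∈ T₂ × InTet p q S (back shift-D +Q x)) → Cover
      from-D (S , S∈ , t) = shiftTet shift-D S , ∈-++⁺ʳ (map (shiftTet shift-C) T₁) (∈-++⁺ˡ (∈-map⁺ (shiftTet shift-D) S∈)) , InTet-forth shift-D t
      from-cell : ∀ {ws} → At ws x → (∃ λ S → AnyCell S × Covers S ws) → Cover
      from-cell a (S , C , cov) = cellTet S , ∈-++⁺ʳ (map (shiftTet shift-C) T₁) (∈-++⁺ʳ (map (shiftTet shift-D) T₂) (∈-map⁺ cellTet (cells-complete C))) ,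
        covers-tet (λ _ → refl) cov a
      rev : ∀ a b → b - a ≡ - (a - b)
      rev = solve-∀
      go : (∃ λ ws → At ws x × Ineq k ws) → Cover
      go (ws , a , h) with ⊩-total ws (λ v → form fW v - + q * + k₂) | ⊩-total ws (λ v → form fY v - + q * + k₁)
      ... | inj₁ pos | _ = from-C (proj₁ (proj₂ (proj₂ tri₁)) _ (measure-poly k₁>0 (At-back shift-C a)
              (Ineq-back {m = k₁} {shift-C} {lift-C} lifts-C (fin4 (zero-lifted i0 (h i0)) (zero-lifted i1 (h i1)) pos (zero-lifted i3 (h i3))))))
      ... | inj₂ _ | inj₁ pos = from-D (proj₁ (proj₂ (proj₂ tri₂)) _ (measure-poly k₂>0 (At-back shift-D a)
              (Ineq-back {m = k₂} {shift-D} {lift-D} lifts-D (fin4 (zero-lifted i0 (h i0)) (zero-lifted i1 (h i1)) (zero-lifted i2 (h i2)) pos))))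
      ... | inj₂ neg | inj₂ neg′ = from-cell a (cover-cells k₁>0 k₂>0 (h i1) (h i3) (h i2) (h i0)
              (⊩-cong (λ v → rev (form fY v) (+ q * + k₁)) neg′) (⊩-cong (λ v → rev (form fW v) (+ q * + k₂)) neg))

    Common : Tet p q → Tet p q → PtQ → Set
    Common S R = InConv (λ y → ∃ λ v → IsVertexOf p q v S × IsVertexOf p q v R × y ≡ ιP v)

    -- Two simplices of the same box are compared by hypothesis, translated back into the original
    -- position; all other pairs by `Meet`.
    facewise : ∀ {S R} → Member S → Member R → ∀ x → InTet p q S x → InTet p q R x → Common S R x
    facewise (in-C S∈ _ _) (in-C R∈ _ _) x s t = common-shift shift-C (proj₂ (proj₂ (proj₂ tri₁)) _ _ S∈ R∈ _ (InTet-back shift-C s) (InTet-back shift-C t))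
    facewise (in-D S∈ _ _) (in-D R∈ _ _) x s t = common-shift shift-D (proj₂ (proj₂ (proj₂ tri₂)) _ _ S∈ R∈ _ (InTet-back shift-D s) (InTet-back shift-D t))
    facewise (in-C _ lat B) (in-D _ lat′ B′) x = common-face (Lat-shift shift-C lat) (Lat-shift shift-D lat′) (Meet-C-D B B′)
    facewise (in-D _ lat B) (in-C _ lat′ B′) x = common-face (Lat-shift shift-D lat) (Lat-shift shift-C lat′) (Meet-sym (Meet-C-D B′ B))
    facewise (in-C _ lat B) (in-cell C) x = common-face (Lat-shift shift-C lat) (λ _ → refl) (Meet-sym (Meet-C-cell B C))
    facewise (in-cell C) (in-C _ lat B) x = common-face (λ _ → refl) (Lat-shift shift-C lat) (Meet-C-cell B C)
    facewise (in-D _ lat B) (in-cell C) x = common-face (Lat-shift shift-D lat) (λ _ → refl) (Meet-sym (Meet-D-cell B C))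
    facewise (in-cell C) (in-D _ lat B) x = common-face (λ _ → refl) (Lat-shift shift-D lat) (Meet-D-cell B C)
    facewise (in-cell C) (in-cell C′) x = common-face (λ _ → refl) (λ _ → refl) (Meet-cells C C′)

    private
      ½ : ℚ
      ½ = ℚ.½

      0<½ : 0ℚ ℚ.< ½
      0<½ = ℚ.positive⁻¹ ½

      ½≤1 : ½ ℚ.≤ 1ℚ
      ½≤1 = ℚ.≤ᵇ⇒≤ tt

      half-on : ∀ {u v} → PosOn (λ w → w ≡ u ⊎ w ≡ v) (segment ½ u v)
      half-on = (0<½ , inj₁ refl) ∷ (0<½ , inj₂ refl) ∷ []

    -- An edge with midpoint in a facet lies in that facet.
    standard : StandardOnBoundary p q k T
    standard u v (S , S∈ , (a , refl) , (b , refl) , ne) bd = go (member-boxed (member S∈))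
      where
      go : (∃ λ S′ → Lat S S′ × Boxed k S′) → ParallelToEdge p q (S a) (S b)
      go (S′ , lat , B) = fin (boundary-measure (subst₂ (λ u v → InBoundary p q k (ιP u +Q (½ ·Q (ιP v -Q ιP u)))) (lat a) (lat b) (bd ½ (ℚ.<⇒≤ 0<½) ½≤1)))
        where
        fin : (∃ λ j → ∀ {ws} → At ws (ιP (ψ (S′ a)) +Q (½ ·Q (ιP (ψ (S′ b)) -Q ιP (ψ (S′ a))))) → ws ⊩ (λ v → - bform k j v)) → ParallelToEdge p q (S a) (S b)
        fin (j , h) = done (⊩-zero half-on (λ v → [ (λ { refl → inside B a j }) , (λ { refl → inside B b j }) ]′) (h (segment-At ½ (S′ a) (S′ b))))
          where
          done : PosOn (λ w → (w ≡ S′ a ⊎ w ≡ S′ b) × bform k j w ≡ 0ℤ) (segment ½ (S′ a) (S′ b)) → ParallelToEdge p q (S a) (S b)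
          done ((_ , _ , ea) ∷ (_ , _ , eb) ∷ []) = subst₂ (ParallelToEdge p q) (sym (lat a)) (sym (lat b))
            (std-parallel (std-on B j a b ea eb) (λ e → ne (trans (lat a) (trans (cong ψ e) (sym (lat b))))))

    triangulated : HasStdUnimodTriang p q k
    triangulated = T , (All.tabulate (λ S∈ → unimodular (member S∈)) , All.tabulate (λ S∈ → contained (member S∈)) , covering ,
      (λ S R S∈ R∈ → facewise (member S∈) (member R∈))) , standard

-- The chain of lattice points of a coprime pair

module _ (p : ℤ) (q : ℕ) .{{_ : NonZero q}} (coprime : gcd ∣ p ∣ q ≡ 1) where

  private
    r : ℕ
    r = p′ p q

    bezout-abs : Σ ℤ λ a → Σ ℤ λ b → a * + ∣ p ∣ + b * + q ≡ 1ℤ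
    bezout-abs with Bézout.identity (subst (GCD ∣ p ∣ q) coprime (gcd-GCD ∣ p ∣ q))
    ... | Bézout.+- x y e = + x , - + y , trans (cong (λ s → s + - + y * + q) (trans (sym (ℤ.pos-* x ∣ p ∣)) (trans (cong +_ (sym e)) (cong (λ s → 1ℤ + s) (ℤ.pos-* y q))))) (eq (+ y) (+ q))
      where
      eq : ∀ y q → 1ℤ + y * q + - y * q ≡ 1ℤ
      eq = solve-∀
    ... | Bézout.-+ x y e = - + x , + y , trans (cong (λ s → - + x * + ∣ p ∣ + s) (trans (sym (ℤ.pos-* y q)) (trans (cong +_ (sym e)) (cong (λ s → 1ℤ + s) (ℤ.pos-* x ∣ p ∣))))) (eq (+ x) (+ ∣ p ∣))
      where
      eq : ∀ x p → - x * p + (1ℤ + x * p) ≡ 1ℤ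
      eq = solve-∀

    bezout-p : Σ ℤ λ a → Σ ℤ λ b → a * p + b * + q ≡ 1ℤ
    bezout-p with bezout-abs | ℤ.+∣i∣≡i⊎+∣i∣≡-i p
    ... | a , b , e | inj₁ s = a , b , trans (cong (λ z → a * z + b * + q) (sym s)) e
    ... | a , b , e | inj₂ s = - a , b , trans (cong (λ z → z + b * + q) (trans (eq a p) (cong (a *_) (sym s)))) e
      where
      eq : ∀ a p → - a * p ≡ a * - p
      eq = solve-∀

    -- As r is the remainder of -p modulo q, a Bézout relation for p and q becomes one for r and q
    -- after substituting the quotient.
    bezout : Σ ℤ λ α → Σ ℤ λ β → α * + r + β * + q ≡ 1ℤ
    bezout with bezout-p
    ... | a , b , e = - a , b - a * κ′ , trans (eq₁ a b (+ q) (+ r) κ′) (trans (cong (λ z → - a * z + b * + q) (sym (ℤ.a≡a%ℕn+[a/ℕn]*n (- p) q))) (trans (eq₂ a b (+ q) p) e))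
      where
      κ′ = (- p) ℤ./ℕ q
      eq₁ : ∀ a b q r κ → - a * r + (b - a * κ) * q ≡ - a * (r + κ * q) + b * q
      eq₁ = solve-∀
      eq₂ : ∀ a b q p → - a * - p + b * q ≡ a * p + b * q
      eq₂ = solve-∀

    -- On the line `y = j` the lattice point of the strip has x equal to the remainder of r j modulo
    -- q, so t is the quotient.
    floor : ℕ → ℤ
    floor j = + ((r ℕ.* j) ℕ./ q)

    remainder : ∀ j → + r * + j - + q * floor j ≡ + ((r ℕ.* j) ℕ.% q)
    remainder j = trans (cong (λ s → s - + q * floor j) (trans (sym (ℤ.pos-* r j)) (trans (cong +_ (ℕ.m≡m%n+[m/n]*n (r ℕ.* j) q)) (cong (λ s → + ((r ℕ.* j) ℕ.% q) + s) (ℤ.pos-* ((r ℕ.* j) ℕ./ q) q)))))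
        (eq (+ ((r ℕ.* j) ℕ.% q)) (floor j) (+ q))
      where
      eq : ∀ m f q → m + f * q - q * f ≡ m
      eq = solve-∀

    q>0 : 0 ℕ.< q
    q>0 = ℕ.>-nonZero⁻¹ q

    -- If the remainder were 0, the Bézout relation multiplied by j would make j a multiple of q.
    rem>0 : ∀ j → 0 ℕ.< j → j ℕ.< q → 0ℤ < + r * + j - + q * floor j
    rem>0 j j>0 j<q = go (ℤ.<-cmp 0ℤ (+ r * + j - + q * floor j))
      where
      α = proj₁ bezout
      β = proj₁ (proj₂ bezout)
      go : _ → 0ℤ < + r * + j - + q * floor j
      go (tri< l _ _) = l
      go (tri> _ _ g) = ⊥-elim (ℤ.≤⇒≯ (subst (0ℤ ≤_) (sym (remainder j)) (+≤+ z≤n)) g)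
      go (tri≈ _ e _) = ⊥-elim (ℤ.<-irrefl (trans (sym (ℤ.*-zeroʳ (+ q))) (trans (cong (+ q *_) (sym K≡0)) (sym j≡))) (+<+ j>0))
        where
        K = α * floor j + β * + j
        eq₁ : ∀ α β r q j f → (α * r + β * q) * j ≡ α * (r * j - q * f) + q * (α * f + β * j)
        eq₁ = solve-∀
        j≡ : + j ≡ + q * K
        j≡ = trans (sym (ℤ.*-identityˡ (+ j))) (trans (cong (_* + j) (sym (proj₂ (proj₂ bezout)))) (trans (eq₁ α β (+ r) (+ q) (+ j) (floor j))
          (trans (cong (λ s → α * s + + q * K) (sym e)) (trans (cong (_+ + q * K) (ℤ.*-zeroʳ α)) (ℤ.+-identityˡ (+ q * K))))))
        K≡0 : K ≡ 0ℤ
        K≡0 = small-multiple (+ q) K (+<+ q>0) (subst (0ℤ ≤_) j≡ (+≤+ z≤n)) (subst (λ s → 0ℤ < + q - s) j≡ (ℕ<⇒0< j<q))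

  lattice-chain : Chain r q
  lattice-chain = record
    { τ = floor ; q>0 = q>0
    ; τ0 = cong +_ (trans (cong (ℕ._/ q) (ℕ.*-zeroʳ r)) (ℕ.0/n≡0 q))
    ; τq = cong +_ (ℕ.m*n/n≡m r q)
    ; x≥0 = λ j → subst (0ℤ ≤_) (sym (remainder j)) (+≤+ z≤n)
    ; x<q = λ j → subst (_< + q) (sym (remainder j)) (+<+ (ℕ.m%n<n (r ℕ.* j) q))
    ; x>0 = rem>0
    ; bez = bezout }

theorem5p7 : (p : ℤ) (q : ℕ) .{{_ : NonZero q}} → gcd ∣ p ∣ q ≡ 1 →
    (k₁ k₂ : ℕ) → k₁ ℕ.≥ 1 → k₂ ℕ.≥ 1 →
    HasStdUnimodTriang p q k₁ → HasStdUnimodTriang p q k₂ →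
    HasStdUnimodTriang p q (k₁ ℕ.+ k₂)
theorem5p7 p q coprime k₁ k₂ k₁≥1 k₂≥1 (T₁ , tri₁ , std₁) (T₂ , tri₂ , std₂) =
  Assembly.triangulated p q (lattice-chain p q coprime) k₁ k₂ k₁≥1 k₂≥1 T₁ T₂ tri₁ tri₂ std₁ std₂
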